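{- Let $\lambda$ and $\mu$ be partitions of $n$. Then $$\chi^\lambda_\mu=\sum_{\rho\subseteq\lambda}\frac{(-1)^{|\rho|}\,\pi_\mu(\rho)}{H_\rho\,H_{\lambda/\rho}}\qquad\text{and}\qquad K_{\lambda\mu}=\sum_{\rho\subseteq\lambda}\frac{(-1)^{|\lambda/\rho|}\,\varkappa_\mu(\rho)}{H_\rho\,H_{\lambda/\rho}},$$ where the sums are over partitions $\rho$ contained in $\lambda$.
   Context: $\chi^\lambda_\mu$ is the value of the irreducible character of the symmetric group $\mathfrak S_n$ indexed by $\lambda$ on permutations of cycle type $\mu$, and $K_{\lambda\mu}$ are the Kostka numbers. $|\theta|$ denotes the number of boxes of a (skew) diagram $\theta$. For any skew diagram $\theta$ let $\dim\theta$ be the number of standard $\theta$-tableaux (row and column strict) with entries in $\{1,2,\dots,|\theta|\}$, and set $H_\theta=|\theta|!/\dim\theta$ (so $H_\theta=1$ for the empty diagram). For partitions $\mu=(1^{m_1}2^{m_2}\dots r^{m_r})$ and $\rho=(\rho_1,\dots,\rho_l)$ (with $\rho_i=0$ for $i>l$) set $$\pi_\mu(\rho)=\prod_{k=1}^r\Big((1-\rho_1)^k+\dots+(l-\rho_l)^k-1^k-\dots-l^k\Big)^{m_k}$$ and $$\varkappa_\mu(\rho)=\prod_{k=1}^r\Big(\sum_{i_1\geqslant\dots\geqslant i_k\geqslant 1}\rho_{i_1}(\rho_{i_2}-1)\cdots(\rho_{i_k}-k+1)\Big)^{m_k}.$$ -}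

module Defs where

open import Data.Fin.Base using (Fin)
import Data.Fin.Base as Fin
import Data.Fin.Properties as Fin
open import Data.Fin.Permutation as Perm
  using (Permutation; Permutation′; _⟨$⟩ʳ_; flip; _∘ₚ_; insert)
open import Data.Integer.Base as ℤ using (ℤ; +_; 0ℤ; 1ℤ; -1ℤ)
open import Data.List.Base
  using (List; []; _∷_; [_]; _++_; map; foldr; filter; length; replicate;
         concat; concatMap; zip; applyUpTo; upTo; allFin; cartesianProduct;
         lookup)
import Data.List.Properties as List
open import Data.List.Membership.Propositional using (_∈_)
open import Data.List.Membership.Propositional.Properties
  using (∈-filter⁺; ∈-map⁺; ∈-concatMap⁺; ∈-length)
open import Data.List.Relation.Binary.Permutation.Propositional using (_↭_)
open import Data.List.Relation.Unary.All as All using (All; []; _∷_)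
open import Data.List.Relation.Unary.AllPairs as AllPairs
  using (AllPairs; []; _∷_; allPairs?)
import Data.List.Relation.Unary.AllPairs.Properties as AllPairs
open import Data.List.Relation.Unary.Any as Any using (here; there)
open import Data.List.Relation.Unary.Linked using (Linked; linked?)
open import Data.List.Relation.Unary.Unique.Propositional using (Unique)
open import Data.Nat.ListAction using (sum)
open import Data.Nat.Base as ℕ
  using (ℕ; zero; suc; _∸_; _⊔_; _≤_; _<_; _≥_; _!; NonZero)
import Data.Nat.Properties as ℕ
open import Data.Product.Base using (∃-syntax; Σ-syntax; _×_; _,_; proj₁; proj₂)
open import Data.Rational.Base as ℚ using (ℚ; 0ℚ; 1ℚ)
import Data.Rational.Properties as ℚ
open import Data.Vec.Base as Vec using (Vec)
import Data.Vec.Properties as Vec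
open import Function.Base using (_∘_; id)
open import Relation.Binary.PropositionalEquality
  using (_≡_; refl; subst)
open import Relation.Nullary.Decidable
  using (Dec; _×-dec_; _→-dec_; ¬?; does)
open import Data.Bool.Base using (if_then_else_)

open import Algebra.Properties.CommutativeMonoid.Sum ℚ.+-0-commutativeMonoid
  using () renaming (sum to sumFin) public

------------------------------------------------------------------------
-- Finite enumerations, sums and products

range : ℕ → List ℕ
range m = applyUpTo suc m

choices : ∀ {A : Set} → List (List A) → List (List A)
choices []         = [ [] ]
choices (xs ∷ xss) = concatMap (λ x → map (x ∷_) (choices xss)) xs

multiplicity : ℕ → List ℕ → ℕ
multiplicity k = length ∘ filter (k ℕ.≟_)

∑ℤ ∏ℤ : ∀ {A : Set} → List A → (A → ℤ) → ℤ
∑ℤ xs f = foldr (λ x s → f x ℤ.+ s) 0ℤ xs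
∏ℤ xs f = foldr (λ x s → f x ℤ.* s) 1ℤ xs

∑ℚ : ∀ {A : Set} → List A → (A → ℚ) → ℚ
∑ℚ xs f = foldr (λ x s → f x ℚ.+ s) 0ℚ xs

fromℤ : ℤ → ℚ
fromℤ z = z ℚ./ 1

------------------------------------------------------------------------
-- Partitions and skew diagrams

record Partition (n : ℕ) : Set where
  field
    parts      : List ℕ
    decreasing : Linked _≥_ parts
    positive   : All NonZero parts
    size       : sum parts ≡ n

open Partition public

-- ρᵢ with i counted from 1, and 0 beyond the end of the list.
part : List ℕ → ℕ → ℕ
part []       _             = 0
part (_ ∷ _)  zero          = 0
part (x ∷ _)  (suc zero)    = x
part (_ ∷ xs) (suc (suc i)) = part xs (suc i)

-- The partitions contained in α, each listed exactly once: ρ is padded with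
-- zeros to the length of α.  Nothing below depends on trailing zeros of ρ.
subpartitions : List ℕ → List (List ℕ)
subpartitions α =
  filter (linked? (λ i j → j ℕ.≤? i)) (choices (map (upTo ∘ suc) α))

Cell : Set
Cell = ℕ × ℕ

-- Cells (row , column), both counted from 1, in row-reading order.  The
-- tableau conditions below rely on this order.
Diagram : Set
Diagram = List Cell

infix 6 _⧸_

_⧸_ : List ℕ → List ℕ → Diagram
α ⧸ ρ = concatMap
  (λ i → map (λ j → i , part ρ i ℕ.+ j) (range (part α i ∸ part ρ i)))
  (range (length α))

diagram : List ℕ → Diagram
diagram α = α ⧸ []

------------------------------------------------------------------------
-- Tableaux

-- A filling of θ is the word of its entries, in the order of the cells of θ.
fillings : Diagram → ℕ → List (List ℕ)
fillings θ m = choices (replicate (length θ) (range m))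

Entry : Set
Entry = Cell × ℕ

-- Conditions on two entries, the first of which comes earlier in row-reading
-- order: it is further left if the rows agree, and higher if the columns agree.
RowStrict RowWeak ColumnStrict : Entry → Entry → Set
RowStrict    ((i , _) , a) ((i′ , _) , b) = i ≡ i′ → a < b
RowWeak      ((i , _) , a) ((i′ , _) , b) = i ≡ i′ → a ≤ b
ColumnStrict ((_ , j) , a) ((_ , j′) , b) = j ≡ j′ → a < b

rowStrict? : ∀ x y → Dec (RowStrict x y)
rowStrict? ((i , _) , a) ((i′ , _) , b) = i ℕ.≟ i′ →-dec a ℕ.<? b

rowWeak? : ∀ x y → Dec (RowWeak x y)
rowWeak? ((i , _) , a) ((i′ , _) , b) = i ℕ.≟ i′ →-dec a ℕ.≤? b

columnStrict? : ∀ x y → Dec (ColumnStrict x y)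
columnStrict? ((_ , j) , a) ((_ , j′) , b) = j ℕ.≟ j′ →-dec a ℕ.<? b

Standard : Diagram → List ℕ → Set
Standard θ w =
  Unique w × AllPairs (λ x y → RowStrict x y × ColumnStrict x y) (zip θ w)

Semistandard : Diagram → List ℕ → Set
Semistandard θ w = AllPairs (λ x y → RowWeak x y × ColumnStrict x y) (zip θ w)

standard? : ∀ θ w → Dec (Standard θ w)
standard? θ w =
  allPairs? (λ a b → ¬? (a ℕ.≟ b)) w ×-dec
  allPairs? (λ x y → rowStrict? x y ×-dec columnStrict? x y) (zip θ w)

semistandard? : ∀ θ w → Dec (Semistandard θ w)
semistandard? θ w =
  allPairs? (λ x y → rowWeak? x y ×-dec columnStrict? x y) (zip θ w)

dim : Diagram → ℕ
dim θ = length (filter (standard? θ) (fillings θ (length θ)))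

weight : ℕ → List ℕ → List ℕ
weight m w = map (λ k → multiplicity k w) (range m)

kostka : ∀ {n} → Partition n → Partition n → ℕ
kostka α μ = length (filter (λ w → semistandard? θ w ×-dec
                                   List.≡-dec ℕ._≟_ (weight m w) (parts μ))
                            (fillings θ m))
  where
  θ = diagram (parts α)
  m = length (parts μ)

-- Numbering the cells in row-reading order is a standard tableau, so dim θ ≢ 0.

choices-replicate : ∀ {A : Set} {xs w : List A} → All (_∈ xs) w →
                    w ∈ choices (replicate (length w) xs)
choices-replicate []         = here refl
choices-replicate (px ∷ pxs) =
  ∈-concatMap⁺ _ (Any.map (λ { refl → ∈-map⁺ _ (choices-replicate pxs) }) px)

All-zip : ∀ {A B : Set} {P : B → Set} (xs : List A) {ys : List B} →
          All P ys → All (P ∘ proj₂) (zip xs ys)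
All-zip []       _          = []
All-zip (_ ∷ _)  []         = []
All-zip (_ ∷ xs) (py ∷ pys) = py ∷ All-zip xs pys

AllPairs-zip : ∀ {A B : Set} {R : B → B → Set} (xs : List A) {ys : List B} →
               AllPairs R ys →
               AllPairs (λ x y → R (proj₂ x) (proj₂ y)) (zip xs ys)
AllPairs-zip []       _          = []
AllPairs-zip (_ ∷ _)  []         = []
AllPairs-zip (_ ∷ xs) (px ∷ pxs) = All-zip xs px ∷ AllPairs-zip xs pxs

range-increasing : ∀ m → AllPairs _<_ (range m)
range-increasing m = AllPairs.applyUpTo⁺₁ suc m (λ i<j _ → ℕ.s≤s i<j)

range-standard : ∀ θ m → Standard θ (range m)
range-standard θ m =
  AllPairs.map ℕ.<⇒≢ (range-increasing m) ,
  AllPairs.map (λ a<b → (λ _ → a<b) , (λ _ → a<b))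
               (AllPairs-zip θ (range-increasing m))

range∈fillings : ∀ θ → range (length θ) ∈ fillings θ (length θ)
range∈fillings θ =
  subst (λ k → range m ∈ choices (replicate k (range m)))
        (List.length-applyUpTo suc m)
        (choices-replicate (All.tabulate id))
  where m = length θ

dim≢0 : ∀ θ → NonZero (dim θ)
dim≢0 θ = ℕ.>-nonZero
  (∈-length (∈-filter⁺ (standard? θ) (range∈fillings θ)
                       (range-standard θ (length θ))))

H : Diagram → ℚ
H θ = ℚ._/_ (+ (length θ !)) (dim θ) {{dim≢0 θ}}

H-positive : ∀ θ → ℚ.Positive (H θ)
H-positive θ = ℚ.normalize-pos (length θ !) (dim θ) {{dim≢0 θ}} {{length θ ℕ.!≢0}}

H*H≢0 : ∀ θ η → ℚ.NonZero (H θ ℚ.* H η)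
H*H≢0 θ η = ℚ.pos⇒nonZero (H θ ℚ.* H η) {{ℚ.pos*pos⇒pos (H θ) {{H-positive θ}}
                                           (H η) {{H-positive η}}}}

infix 7 _/H[_,_]

_/H[_,_] : ℤ → Diagram → Diagram → ℚ
z /H[ θ , η ] = ℚ._÷_ (fromℤ z) (H θ ℚ.* H η) {{H*H≢0 θ η}}

------------------------------------------------------------------------
-- The functions π_μ and ϰ_μ

∏-multiplicities : ∀ {n} → Partition n → (ℕ → ℤ) → ℤ
∏-multiplicities μ f =
  ∏ℤ (range (foldr _⊔_ 0 (parts μ))) (λ k → f k ℤ.^ multiplicity k (parts μ))

π : ∀ {n} → Partition n → List ℕ → ℤ
π μ ρ = ∏-multiplicities μ λ k →
  ∑ℤ (range (length ρ)) (λ i → (+ i ℤ.- + part ρ i) ℤ.^ k)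
  ℤ.- ∑ℤ (range (length ρ)) (λ i → (+ i) ℤ.^ k)

-- falling ρ s (i₁ ∷ i₂ ∷ …) = (ρ_{i₁} - s) (ρ_{i₂} - s - 1) …
falling : List ℕ → ℕ → List ℕ → ℤ
falling ρ s []       = 1ℤ
falling ρ s (i ∷ is) = (+ part ρ i ℤ.- + s) ℤ.* falling ρ (suc s) is

-- A summand with i₁ > length ρ has the factor ρ_{i₁} = 0, so the infinite sum
-- over i₁ ≥ … ≥ i_k ≥ 1 reduces to indices up to length ρ.
ϰ : ∀ {n} → Partition n → List ℕ → ℤ
ϰ μ ρ = ∏-multiplicities μ λ k →
  ∑ℤ (filter (linked? (λ i j → j ℕ.≤? i))
             (choices (replicate k (range (length ρ)))))
     (falling ρ 0)

------------------------------------------------------------------------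
-- Permutations

-- The n! elements of the symmetric group.
permutations : ∀ n → List (Permutation′ n)
permutations zero    = [ Perm.id ]
permutations (suc n) =
  concatMap (λ j → map (insert Fin.zero j) (permutations n)) (allFin (suc n))

Inversion : ∀ {n} → Permutation′ n → Fin n × Fin n → Set
Inversion σ (i , j) = i Fin.< j × (σ ⟨$⟩ʳ j) Fin.< (σ ⟨$⟩ʳ i)

inversion? : ∀ {n} (σ : Permutation′ n) p → Dec (Inversion σ p)
inversion? σ (i , j) = i Fin.<? j ×-dec (σ ⟨$⟩ʳ j) Fin.<? (σ ⟨$⟩ʳ i)

inversions : ∀ {n} → Permutation′ n → ℕ
inversions {n} σ =
  length (filter (inversion? σ) (cartesianProduct (allFin n) (allFin n)))

sgn : ∀ {n} → Permutation′ n → ℚ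
sgn σ = fromℤ (-1ℤ ℤ.^ inversions σ)

rotate : ∀ {A : Set} → List A → List A
rotate []       = []
rotate (x ∷ xs) = xs ++ [ x ]

-- σ permutes the entries of c cyclically: each is sent to the next one, and
-- the last to the first.
IsCycleOf : ∀ {n} → Permutation′ n → List (Fin n) → Set
IsCycleOf σ c = map (σ ⟨$⟩ʳ_) c ≡ rotate c

HasCycleType : ∀ {n} → Permutation′ n → Partition n → Set
HasCycleType {n} σ μ = ∃[ cs ]
  All (IsCycleOf σ) cs × concat cs ↭ allFin n × map length cs ≡ parts μ

------------------------------------------------------------------------
-- Specht modules over ℚ and their characters

-- A bijection from the entries to the cells of the diagram.
record Tableau {n : ℕ} (α : Partition n) : Set where
  constructor tableau
  field position : Permutation n (length (diagram (parts α)))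

open Tableau public

cell : ∀ {n} {α : Partition n} → Tableau α → Fin n → Cell
cell {α = α} t i = lookup (diagram (parts α)) (position t ⟨$⟩ʳ i)

-- The tableau σt: every entry i of t is replaced by σ(i).
relabel : ∀ {n} {α : Partition n} → Permutation′ n → Tableau α → Tableau α
relabel σ t = tableau (flip σ ∘ₚ position t)

-- A tabloid is determined by the row of each entry.
Tabloid : ℕ → Set
Tabloid n = Vec ℕ n

tabloid : ∀ {n} {α : Partition n} → Tableau α → Tabloid n
tabloid t = Vec.tabulate (λ i → proj₁ (cell t i))

ColumnStabilizes : ∀ {n} {α : Partition n} →
                   Tableau α → Permutation′ n → Set
ColumnStabilizes t q =
  ∀ i → proj₂ (cell t (q ⟨$⟩ʳ i)) ≡ proj₂ (cell t i)

columnStabilizes? : ∀ {n} {α : Partition n} (t : Tableau α) q →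
                    Dec (ColumnStabilizes t q)
columnStabilizes? t q =
  Fin.all? (λ i → proj₂ (cell t (q ⟨$⟩ʳ i)) ℕ.≟ proj₂ (cell t i))

columnStabilizer : ∀ {n} {α : Partition n} → Tableau α → List (Permutation′ n)
columnStabilizer {n} t = filter (columnStabilizes? t) (permutations n)

-- v is the linear combination of the tabloids r with coefficients v r.
TabloidSpace : ℕ → Set
TabloidSpace n = Tabloid n → ℚ

infix 4 _≋_

_≋_ : ∀ {n} → TabloidSpace n → TabloidSpace n → Set
u ≋ v = ∀ r → u r ≡ v r

combination : ∀ {n d} → (Fin d → ℚ) → (Fin d → TabloidSpace n) → TabloidSpace n
combination a b r = sumFin (λ i → a i ℚ.* b i r)

-- The linear extension of r ↦ σr, where (σr)(i) = r(σ⁻¹ i): the coefficient of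
-- r in σv is that of σ⁻¹r in v.
infixr 7 _•_

_•_ : ∀ {n} → Permutation′ n → TabloidSpace n → TabloidSpace n
(σ • v) r = v (Vec.tabulate (λ i → Vec.lookup r (σ ⟨$⟩ʳ i)))

single : ∀ {n} → Tabloid n → TabloidSpace n
single s r = if does (Vec.≡-dec ℕ._≟_ s r) then 1ℚ else 0ℚ

polytabloid : ∀ {n} {α : Partition n} → Tableau α → TabloidSpace n
polytabloid t r =
  ∑ℚ (columnStabilizer t)
     (λ q → sgn q ℚ.* single (tabloid (relabel q t)) r)

infix 4 _∈Specht_

_∈Specht_ : ∀ {n} → TabloidSpace n → Partition n → Set
_∈Specht_ v α = Σ[ m ∈ ℕ ] Σ[ a ∈ (Fin m → ℚ) ] Σ[ t ∈ (Fin m → Tableau α) ]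
  v ≋ combination a (polytabloid ∘ t)

-- A basis of the Specht module, with the matrices by which permutations act.
-- Column j of matrix σ holds the coordinates of σ • basis j.
record SpechtRealization {n : ℕ} (α : Partition n) : Set where
  field
    dimension   : ℕ
    basis       : Fin dimension → TabloidSpace n
    member      : ∀ i → basis i ∈Specht α
    independent : ∀ a → combination a basis ≋ (λ _ → 0ℚ) → ∀ i → a i ≡ 0ℚ
    spanning    : ∀ v → v ∈Specht α → ∃[ a ] v ≋ combination a basis
    matrix      : Permutation′ n → Fin dimension → Fin dimension → ℚ
    action      : ∀ σ j →
                  σ • basis j ≋ combination (λ i → matrix σ i j) basis

open SpechtRealization public

character : ∀ {n} {α : Partition n} →
            SpechtRealization α → Permutation′ n → ℚ
character V σ = sumFin (λ i → matrix V σ i i)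

{-# OPTIONS --safe #-}

-- Both sums are alternating sums over the removals of boxes: dim(λ/ρ) counts the
-- ways to remove |λ/ρ| boxes from λ, so with D the operator summing over all
-- removals of one box the right-hand sides are ∑ (±1) D^k z D^{n-k} 1 / (k! (n-k)!)
-- at λ, that is, n-fold iterated differences or commutators divided by n!.
--
-- Kostka numbers.  In the coordinates lᵢ = ρᵢ + N - i, D becomes V = ∑ Xᵢ on
-- antisymmetric functions, where Xᵢ lowers lᵢ.  The commutator of lᵢ and V is Xᵢ,
-- which commutes with V, so the n-fold commutator of ϰ_μ, a polynomial of degree n
-- in the lᵢ, is n! times the product of the complete symmetric functions h_{μᵢ} of
-- the Xᵢ.  By the Pieri rule this counts chains of horizontal strips.
--
-- Characters.  The elements of the Specht module are killed by the operators which
-- raise a letter, and a vector with this property is determined by its values on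
-- row words of standard tableaux.  With respect to this triangular structure the
-- Jucys–Murphy elements of the last n - k letters have the contents of ρ as
-- eigenvalues.  Up to sign, the factors of π_μ(ρ) are power sums ∑ (c^k - (c - 1)^k)
-- over the contents c of ρ, so the right-hand side is an alternating sum of traces
-- of products of such power sums of Jucys–Murphy elements of S_{n-k}.  Expanded into
-- permutations with recorded supports, inclusion–exclusion leaves only the terms
-- whose support is everything.  As each factor involves at most μᵢ letters, these
-- are permutations of cycle type μ, and their total weight is n!.

module Submission where

open import Defs
import Algebra.Properties.CommutativeMonoid.Sum
open import Algebra.Bundles using (CommutativeRing)
import Algebra.Solver.Ring
open import Algebra.Solver.Ring.AlmostCommutativeRing
  using (AlmostCommutativeRing; fromCommutativeRing; _-Raw-AlmostCommutative⟶_)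
open import Algebra.Structures using (IsCommutativeRing)
open import Data.Bool.Base using (Bool; true; false; if_then_else_)
import Data.Bool.Properties as Bool
open import Data.Empty using (⊥)
open import Data.Fin.Base as Fin using (Fin)
open import Data.Fin.Permutation as Perm
  using (Permutation; Permutation′; permutation; _⟨$⟩ʳ_; _⟨$⟩ˡ_; _∘ₚ_; flip; transpose; _≈_; inverseˡ; inverseʳ; insert; remove)
import Data.Fin.Properties as Fin
open import Data.Integer.Base as ℤ using (ℤ; 1ℤ; -1ℤ)
import Data.Integer.Properties as ℤ
open import Data.List.Base as List
  using (List; []; _∷_; [_]; _++_; map; concat; concatMap; foldr; filter; length; replicate; drop; reverse; zip; zipWith; upTo; applyUpTo; allFin; cartesianProduct; _∷ʳ_)
open import Data.List.Membership.DecPropositional using () renaming (_∈?_ to member?)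
open import Data.List.Membership.Propositional using (_∈_; find)
open import Data.List.Membership.Propositional.Properties
  using (∈-map⁺; ∈-map⁻; ∈-concatMap⁺; ∈-concatMap⁻; ∈-filter⁺; ∈-filter⁻; ∈-applyUpTo⁺; ∈-applyUpTo⁻; ∈-upTo⁺; ∈-upTo⁻; ∈-++⁺ˡ; ∈-++⁺ʳ; ∈-++⁻; ∈-∃++; ∈-allFin; ∈-lookup)
import Data.List.Properties as List
open import Data.List.Relation.Binary.Permutation.Propositional as ↭ using (_↭_; ↭-sym; ↭-trans)
open import Data.List.Relation.Binary.Permutation.Propositional.Properties using (↭-length; ↭-reverse; ∈-resp-↭) renaming (shift to ↭-shift)
open import Data.List.Relation.Binary.Pointwise as Pointwise using (Pointwise; []; _∷_; Pointwise-length)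
open import Data.List.Relation.Binary.Sublist.Propositional as Sub using (_⊆_; []; _∷_)
open import Data.List.Relation.Unary.All as All using (All; []; _∷_)
import Data.List.Relation.Unary.All.Properties as All
open import Data.List.Relation.Unary.AllPairs as AllPairs using (AllPairs; []; _∷_; allPairs?)
import Data.List.Relation.Unary.AllPairs.Properties as AllPairs
open import Data.List.Relation.Unary.Any as Any using (Any; here; there; any?)
open import Data.List.Relation.Unary.Any.Properties using (lookup-index)
open import Data.List.Relation.Unary.Linked as Linked using (Linked; linked?; []; [-]; _∷_)
open import Data.List.Relation.Unary.Unique.Propositional using (Unique)
import Data.List.Relation.Unary.Unique.Propositional.Properties as Unique
import Data.Maybe.Base as Maybe
open import Data.Nat.Base as ℕ using (ℕ; zero; suc; pred; _∸_; _⊔_; _≤_; _<_; _≥_; z≤n; s≤s; _!)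
open import Data.Nat.ListAction using (sum)
open import Data.Nat.ListAction.Properties using (sum-++; sum-↭)
import Data.Nat.Properties as ℕ
open import Data.Product.Base using (_×_; _,_; proj₁; proj₂; ∃-syntax; Σ-syntax)
open import Data.Rational.Base as ℚ using (ℚ; 0ℚ; 1ℚ)
import Data.Rational.Properties as ℚ
import Data.Rational.Unnormalised.Base as ℚᵘ
import Data.Rational.Unnormalised.Properties as ℚᵘ
open import Data.Sum.Base using (_⊎_; inj₁; inj₂)
open import Data.Unit.Base using (⊤; tt)
open import Data.Vec.Base as Vec using (Vec; []; _∷_; lookup; _[_]≔_)
import Data.Vec.Properties as Vec
open import Function.Base using (_∘_; id)
open import Relation.Binary.Definitions using (Tri; tri<; tri≈; tri>)
open import Relation.Binary.PropositionalEquality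
open import Relation.Nullary.Decidable using (Dec; yes; no; does; _×-dec_; _→-dec_; ¬?; dec-true; dec-false; dec⇒maybe)
open import Relation.Nullary.Negation using (¬_; contradiction)
open ≡-Reasoning

-- The weights in both sums are 1/(k!(n - k)!) with k = |λ/ρ|, since 1/H_θ = dim θ/|θ|!; up to n!
-- they are binomial coefficients, which is why n-fold differences appear. For Kostka numbers the
-- obstacle is that D agrees with V only on antisymmetric functions: lowering an entry where no box
-- can be removed may produce two equal entries. So ϰ_μ must be symmetric in the lᵢ, which its
-- definition hides, and the constant function 1 must be replaced by an antisymmetric one. For
-- characters, the given basis of the Specht module is arbitrary. The trace is moved to a family
-- dual to evaluation at the row words, and linear independence of the given basis replaces a
-- dimension count. Jucys-Murphy elements depend on an order of the letters, whereas
-- inclusion-exclusion runs over all subsets; since the trace is a class function, only the number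
-- of letters matters. The total weight of the top terms comes from the same argument for the
-- trivial character, where products of power sums become a monic polynomial of degree n in the
-- number of letters.

-- Rational arithmetic for the ring solver

module Rationals where

  open import Data.Integer.Base using (+_)

  module FromℤLaws where

    fromℤ-+ : ∀ a b → fromℤ (a ℤ.+ b) ≡ fromℤ a ℚ.+ fromℤ b
    fromℤ-+ a b = ℚ.toℚᵘ-injective (begin′
      ℚ.toℚᵘ (fromℤ (a ℤ.+ b)) ≈⟨ ℚ.toℚᵘ-fromℚᵘ (ℚᵘ.mkℚᵘ (a ℤ.+ b) 0) ⟩
      ℚᵘ.mkℚᵘ (a ℤ.+ b) 0 ≈⟨ ℚᵘ.*≡* (cong (ℤ._* ℤ.+ 1) (cong₂ ℤ._+_ (sym (ℤ.*-identityʳ a)) (sym (ℤ.*-identityʳ b)))) ⟩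
      ℚᵘ.mkℚᵘ a 0 ℚᵘ.+ ℚᵘ.mkℚᵘ b 0 ≈⟨ ℚᵘ.+-cong (ℚᵘ.≃-sym (ℚ.toℚᵘ-fromℚᵘ (ℚᵘ.mkℚᵘ a 0))) (ℚᵘ.≃-sym (ℚ.toℚᵘ-fromℚᵘ (ℚᵘ.mkℚᵘ b 0))) ⟩
      ℚ.toℚᵘ (fromℤ a) ℚᵘ.+ ℚ.toℚᵘ (fromℤ b) ≈⟨ ℚᵘ.≃-sym (ℚ.toℚᵘ-homo-+ (fromℤ a) (fromℤ b)) ⟩
      ℚ.toℚᵘ (fromℤ a ℚ.+ fromℤ b) ∎′)
      where open ℚᵘ.≃-Reasoning using (step-≈-⟩) renaming (begin_ to begin′_; _∎ to _∎′)

    fromℤ-* : ∀ a b → fromℤ (a ℤ.* b) ≡ fromℤ a ℚ.* fromℤ b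
    fromℤ-* a b = ℚ.toℚᵘ-injective (begin′
      ℚ.toℚᵘ (fromℤ (a ℤ.* b)) ≈⟨ ℚ.toℚᵘ-fromℚᵘ (ℚᵘ.mkℚᵘ (a ℤ.* b) 0) ⟩
      ℚᵘ.mkℚᵘ a 0 ℚᵘ.* ℚᵘ.mkℚᵘ b 0 ≈⟨ ℚᵘ.*-cong (ℚᵘ.≃-sym (ℚ.toℚᵘ-fromℚᵘ (ℚᵘ.mkℚᵘ a 0))) (ℚᵘ.≃-sym (ℚ.toℚᵘ-fromℚᵘ (ℚᵘ.mkℚᵘ b 0))) ⟩
      ℚ.toℚᵘ (fromℤ a) ℚᵘ.* ℚ.toℚᵘ (fromℤ b) ≈⟨ ℚᵘ.≃-sym (ℚ.toℚᵘ-homo-* (fromℤ a) (fromℤ b)) ⟩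
      ℚ.toℚᵘ (fromℤ a ℚ.* fromℤ b) ∎′)
      where open ℚᵘ.≃-Reasoning using (step-≈-⟩) renaming (begin_ to begin′_; _∎ to _∎′)

    fromℤ-neg : ∀ a → fromℤ (ℤ.- a) ≡ ℚ.- fromℤ a
    fromℤ-neg a = ℚ.toℚᵘ-injective (begin′
      ℚ.toℚᵘ (fromℤ (ℤ.- a)) ≈⟨ ℚ.toℚᵘ-fromℚᵘ (ℚᵘ.mkℚᵘ (ℤ.- a) 0) ⟩
      ℚᵘ.- ℚᵘ.mkℚᵘ a 0 ≈⟨ ℚᵘ.-‿cong (ℚᵘ.≃-sym (ℚ.toℚᵘ-fromℚᵘ (ℚᵘ.mkℚᵘ a 0))) ⟩
      ℚᵘ.- ℚ.toℚᵘ (fromℤ a) ≈⟨ ℚᵘ.≃-sym (ℚ.toℚᵘ-homo‿- (fromℤ a)) ⟩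
      ℚ.toℚᵘ (ℚ.- fromℤ a) ∎′)
      where open ℚᵘ.≃-Reasoning using (step-≈-⟩) renaming (begin_ to begin′_; _∎ to _∎′)

    1/suc : ℕ → ℚ
    1/suc n = ℚ.1/_ (fromℤ (+ suc n)) {{ℚ.pos⇒nonZero (fromℤ (+ suc n)) {{ℚ.normalize-pos (suc n) 1}}}}

    *-1/suc : ∀ n → fromℤ (+ suc n) ℚ.* 1/suc n ≡ 1ℚ
    *-1/suc n = ℚ.*-inverseʳ (fromℤ (+ suc n)) {{ℚ.pos⇒nonZero (fromℤ (+ suc n)) {{ℚ.normalize-pos (suc n) 1}}}}

  -- The field operations are opaque: those of the library compute by pattern
  -- matching, which keeps Agda from inferring arguments by unification.
  opaque

    infixl 6 _+_
    infixl 7 _*_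
    infix  8 -_

    _+_ _*_ : ℚ → ℚ → ℚ
    _+_ = ℚ._+_
    _*_ = ℚ._*_

    -_ : ℚ → ℚ
    -_ = ℚ.-_

    ι : ℤ → ℚ
    ι = fromℤ

    1/[1+_] : ℕ → ℚ
    1/[1+_] = FromℤLaws.1/suc

  infixl 6 _-_
  _-_ : ℚ → ℚ → ℚ
  x - y = x + - y

  pattern one = + 1

  0# 1# : ℚ
  0# = ι (+ 0)
  1# = ι (+ 1)

  fromℕ : ℕ → ℚ
  fromℕ n = ι (+ n)

  opaque
    unfolding _+_ _*_ -_ ι 1/[1+_]

    *-def : ∀ x y → x * y ≡ x ℚ.* y
    *-def x y = refl

    ι-def : ∀ z → ι z ≡ fromℤ z
    ι-def z = refl

    isCommutativeRing : IsCommutativeRing _≡_ _+_ _*_ -_ 0# 1#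
    isCommutativeRing = ℚ.+-*-isCommutativeRing

    ι-+ : ∀ a b → ι (a ℤ.+ b) ≡ ι a + ι b
    ι-+ = FromℤLaws.fromℤ-+

    ι-* : ∀ a b → ι (a ℤ.* b) ≡ ι a * ι b
    ι-* = FromℤLaws.fromℤ-*

    ι-neg : ∀ a → ι (ℤ.- a) ≡ - ι a
    ι-neg = FromℤLaws.fromℤ-neg

    *-1/[1+] : ∀ n → fromℕ (suc n) * 1/[1+ n ] ≡ 1#
    *-1/[1+] = FromℤLaws.*-1/suc

  commutativeRing : CommutativeRing _ _
  commutativeRing = record { isCommutativeRing = isCommutativeRing }

  open CommutativeRing commutativeRing public
    using (+-assoc; +-comm; +-identityˡ; +-identityʳ; *-assoc; *-comm; *-identityˡ; *-identityʳ;
           distribˡ; distribʳ; zeroˡ; zeroʳ; -‿inverseˡ; -‿inverseʳ; +-commutativeMonoid)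

  private
    acRing : AlmostCommutativeRing _ _
    acRing = fromCommutativeRing commutativeRing

    ι-morphism : ℤ.+-*-rawRing -Raw-AlmostCommutative⟶ acRing
    ι-morphism = record
      { ⟦_⟧ = ι ; +-homo = ι-+ ; *-homo = ι-* ; -‿homo = ι-neg ; 0-homo = refl ; 1-homo = refl }

  open Algebra.Solver.Ring ℤ.+-*-rawRing acRing ι-morphism
    (λ a b → Maybe.map (cong ι) (dec⇒maybe (a ℤ.≟ b))) public
    using (solve; _:+_; _:*_; _:-_; :-_; _:=_; con)

  opaque
    unfolding ι
    ι-injective : ∀ {a b} → ι a ≡ ι b → a ≡ b
    ι-injective {a} {b} eq = trans (sym (ℤ.*-identityʳ a)) (trans (numerators (ℚᵘ.≃-trans
      (ℚᵘ.≃-sym (ℚ.toℚᵘ-fromℚᵘ (ℚᵘ.mkℚᵘ a 0)))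
      (ℚᵘ.≃-trans (ℚ.toℚᵘ-cong eq) (ℚ.toℚᵘ-fromℚᵘ (ℚᵘ.mkℚᵘ b 0))))) (ℤ.*-identityʳ b))
      where
      numerators : ℚᵘ.mkℚᵘ a 0 ℚᵘ.≃ ℚᵘ.mkℚᵘ b 0 → a ℤ.* ℤ.+ 1 ≡ b ℤ.* ℤ.+ 1
      numerators (ℚᵘ.*≡* e) = e

  fromℕ-injective : ∀ {m n} → fromℕ m ≡ fromℕ n → m ≡ n
  fromℕ-injective eq = ℤ.+-injective (ι-injective eq)

-- Finite sums, indicators and inverse factorials

module Sums where

  open Rationals
  open import Data.Integer.Base using (+_)
  open import Data.Fin.Base using (zero; suc)

  fromℕ-+ : ∀ m n → fromℕ (m ℕ.+ n) ≡ fromℕ m + fromℕ n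
  fromℕ-+ m n = trans (cong ι (ℤ.pos-+ m n)) (ι-+ (+ m) (+ n))

  fromℕ-* : ∀ m n → fromℕ (m ℕ.* n) ≡ fromℕ m * fromℕ n
  fromℕ-* m n = trans (cong ι (ℤ.pos-* m n)) (ι-* (+ m) (+ n))

  fromℕ-suc : ∀ n → fromℕ (suc n) ≡ 1# + fromℕ n
  fromℕ-suc n = fromℕ-+ 1 n

  ι-- : ∀ a b → ι (a ℤ.- b) ≡ ι a - ι b
  ι-- a b = trans (ι-+ a (ℤ.- b)) (cong (_+_ (ι a)) (ι-neg b))

  *-cancelˡ-suc : ∀ n {x y} → fromℕ (suc n) * x ≡ fromℕ (suc n) * y → x ≡ y
  *-cancelˡ-suc n {x} {y} eq = trans (lemma x) (trans (cong (1/[1+ n ] *_) eq) (sym (lemma y)))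
    where
    lemma : ∀ z → z ≡ 1/[1+ n ] * (fromℕ (suc n) * z)
    lemma z = begin
      z                                 ≡⟨ *-identityˡ z ⟨
      1# * z                            ≡⟨ cong (_* z) (*-1/[1+] n) ⟨
      (fromℕ (suc n) * 1/[1+ n ]) * z   ≡⟨ solve 3 (λ a b c → (a :* b) :* c := b :* (a :* c)) refl _ _ _ ⟩
      1/[1+ n ] * (fromℕ (suc n) * z)   ∎

  -- This is 1/n!, given by recursion so that `suc*ifac` cancels one factor at a time.
  ifac : ℕ → ℚ
  ifac zero    = 1#
  ifac (suc n) = ifac n * 1/[1+ n ]

  suc*ifac : ∀ n → fromℕ (suc n) * ifac (suc n) ≡ ifac n
  suc*ifac n = begin
    fromℕ (suc n) * (ifac n * 1/[1+ n ]) ≡⟨ solve 3 (λ a b c → a :* (b :* c) := (a :* c) :* b) refl _ _ _ ⟩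
    (fromℕ (suc n) * 1/[1+ n ]) * ifac n ≡⟨ cong (_* ifac n) (*-1/[1+] n) ⟩
    1# * ifac n                          ≡⟨ *-identityˡ _ ⟩
    ifac n                               ∎

  !*ifac : ∀ n → fromℕ (n !) * ifac n ≡ 1#
  !*ifac zero    = *-identityˡ 1#
  !*ifac (suc n) = begin
    fromℕ (suc n ℕ.* n !) * ifac (suc n)            ≡⟨ cong (_* ifac (suc n)) (fromℕ-* (suc n) (n !)) ⟩
    (fromℕ (suc n) * fromℕ (n !)) * ifac (suc n)    ≡⟨ solve 3 (λ a b c → (a :* b) :* c := b :* (a :* c)) refl _ _ _ ⟩
    fromℕ (n !) * (fromℕ (suc n) * ifac (suc n))    ≡⟨ cong (fromℕ (n !) *_) (suc*ifac n) ⟩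
    fromℕ (n !) * ifac n                            ≡⟨ !*ifac n ⟩
    1#                                              ∎

  ∑ : ∀ {A : Set} → List A → (A → ℚ) → ℚ
  ∑ []       f = 0#
  ∑ (x ∷ xs) f = f x + ∑ xs f

  opaque
    unfolding _+_ ι
    ∑-def : ∀ {A : Set} (xs : List A) f → ∑ xs f ≡ ∑ℚ xs f
    ∑-def []       f = refl
    ∑-def (x ∷ xs) f = cong (f x ℚ.+_) (∑-def xs f)

  open Algebra.Properties.CommutativeMonoid.Sum +-commutativeMonoid public
    using () renaming (sum to ∑ᶠ; sum-cong-≗ to ∑ᶠ-cong; sum-permute to ∑ᶠ-permute; ∑-distrib-+ to ∑ᶠ-+; ∑-comm to ∑ᶠ-comm; sum-replicate-zero to ∑ᶠ-replicate-zero)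

  opaque
    unfolding _+_ ι
    ∑ᶠ-def : ∀ {n} (f : Fin n → ℚ) → ∑ᶠ f ≡ sumFin f
    ∑ᶠ-def {zero}  f = refl
    ∑ᶠ-def {suc n} f = cong (f zero ℚ.+_) (∑ᶠ-def (f ∘ suc))

  ∑ᶠ-zero : ∀ {n} {f : Fin n → ℚ} → (∀ i → f i ≡ 0#) → ∑ᶠ f ≡ 0#
  ∑ᶠ-zero {zero}  eq = refl
  ∑ᶠ-zero {suc n} {f} eq = trans (cong₂ _+_ (eq zero) (∑ᶠ-zero (eq ∘ suc))) (+-identityˡ 0#)

  ∑ᶠ-*ˡ : ∀ {n} c (f : Fin n → ℚ) → ∑ᶠ (λ i → c * f i) ≡ c * ∑ᶠ f
  ∑ᶠ-*ˡ {zero}  c f = sym (zeroʳ c)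
  ∑ᶠ-*ˡ {suc n} c f = trans (cong (_+_ (c * f zero)) (∑ᶠ-*ˡ c (f ∘ suc))) (sym (distribˡ c _ _))

  ∑ᶠ-*ʳ : ∀ {n} c (f : Fin n → ℚ) → ∑ᶠ (λ i → f i * c) ≡ ∑ᶠ f * c
  ∑ᶠ-*ʳ c f = trans (∑ᶠ-cong (λ i → *-comm (f i) c)) (trans (∑ᶠ-*ˡ c f) (*-comm c _))

  module _ {A : Set} where

    ∑-cong : ∀ (xs : List A) {f g : A → ℚ} → (∀ x → f x ≡ g x) → ∑ xs f ≡ ∑ xs g
    ∑-cong []       eq = refl
    ∑-cong (x ∷ xs) eq = cong₂ _+_ (eq x) (∑-cong xs eq)

    ∑-cong∈ : ∀ (xs : List A) {f g : A → ℚ} → (∀ {x} → x ∈ xs → f x ≡ g x) → ∑ xs f ≡ ∑ xs g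
    ∑-cong∈ []       eq = refl
    ∑-cong∈ (x ∷ xs) eq = cong₂ _+_ (eq (here refl)) (∑-cong∈ xs (eq ∘ there))

    ∑-zero : ∀ (xs : List A) {f : A → ℚ} → (∀ x → f x ≡ 0#) → ∑ xs f ≡ 0#
    ∑-zero []       eq = refl
    ∑-zero (x ∷ xs) eq = trans (cong₂ _+_ (eq x) (∑-zero xs eq)) (+-identityˡ 0#)

    ∑-zero∈ : ∀ (xs : List A) {f : A → ℚ} → (∀ {x} → x ∈ xs → f x ≡ 0#) → ∑ xs f ≡ 0#
    ∑-zero∈ xs eq = trans (∑-cong∈ xs eq) (∑-zero xs {λ _ → 0#} (λ _ → refl))

    ∑-+ : ∀ (xs : List A) (f g : A → ℚ) → ∑ xs (λ x → f x + g x) ≡ ∑ xs f + ∑ xs g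
    ∑-+ []       f g = sym (+-identityˡ 0#)
    ∑-+ (x ∷ xs) f g = trans (cong (_+_ (f x + g x)) (∑-+ xs f g))
      (solve 4 (λ a b c d → (a :+ b) :+ (c :+ d) := (a :+ c) :+ (b :+ d)) refl _ _ _ _)

    ∑-*ˡ : ∀ c (xs : List A) (f : A → ℚ) → ∑ xs (λ x → c * f x) ≡ c * ∑ xs f
    ∑-*ˡ c []       f = sym (zeroʳ c)
    ∑-*ˡ c (x ∷ xs) f = trans (cong (_+_ (c * f x)) (∑-*ˡ c xs f)) (sym (distribˡ c _ _))

    ∑-*ʳ : ∀ c (xs : List A) (f : A → ℚ) → ∑ xs (λ x → f x * c) ≡ ∑ xs f * c
    ∑-*ʳ c xs f = trans (∑-cong xs (λ x → *-comm (f x) c)) (trans (∑-*ˡ c xs f) (*-comm c _))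

    ∑-neg : ∀ (xs : List A) (f : A → ℚ) → ∑ xs (λ x → - f x) ≡ - ∑ xs f
    ∑-neg []       f = solve 0 (con (+ 0) := :- con (+ 0)) refl
    ∑-neg (x ∷ xs) f = trans (cong (_+_ (- f x)) (∑-neg xs f))
      (solve 2 (λ a b → :- a :+ :- b := :- (a :+ b)) refl _ _)

    ∑-- : ∀ (xs : List A) (f g : A → ℚ) → ∑ xs (λ x → f x - g x) ≡ ∑ xs f - ∑ xs g
    ∑-- xs f g = trans (∑-+ xs f (λ x → - g x)) (cong (_+_ (∑ xs f)) (∑-neg xs g))

    ∑-++ : ∀ (xs ys : List A) f → ∑ (xs ++ ys) f ≡ ∑ xs f + ∑ ys f
    ∑-++ []       ys f = sym (+-identityˡ _)
    ∑-++ (x ∷ xs) ys f = trans (cong (_+_ (f x)) (∑-++ xs ys f)) (sym (+-assoc (f x) _ _))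

    ∑-↭ : ∀ {xs ys : List A} f → xs ↭ ys → ∑ xs f ≡ ∑ ys f
    ∑-↭ f ↭.refl          = refl
    ∑-↭ f (↭.prep x p)    = cong (_+_ (f x)) (∑-↭ f p)
    ∑-↭ f (↭.swap x y p)  = trans (cong (λ s → f x + (f y + s)) (∑-↭ f p))
      (solve 3 (λ a b c → a :+ (b :+ c) := b :+ (a :+ c)) refl _ _ _)
    ∑-↭ f (↭.trans p q)   = trans (∑-↭ f p) (∑-↭ f q)

  ∑-map : ∀ {A B : Set} (h : A → B) (xs : List A) f → ∑ (map h xs) f ≡ ∑ xs (f ∘ h)
  ∑-map h []       f = refl
  ∑-map h (x ∷ xs) f = cong (_+_ (f (h x))) (∑-map h xs f)

  ∑-concatMap : ∀ {A B : Set} (h : A → List B) (xs : List A) f →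
                ∑ (concatMap h xs) f ≡ ∑ xs (λ x → ∑ (h x) f)
  ∑-concatMap h []       f = refl
  ∑-concatMap h (x ∷ xs) f = trans (∑-++ (h x) _ f) (cong (_+_ (∑ (h x) f)) (∑-concatMap h xs f))

  ∑-swap : ∀ {A B : Set} (xs : List A) (ys : List B) (f : A → B → ℚ) →
           ∑ xs (λ x → ∑ ys (f x)) ≡ ∑ ys (λ y → ∑ xs (λ x → f x y))
  ∑-swap []       ys f = sym (∑-zero ys (λ _ → refl))
  ∑-swap (x ∷ xs) ys f = trans (cong (_+_ (∑ ys (f x))) (∑-swap xs ys f)) (sym (∑-+ ys (f x) _))

  ∑-∑ᶠ-swap : ∀ {A : Set} (xs : List A) {n} (f : A → Fin n → ℚ) →
              ∑ xs (λ x → ∑ᶠ (f x)) ≡ ∑ᶠ (λ i → ∑ xs (λ x → f x i))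
  ∑-∑ᶠ-swap xs {zero}  f = ∑-zero xs (λ _ → refl)
  ∑-∑ᶠ-swap xs {suc n} f = trans (∑-+ xs (λ x → f x zero) _)
    (cong (_+_ (∑ xs (λ x → f x zero))) (∑-∑ᶠ-swap xs (λ x → f x ∘ suc)))

  ∑-choices-∷ : ∀ {A : Set} (xs : List A) xss f →
                ∑ (choices (xs ∷ xss)) f ≡ ∑ xs (λ x → ∑ (choices xss) (f ∘ (x ∷_)))
  ∑-choices-∷ xs xss f = trans (∑-concatMap _ xs f) (∑-cong xs (λ x → ∑-map (x ∷_) (choices xss) f))

  -- Conditions become factors: a sum over a filtered list then runs over the whole list and can be
  -- exchanged with other sums.
  𝟙 : ∀ {P : Set} → Dec P → ℚ
  𝟙 d = if does d then 1# else 0#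

  𝟙-yes : ∀ {P : Set} (d : Dec P) → P → 𝟙 d ≡ 1#
  𝟙-yes d p = cong (if_then 1# else 0#) (dec-true d p)

  𝟙-no : ∀ {P : Set} (d : Dec P) → ¬ P → 𝟙 d ≡ 0#
  𝟙-no d ¬p = cong (if_then 1# else 0#) (dec-false d ¬p)

  𝟙-⇔ : ∀ {P Q : Set} (d : Dec P) (e : Dec Q) → (P → Q) → (Q → P) → 𝟙 d ≡ 𝟙 e
  𝟙-⇔ d (yes q) to from = 𝟙-yes d (from q)
  𝟙-⇔ d (no ¬q) to from = 𝟙-no d (¬q ∘ to)

  𝟙-× : ∀ {P Q : Set} (d : Dec P) (e : Dec Q) → 𝟙 (d ×-dec e) ≡ 𝟙 d * 𝟙 e
  𝟙-× (yes _) (yes _) = sym (*-identityˡ 1#)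
  𝟙-× (yes _) (no _)  = sym (zeroʳ 1#)
  𝟙-× (no _)  e       = sym (zeroˡ (𝟙 e))

  𝟙-yes* : ∀ {P : Set} (d : Dec P) → P → ∀ x → 𝟙 d * x ≡ x
  𝟙-yes* d p x = trans (cong (_* x) (𝟙-yes d p)) (*-identityˡ x)

  𝟙-no* : ∀ {P : Set} (d : Dec P) → ¬ P → ∀ x → 𝟙 d * x ≡ 0#
  𝟙-no* d ¬p x = trans (cong (_* x) (𝟙-no d ¬p)) (zeroˡ x)

  𝟙-cong* : ∀ {P : Set} (d : Dec P) {x y} → (P → x ≡ y) → 𝟙 d * x ≡ 𝟙 d * y
  𝟙-cong* (yes p) eq = cong (1# *_) (eq p)
  𝟙-cong* (no _) {x} {y} eq = trans (zeroˡ x) (sym (zeroˡ y))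

  ∑-filter : ∀ {A : Set} {P : A → Set} (P? : ∀ x → Dec (P x)) xs f →
             ∑ (filter P? xs) f ≡ ∑ xs (λ x → 𝟙 (P? x) * f x)
  ∑-filter P? []       f = refl
  ∑-filter P? (x ∷ xs) f with P? x
  ... | yes _ = cong₂ _+_ (sym (*-identityˡ (f x))) (∑-filter P? xs f)
  ... | no  _ = trans (∑-filter P? xs f)
    (sym (trans (cong (_+ _) (zeroˡ (f x))) (+-identityˡ _)))

  fromℕ-length : ∀ {A : Set} (xs : List A) → fromℕ (length xs) ≡ ∑ xs (λ _ → 1#)
  fromℕ-length []       = refl
  fromℕ-length (x ∷ xs) = trans (fromℕ-suc (length xs)) (cong (_+_ 1#) (fromℕ-length xs))

  fromℕ-count : ∀ {A : Set} {P : A → Set} (P? : ∀ x → Dec (P x)) xs →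
                fromℕ (length (filter P? xs)) ≡ ∑ xs (λ x → 𝟙 (P? x))
  fromℕ-count P? xs = trans (fromℕ-length (filter P? xs))
    (trans (∑-filter P? xs _) (∑-cong xs (λ x → *-identityʳ _)))

  ∑-applyUpTo-suc : ∀ {A : Set} (h : ℕ → A) n f →
                    ∑ (applyUpTo h (suc n)) f ≡ ∑ (applyUpTo h n) f + f (h n)
  ∑-applyUpTo-suc h zero    f = trans (+-identityʳ _) (sym (+-identityˡ _))
  ∑-applyUpTo-suc h (suc n) f =
    trans (cong (_+_ (f (h 0))) (∑-applyUpTo-suc (h ∘ suc) n f)) (sym (+-assoc _ _ _))

  ∑-applyUpTo : ∀ {A : Set} (h : ℕ → A) n f → ∑ (applyUpTo h n) f ≡ ∑ (upTo n) (f ∘ h)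
  ∑-applyUpTo h zero    f = refl
  ∑-applyUpTo h (suc n) f = trans (∑-applyUpTo-suc h n f)
    (trans (cong (_+ f (h n)) (∑-applyUpTo h n f)) (sym (∑-applyUpTo-suc id n (f ∘ h))))

  ∑-upTo-reverse : ∀ k f → ∑ (upTo (suc k)) f ≡ ∑ (upTo (suc k)) (λ d → f (k ℕ.∸ d))
  ∑-upTo-reverse zero    f = refl
  ∑-upTo-reverse (suc k) f = begin
    ∑ (upTo (suc (suc k))) f                                     ≡⟨ ∑-applyUpTo-suc id (suc k) f ⟩
    ∑ (upTo (suc k)) f + f (suc k)                               ≡⟨ cong (_+ f (suc k)) (∑-upTo-reverse k f) ⟩
    ∑ (upTo (suc k)) (λ d → f (k ℕ.∸ d)) + f (suc k)             ≡⟨ +-comm _ _ ⟩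
    f (suc k) + ∑ (upTo (suc k)) (λ d → f (k ℕ.∸ d))             ≡⟨ cong (_+_ (f (suc k))) (∑-applyUpTo suc (suc k) (λ d → f (suc k ℕ.∸ d))) ⟨
    f (suc k) + ∑ (applyUpTo suc (suc k)) (λ d → f (suc k ℕ.∸ d)) ∎

  module _ {A : Set} (_≟_ : ∀ (x y : A) → Dec (x ≡ y)) where

    ∑-none : ∀ {xs} {y} → All (y ≢_) xs → ∀ (f : A → ℚ) → ∑ xs (λ x → 𝟙 (x ≟ y) * f x) ≡ 0#
    ∑-none {xs} y∉ f = ∑-zero∈ xs (λ {x} x∈ → 𝟙-no* (x ≟ _) (λ { refl → All.lookup y∉ x∈ refl }) (f x))

    ∑-single : ∀ {xs} {y} → Unique xs → y ∈ xs → ∀ (f : A → ℚ) → ∑ xs (λ x → 𝟙 (x ≟ y) * f x) ≡ f y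
    ∑-single {x ∷ xs} (x∉ ∷ u) (here refl) f =
      trans (cong₂ _+_ (𝟙-yes* (x ≟ x) refl (f x)) (∑-none x∉ f)) (+-identityʳ _)
    ∑-single {x ∷ xs} {y} (x∉ ∷ u) (there y∈) f =
      trans (cong₂ _+_ (𝟙-no* (x ≟ y) (λ { refl → All.lookup x∉ y∈ refl }) (f x)) (∑-single u y∈ f)) (+-identityˡ _)

-- Skew shapes and removal of the largest letter of a tableau

module SkewTableaux where

  open Rationals
  open Sums

  -- The default 0 makes the condition on the last part in `Decreasing` vacuous, which saves a case
  -- distinction.
  hd : List ℕ → ℕ
  hd []      = 0
  hd (x ∷ _) = x

  Decreasing : List ℕ → Set
  Decreasing []       = ⊤
  Decreasing (x ∷ xs) = hd xs ≤ x × Decreasing xs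

  Linked⇒Decreasing : ∀ {xs} → Linked _≥_ xs → Decreasing xs
  Linked⇒Decreasing []        = tt
  Linked⇒Decreasing [-]       = z≤n , tt
  Linked⇒Decreasing (p ∷ ps)  = p , Linked⇒Decreasing ps

  Decreasing⇒Linked : ∀ xs → Decreasing xs → Linked _≥_ xs
  Decreasing⇒Linked []           _        = []
  Decreasing⇒Linked (x ∷ [])     _        = [-]
  Decreasing⇒Linked (x ∷ y ∷ xs) (p , ps) = p ∷ Decreasing⇒Linked (y ∷ xs) ps

  row : ℕ → ℕ → ℕ → Diagram
  row i a zero    = []
  row i a (suc k) = (i , suc a) ∷ row i (suc a) k

  -- The diagram of `_⧸_` by recursion on rows, the first of which has number `i`; this is the form
  -- on which inductions run. Parts missing from the inner shape count as 0.
  skew : ℕ → List ℕ → List ℕ → Diagram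
  skew i []       _        = []
  skew i (x ∷ xs) []       = row i 0 x ++ skew (suc i) xs []
  skew i (x ∷ xs) (r ∷ rs) = row i r (x ∸ r) ++ skew (suc i) xs rs

  ⧸-skew : ∀ α ρ → α ⧸ ρ ≡ skew 1 α ρ
  ⧸-skew α ρ = trans (cong concat (List.map-applyUpTo suc _ (length α))) (rows α ρ suc 1 (λ _ → refl))
    where
    row-map : ∀ i a k → map (λ j → i , a ℕ.+ j) (range k) ≡ row i a k
    row-map i a k = trans (List.map-applyUpTo suc _ k) (go a k (λ j → (i , a ℕ.+ suc j)) (λ j → cong (i ,_) (ℕ.+-suc a j)))
      where
      go : ∀ a k (f : ℕ → Cell) → (∀ j → f j ≡ (i , suc a ℕ.+ j)) → applyUpTo f k ≡ row i a k
      go a zero    f eq = refl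
      go a (suc k) f eq = cong₂ _∷_ (trans (eq 0) (cong (i ,_) (ℕ.+-identityʳ (suc a))))
        (go (suc a) k (f ∘ suc) (λ j → trans (eq (suc j)) (cong (i ,_) (ℕ.+-suc (suc a) j))))
    rows : ∀ α ρ (h : ℕ → ℕ) i → (∀ k → h k ≡ i ℕ.+ k) →
           concat (applyUpTo (λ k → map (λ j → h k , part ρ (suc k) ℕ.+ j) (range (part α (suc k) ∸ part ρ (suc k)))) (length α))
           ≡ skew i α ρ
    rows []       ρ        h i eq = refl
    rows (x ∷ xs) []       h i eq = cong₂ _++_
      (trans (row-map (h 0) 0 x) (cong (λ r → row r 0 x) (trans (eq 0) (ℕ.+-identityʳ i))))
      (rows xs [] (h ∘ suc) (suc i) (λ k → trans (eq (suc k)) (ℕ.+-suc i k)))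
    rows (x ∷ xs) (r ∷ rs) h i eq = cong₂ _++_
      (trans (row-map (h 0) r (x ∸ r)) (cong (λ q → row q r (x ∸ r)) (trans (eq 0) (ℕ.+-identityʳ i))))
      (rows xs rs (h ∘ suc) (suc i) (λ k → trans (eq (suc k)) (ℕ.+-suc i k)))

  skew-[] : ∀ i xs → skew i xs [] ≡ skew i xs (replicate (length xs) 0)
  skew-[] i []       = refl
  skew-[] i (x ∷ xs) = cong (row i 0 x ++_) (skew-[] (suc i) xs)

  length-row : ∀ i a k → length (row i a k) ≡ k
  length-row i a zero    = refl
  length-row i a (suc k) = cong suc (length-row i (suc a) k)

  length-skew : ∀ i {ρ xs} → Pointwise _≤_ ρ xs → length (skew i xs ρ) ℕ.+ sum ρ ≡ sum xs
  length-skew i []                          = refl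
  length-skew i {r ∷ rs} {x ∷ xs} (p ∷ ps) = begin
    length (row i r (x ∸ r) ++ skew (suc i) xs rs) ℕ.+ (r ℕ.+ sum rs)
      ≡⟨ cong (ℕ._+ (r ℕ.+ sum rs)) (trans (List.length-++ (row i r (x ∸ r))) (cong (ℕ._+ length (skew (suc i) xs rs)) (length-row i r (x ∸ r)))) ⟩
    (x ∸ r ℕ.+ length (skew (suc i) xs rs)) ℕ.+ (r ℕ.+ sum rs)
      ≡⟨ shuffle (x ∸ r) _ r (sum rs) ⟩
    (x ∸ r ℕ.+ r) ℕ.+ (length (skew (suc i) xs rs) ℕ.+ sum rs)
      ≡⟨ cong₂ ℕ._+_ (ℕ.m∸n+n≡m p) (length-skew (suc i) ps) ⟩
    x ℕ.+ sum xs ∎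
    where
    open import Algebra.Properties.CommutativeSemigroup ℕ.+-commutativeSemigroup using (interchange)
    shuffle : ∀ a b c d → (a ℕ.+ b) ℕ.+ (c ℕ.+ d) ≡ (a ℕ.+ c) ℕ.+ (b ℕ.+ d)
    shuffle = interchange

  -- A mask marks the cells of a diagram which hold the largest entry.
  masks : Diagram → List (List Bool)
  masks θ = choices (replicate (length θ) (true ∷ false ∷ []))

  keep : Diagram → List Bool → Diagram
  keep (c ∷ θ) (true ∷ b)  = keep θ b
  keep (c ∷ θ) (false ∷ b) = c ∷ keep θ b
  keep _       _           = []

  trues : List Bool → ℕ
  trues []          = 0
  trues (true ∷ b)  = suc (trues b)
  trues (false ∷ b) = trues b

  trues≤ : ∀ b → trues b ≤ length b
  trues≤ []          = z≤n
  trues≤ (true ∷ b)  = s≤s (trues≤ b)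
  trues≤ (false ∷ b) = ℕ.m≤n⇒m≤1+n (trues≤ b)

  -- Undoes the splitting of a filling into the mask of the letter `M` and the word of the other
  -- letters.
  merge′ : ℕ → List Bool → List ℕ → List ℕ
  merge′ M (true ∷ b)  w       = M ∷ merge′ M b w
  merge′ M (false ∷ b) (x ∷ w) = x ∷ merge′ M b w
  merge′ M _           _       = []

  ∑-two : (f : Bool → ℚ) → ∑ (true ∷ false ∷ []) f ≡ f true + f false
  ∑-two f = cong (f true +_) (+-identityʳ (f false))

  ∑-masks-∷ : ∀ c θ (f : List Bool → ℚ) →
              ∑ (masks (c ∷ θ)) f ≡ ∑ (masks θ) (f ∘ (true ∷_)) + ∑ (masks θ) (f ∘ (false ∷_))
  ∑-masks-∷ c θ f = trans (∑-choices-∷ (true ∷ false ∷ []) (replicate (length θ) (true ∷ false ∷ [])) f) (∑-two (λ b → ∑ (masks θ) (f ∘ (b ∷_))))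

  -- A filling with letters up to `suc m` is the set of cells that hold `suc m` together with a
  -- filling of the other cells by smaller letters.
  ∑-fillings-masks : ∀ m θ (g : List ℕ → ℚ) →
    ∑ (fillings θ (suc m)) g ≡ ∑ (masks θ) (λ b → ∑ (fillings (keep θ b) m) (λ w → g (merge′ (suc m) b w)))
  ∑-fillings-masks m []      g = sym (+-identityʳ _)
  ∑-fillings-masks m (c ∷ θ) g = begin
    ∑ (fillings (c ∷ θ) (suc m)) g
      ≡⟨ ∑-choices-∷ (range (suc m)) (replicate (length θ) (range (suc m))) g ⟩
    ∑ (range (suc m)) (λ x → ∑ (fillings θ (suc m)) (g ∘ (x ∷_)))
      ≡⟨ ∑-cong (range (suc m)) (λ x → ∑-fillings-masks m θ (g ∘ (x ∷_))) ⟩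
    ∑ (range (suc m)) F
      ≡⟨ ∑-applyUpTo-suc suc m F ⟩
    ∑ (range m) F + F (suc m)
      ≡⟨ +-comm _ _ ⟩
    F (suc m) + ∑ (range m) F
      ≡⟨ cong (F (suc m) +_) (∑-swap (range m) (masks θ) _) ⟩
    F (suc m) + ∑ (masks θ) (λ b → ∑ (range m) (λ x → ∑ (fillings (keep θ b) m) (λ w → g (x ∷ merge′ (suc m) b w))))
      ≡⟨ cong (F (suc m) +_) (∑-cong (masks θ) (λ b → sym (∑-choices-∷ (range m) (replicate (length (keep θ b)) (range m)) (λ w → g (merge′ (suc m) (false ∷ b) w))))) ⟩
    F (suc m) + ∑ (masks θ) (λ b → ∑ (fillings (c ∷ keep θ b) m) (λ w → g (merge′ (suc m) (false ∷ b) w)))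
      ≡⟨ ∑-masks-∷ c θ (λ b → ∑ (fillings (keep (c ∷ θ) b) m) (λ w → g (merge′ (suc m) b w))) ⟨
    ∑ (masks (c ∷ θ)) (λ b → ∑ (fillings (keep (c ∷ θ) b) m) (λ w → g (merge′ (suc m) b w))) ∎
    where
    F : ℕ → ℚ
    F x = ∑ (masks θ) (λ b → ∑ (fillings (keep θ b) m) (λ w → g (x ∷ merge′ (suc m) b w)))

  -- The condition that the cells of the largest letter occupy the ends of their rows and columns,
  -- for two cells in reading order. Below a marked cell there can be no cell at all, marked or not,
  -- as its entry would have to be larger.
  MaskRel : Cell × Bool → Cell × Bool → Set
  MaskRel ((i , j) , b) ((i′ , j′) , b′) = b ≡ true → (i ≡ i′ → b′ ≡ true) × j ≢ j′

  maskRel? : ∀ x y → Dec (MaskRel x y)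
  maskRel? ((i , j) , b) ((i′ , j′) , b′) =
    b Bool.≟ true →-dec ((i ℕ.≟ i′ →-dec b′ Bool.≟ true) ×-dec ¬? (j ℕ.≟ j′))

  Strip : Diagram → List Bool → Set
  Strip θ b = AllPairs MaskRel (zip θ b)

  strip? : ∀ θ b → Dec (Strip θ b)
  strip? θ b = allPairs? maskRel? (zip θ b)

  SSRel : Entry → Entry → Set
  SSRel x y = RowWeak x y × ColumnStrict x y

  ∈-concatMap-map⁻ : ∀ {A B C : Set} (f : A → B → C) (g : A → List B) xs {y} → y ∈ concatMap (λ x → map (f x) (g x)) xs →
    ∃[ x ] ∃[ z ] x ∈ xs × z ∈ g x × y ≡ f x z
  ∈-concatMap-map⁻ f g xs y∈ with find (∈-concatMap⁻ _ {xs = xs} y∈)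
  ... | x , x∈ , q with ∈-map⁻ (f x) q
  ...   | z , z∈ , e = x , z , x∈ , z∈ , e

  ∈-choices-replicate⁻ : ∀ {A : Set} k {xs w : List A} → w ∈ choices (replicate k xs) → length w ≡ k × All (_∈ xs) w
  ∈-choices-replicate⁻ zero    (here refl) = refl , []
  ∈-choices-replicate⁻ (suc k) {xs} w∈ with ∈-concatMap-map⁻ _∷_ (λ _ → choices (replicate k xs)) xs w∈
  ... | x , v , x∈ , v∈ , refl with ∈-choices-replicate⁻ k v∈
  ...   | e , all = cong suc e , x∈ ∷ all

  ∈-range⁻ : ∀ {m x} → x ∈ range m → 0 < x × x < suc m
  ∈-range⁻ x∈ with ∈-applyUpTo⁻ suc x∈
  ... | _ , p , refl = s≤s z≤n , s≤s p

  multiplicity-∷ : ∀ k x {u w} → multiplicity k u ≡ multiplicity k w → multiplicity k (x ∷ u) ≡ multiplicity k (x ∷ w)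
  multiplicity-∷ k x {u} {w} eq with k ℕ.≟ x
  ... | yes p = trans (cong length (List.filter-accept (k ℕ.≟_) p)) (trans (cong suc eq) (sym (cong length (List.filter-accept (k ℕ.≟_) p))))
  ... | no ¬p = trans (cong length (List.filter-reject (k ℕ.≟_) ¬p)) (trans eq (sym (cong length (List.filter-reject (k ℕ.≟_) ¬p))))

  module _ {M : ℕ} where

    all-true⁺ : ∀ c θ b w → All (_< M) w → length b ≡ length θ →
      All (λ y → SSRel (c , M) y) (zip θ (merge′ M b w)) → length w ≡ length (keep θ b) →
      All (λ y → MaskRel (c , true) y) (zip θ b)
    all-true⁺ c []      b           w       _         _   _        _   = []
    all-true⁺ c (d ∷ θ) (true ∷ b)  w       w<        lb  (p ∷ ps) lw  =
      (λ _ → (λ _ → refl) , (λ eq → ℕ.<-irrefl refl (proj₂ p eq))) ∷ all-true⁺ c θ b w w< (ℕ.suc-injective lb) ps lw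
    all-true⁺ c (d ∷ θ) (false ∷ b) (x ∷ w) (x< ∷ w<) lb  (p ∷ ps) lw  =
      (λ _ → (λ eq → contradiction (proj₁ p eq) (ℕ.<⇒≱ x<)) , (λ eq → ℕ.<-asym x< (proj₂ p eq)))
      ∷ all-true⁺ c θ b w w< (ℕ.suc-injective lb) ps (ℕ.suc-injective lw)

    all-true⁻ : ∀ c θ b w → All (_< M) w →
      All (λ y → MaskRel (c , true) y) (zip θ b) →
      All (λ y → SSRel (c , M) y) (zip θ (merge′ M b w))
    all-true⁻ c []      b           w       _         _        = []
    all-true⁻ c (d ∷ θ) []          w       _         _        = []
    all-true⁻ c (d ∷ θ) (true ∷ b)  w       w<        (p ∷ ps) =
      ((λ _ → ℕ.≤-refl) , (λ eq → contradiction eq (proj₂ (p refl)))) ∷ all-true⁻ c θ b w w< ps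
    all-true⁻ c (d ∷ θ) (false ∷ b) []      _         _        = []
    all-true⁻ c (d ∷ θ) (false ∷ b) (x ∷ w) (x< ∷ w<) (p ∷ ps) =
      ((λ eq → contradiction (proj₁ (p refl) eq) λ ()) , (λ eq → contradiction eq (proj₂ (p refl)))) ∷ all-true⁻ c θ b w w< ps

    all-false⁺ : ∀ e θ b w → All (λ y → SSRel e y) (zip θ (merge′ M b w)) → All (λ y → SSRel e y) (zip (keep θ b) w)
    all-false⁺ e []      b           w       ps       = []
    all-false⁺ e (d ∷ θ) []          w       ps       = []
    all-false⁺ e (d ∷ θ) (true ∷ b)  w       (p ∷ ps) = all-false⁺ e θ b w ps
    all-false⁺ e (d ∷ θ) (false ∷ b) []      ps       = []
    all-false⁺ e (d ∷ θ) (false ∷ b) (x ∷ w) (p ∷ ps) = p ∷ all-false⁺ e θ b w ps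

    all-false⁻ : ∀ e θ b w → proj₂ e < M → All (λ y → SSRel e y) (zip (keep θ b) w) → All (λ y → SSRel e y) (zip θ (merge′ M b w))
    all-false⁻ e []      b           w       e< ps       = []
    all-false⁻ e (d ∷ θ) []          w       e< ps       = []
    all-false⁻ e (d ∷ θ) (true ∷ b)  w       e< ps       = ((λ _ → ℕ.<⇒≤ e<) , (λ _ → e<)) ∷ all-false⁻ e θ b w e< ps
    all-false⁻ e (d ∷ θ) (false ∷ b) []      e< ps       = []
    all-false⁻ e (d ∷ θ) (false ∷ b) (x ∷ w) e< (p ∷ ps) = p ∷ all-false⁻ e θ b w e< ps

    all-unmasked : ∀ c θ b → All (λ y → MaskRel (c , false) y) (zip θ b)
    all-unmasked c []      b       = []
    all-unmasked c (d ∷ θ) []      = []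
    all-unmasked c (d ∷ θ) (x ∷ b) = (λ ()) ∷ all-unmasked c θ b

    -- All other letters are below `M`. So a comparison that starts at a marked cell amounts to
    -- `MaskRel`, one that leads from an unmarked cell to a marked one holds anyway, and only the
    -- pairs of unmarked cells remain.
    merge-semistandard⁺ : ∀ θ b w → All (_< M) w → length b ≡ length θ → length w ≡ length (keep θ b) →
      Semistandard θ (merge′ M b w) → Semistandard (keep θ b) w × Strip θ b
    merge-semistandard⁺ []      b           w       _         _  _  _        = [] , []
    merge-semistandard⁺ (c ∷ θ) (true ∷ b)  w       w<        lb lw (p ∷ ps) with merge-semistandard⁺ θ b w w< (ℕ.suc-injective lb) lw ps
    ... | s , q = s , all-true⁺ c θ b w w< (ℕ.suc-injective lb) p lw ∷ q
    merge-semistandard⁺ (c ∷ θ) (false ∷ b) (x ∷ w) (x< ∷ w<) lb lw (p ∷ ps) with merge-semistandard⁺ θ b w w< (ℕ.suc-injective lb) (ℕ.suc-injective lw) ps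
    ... | s , q = all-false⁺ (c , x) θ b w p ∷ s , all-unmasked c θ b ∷ q

    merge-semistandard⁻ : ∀ θ b w → All (_< M) w →
      Semistandard (keep θ b) w × Strip θ b → Semistandard θ (merge′ M b w)
    merge-semistandard⁻ []      b           w       _         _             = []
    merge-semistandard⁻ (c ∷ θ) []          w       _         _             = []
    merge-semistandard⁻ (c ∷ θ) (true ∷ b)  w       w<        (s , q ∷ qs)  = all-true⁻ c θ b w w< q ∷ merge-semistandard⁻ θ b w w< (s , qs)
    merge-semistandard⁻ (c ∷ θ) (false ∷ b) []      _         _             = []
    merge-semistandard⁻ (c ∷ θ) (false ∷ b) (x ∷ w) (x< ∷ w<) (p ∷ s , q ∷ qs) = all-false⁻ (c , x) θ b w x< p ∷ merge-semistandard⁻ θ b w w< (s , qs)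

    multiplicity-≢ : ∀ {k} → k ≢ M → ∀ b w → length w ℕ.+ trues b ≡ length b → multiplicity k (merge′ M b w) ≡ multiplicity k w
    multiplicity-≢ k≢ []          []      _ = refl
    multiplicity-≢ k≢ (true ∷ b)  w       l = trans (cong length (List.filter-reject (_ ℕ.≟_) k≢)) (multiplicity-≢ k≢ b w (ℕ.suc-injective (trans (sym (ℕ.+-suc (length w) (trues b))) l)))
    multiplicity-≢ {k} k≢ (false ∷ b) [] l = contradiction (trues≤ b) (ℕ.<⇒≱ (subst (_≤ trues b) l ℕ.≤-refl))
    multiplicity-≢ {k} k≢ (false ∷ b) (x ∷ w) l = multiplicity-∷ k x (multiplicity-≢ k≢ b w (ℕ.suc-injective l))

    multiplicity-max : ∀ b w → All (_< M) w → length w ℕ.+ trues b ≡ length b → multiplicity M (merge′ M b w) ≡ trues b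
    multiplicity-max []          []      _         l = refl
    multiplicity-max (true ∷ b)  w       w<        l = trans (cong length (List.filter-accept (M ℕ.≟_) refl))
      (cong suc (multiplicity-max b w w< (ℕ.suc-injective (trans (sym (ℕ.+-suc (length w) (trues b))) l))))
    multiplicity-max (false ∷ b) []      _         l = contradiction (trues≤ b) (ℕ.<⇒≱ (subst (_≤ trues b) l ℕ.≤-refl))
    multiplicity-max (false ∷ b) (x ∷ w) (x< ∷ w<) l = trans (cong length (List.filter-reject (M ℕ.≟_) (λ { refl → ℕ.<-irrefl refl x< })))
      (multiplicity-max b w w< (ℕ.suc-injective l))

  keep-trues : ∀ θ b → length b ≡ length θ → length (keep θ b) ℕ.+ trues b ≡ length b
  keep-trues []      []          _ = refl
  keep-trues (c ∷ θ) (true ∷ b)  l = trans (ℕ.+-suc _ _) (cong suc (keep-trues θ b (ℕ.suc-injective l)))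
  keep-trues (c ∷ θ) (false ∷ b) l = cong suc (keep-trues θ b (ℕ.suc-injective l))

  weight-merge : ∀ m b w → All (_< suc m) w → length w ℕ.+ trues b ≡ length b →
                 weight (suc m) (merge′ (suc m) b w) ≡ weight m w ∷ʳ trues b
  weight-merge m b w w< l = begin
    map (λ k → multiplicity k (merge′ (suc m) b w)) (range (suc m))
      ≡⟨ cong (map _) (sym (List.applyUpTo-∷ʳ suc m)) ⟩
    map (λ k → multiplicity k (merge′ (suc m) b w)) (range m ∷ʳ suc m)
      ≡⟨ List.map-++ _ (range m) _ ⟩
    map (λ k → multiplicity k (merge′ (suc m) b w)) (range m) ∷ʳ multiplicity (suc m) (merge′ (suc m) b w)
      ≡⟨ cong₂ _∷ʳ_ (List.map-cong-local (All.applyUpTo⁺₁ suc m (λ {i} i<m → multiplicity-≢ (λ eq → ℕ.<-irrefl (ℕ.suc-injective eq) i<m) b w l)))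
                    (multiplicity-max b w w< l) ⟩
    weight m w ∷ʳ trues b ∎

  _≟*_ : ∀ (xs ys : List ℕ) → Dec (xs ≡ ys)
  _≟*_ = List.≡-dec ℕ._≟_

  -- Counts semistandard fillings of weight `μ`, for any diagram. Kostka numbers are one instance
  -- and, with weight (1, ..., 1), numbers of standard tableaux another, so one removal argument
  -- serves both.
  SS : ℕ → Diagram → List ℕ → ℚ
  SS m θ μ = ∑ (fillings θ m) (λ w → 𝟙 (semistandard? θ w) * 𝟙 (weight m w ≟* μ))

  -- The largest letter is the last one of the weight, which is why `k` stands at the end; its cells
  -- form a mask with the property `Strip`, and the smaller letters fill the cells that are kept.
  SS-masks : ∀ m θ μ k →
    SS (suc m) θ (μ ∷ʳ k) ≡ ∑ (masks θ) (λ b → 𝟙 (strip? θ b) * (𝟙 (trues b ℕ.≟ k) * SS m (keep θ b) μ))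
  SS-masks m θ μ k = trans (∑-fillings-masks m θ _) (∑-cong∈ (masks θ) per-mask)
    where
    per-word : ∀ {b} → length b ≡ length θ → ∀ {w} → w ∈ fillings (keep θ b) m →
      𝟙 (semistandard? θ (merge′ (suc m) b w)) * 𝟙 (weight (suc m) (merge′ (suc m) b w) ≟* (μ ∷ʳ k)) ≡
      (𝟙 (strip? θ b) * 𝟙 (trues b ℕ.≟ k)) * (𝟙 (semistandard? (keep θ b) w) * 𝟙 (weight m w ≟* μ))
    per-word {b} lb {w} w∈ = begin
      𝟙 (semistandard? θ (merge′ (suc m) b w)) * 𝟙 (weight (suc m) (merge′ (suc m) b w) ≟* (μ ∷ʳ k))
        ≡⟨ cong₂ _*_
            (trans (𝟙-⇔ (semistandard? θ (merge′ (suc m) b w)) (semistandard? (keep θ b) w ×-dec strip? θ b) (merge-semistandard⁺ θ b w w< lb lw) (merge-semistandard⁻ θ b w w<))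
                   (𝟙-× (semistandard? (keep θ b) w) (strip? θ b)))
            (trans (𝟙-⇔ (weight (suc m) (merge′ (suc m) b w) ≟* (μ ∷ʳ k)) ((weight m w ≟* μ) ×-dec (trues b ℕ.≟ k))
                     (λ eq → List.∷ʳ-injective (weight m w) μ (trans (sym wm) eq))
                     (λ (e₁ , e₂) → trans wm (cong₂ _∷ʳ_ e₁ e₂)))
                   (𝟙-× (weight m w ≟* μ) (trues b ℕ.≟ k))) ⟩
      (𝟙 (semistandard? (keep θ b) w) * 𝟙 (strip? θ b)) * (𝟙 (weight m w ≟* μ) * 𝟙 (trues b ℕ.≟ k))
        ≡⟨ solve 4 (λ a b c d → (a :* b) :* (c :* d) := (b :* d) :* (a :* c)) refl _ _ _ _ ⟩
      (𝟙 (strip? θ b) * 𝟙 (trues b ℕ.≟ k)) * (𝟙 (semistandard? (keep θ b) w) * 𝟙 (weight m w ≟* μ)) ∎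
      where
      w< = All.map (proj₂ ∘ ∈-range⁻) (proj₂ (∈-choices-replicate⁻ (length (keep θ b)) w∈))
      lw : length w ≡ length (keep θ b)
      lw = proj₁ (∈-choices-replicate⁻ (length (keep θ b)) w∈)
      wm = weight-merge m b w w< (trans (cong (ℕ._+ trues b) lw) (keep-trues θ b lb))
    per-mask : ∀ {b} → b ∈ masks θ →
      ∑ (fillings (keep θ b) m) (λ w → 𝟙 (semistandard? θ (merge′ (suc m) b w)) * 𝟙 (weight (suc m) (merge′ (suc m) b w) ≟* (μ ∷ʳ k)))
      ≡ 𝟙 (strip? θ b) * (𝟙 (trues b ℕ.≟ k) * SS m (keep θ b) μ)
    per-mask {b} b∈ = trans (∑-cong∈ (fillings (keep θ b) m) (per-word (proj₁ (∈-choices-replicate⁻ (length θ) b∈))))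
      (trans (∑-*ˡ _ (fillings (keep θ b) m) _) (*-assoc _ _ _))

-- Horizontal strips and the branching rule

module HorizontalStrips where

  open Rationals
  open Sums
  open SkewTableaux

  replicate-++ : ∀ {A : Set} k {x : A} ys → replicate k x ++ x ∷ ys ≡ x ∷ replicate k x ++ ys
  replicate-++ zero    ys = refl
  replicate-++ (suc k) ys = cong (_ ∷_) (replicate-++ k ys)

  ∑-masks-all : ∀ A B (f : List Bool → ℚ) →
    (∀ j b → j < length A → f (replicate j true ++ false ∷ b) ≡ 0#) →
    ∑ (masks (A ++ B)) f ≡ ∑ (masks B) (λ b → f (replicate (length A) true ++ b))
  ∑-masks-all []      B f z = refl
  ∑-masks-all (c ∷ A) B f z = begin
    ∑ (masks (c ∷ A ++ B)) f
      ≡⟨ ∑-masks-∷ c (A ++ B) f ⟩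
    ∑ (masks (A ++ B)) (f ∘ (true ∷_)) + ∑ (masks (A ++ B)) (f ∘ (false ∷_))
      ≡⟨ cong₂ _+_ (∑-masks-all A B (f ∘ (true ∷_)) (λ j b j< → z (suc j) b (s≤s j<)))
                   (∑-zero (masks (A ++ B)) (λ b → z 0 b (s≤s z≤n))) ⟩
    ∑ (masks B) (λ b → f (true ∷ replicate (length A) true ++ b)) + 0#
      ≡⟨ +-identityʳ _ ⟩
    ∑ (masks B) (λ b → f (true ∷ replicate (length A) true ++ b)) ∎

  row-not-all : ∀ i c a k j B b → j < k →
    ¬ All (MaskRel ((i , c) , true)) (zip (row i a k ++ B) (replicate j true ++ false ∷ b))
  row-not-all i c a (suc k) zero    B b _       (p ∷ _)  = contradiction (proj₁ (p refl) refl) λ ()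
  row-not-all i c a (suc k) (suc j) B b (s≤s l) (_ ∷ ps) = row-not-all i c (suc a) k j B b l ps

  strip-row-zero : ∀ i a k j B b → j < k → ¬ Strip (row i a (suc k) ++ B) (true ∷ replicate j true ++ false ∷ b)
  strip-row-zero i a k j B b j< (p ∷ _) = row-not-all i (suc a) (suc a) k j B b j< p

  All-zip-proj₁⁻ : ∀ {A B : Set} {P : A → Set} (xs : List A) (ys : List B) → length ys ≡ length xs →
                All (P ∘ proj₁) (zip xs ys) → All P xs
  All-zip-proj₁⁻ []       ys       _  _        = []
  All-zip-proj₁⁻ (x ∷ xs) (y ∷ ys) eq (p ∷ ps) = p ∷ All-zip-proj₁⁻ xs ys (ℕ.suc-injective eq) ps

  All-zip-proj₁⁺ : ∀ {A B : Set} {P : A → Set} {xs : List A} (ys : List B) →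
                All P xs → All (P ∘ proj₁) (zip xs ys)
  All-zip-proj₁⁺ ys       []       = []
  All-zip-proj₁⁺ []       (p ∷ ps) = []
  All-zip-proj₁⁺ (y ∷ ys) (p ∷ ps) = p ∷ All-zip-proj₁⁺ ys ps

  row-cells : ∀ i a k → All (λ c → proj₁ c ≡ i × a < proj₂ c × proj₂ c ≤ a ℕ.+ k) (row i a k)
  row-cells i a zero    = []
  row-cells i a (suc k) = (refl , ℕ.≤-refl , ℕ.≤-trans (ℕ.≤-reflexive (ℕ.+-comm 1 a)) (ℕ.+-monoʳ-≤ a (s≤s z≤n)))
    ∷ All.map (λ {c} (p , q , r) → p , ℕ.<-trans (ℕ.n<1+n a) q , subst (proj₂ c ≤_) (sym (ℕ.+-suc a k)) r) (row-cells i (suc a) k)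

  skew-cells : ∀ i xs rs → Decreasing xs → All (λ c → i ≤ proj₁ c × proj₂ c ≤ hd xs) (skew i xs rs)
  skew-cells i []       rs       d        = []
  skew-cells i (x ∷ xs) []       (p , d)  = All.++⁺
    (All.map (λ (e , _ , q) → ℕ.≤-reflexive (sym e) , q) (row-cells i 0 x))
    (All.map (λ (q , r) → ℕ.<⇒≤ q , ℕ.≤-trans r p) (skew-cells (suc i) xs [] d))
  skew-cells i (x ∷ xs) (r ∷ rs) (p , d) = All.++⁺ (go (ℕ.≤-total r x))
    (All.map (λ (q , r) → ℕ.<⇒≤ q , ℕ.≤-trans r p) (skew-cells (suc i) xs rs d))
    where
    go : r ≤ x ⊎ x ≤ r → All (λ c → i ≤ proj₁ c × proj₂ c ≤ x) (row i r (x ∸ r))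
    go (inj₁ r≤x) = All.map (λ (e , _ , q) → ℕ.≤-reflexive (sym e) , ℕ.≤-trans q (ℕ.≤-reflexive (ℕ.m+[n∸m]≡n r≤x))) (row-cells i r (x ∸ r))
    go (inj₂ x≤r) = subst (λ k → All (λ c → i ≤ proj₁ c × proj₂ c ≤ x) (row i r k)) (sym (ℕ.m≤n⇒m∸n≡0 x≤r)) []

  ∈-row : ∀ i a k c → a ≤ c → c < a ℕ.+ k → (i , suc c) ∈ row i a k
  ∈-row i a zero    c p q = contradiction (ℕ.≤-trans q (ℕ.≤-reflexive (ℕ.+-identityʳ a))) (ℕ.≤⇒≯ p)
  ∈-row i a (suc k) c p q with a ℕ.≟ c
  ... | yes refl = here refl
  ... | no a≢c   = there (∈-row i (suc a) k c (ℕ.≤∧≢⇒< p a≢c) (subst (c <_) (ℕ.+-suc a k) q))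

  ∈-skew-first : ∀ i xs rs c → hd rs ≤ c → c < hd xs → (i , suc c) ∈ skew i xs rs
  ∈-skew-first i (x ∷ xs) []       c p q = ∈-++⁺ˡ (∈-row i 0 x c p q)
  ∈-skew-first i (x ∷ xs) (r ∷ rs) c p q =
    ∈-++⁺ˡ (∈-row i r (x ∸ r) c p (ℕ.≤-trans q (ℕ.m≤n+m∸n x r)))

  module _ {i : ℕ} {xs rs : List ℕ} (d : Decreasing xs) where

    private B = skew (suc i) xs rs

    strip-true⁻ : ∀ a k b → Strip (row i a k ++ B) (replicate k true ++ b) → Strip B b
    strip-true⁻ a zero    b s       = s
    strip-true⁻ a (suc k) b (_ ∷ s) = strip-true⁻ (suc a) k b s

    -- A marked cell in column a + 1 forbids a cell of that column in the next row. The next row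
    -- would have one if a < `hd xs`, because it begins at or before that column. The bound is the
    -- interlacing condition for horizontal strips.
    strip-hd : ∀ a k b → hd rs ≤ a → length b ≡ length B →
      Strip (row i a (suc k) ++ B) (replicate (suc k) true ++ b) → hd xs ≤ a
    strip-hd a k b r≤a lb (p ∷ _) = ℕ.≮⇒≥ λ a<h →
      All.lookup (All-zip-proj₁⁻ (row i (suc a) k ++ B) (replicate k true ++ b) len (All.map (λ q → proj₂ (q refl)) p))
                 (∈-++⁺ʳ (row i (suc a) k) (∈-skew-first (suc i) xs rs a r≤a a<h)) refl
      where
      len : length (replicate k true ++ b) ≡ length (row i (suc a) k ++ B)
      len = trans (List.length-++ (replicate k true)) (trans (cong₂ ℕ._+_ (trans (List.length-replicate k) (sym (length-row i (suc a) k))) lb)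
        (sym (List.length-++ (row i (suc a) k))))

    strip-true⁺ : ∀ a k b → hd xs ≤ a → Strip B b → Strip (row i a k ++ B) (replicate k true ++ b)
    strip-true⁺ a zero    b h s = s
    strip-true⁺ a (suc k) b h s = cells (suc a) k ℕ.≤-refl ∷ strip-true⁺ (suc a) k b (ℕ.m≤n⇒m≤1+n h) s
      where
      rest : ∀ θ b → All (λ c → suc i ≤ proj₁ c × proj₂ c ≤ hd xs) θ → All (MaskRel ((i , suc a) , true)) (zip θ b)
      rest []      b       _        = []
      rest (c ∷ θ) []      _        = []
      rest (c ∷ θ) (x ∷ b) ((p , q) ∷ ps) =
        (λ _ → (λ { refl → contradiction p ℕ.1+n≰n }) , λ { refl → contradiction (ℕ.≤-trans q h) ℕ.1+n≰n }) ∷ rest θ b ps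
      cells : ∀ a′ k → suc a ≤ a′ → All (MaskRel ((i , suc a) , true)) (zip (row i a′ k ++ B) (replicate k true ++ b))
      cells a′ zero    _ = rest B b (skew-cells (suc i) xs rs d)
      cells a′ (suc k) l = (λ _ → (λ _ → refl) , λ { refl → contradiction l ℕ.1+n≰n }) ∷ cells (suc a′) k (ℕ.m≤n⇒m≤1+n l)

    -- Within a row a horizontal strip is a final segment, which must not
    -- contain a column of the next row.
    ∑-row-masks : ∀ a k (g : List Bool → ℚ) → hd rs ≤ a → hd xs ≤ a ℕ.+ k →
      ∑ (masks (row i a k ++ B)) (λ b → 𝟙 (strip? (row i a k ++ B) b) * g b) ≡
      ∑ (upTo (suc k)) (λ t → 𝟙 (hd xs ℕ.≤? a ℕ.+ t) *
        ∑ (masks B) (λ b → 𝟙 (strip? B b) * g (replicate t false ++ replicate (k ∸ t) true ++ b)))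
    ∑-row-masks a zero    g r≤a h≤ = sym (trans (+-identityʳ _) (𝟙-yes* (hd xs ℕ.≤? a ℕ.+ 0) h≤ _))
    ∑-row-masks a (suc k) g r≤a h≤ = begin
      ∑ (masks (c ∷ θ)) (λ b → 𝟙 (strip? (c ∷ θ) b) * g b)
        ≡⟨ ∑-masks-∷ c θ (λ b → 𝟙 (strip? (c ∷ θ) b) * g b) ⟩
      ∑ (masks θ) (λ b → 𝟙 (strip? (c ∷ θ) (true ∷ b)) * g (true ∷ b)) +
      ∑ (masks θ) (λ b → 𝟙 (strip? (c ∷ θ) (false ∷ b)) * g (false ∷ b))
        ≡⟨ cong₂ _+_ masked unmasked ⟩
      F 0 + ∑ (upTo (suc k)) (λ t → F (suc t))
        ≡⟨ cong (F 0 +_) (sym (∑-applyUpTo suc (suc k) F)) ⟩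
      ∑ (upTo (suc (suc k))) F ∎
      where
      c = (i , suc a)
      θ = row i (suc a) k ++ B
      F : ℕ → ℚ
      F t = 𝟙 (hd xs ℕ.≤? a ℕ.+ t) *
        ∑ (masks B) (λ b → 𝟙 (strip? B b) * g (replicate t false ++ replicate (suc k ∸ t) true ++ b))
      G : List Bool → ℚ
      G b = 𝟙 (strip? (c ∷ θ) (true ∷ b)) * g (true ∷ b)
      -- Once the first cell of the row is marked, so is the whole row, and a single mask of the row
      -- survives.
      masked : ∑ (masks θ) G ≡ F 0
      masked = begin
        ∑ (masks θ) G
          ≡⟨ ∑-masks-all (row i (suc a) k) B G (λ j b j< → 𝟙-no* (strip? (c ∷ θ) _)
               (strip-row-zero i a k j B b (subst (j <_) (length-row i (suc a) k) j<)) _) ⟩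
        ∑ (masks B) (λ b → G (replicate (length (row i (suc a) k)) true ++ b))
          ≡⟨ cong (λ l → ∑ (masks B) (λ b → G (replicate l true ++ b))) (length-row i (suc a) k) ⟩
        ∑ (masks B) (λ b → G (replicate k true ++ b))
          ≡⟨ ∑-cong∈ (masks B) (λ {b} b∈ → trans (cong (_* g (replicate (suc k) true ++ b)) (indicator b
                (proj₁ (∈-choices-replicate⁻ (length B) b∈))))
                (*-assoc _ _ _)) ⟩
        ∑ (masks B) (λ b → 𝟙 (hd xs ℕ.≤? a ℕ.+ 0) * (𝟙 (strip? B b) * g (replicate (suc k) true ++ b)))
          ≡⟨ ∑-*ˡ _ (masks B) _ ⟩
        F 0 ∎
        where
        indicator : ∀ b → length b ≡ length B →
          𝟙 (strip? (c ∷ θ) (replicate (suc k) true ++ b)) ≡ 𝟙 (hd xs ℕ.≤? a ℕ.+ 0) * 𝟙 (strip? B b)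
        indicator b lb = trans (𝟙-⇔ (strip? (c ∷ θ) (replicate (suc k) true ++ b)) ((hd xs ℕ.≤? a ℕ.+ 0) ×-dec strip? B b)
          (λ s → subst (hd xs ≤_) (sym (ℕ.+-identityʳ a)) (strip-hd a k b r≤a lb s) , strip-true⁻ a (suc k) b s)
          (λ (h , s) → strip-true⁺ a (suc k) b (subst (hd xs ≤_) (ℕ.+-identityʳ a) h) s))
          (𝟙-× (hd xs ℕ.≤? a ℕ.+ 0) (strip? B b))
      unmasked : ∑ (masks θ) (λ b → 𝟙 (strip? (c ∷ θ) (false ∷ b)) * g (false ∷ b)) ≡ ∑ (upTo (suc k)) (λ t → F (suc t))
      unmasked = begin
        ∑ (masks θ) (λ b → 𝟙 (strip? (c ∷ θ) (false ∷ b)) * g (false ∷ b))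
          ≡⟨ ∑-cong (masks θ) (λ b → cong (_* g (false ∷ b)) (𝟙-⇔ (strip? (c ∷ θ) (false ∷ b)) (strip? θ b)
               (λ { (_ ∷ s) → s }) (λ s → all-unmasked {0} c θ b ∷ s))) ⟩
        ∑ (masks θ) (λ b → 𝟙 (strip? θ b) * g (false ∷ b))
          ≡⟨ ∑-row-masks (suc a) k (g ∘ (false ∷_)) (ℕ.m≤n⇒m≤1+n r≤a) (subst (hd xs ≤_) (ℕ.+-suc a k) h≤) ⟩
        ∑ (upTo (suc k)) (λ t → 𝟙 (hd xs ℕ.≤? suc a ℕ.+ t) *
          ∑ (masks B) (λ b → 𝟙 (strip? B b) * g (false ∷ replicate t false ++ replicate (k ∸ t) true ++ b)))
          ≡⟨ ∑-cong (upTo (suc k)) (λ t → cong (λ u → 𝟙 (hd xs ℕ.≤? u) *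
               ∑ (masks B) (λ b → 𝟙 (strip? B b) * g (false ∷ replicate t false ++ replicate (k ∸ t) true ++ b))) (sym (ℕ.+-suc a t))) ⟩
        ∑ (upTo (suc k)) (λ t → F (suc t)) ∎

  -- The pairs (∣α∣ - ∣ν∣ , ν) with ρ ⊆ ν ⊆ α and α / ν a horizontal strip.
  strips : List ℕ → List ℕ → List (ℕ × List ℕ)
  strips (x ∷ xs) (r ∷ rs) = concatMap
    (λ t → map (λ (s , ν) → (x ∸ r) ∸ t ℕ.+ s , r ℕ.+ t ∷ ν) (strips xs rs))
    (filter (λ t → hd xs ℕ.≤? r ℕ.+ t) (upTo (suc (x ∸ r))))
  strips _        _        = (0 , []) ∷ []

  ∑-strips-∷ : ∀ x xs r rs (f : ℕ × List ℕ → ℚ) → ∑ (strips (x ∷ xs) (r ∷ rs)) f ≡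
    ∑ (upTo (suc (x ∸ r))) (λ t → 𝟙 (hd xs ℕ.≤? r ℕ.+ t) *
      ∑ (strips xs rs) (λ (s , ν) → f ((x ∸ r) ∸ t ℕ.+ s , r ℕ.+ t ∷ ν)))
  ∑-strips-∷ x xs r rs f = trans (∑-concatMap _ (filter (λ t → hd xs ℕ.≤? r ℕ.+ t) (upTo (suc (x ∸ r)))) f)
    (trans (∑-filter (λ t → hd xs ℕ.≤? r ℕ.+ t) (upTo (suc (x ∸ r))) _)
    (∑-cong (upTo (suc (x ∸ r))) (λ t → cong (𝟙 (hd xs ℕ.≤? r ℕ.+ t) *_) (∑-map _ (strips xs rs) f))))

  keep-row : ∀ i a t j B b → keep (row i a (t ℕ.+ j) ++ B) (replicate t false ++ replicate j true ++ b) ≡ row i a t ++ keep B b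
  keep-row i a zero    zero    B b = refl
  keep-row i a zero    (suc j) B b = keep-row i (suc a) zero j B b
  keep-row i a (suc t) j       B b = cong ((i , suc a) ∷_) (keep-row i (suc a) t j B b)

  trues-row : ∀ t j b → trues (replicate t false ++ replicate j true ++ b) ≡ j ℕ.+ trues b
  trues-row zero    zero    b = refl
  trues-row zero    (suc j) b = cong suc (trues-row zero j b)
  trues-row (suc t) j       b = trues-row t j b

  -- The summand is an arbitrary function `g` of the size of the strip and of the remaining diagram,
  -- because the induction on rows adds the current row to both.
  ∑-masks-strips : ∀ i α ρ → Decreasing α → Decreasing ρ → Pointwise _≤_ ρ α → (g : ℕ → Diagram → ℚ) →
    ∑ (masks (skew i α ρ)) (λ b → 𝟙 (strip? (skew i α ρ) b) * g (trues b) (keep (skew i α ρ) b)) ≡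
    ∑ (strips α ρ) (λ (t , ν) → g t (skew i ν ρ))
  ∑-masks-strips i []       []       dα       dρ       []       g = cong (_+ 0#) (*-identityˡ _)
  ∑-masks-strips i (x ∷ xs) (r ∷ rs) (hα , dα) (hρ , dρ) (p ∷ ps) g = begin
    ∑ (masks θ) (λ b → 𝟙 (strip? θ b) * g (trues b) (keep θ b))
      ≡⟨ ∑-row-masks {i} {xs} {rs} dα r k (λ b → g (trues b) (keep θ b)) hρ
           (ℕ.≤-trans hα (ℕ.≤-reflexive (sym (ℕ.m+[n∸m]≡n p)))) ⟩
    ∑ (upTo (suc k)) (λ t → 𝟙 (hd xs ℕ.≤? r ℕ.+ t) * ∑ (masks B) (λ b → 𝟙 (strip? B b) *
      g (trues (M t b)) (keep θ (M t b))))
      ≡⟨ ∑-cong∈ (upTo (suc k)) (λ {t} t∈ → cong (𝟙 (hd xs ℕ.≤? r ℕ.+ t) *_) (per-row (bound t∈))) ⟩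
    ∑ (upTo (suc k)) (λ t → 𝟙 (hd xs ℕ.≤? r ℕ.+ t) * ∑ (strips xs rs) (λ (s , ν) → g (k ∸ t ℕ.+ s) (skew i (r ℕ.+ t ∷ ν) (r ∷ rs))))
      ≡⟨ ∑-strips-∷ x xs r rs _ ⟨
    ∑ (strips (x ∷ xs) (r ∷ rs)) (λ (t , ν) → g t (skew i ν (r ∷ rs))) ∎
    where
    k = x ∸ r
    B = skew (suc i) xs rs
    θ = row i r k ++ B
    M : ℕ → List Bool → List Bool
    M t b = replicate t false ++ replicate (k ∸ t) true ++ b
    bound : ∀ {t} → t ∈ upTo (suc k) → t ≤ k
    bound t∈ = ℕ.≤-pred (∈-upTo⁻ t∈)
    per-row : ∀ {t} → t ≤ k →
      ∑ (masks B) (λ b → 𝟙 (strip? B b) * g (trues (M t b)) (keep θ (M t b))) ≡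
      ∑ (strips xs rs) (λ (s , ν) → g (k ∸ t ℕ.+ s) (skew i (r ℕ.+ t ∷ ν) (r ∷ rs)))
    per-row {t} t≤k = begin
      ∑ (masks B) (λ b → 𝟙 (strip? B b) * g (trues (M t b)) (keep θ (M t b)))
        ≡⟨ ∑-cong (masks B) (λ b → cong₂ (λ u v → 𝟙 (strip? B b) * g u v) (trues-row t (k ∸ t) b)
             (trans (cong (λ l → keep (row i r l ++ B) (M t b)) (sym (ℕ.m+[n∸m]≡n t≤k))) (keep-row i r t (k ∸ t) B b))) ⟩
      ∑ (masks B) (λ b → 𝟙 (strip? B b) * g (k ∸ t ℕ.+ trues b) (row i r t ++ keep B b))
        ≡⟨ ∑-masks-strips (suc i) xs rs dα dρ ps (λ s η → g (k ∸ t ℕ.+ s) (row i r t ++ η)) ⟩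
      ∑ (strips xs rs) (λ (s , ν) → g (k ∸ t ℕ.+ s) (row i r t ++ skew (suc i) ν rs))
        ≡⟨ ∑-cong (strips xs rs) (λ (s , ν) → cong (λ l → g (k ∸ t ℕ.+ s) (row i r l ++ skew (suc i) ν rs)) (sym (ℕ.m+n∸m≡n r t))) ⟩
      ∑ (strips xs rs) (λ (s , ν) → g (k ∸ t ℕ.+ s) (skew i (r ℕ.+ t ∷ ν) (r ∷ rs))) ∎

  -- The branching rule: deleting the largest letter leaves a skew shape with the same inner shape,
  -- so the recursion stays within skew shapes.
  SS-strips : ∀ m i α ρ μ k → Decreasing α → Decreasing ρ → Pointwise _≤_ ρ α →
    SS (suc m) (skew i α ρ) (μ ∷ʳ k) ≡ ∑ (strips α ρ) (λ (t , ν) → 𝟙 (t ℕ.≟ k) * SS m (skew i ν ρ) μ)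
  SS-strips m i α ρ μ k dα dρ ρ≤α = trans (SS-masks m (skew i α ρ) μ k)
    (∑-masks-strips i α ρ dα dρ ρ≤α (λ t η → 𝟙 (t ℕ.≟ k) * SS m η μ))

-- Numbers of standard tableaux of skew shape

module Dimensions where

  open Rationals
  open Sums
  open SkewTableaux
  open HorizontalStrips

  fromℕ-sum : ∀ {A : Set} (f : A → ℕ) xs → fromℕ (sum (map f xs)) ≡ ∑ xs (λ x → fromℕ (f x))
  fromℕ-sum f []       = refl
  fromℕ-sum f (x ∷ xs) = trans (fromℕ-+ (f x) _) (cong (fromℕ (f x) +_) (fromℕ-sum f xs))

  range-unique : ∀ m → Unique (range m)
  range-unique m = AllPairs.map ℕ.<⇒≢ (range-increasing m)

  ∈-range : ∀ {m y} → 0 < y → y < suc m → y ∈ range m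
  ∈-range {m} {suc y} _ (s≤s y<m) = ∈-applyUpTo⁺ suc y<m

  sum-weight : ∀ m w → All (_∈ range m) w → sum (weight m w) ≡ length w
  sum-weight m w w∈ = fromℕ-injective (begin
    fromℕ (sum (weight m w))                          ≡⟨ fromℕ-sum (λ k → multiplicity k w) (range m) ⟩
    ∑ (range m) (λ k → fromℕ (multiplicity k w))      ≡⟨ ∑-cong (range m) (λ k → fromℕ-count (k ℕ.≟_) w) ⟩
    ∑ (range m) (λ k → ∑ w (λ y → 𝟙 (k ℕ.≟ y)))       ≡⟨ ∑-swap (range m) w _ ⟩
    ∑ w (λ y → ∑ (range m) (λ k → 𝟙 (k ℕ.≟ y)))       ≡⟨ ∑-cong∈ w (λ {y} y∈ → trans
        (∑-cong (range m) (λ k → sym (*-identityʳ (𝟙 (k ℕ.≟ y)))))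
        (∑-single ℕ._≟_ (range-unique m) (All.lookup w∈ y∈) (λ _ → 1#))) ⟩
    ∑ w (λ _ → 1#)                                    ≡⟨ fromℕ-length w ⟨
    fromℕ (length w)                                  ∎)

  multiplicity-∉ : ∀ {k w} → All (k ≢_) w → multiplicity k w ≡ 0
  multiplicity-∉ {k} k∉ = cong length (List.filter-none (k ℕ.≟_) k∉)

  multiplicity≡0⇒∉ : ∀ k w → multiplicity k w ≡ 0 → All (k ≢_) w
  multiplicity≡0⇒∉ k []      _  = []
  multiplicity≡0⇒∉ k (x ∷ w) eq with k ℕ.≟ x
  ... | yes p = contradiction (trans (sym (cong length (List.filter-accept (k ℕ.≟_) p))) eq) λ ()
  ... | no ¬p = ¬p ∷ multiplicity≡0⇒∉ k w (trans (sym (cong length (List.filter-reject (k ℕ.≟_) ¬p))) eq)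

  Unique⇒multiplicity≤1 : ∀ k {w} → Unique w → multiplicity k w ≤ 1
  Unique⇒multiplicity≤1 k []      = z≤n
  Unique⇒multiplicity≤1 k {x ∷ w} (x∉ ∷ u) with k ℕ.≟ x
  ... | yes refl = ℕ.≤-reflexive (trans (cong length (List.filter-accept (k ℕ.≟_) refl)) (cong suc (multiplicity-∉ x∉)))
  ... | no ¬p    = subst (_≤ 1) (sym (cong length (List.filter-reject (k ℕ.≟_) ¬p))) (Unique⇒multiplicity≤1 k u)

  multiplicity≤-∷ : ∀ k x w → multiplicity k w ≤ multiplicity k (x ∷ w)
  multiplicity≤-∷ k x w with k ℕ.≟ x
  ... | yes p = subst (multiplicity k w ≤_) (sym (cong length (List.filter-accept (k ℕ.≟_) p))) (ℕ.n≤1+n _)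
  ... | no ¬p = ℕ.≤-reflexive (sym (cong length (List.filter-reject (k ℕ.≟_) ¬p)))

  multiplicity≤1⇒Unique : ∀ w → (∀ {k} → k ∈ w → multiplicity k w ≤ 1) → Unique w
  multiplicity≤1⇒Unique []      _ = []
  multiplicity≤1⇒Unique (x ∷ w) h =
    multiplicity≡0⇒∉ x w (ℕ.n≤0⇒n≡0 (ℕ.≤-pred (subst (_≤ 1) (cong length (List.filter-accept (x ℕ.≟_) refl)) (h (here refl)))))
    ∷ multiplicity≤1⇒Unique w (λ {k} k∈ → ℕ.≤-trans (multiplicity≤-∷ k x w) (h (there k∈)))

  sum≤length : ∀ {xs} → All (_≤ 1) xs → sum xs ≤ length xs
  sum≤length []       = z≤n
  sum≤length (p ∷ ps) = ℕ.+-mono-≤ p (sum≤length ps)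

  all-ones : ∀ {xs} → All (_≤ 1) xs → sum xs ≡ length xs → xs ≡ replicate (length xs) 1
  all-ones []                          _  = refl
  all-ones {zero ∷ xs}  (_ ∷ ps)       eq = contradiction (sum≤length ps) (ℕ.<⇒≱ (ℕ.≤-reflexive (sym eq)))
  all-ones {suc zero ∷ xs} (_ ∷ ps)    eq = cong (1 ∷_) (all-ones ps (ℕ.suc-injective eq))
  all-ones {suc (suc x) ∷ xs} (s≤s () ∷ ps) eq

  All-map∈ : ∀ {A B : Set} {P : B → Set} (f : A → B) {xs} → (∀ {x} → x ∈ xs → P (f x)) → All P (map f xs)
  All-map∈ f h = All.map⁺ (All.tabulate h)

  -- Distinct letters from 1, ..., |θ| have multiplicities at most 1 which add up to |θ|, so all of
  -- them are 1.
  standard⁺ : ∀ θ {w} → w ∈ fillings θ (length θ) →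
    Standard θ w → Semistandard θ w × weight (length θ) w ≡ replicate (length θ) 1
  standard⁺ θ {w} w∈ (u , s) =
    AllPairs.map (λ (r , c) → (λ e → ℕ.<⇒≤ (r e)) , c) s ,
    trans (all-ones (All-map∈ (λ k → multiplicity k w) {range m} (λ {k} _ → Unique⇒multiplicity≤1 k u))
            (trans (sum-weight m w (proj₂ (∈-choices-replicate⁻ (length θ) w∈))) (trans lw (sym lm))))
          (cong (λ l → replicate l 1) lm)
    where
    m = length θ
    lw : length w ≡ m
    lw = proj₁ (∈-choices-replicate⁻ m w∈)
    lm : length (weight m w) ≡ m
    lm = trans (List.length-map _ (range m)) (List.length-applyUpTo suc m)

  -- Multiplicities 1 make the letters distinct, and weak inequalities along rows become strict.
  standard⁻ : ∀ θ {w} → w ∈ fillings θ (length θ) →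
    Semistandard θ w × weight (length θ) w ≡ replicate (length θ) 1 → Standard θ w
  standard⁻ θ {w} w∈ (s , e) = u ,
    AllPairs.zipWith (λ ((r , c) , ne) → (λ eq → ℕ.≤∧≢⇒< (r eq) ne) , c) (s , AllPairs-zip θ u)
    where
    m = length θ
    all1 : All (_≤ 1) (weight m w)
    all1 = subst (All (_≤ 1)) (sym e) (All.replicate⁺ m ℕ.≤-refl)
    u : Unique w
    u = multiplicity≤1⇒Unique w (λ k∈ → All.lookup (All.map⁻ all1) (All.lookup (proj₂ (∈-choices-replicate⁻ (length θ) w∈)) k∈))

  dimℚ : Diagram → ℚ
  dimℚ θ = fromℕ (dim θ)

  dim-SS : ∀ θ → dimℚ θ ≡ SS (length θ) θ (replicate (length θ) 1)
  dim-SS θ = trans (fromℕ-count (standard? θ) (fillings θ (length θ))) (∑-cong∈ (fillings θ (length θ)) (λ {w} w∈ →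
    trans (𝟙-⇔ (standard? θ w) (semistandard? θ w ×-dec (weight (length θ) w ≟* replicate (length θ) 1)) (standard⁺ θ w∈) (standard⁻ θ w∈))
          (𝟙-× (semistandard? θ w) (weight (length θ) w ≟* replicate (length θ) 1))))

  kostka-SS : ∀ {n} (α μ : Partition n) →
    fromℕ (kostka α μ) ≡ SS (length (parts μ)) (diagram (parts α)) (parts μ)
  kostka-SS α μ = trans (fromℕ-count _ (fillings (diagram (parts α)) (length (parts μ))))
    (∑-cong (fillings (diagram (parts α)) (length (parts μ)))
      (λ w → 𝟙-× (semistandard? (diagram (parts α)) w) (weight (length (parts μ)) w ≟* parts μ)))

  -- Here the index is the number `d` of boxes removed from the first row instead of the number
  -- kept, so that strips of size 0 and 1 involve only d = 0 and d = 1.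
  ∑-strips-∷′ : ∀ x xs r rs → r ≤ x → (f : ℕ × List ℕ → ℚ) → ∑ (strips (x ∷ xs) (r ∷ rs)) f ≡
    ∑ (upTo (suc (x ∸ r))) (λ d → 𝟙 (hd xs ℕ.≤? x ∸ d) *
      ∑ (strips xs rs) (λ (s , ν) → f (d ℕ.+ s , x ∸ d ∷ ν)))
  ∑-strips-∷′ x xs r rs r≤x f = trans (∑-strips-∷ x xs r rs f) (trans (∑-upTo-reverse (x ∸ r) _)
    (∑-cong∈ (upTo (suc (x ∸ r))) (λ {d} d∈ → cong₂ (λ u v → 𝟙 (hd xs ℕ.≤? v) * ∑ (strips xs rs) (λ (s , ν) → f (u ℕ.+ s , v ∷ ν)))
       (ℕ.m∸[m∸n]≡n (ℕ.≤-pred (∈-upTo⁻ d∈)))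
       (trans (sym (ℕ.+-∸-assoc r (ℕ.≤-pred (∈-upTo⁻ d∈)))) (cong (_∸ d) (ℕ.m+[n∸m]≡n r≤x))))))

  _⊑_ : List ℕ → List ℕ → Set
  _⊑_ = Pointwise _≤_

  _⊑?_ : ∀ ρ α → Dec (ρ ⊑ α)
  _⊑?_ = Pointwise.decidable ℕ._≤?_

  hd-mono : ∀ {ρ α} → ρ ⊑ α → hd ρ ≤ hd α
  hd-mono []      = z≤n
  hd-mono (p ∷ _) = p

  StripOf : List ℕ → List ℕ → ℕ × List ℕ → Set
  StripOf α ρ (t , ν) = Decreasing ν × ρ ⊑ ν × ν ⊑ α × t ℕ.+ sum ν ≡ sum α

  strips-all : ∀ {α ρ} → Decreasing α → ρ ⊑ α → ∀ {tν} → tν ∈ strips α ρ → StripOf α ρ tν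
  strips-all {[]}     {[]}     d       []       (here refl) = tt , [] , [] , refl
  strips-all {x ∷ xs} {r ∷ rs} (h , d) (p ∷ ps) tν∈
    with ∈-concatMap-map⁻ (λ t (s , ν) → (x ∸ r) ∸ t ℕ.+ s , r ℕ.+ t ∷ ν) (λ _ → strips xs rs) (filter (λ t → hd xs ℕ.≤? r ℕ.+ t) (upTo (suc (x ∸ r)))) tν∈
  ... | t , (s , ν) , t∈′ , sν∈ , refl with strips-all d ps sν∈ | ∈-filter⁻ (λ t → hd xs ℕ.≤? r ℕ.+ t) {xs = upTo (suc (x ∸ r))} t∈′
  ...   | dν , ρ⊑ν , ν⊑xs , e | t∈ , hx =
    (ℕ.≤-trans (hd-mono ν⊑xs) hx , dν) , (ℕ.m≤m+n r t ∷ ρ⊑ν) , (r+t≤x ∷ ν⊑xs) ,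
    trans (interchange (x ∸ r ∸ t) s (r ℕ.+ t) (sum ν)) (cong₂ ℕ._+_
      (trans (cong (ℕ._+ (r ℕ.+ t)) (ℕ.∸-+-assoc x r t)) (ℕ.m∸n+n≡m r+t≤x)) e)
    where
    open import Algebra.Properties.CommutativeSemigroup ℕ.+-commutativeSemigroup using (interchange)
    r+t≤x : r ℕ.+ t ≤ x
    r+t≤x = subst (r ℕ.+ t ≤_) (ℕ.m+[n∸m]≡n p) (ℕ.+-monoʳ-≤ r (ℕ.≤-pred (∈-upTo⁻ t∈)))

  ∑-strips-0 : ∀ {α ρ} → Decreasing α → ρ ⊑ α → (h : List ℕ → ℚ) →
    ∑ (strips α ρ) (λ (t , ν) → 𝟙 (t ℕ.≟ 0) * h ν) ≡ h α
  ∑-strips-0 {[]}     {[]}     d       []       h = trans (+-identityʳ _) (*-identityˡ _)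
  ∑-strips-0 {x ∷ xs} {r ∷ rs} (q , d) (p ∷ ps) h = begin
    ∑ (strips (x ∷ xs) (r ∷ rs)) (λ (t , ν) → 𝟙 (t ℕ.≟ 0) * h ν)
      ≡⟨ ∑-strips-∷′ x xs r rs p (λ (t , ν) → 𝟙 (t ℕ.≟ 0) * h ν) ⟩
    F 0 + ∑ (applyUpTo suc (x ∸ r)) F
      ≡⟨ cong₂ _+_ (trans (𝟙-yes* (hd xs ℕ.≤? x) q _) (∑-strips-0 d ps (h ∘ (x ∷_))))
           (trans (∑-applyUpTo suc (x ∸ r) F) (∑-zero (upTo (x ∸ r)) λ i →
             trans (cong (𝟙 (hd xs ℕ.≤? x ∸ suc i) *_) (∑-zero (strips xs rs) (λ (s , ν) → zeroˡ _))) (zeroʳ _))) ⟩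
    h (x ∷ xs) + 0#
      ≡⟨ +-identityʳ _ ⟩
    h (x ∷ xs) ∎
    where
    F : ℕ → ℚ
    F d = 𝟙 (hd xs ℕ.≤? x ∸ d) * ∑ (strips xs rs) (λ (s , ν) → 𝟙 (d ℕ.+ s ℕ.≟ 0) * h (x ∸ d ∷ ν))

  -- The partitions obtained by removing a box, with the row of the box.
  removals : List ℕ → List (ℕ × List ℕ)
  removals []       = []
  removals (x ∷ xs) =
    (if does (hd xs ℕ.<? x) then (1 , pred x ∷ xs) ∷ [] else []) ++
    map (λ (i , ν) → suc i , x ∷ ν) (removals xs)
    where open import Data.Bool.Base using (if_then_else_)

  ∑-removals-∷ : ∀ x xs (f : ℕ × List ℕ → ℚ) → ∑ (removals (x ∷ xs)) f ≡
    𝟙 (hd xs ℕ.<? x) * f (1 , pred x ∷ xs) + ∑ (removals xs) (λ (i , ν) → f (suc i , x ∷ ν))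
  ∑-removals-∷ x xs f = trans (∑-++ first (map (λ (i , ν) → suc i , x ∷ ν) (removals xs)) f)
    (cong₂ _+_ head′ (∑-map (λ (i , ν) → suc i , x ∷ ν) (removals xs) f))
    where
    first = if does (hd xs ℕ.<? x) then (1 , pred x ∷ xs) ∷ [] else []
    head′ : ∑ first f ≡ 𝟙 (hd xs ℕ.<? x) * f (1 , pred x ∷ xs)
    head′ with hd xs ℕ.<ᵇ x
    ... | true  = trans (+-identityʳ _) (sym (*-identityˡ _))
    ... | false = sym (zeroˡ _)

  -- A horizontal strip with one box is a removable box. As `removals` does not know the inner
  -- shape, the condition that the inner shape survives is put in as an indicator.
  ∑-strips-1 : ∀ {α ρ} → Decreasing α → ρ ⊑ α → (h : List ℕ → ℚ) →
    ∑ (strips α ρ) (λ (t , ν) → 𝟙 (t ℕ.≟ 1) * h ν) ≡ ∑ (removals α) (λ (_ , ν) → 𝟙 (ρ ⊑? ν) * h ν)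
  ∑-strips-1 {[]}     {[]}     d       []       h = trans (+-identityʳ _) (zeroˡ _)
  ∑-strips-1 {x ∷ xs} {r ∷ rs} (q , d) (p ∷ ps) h = begin
    ∑ (strips (x ∷ xs) (r ∷ rs)) (λ (t , ν) → 𝟙 (t ℕ.≟ 1) * h ν)
      ≡⟨ ∑-strips-∷′ x xs r rs p (λ (t , ν) → 𝟙 (t ℕ.≟ 1) * h ν) ⟩
    F 0 + ∑ (applyUpTo suc (x ∸ r)) F
      ≡⟨ cong₂ _+_ unchanged removed ⟩
    ∑ (removals xs) (λ (_ , ν) → 𝟙 ((r ∷ rs) ⊑? (x ∷ ν)) * h (x ∷ ν)) +
    𝟙 (hd xs ℕ.<? x) * (𝟙 ((r ∷ rs) ⊑? (pred x ∷ xs)) * h (pred x ∷ xs))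
      ≡⟨ trans (+-comm _ _) (sym (∑-removals-∷ x xs (λ (_ , ν) → 𝟙 ((r ∷ rs) ⊑? ν) * h ν))) ⟩
    ∑ (removals (x ∷ xs)) (λ (_ , ν) → 𝟙 ((r ∷ rs) ⊑? ν) * h ν) ∎
    where
    F : ℕ → ℚ
    F d = 𝟙 (hd xs ℕ.≤? x ∸ d) * ∑ (strips xs rs) (λ (s , ν) → 𝟙 (d ℕ.+ s ℕ.≟ 1) * h (x ∸ d ∷ ν))
    unchanged : F 0 ≡ ∑ (removals xs) (λ (_ , ν) → 𝟙 ((r ∷ rs) ⊑? (x ∷ ν)) * h (x ∷ ν))
    unchanged = trans (𝟙-yes* (hd xs ℕ.≤? x) q _) (trans (∑-strips-1 d ps (h ∘ (x ∷_)))
      (∑-cong (removals xs) (λ (_ , ν) → cong (_* h (x ∷ ν))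
        (𝟙-⇔ (rs ⊑? ν) ((r ∷ rs) ⊑? (x ∷ ν)) (p ∷_) (λ { (_ ∷ l) → l })))))
    F2 : ∀ i → F (suc (suc i)) ≡ 0#
    F2 i = trans (cong (𝟙 (hd xs ℕ.≤? x ∸ suc (suc i)) *_) (∑-zero (strips xs rs) (λ (s , ν) → zeroˡ _))) (zeroʳ _)
    removed : ∑ (applyUpTo suc (x ∸ r)) F ≡ 𝟙 (hd xs ℕ.<? x) * (𝟙 ((r ∷ rs) ⊑? (pred x ∷ xs)) * h (pred x ∷ xs))
    -- If the first row has no box outside the inner shape, the removal is excluded by the
    -- indicator; otherwise the term d = 1 alone remains.
    removed with x ∸ r in eq
    ... | zero = sym (zero-case (hd xs ℕ.<? x))
      where
      zero-case : (D : Dec (hd xs < x)) → 𝟙 D * (𝟙 ((r ∷ rs) ⊑? (pred x ∷ xs)) * h (pred x ∷ xs)) ≡ 0#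
      zero-case (no ¬h)  = zeroˡ _
      zero-case (yes h<) = trans (cong (1# *_) (𝟙-no* ((r ∷ rs) ⊑? (pred x ∷ xs)) (λ { (r≤ ∷ _) → bad x (ℕ.m∸n≡0⇒m≤n eq) r≤ h< }) _)) (zeroʳ 1#)
        where
        bad : ∀ x → x ≤ r → r ≤ pred x → hd xs < x → ⊥
        bad (suc x) x≤r r≤x _ = ℕ.1+n≰n (ℕ.≤-trans x≤r r≤x)
    ... | suc k = begin
      F 1 + ∑ (applyUpTo (suc ∘ suc) k) F
        ≡⟨ cong (F 1 +_) (trans (∑-applyUpTo (suc ∘ suc) k F) (∑-zero (upTo k) F2)) ⟩
      F 1 + 0#
        ≡⟨ +-identityʳ _ ⟩
      𝟙 (hd xs ℕ.≤? x ∸ 1) * ∑ (strips xs rs) (λ (s , ν) → 𝟙 (suc s ℕ.≟ 1) * h (x ∸ 1 ∷ ν))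
        ≡⟨ cong (𝟙 (hd xs ℕ.≤? x ∸ 1) *_) (∑-cong (strips xs rs) (λ (s , ν) → cong (_* h (x ∸ 1 ∷ ν)) (𝟙-⇔ (suc s ℕ.≟ 1) (s ℕ.≟ 0) ℕ.suc-injective (cong suc)))) ⟩
      𝟙 (hd xs ℕ.≤? x ∸ 1) * ∑ (strips xs rs) (λ (s , ν) → 𝟙 (s ℕ.≟ 0) * h (x ∸ 1 ∷ ν))
        ≡⟨ cong (𝟙 (hd xs ℕ.≤? x ∸ 1) *_) (∑-strips-0 d ps (h ∘ (x ∸ 1 ∷_))) ⟩
      𝟙 (hd xs ℕ.≤? x ∸ 1) * h (x ∸ 1 ∷ xs)
        ≡⟨ cong₂ _*_ (𝟙-⇔ (hd xs ℕ.≤? x ∸ 1) (hd xs ℕ.<? x) (λ l → ℕ.≤-<-trans l (pred< x x>r)) (λ l → ℕ.∸-monoˡ-≤ 1 l))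
             refl ⟩
      𝟙 (hd xs ℕ.<? x) * h (pred x ∷ xs)
        ≡⟨ cong (𝟙 (hd xs ℕ.<? x) *_) (sym (𝟙-yes* ((r ∷ rs) ⊑? (pred x ∷ xs)) (ℕ.<⇒≤pred x>r ∷ ps) _)) ⟩
      𝟙 (hd xs ℕ.<? x) * (𝟙 ((r ∷ rs) ⊑? (pred x ∷ xs)) * h (pred x ∷ xs)) ∎
      where
      x>r : r < x
      x>r = ℕ.m∸n≢0⇒n<m (λ e → contradiction (trans (sym eq) e) λ ())
      pred< : ∀ x → r < x → x ∸ 1 < x
      pred< (suc x) _ = ℕ.n<1+n x

  replicate-∷ʳ : ∀ {A : Set} k (x : A) → replicate (suc k) x ≡ replicate k x ∷ʳ x
  replicate-∷ʳ zero    x = refl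
  replicate-∷ʳ (suc k) x = cong (x ∷_) (replicate-∷ʳ k x)

  skewdim : List ℕ → List ℕ → ℚ
  skewdim α ρ = dimℚ (skew 1 α ρ)

  -- The largest entry of a standard tableau sits in a removable box: the branching rule for strips
  -- of size 1.
  skewdim-rec : ∀ {α ρ} → Decreasing α → Decreasing ρ → ρ ⊑ α → ∀ {k} → length (skew 1 α ρ) ≡ suc k →
    skewdim α ρ ≡ ∑ (removals α) (λ (_ , ν) → 𝟙 (ρ ⊑? ν) * skewdim ν ρ)
  skewdim-rec {α} {ρ} dα dρ ρ⊑α {k} len = begin
    dimℚ (skew 1 α ρ)
      ≡⟨ dim-SS (skew 1 α ρ) ⟩
    SS (length (skew 1 α ρ)) (skew 1 α ρ) (replicate (length (skew 1 α ρ)) 1)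
      ≡⟨ cong (λ l → SS l (skew 1 α ρ) (replicate l 1)) len ⟩
    SS (suc k) (skew 1 α ρ) (replicate (suc k) 1)
      ≡⟨ cong (SS (suc k) (skew 1 α ρ)) (replicate-∷ʳ k 1) ⟩
    SS (suc k) (skew 1 α ρ) (replicate k 1 ∷ʳ 1)
      ≡⟨ SS-strips k 1 α ρ (replicate k 1) 1 dα dρ ρ⊑α ⟩
    ∑ (strips α ρ) (λ (t , ν) → 𝟙 (t ℕ.≟ 1) * SS k (skew 1 ν ρ) (replicate k 1))
      ≡⟨ ∑-cong∈ (strips α ρ) (λ {(t , ν)} ∈s → 𝟙-cong* (t ℕ.≟ 1) (λ { refl → same ν (strips-all dα ρ⊑α ∈s) })) ⟩
    ∑ (strips α ρ) (λ (t , ν) → 𝟙 (t ℕ.≟ 1) * skewdim ν ρ)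
      ≡⟨ ∑-strips-1 dα ρ⊑α (λ ν → skewdim ν ρ) ⟩
    ∑ (removals α) (λ (_ , ν) → 𝟙 (ρ ⊑? ν) * skewdim ν ρ) ∎
    where
    same : ∀ ν → StripOf α ρ (1 , ν) → SS k (skew 1 ν ρ) (replicate k 1) ≡ skewdim ν ρ
    same ν (_ , ρ⊑ν , _ , e) = trans (cong (λ l → SS l (skew 1 ν ρ) (replicate l 1)) (sym lν)) (sym (dim-SS (skew 1 ν ρ)))
      where
      lν : length (skew 1 ν ρ) ≡ k
      lν = ℕ.+-cancelʳ-≡ (sum ρ) _ k (trans (length-skew 1 ρ⊑ν) (ℕ.suc-injective (trans e (trans (sym (length-skew 1 ρ⊑α)) (cong (ℕ._+ sum ρ) len)))))

-- The sums of the theorem as iterated removals of boxes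

module HookSums where

  open Rationals
  open Sums
  open SkewTableaux
  open HorizontalStrips
  open Dimensions
  open import Data.Integer.Base using (+_)

  -- The relation behind the list `removals`, in a form that allows induction. Rows count from 1,
  -- and a row that becomes empty is kept as a part 0, so that lengths are preserved.
  data Removes : List ℕ → ℕ → List ℕ → Set where
    here  : ∀ {x xs} → hd xs ≤ x → Removes (suc x ∷ xs) 1 (x ∷ xs)
    there : ∀ {x xs i ν} → Removes xs i ν → Removes (x ∷ xs) (suc i) (x ∷ ν)

  ∈-if : ∀ {A P : Set} (d : Dec P) {a x : A} → x ∈ (if does d then a ∷ [] else []) → P × x ≡ a
  ∈-if d x∈ with d
  ∈-if _ (here e) | yes p = p , e

  ∈-removals : ∀ α {i ν} → (i , ν) ∈ removals α → Removes α i ν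
  ∈-removals (x ∷ xs) m with ∈-++⁻ (if does (hd xs ℕ.<? x) then (1 , pred x ∷ xs) ∷ [] else []) m
  ∈-removals (zero ∷ xs)  m | inj₁ ()
  ∈-removals (suc x ∷ xs) m | inj₁ m′ with ∈-if (hd xs ℕ.<? suc x) m′
  ... | p , refl = here (ℕ.≤-pred p)
  ∈-removals (x ∷ xs)     m | inj₂ m′ with ∈-map⁻ (λ (i , ν) → suc i , x ∷ ν) m′
  ... | _ , m″ , refl = there (∈-removals xs m″)

  Removes-⊑ : ∀ {α i ν} → Removes α i ν → ν ⊑ α
  Removes-⊑ (here _)  = ℕ.n≤1+n _ ∷ Pointwise.refl ℕ.≤-refl
  Removes-⊑ (there r) = ℕ.≤-refl ∷ Removes-⊑ r

  Removes-sum : ∀ {α i ν} → Removes α i ν → suc (sum ν) ≡ sum α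
  Removes-sum (here _)              = refl
  Removes-sum (there {x} {ν = ν} r) = trans (sym (ℕ.+-suc x (sum ν))) (cong (x ℕ.+_) (Removes-sum r))

  Removes-decreasing : ∀ {α i ν} → Removes α i ν → Decreasing α → Decreasing ν
  Removes-decreasing (here p)  (_ , d) = p , d
  Removes-decreasing (there r) (p , d) = ℕ.≤-trans (hd-mono (Removes-⊑ r)) p , Removes-decreasing r d

  box : List ℕ → List (List ℕ)
  box α = choices (map (upTo ∘ suc) α)

  ∑-box-∷ : ∀ x xs (f : List ℕ → ℚ) → ∑ (box (x ∷ xs)) f ≡ ∑ (upTo (suc x)) (λ i → ∑ (box xs) (f ∘ (i ∷_)))
  ∑-box-∷ x xs f = ∑-choices-∷ (upTo (suc x)) (map (upTo ∘ suc) xs) f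

  ∈-box : ∀ α {ρ} → ρ ∈ box α → ρ ⊑ α
  ∈-box []       (here refl) = []
  ∈-box (x ∷ xs) ρ∈ with ∈-concatMap-map⁻ _∷_ (λ _ → box xs) (upTo (suc x)) ρ∈
  ... | _ , _ , i∈ , q , refl = ℕ.≤-pred (∈-upTo⁻ i∈) ∷ ∈-box xs q

  ∑-upTo-≤ : ∀ {y x} → y ≤ x → (f : ℕ → ℚ) → ∑ (upTo (suc x)) (λ i → 𝟙 (i ℕ.≤? y) * f i) ≡ ∑ (upTo (suc y)) f
  ∑-upTo-≤ {y} {x} y≤x f with ℕ.≤⇒≤′ y≤x
  ... | ℕ.≤′-reflexive refl = ∑-cong∈ (upTo (suc x)) (λ {i} i∈ → 𝟙-yes* (i ℕ.≤? x) (ℕ.≤-pred (∈-upTo⁻ i∈)) (f i))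
  ... | ℕ.≤′-step {n = x′} q = begin
    ∑ (upTo (suc (suc x′))) (λ i → 𝟙 (i ℕ.≤? y) * f i)
      ≡⟨ ∑-applyUpTo-suc id (suc x′) (λ i → 𝟙 (i ℕ.≤? y) * f i) ⟩
    ∑ (upTo (suc x′)) (λ i → 𝟙 (i ℕ.≤? y) * f i) + 𝟙 (suc x′ ℕ.≤? y) * f (suc x′)
      ≡⟨ cong₂ _+_ (∑-upTo-≤ (ℕ.≤′⇒≤ q) f) (𝟙-no* (suc x′ ℕ.≤? y) (ℕ.<⇒≱ (s≤s (ℕ.≤′⇒≤ q))) _) ⟩
    ∑ (upTo (suc y)) f + 0#
      ≡⟨ +-identityʳ _ ⟩
    ∑ (upTo (suc y)) f ∎

  ∑-box-⊑ : ∀ {ν α} → ν ⊑ α → (f : List ℕ → ℚ) → ∑ (box α) (λ ρ → 𝟙 (ρ ⊑? ν) * f ρ) ≡ ∑ (box ν) f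
  ∑-box-⊑ []       f = cong (_+ 0#) (*-identityˡ _)
  ∑-box-⊑ {y ∷ ν} {x ∷ xs} (p ∷ ps) f = begin
    ∑ (box (x ∷ xs)) (λ ρ → 𝟙 (ρ ⊑? (y ∷ ν)) * f ρ)
      ≡⟨ ∑-box-∷ x xs _ ⟩
    ∑ (upTo (suc x)) (λ i → ∑ (box xs) (λ ρ → 𝟙 ((i ∷ ρ) ⊑? (y ∷ ν)) * f (i ∷ ρ)))
      ≡⟨ ∑-cong (upTo (suc x)) (λ i → trans (∑-cong (box xs) (λ ρ →
           trans (cong (_* f (i ∷ ρ)) (trans (𝟙-⇔ ((i ∷ ρ) ⊑? (y ∷ ν)) ((i ℕ.≤? y) ×-dec (ρ ⊑? ν)) (λ { (a ∷ b) → a , b }) (λ (a , b) → a ∷ b)) (𝟙-× (i ℕ.≤? y) (ρ ⊑? ν))))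
                 (*-assoc _ _ _))) (∑-*ˡ _ (box xs) _)) ⟩
    ∑ (upTo (suc x)) (λ i → 𝟙 (i ℕ.≤? y) * ∑ (box xs) (λ ρ → 𝟙 (ρ ⊑? ν) * f (i ∷ ρ)))
      ≡⟨ ∑-upTo-≤ p _ ⟩
    ∑ (upTo (suc y)) (λ i → ∑ (box xs) (λ ρ → 𝟙 (ρ ⊑? ν) * f (i ∷ ρ)))
      ≡⟨ ∑-cong (upTo (suc y)) (λ i → ∑-box-⊑ ps (f ∘ (i ∷_))) ⟩
    ∑ (upTo (suc y)) (λ i → ∑ (box ν) (f ∘ (i ∷_)))
      ≡⟨ ∑-box-∷ y ν f ⟨
    ∑ (box (y ∷ ν)) f ∎

  ∑-box-≡ : ∀ α (f : List ℕ → ℚ) → ∑ (box α) (λ ρ → 𝟙 (ρ ≟* α) * f ρ) ≡ f α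
  ∑-box-≡ []       f = trans (+-identityʳ _) (*-identityˡ _)
  ∑-box-≡ (x ∷ xs) f = begin
    ∑ (box (x ∷ xs)) (λ ρ → 𝟙 (ρ ≟* (x ∷ xs)) * f ρ)
      ≡⟨ ∑-box-∷ x xs _ ⟩
    ∑ (upTo (suc x)) (λ i → ∑ (box xs) (λ ρ → 𝟙 ((i ∷ ρ) ≟* (x ∷ xs)) * f (i ∷ ρ)))
      ≡⟨ ∑-cong (upTo (suc x)) (λ i → trans (∑-cong (box xs) (λ ρ →
           trans (cong (_* f (i ∷ ρ)) (trans (𝟙-⇔ ((i ∷ ρ) ≟* (x ∷ xs)) ((i ℕ.≟ x) ×-dec (ρ ≟* xs)) List.∷-injective (λ (a , b) → cong₂ _∷_ a b)) (𝟙-× (i ℕ.≟ x) (ρ ≟* xs))))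
                 (*-assoc _ _ _))) (∑-*ˡ _ (box xs) _)) ⟩
    ∑ (upTo (suc x)) (λ i → 𝟙 (i ℕ.≟ x) * ∑ (box xs) (λ ρ → 𝟙 (ρ ≟* xs) * f (i ∷ ρ)))
      ≡⟨ ∑-single ℕ._≟_ (Unique.upTo⁺ (suc x)) (∈-upTo⁺ ℕ.≤-refl) _ ⟩
    ∑ (box xs) (λ ρ → 𝟙 (ρ ≟* xs) * f (x ∷ ρ))
      ≡⟨ ∑-box-≡ xs (f ∘ (x ∷_)) ⟩
    f (x ∷ xs) ∎

  -- This is the k-th power of the operator D.
  down : ℕ → (List ℕ → ℚ) → List ℕ → ℚ
  down zero    G α = G α
  down (suc k) G α = ∑ (removals α) (λ (_ , ν) → down k G ν)

  decreasing? : ∀ ρ → Dec (Linked _≥_ ρ)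
  decreasing? = linked? (λ i j → j ℕ.≤? i)

  Linked⇒dec : ∀ {ρ} → Linked _≥_ ρ → Decreasing ρ
  Linked⇒dec = Linked⇒Decreasing

  ⊑-sum≡ : ∀ {ρ α} → ρ ⊑ α → sum ρ ≡ sum α → ρ ≡ α
  ⊑-sum≡ []       _  = refl
  ⊑-sum≡ {r ∷ rs} {x ∷ xs} (p ∷ ps) eq = cong₂ _∷_ r≡x (⊑-sum≡ ps (ℕ.+-cancelˡ-≡ r _ _ (trans eq (cong (ℕ._+ sum xs) (sym r≡x)))))
    where
    sum-mono : ∀ {ρ α} → ρ ⊑ α → sum ρ ≤ sum α
    sum-mono []       = z≤n
    sum-mono (p ∷ ps) = ℕ.+-mono-≤ p (sum-mono ps)
    r≡x : r ≡ x
    r≡x = ℕ.≤-antisym p (ℕ.≮⇒≥ λ r<x → ℕ.<-irrefl eq (ℕ.+-mono-<-≤ r<x (sum-mono ps)))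

  skew-self : ∀ i α → skew i α α ≡ []
  skew-self i []       = refl
  skew-self i (x ∷ xs) = cong₂ _++_ (cong (row i x) (ℕ.n∸n≡0 x)) (skew-self (suc i) xs)

  -- Removing boxes from α one at a time reaches a shape ρ with |α/ρ| = k in dim(α/ρ) ways. The
  -- recursion for `skewdim` is substituted and the sum over removals is moved outside.
  ∑-skewdim : ∀ k {α} → Decreasing α → ∀ G →
    ∑ (box α) (λ ρ → 𝟙 (decreasing? ρ) * (𝟙 (length (skew 1 α ρ) ℕ.≟ k) * (skewdim α ρ * G ρ))) ≡ down k G α
  ∑-skewdim zero {α} dα G = trans (∑-cong∈ (box α) term) (∑-box-≡ α G)
    where
    term : ∀ {ρ} → ρ ∈ box α → 𝟙 (decreasing? ρ) * (𝟙 (length (skew 1 α ρ) ℕ.≟ 0) * (skewdim α ρ * G ρ)) ≡ 𝟙 (ρ ≟* α) * G ρ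
    term {ρ} ρ∈ with ρ ≟* α
    ... | yes refl = trans (𝟙-yes* (decreasing? ρ) (Decreasing⇒Linked ρ dα) _)
          (trans (𝟙-yes* (length (skew 1 ρ ρ) ℕ.≟ 0) (cong length (skew-self 1 ρ)) _) (cong (λ θ → dimℚ θ * G ρ) (skew-self 1 ρ)))
    ... | no ρ≢α  = trans (cong (𝟙 (decreasing? ρ) *_) (𝟙-no* (length (skew 1 α ρ) ℕ.≟ 0)
          (λ e → ρ≢α (⊑-sum≡ (∈-box α ρ∈) (trans (cong (ℕ._+ sum ρ) (sym e)) (length-skew 1 (∈-box α ρ∈))))) _)) (trans (zeroʳ _) (sym (zeroˡ _)))
  ∑-skewdim (suc k) {α} dα G = begin
    ∑ (box α) (λ ρ → 𝟙 (decreasing? ρ) * (𝟙 (length (skew 1 α ρ) ℕ.≟ suc k) * (skewdim α ρ * G ρ)))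
      ≡⟨ ∑-cong∈ (box α) (λ {ρ} ρ∈ → trans (𝟙-cong* (decreasing? ρ) (λ l → trans (𝟙-cong* (length (skew 1 α ρ) ℕ.≟ suc k)
           (λ e → trans (cong (_* G ρ) (skewdim-rec dα (Linked⇒dec l) (∈-box α ρ∈) e)) (sym (∑-*ʳ (G ρ) (removals α) _))))
           (sym (∑-*ˡ _ (removals α) _)))) (sym (∑-*ˡ _ (removals α) _))) ⟩
    ∑ (box α) (λ ρ → ∑ (removals α) (λ (_ , ν) → 𝟙 (decreasing? ρ) * (𝟙 (length (skew 1 α ρ) ℕ.≟ suc k) * ((𝟙 (ρ ⊑? ν) * skewdim ν ρ) * G ρ))))
      ≡⟨ ∑-swap (box α) (removals α) _ ⟩
    ∑ (removals α) (λ (_ , ν) → ∑ (box α) (λ ρ → 𝟙 (decreasing? ρ) * (𝟙 (length (skew 1 α ρ) ℕ.≟ suc k) * ((𝟙 (ρ ⊑? ν) * skewdim ν ρ) * G ρ))))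
      ≡⟨ ∑-cong∈ (removals α) (λ ν∈ → per-removal (∈-removals α ν∈)) ⟩
    ∑ (removals α) (λ (_ , ν) → down k G ν) ∎
    where
    per-removal : ∀ {i ν} → Removes α i ν →
      ∑ (box α) (λ ρ → 𝟙 (decreasing? ρ) * (𝟙 (length (skew 1 α ρ) ℕ.≟ suc k) * ((𝟙 (ρ ⊑? ν) * skewdim ν ρ) * G ρ))) ≡ down k G ν
    per-removal {i} {ν} r = begin
      ∑ (box α) (λ ρ → 𝟙 (decreasing? ρ) * (𝟙 (length (skew 1 α ρ) ℕ.≟ suc k) * ((𝟙 (ρ ⊑? ν) * skewdim ν ρ) * G ρ)))
        ≡⟨ ∑-cong∈ (box α) (λ {ρ} ρ∈ → trans
             (solve 5 (λ a b c d e → a :* (b :* ((c :* d) :* e)) := c :* (a :* (b :* (d :* e)))) refl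
               (𝟙 (decreasing? ρ)) (𝟙 (length (skew 1 α ρ) ℕ.≟ suc k)) (𝟙 (ρ ⊑? ν)) (skewdim ν ρ) (G ρ))
             (𝟙-cong* (ρ ⊑? ν) (λ ρ⊑ν → cong (λ z → 𝟙 (decreasing? ρ) * (z * (skewdim ν ρ * G ρ)))
               (𝟙-⇔ (length (skew 1 α ρ) ℕ.≟ suc k) (length (skew 1 ν ρ) ℕ.≟ k)
                  (λ e → ℕ.suc-injective (trans (sym (lengths ρ⊑ν (∈-box α ρ∈))) e))
                  (λ e → trans (lengths ρ⊑ν (∈-box α ρ∈)) (cong suc e)))))) ⟩
      ∑ (box α) (λ ρ → 𝟙 (ρ ⊑? ν) * (𝟙 (decreasing? ρ) * (𝟙 (length (skew 1 ν ρ) ℕ.≟ k) * (skewdim ν ρ * G ρ))))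
        ≡⟨ ∑-box-⊑ (Removes-⊑ r) _ ⟩
      ∑ (box ν) (λ ρ → 𝟙 (decreasing? ρ) * (𝟙 (length (skew 1 ν ρ) ℕ.≟ k) * (skewdim ν ρ * G ρ)))
        ≡⟨ ∑-skewdim k (Removes-decreasing r dα) G ⟩
      down k G ν ∎
      where
      lengths : ∀ {ρ} → ρ ⊑ ν → ρ ⊑ α → length (skew 1 α ρ) ≡ suc (length (skew 1 ν ρ))
      lengths {ρ} p q = ℕ.+-cancelʳ-≡ (sum ρ) _ _ (trans (length-skew 1 q) (trans (sym (Removes-sum r)) (cong suc (sym (length-skew 1 p)))))

  -- The empty partition padded with zeros, because `_⊑_` compares lists of equal length.
  zeros : ℕ → List ℕ
  zeros n = replicate n 0

  zeros-⊑ : ∀ xs → zeros (length xs) ⊑ xs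
  zeros-⊑ []       = []
  zeros-⊑ (x ∷ xs) = z≤n ∷ zeros-⊑ xs

  zeros-decreasing : ∀ n → Decreasing (zeros n)
  zeros-decreasing zero          = tt
  zeros-decreasing (suc zero)    = z≤n , tt
  zeros-decreasing (suc (suc n)) = z≤n , zeros-decreasing (suc n)

  sum-zeros : ∀ n → sum (zeros n) ≡ 0
  sum-zeros zero    = refl
  sum-zeros (suc n) = sum-zeros n

  length-skew-zeros : ∀ ρ → length (skew 1 ρ (zeros (length ρ))) ≡ sum ρ
  length-skew-zeros ρ = trans (sym (ℕ.+-identityʳ _)) (trans (cong (length (skew 1 ρ (zeros (length ρ))) ℕ.+_) (sym (sum-zeros (length ρ))))
    (length-skew 1 (zeros-⊑ ρ)))

  -- After |ρ| removals only the empty shape is left, so D^m applied to the constant 1 counts all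
  -- orders in which the boxes of ρ can be removed.
  skewdim-zeros : ∀ m ρ → Decreasing ρ → sum ρ ≡ m → skewdim ρ (zeros (length ρ)) ≡ down m (λ _ → 1#) ρ
  skewdim-zeros zero    ρ d eq = cong dimℚ (length≡0 (skew 1 ρ (zeros (length ρ))) (trans (length-skew-zeros ρ) eq))
    where
    length≡0 : ∀ (θ : Diagram) → length θ ≡ 0 → θ ≡ []
    length≡0 [] _ = refl
  skewdim-zeros (suc m) ρ d eq = trans (skewdim-rec d (zeros-decreasing (length ρ)) (zeros-⊑ ρ) (trans (length-skew-zeros ρ) eq))
    (∑-cong∈ (removals ρ) (λ {(i , ν)} ν∈ → step (∈-removals ρ ν∈)))
    where
    step : ∀ {i ν} → Removes ρ i ν → 𝟙 (zeros (length ρ) ⊑? ν) * skewdim ν (zeros (length ρ)) ≡ down m (λ _ → 1#) ν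
    step {i} {ν} r = trans (cong (λ l → 𝟙 (zeros l ⊑? ν) * skewdim ν (zeros l)) (sym (Pointwise.Pointwise-length (Removes-⊑ r))))
      (trans (𝟙-yes* (zeros (length ν) ⊑? ν) (zeros-⊑ ν) _)
        (skewdim-zeros m ν (Removes-decreasing r d) (ℕ.suc-injective (trans (Removes-sum r) eq))))

  module _ where
    private
      /-* : ∀ a d .{{_ : ℕ.NonZero d}} → (+ a ℚ./ d) ℚ.* fromℤ (+ d) ≡ fromℤ (+ a)
      /-* a (suc d) = ℚ.toℚᵘ-injective (ℚᵘ.≃-trans (ℚ.toℚᵘ-homo-* (+ a ℚ./ suc d) (fromℤ (+ suc d)))
        (ℚᵘ.≃-trans (ℚᵘ.*-cong (ℚ.toℚᵘ-fromℚᵘ (ℚᵘ.mkℚᵘ (+ a) d)) (ℚ.toℚᵘ-fromℚᵘ (ℚᵘ.mkℚᵘ (+ suc d) 0)))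
        (ℚᵘ.≃-trans (ℚᵘ.*≡* (trans (ℤ.*-assoc (+ a) (+ suc d) (+ 1)) (cong (λ u → + a ℤ.* u) (cong (λ v → + v) (trans (ℕ.*-identityʳ (suc d)) (sym (ℕ.*-identityʳ (suc d))))))))
          (ℚᵘ.≃-sym (ℚ.toℚᵘ-fromℚᵘ (ℚᵘ.mkℚᵘ (+ a) 0))))))

      H-dim : ∀ θ → H θ ℚ.* fromℤ (+ dim θ) ≡ fromℤ (+ (length θ !))
      H-dim θ = /-* (length θ !) (dim θ) {{dim≢0 θ}}

    opaque
      unfolding _*_ ι
      /H-* : ∀ z θ η → (z /H[ θ , η ]) * (H θ ℚ.* H η) ≡ ι z
      /H-* z θ η = trans (ℚ.*-assoc (fromℤ z) (ℚ.1/_ (H θ ℚ.* H η) {{H*H≢0 θ η}}) (H θ ℚ.* H η))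
        (trans (cong (fromℤ z ℚ.*_) (ℚ.*-inverseˡ (H θ ℚ.* H η) {{H*H≢0 θ η}})) (ℚ.*-identityʳ (fromℤ z)))

      H-dimℚ : ∀ θ → H θ * dimℚ θ ≡ fromℕ (length θ !)
      H-dimℚ = H-dim

  -- As H_θ = |θ|!/dim θ, division by it turns into multiplication by a number of tableaux and an
  -- inverse factorial.
  /H-dims : ∀ z θ η → z /H[ θ , η ] ≡ ι z * ((dimℚ θ * ifac (length θ)) * (dimℚ η * ifac (length η)))
  /H-dims z θ η = begin
    q
      ≡⟨ *-identityʳ q ⟨
    q * 1#
      ≡⟨ cong (q *_) (trans (sym (*-identityˡ 1#)) (cong₂ _*_ (sym (inv θ)) (sym (inv η)))) ⟩
    q * ((H θ * (dimℚ θ * ifac (length θ))) * (H η * (dimℚ η * ifac (length η))))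
      ≡⟨ solve 5 (λ q a b c d → q :* ((a :* b) :* (c :* d)) := (q :* (a :* c)) :* (b :* d)) refl _ _ _ _ _ ⟩
    (q * (H θ * H η)) * ((dimℚ θ * ifac (length θ)) * (dimℚ η * ifac (length η)))
      ≡⟨ cong (_* ((dimℚ θ * ifac (length θ)) * (dimℚ η * ifac (length η)))) (trans (cong (q *_) (*-def (H θ) (H η))) (/H-* z θ η)) ⟩
    ι z * ((dimℚ θ * ifac (length θ)) * (dimℚ η * ifac (length η))) ∎
    where
    q = z /H[ θ , η ]
    inv : ∀ θ → H θ * (dimℚ θ * ifac (length θ)) ≡ 1#
    inv θ = trans (sym (*-assoc _ _ _)) (trans (cong (_* ifac (length θ)) (H-dimℚ θ)) (!*ifac (length θ)))

  -- The right-hand sides of the theorem, graded by ∣α∣ - ∣ρ∣.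
  hookSum : ∀ n α → Decreasing α → sum α ≡ n → (z : List ℕ → ℤ) →
    ∑ℚ (subpartitions α) (λ ρ → z ρ /H[ diagram ρ , α ⧸ ρ ]) ≡
    ∑ (upTo (suc n)) (λ k → (ifac k * ifac (n ∸ k)) * down k (λ ρ → ι (z ρ) * down (n ∸ k) (λ _ → 1#) ρ) α)
  hookSum n α dα sα z = begin
    ∑ℚ (subpartitions α) (λ ρ → z ρ /H[ diagram ρ , α ⧸ ρ ])
      ≡⟨ ∑-def (subpartitions α) _ ⟨
    ∑ (subpartitions α) (λ ρ → z ρ /H[ diagram ρ , α ⧸ ρ ])
      ≡⟨ ∑-filter decreasing? (box α) _ ⟩
    ∑ (box α) (λ ρ → 𝟙 (decreasing? ρ) * (z ρ /H[ diagram ρ , α ⧸ ρ ]))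
      ≡⟨ ∑-cong∈ (box α) (λ {ρ} ρ∈ → 𝟙-cong* (decreasing? ρ) (λ l → per-ρ ρ (∈-box α ρ∈) (Linked⇒dec l))) ⟩
    ∑ (box α) (λ ρ → 𝟙 (decreasing? ρ) * ∑ (upTo (suc n)) (λ k → (ifac k * ifac (n ∸ k)) * (𝟙 (len ρ ℕ.≟ k) * (skewdim α ρ * G k ρ))))
      ≡⟨ ∑-cong (box α) (λ ρ → trans (sym (∑-*ˡ (𝟙 (decreasing? ρ)) (upTo (suc n)) _)) (∑-cong (upTo (suc n)) (λ k →
           solve 3 (λ a b c → a :* (b :* c) := b :* (a :* c)) refl (𝟙 (decreasing? ρ)) (ifac k * ifac (n ∸ k)) (𝟙 (len ρ ℕ.≟ k) * (skewdim α ρ * G k ρ))))) ⟩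
    ∑ (box α) (λ ρ → ∑ (upTo (suc n)) (λ k → (ifac k * ifac (n ∸ k)) * (𝟙 (decreasing? ρ) * (𝟙 (len ρ ℕ.≟ k) * (skewdim α ρ * G k ρ)))))
      ≡⟨ ∑-swap (box α) (upTo (suc n)) _ ⟩
    ∑ (upTo (suc n)) (λ k → ∑ (box α) (λ ρ → (ifac k * ifac (n ∸ k)) * (𝟙 (decreasing? ρ) * (𝟙 (len ρ ℕ.≟ k) * (skewdim α ρ * G k ρ)))))
      ≡⟨ ∑-cong (upTo (suc n)) (λ k → trans (∑-*ˡ (ifac k * ifac (n ∸ k)) (box α) _) (cong ((ifac k * ifac (n ∸ k)) *_) (∑-skewdim k dα (G k)))) ⟩
    ∑ (upTo (suc n)) (λ k → (ifac k * ifac (n ∸ k)) * down k (G k) α) ∎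
    where
    G : ℕ → List ℕ → ℚ
    G k ρ = ι (z ρ) * down (n ∸ k) (λ _ → 1#) ρ
    len : List ℕ → ℕ
    len ρ = length (skew 1 α ρ)
    per-ρ : ∀ ρ → ρ ⊑ α → Decreasing ρ → z ρ /H[ diagram ρ , α ⧸ ρ ] ≡
      ∑ (upTo (suc n)) (λ k → (ifac k * ifac (n ∸ k)) * (𝟙 (len ρ ℕ.≟ k) * (skewdim α ρ * G k ρ)))
    per-ρ ρ ρ⊑α dρ = begin
      z ρ /H[ diagram ρ , α ⧸ ρ ]
        ≡⟨ cong₂ (λ θ η → z ρ /H[ θ , η ]) (trans (⧸-skew ρ []) (skew-[] 1 ρ)) (⧸-skew α ρ) ⟩
      z ρ /H[ θ , η ]
        ≡⟨ /H-dims (z ρ) θ η ⟩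
      ι (z ρ) * ((dimℚ θ * ifac (length θ)) * (dimℚ η * ifac (length η)))
        ≡⟨ cong (λ l → ι (z ρ) * ((dimℚ θ * ifac l) * (dimℚ η * ifac (length η)))) lθ ⟩
      ι (z ρ) * ((dimℚ θ * ifac (n ∸ len ρ)) * (dimℚ η * ifac (len ρ)))
        ≡⟨ cong (λ d → ι (z ρ) * ((d * ifac (n ∸ len ρ)) * (dimℚ η * ifac (len ρ)))) (skewdim-zeros (n ∸ len ρ) ρ dρ (trans (sym (length-skew-zeros ρ)) lθ)) ⟩
      ι (z ρ) * ((D * ifac (n ∸ len ρ)) * (dimℚ η * ifac (len ρ)))
        ≡⟨ solve 5 (λ a b c d e → a :* ((b :* c) :* (d :* e)) := (e :* c) :* (d :* (a :* b))) refl _ _ _ _ _ ⟩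
      (ifac (len ρ) * ifac (n ∸ len ρ)) * (skewdim α ρ * G (len ρ) ρ)
        -- The size of α/ρ is made a summation variable `k`; the sum over ρ for fixed `k` is then in
        -- the form of `∑-skewdim`.
        ≡⟨ ∑-single ℕ._≟_ (Unique.upTo⁺ (suc n)) (∈-upTo⁺ (s≤s len≤n)) (λ k → (ifac k * ifac (n ∸ k)) * (skewdim α ρ * G k ρ)) ⟨
      ∑ (upTo (suc n)) (λ k → 𝟙 (k ℕ.≟ len ρ) * ((ifac k * ifac (n ∸ k)) * (skewdim α ρ * G k ρ)))
        ≡⟨ ∑-cong (upTo (suc n)) (λ k → trans
             (solve 3 (λ a b c → a :* (b :* c) := b :* (a :* c)) refl (𝟙 (k ℕ.≟ len ρ)) (ifac k * ifac (n ∸ k)) (skewdim α ρ * G k ρ))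
             (cong (λ i → (ifac k * ifac (n ∸ k)) * (i * (skewdim α ρ * G k ρ))) (𝟙-⇔ (k ℕ.≟ len ρ) (len ρ ℕ.≟ k) sym sym))) ⟩
      ∑ (upTo (suc n)) (λ k → (ifac k * ifac (n ∸ k)) * (𝟙 (len ρ ℕ.≟ k) * (skewdim α ρ * G k ρ))) ∎
      where
      θ = skew 1 ρ (zeros (length ρ))
      η = skew 1 α ρ
      D = down (n ∸ len ρ) (λ _ → 1#) ρ
      total : len ρ ℕ.+ sum ρ ≡ n
      total = trans (length-skew 1 ρ⊑α) sα
      len≤n : len ρ ≤ n
      len≤n = ℕ.m+n≤o⇒m≤o (len ρ) (ℕ.≤-reflexive total)
      lθ : length θ ≡ n ∸ len ρ
      lθ = trans (length-skew-zeros ρ) (trans (sym (ℕ.m+n∸m≡n (len ρ) (sum ρ))) (cong (_∸ len ρ) total))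

-- Alternating sums as iterated differences

module Differences where

  open Rationals
  open Sums

  sign : ℕ → ℚ
  sign k = ι (-1ℤ ℤ.^ k)

  sign-suc : ∀ k → sign (suc k) ≡ - sign k
  sign-suc k = trans (cong ι (ℤ.-1*i≡-i (-1ℤ ℤ.^ k))) (ι-neg _)

  sign-+ : ∀ j k → sign (j ℕ.+ k) ≡ sign j * sign k
  sign-+ j k = trans (cong ι (ℤ.^-distribˡ-+-* -1ℤ j k)) (ι-* (-1ℤ ℤ.^ j) (-1ℤ ℤ.^ k))

  sign-square : ∀ k → sign k * sign k ≡ 1#
  sign-square zero    = *-identityˡ 1#
  sign-square (suc k) = trans (cong₂ _*_ (sign-suc k) (sign-suc k))
    (trans (solve 1 (λ a → :- a :* :- a := a :* a) refl (sign k)) (sign-square k))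

  -- The sum over k + m = n with both indices explicit, which avoids truncated subtraction in the
  -- inductions.
  antidiagonal : ℕ → (ℕ → ℕ → ℚ) → ℚ
  antidiagonal zero    f = f 0 0
  antidiagonal (suc n) f = f 0 (suc n) + antidiagonal n (λ k m → f (suc k) m)

  antidiagonal-last : ∀ n f → antidiagonal (suc n) f ≡ antidiagonal n (λ k m → f k (suc m)) + f (suc n) 0
  antidiagonal-last zero    f = refl
  antidiagonal-last (suc n) f = trans (cong (f 0 (suc (suc n)) +_) (antidiagonal-last n (λ k m → f (suc k) m)))
    (sym (+-assoc (f 0 (suc (suc n))) _ _))

  antidiagonal-cong : ∀ n {f g} → (∀ k m → k ℕ.+ m ≡ n → f k m ≡ g k m) → antidiagonal n f ≡ antidiagonal n g
  antidiagonal-cong zero    eq = eq 0 0 refl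
  antidiagonal-cong (suc n) eq = cong₂ _+_ (eq 0 (suc n) refl) (antidiagonal-cong n (λ k m e → eq (suc k) m (cong suc e)))

  antidiagonal-+ : ∀ n f g → antidiagonal n (λ k m → f k m + g k m) ≡ antidiagonal n f + antidiagonal n g
  antidiagonal-+ zero    f g = refl
  antidiagonal-+ (suc n) f g = trans (cong ((f 0 (suc n) + g 0 (suc n)) +_) (antidiagonal-+ n _ _))
    (solve 4 (λ a b c d → (a :+ b) :+ (c :+ d) := (a :+ c) :+ (b :+ d)) refl _ _ _ _)

  antidiagonal-*ˡ : ∀ c n f → antidiagonal n (λ k m → c * f k m) ≡ c * antidiagonal n f
  antidiagonal-*ˡ c zero    f = refl
  antidiagonal-*ˡ c (suc n) f = trans (cong (c * f 0 (suc n) +_) (antidiagonal-*ˡ c n _)) (sym (distribˡ c _ _))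

  ∑-antidiagonal : ∀ n f → ∑ (upTo (suc n)) (λ k → f k (n ∸ k)) ≡ antidiagonal n f
  ∑-antidiagonal zero    f = +-identityʳ _
  ∑-antidiagonal (suc n) f = cong (f 0 (suc n) +_)
    (trans (∑-applyUpTo suc (suc n) (λ k → f k (suc n ∸ k))) (∑-antidiagonal n (λ k m → f (suc k) m)))

  -- Expanded, this is the sum over k + m = n of u k m with (-1)^k times a binomial coefficient. The
  -- recursive form is the one that commutators and inclusion-exclusion produce.
  Δ : ℕ → (ℕ → ℕ → ℚ) → ℚ
  Δ zero    u = u 0 0
  Δ (suc n) u = Δ n (λ k m → u k (suc m) - u (suc k) m)

  Δ-cong : ∀ n {u v} → (∀ k m → k ℕ.+ m ≡ n → u k m ≡ v k m) → Δ n u ≡ Δ n v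
  Δ-cong zero    eq = eq 0 0 refl
  Δ-cong (suc n) eq = Δ-cong n (λ k m e → cong₂ _-_ (eq k (suc m) (trans (ℕ.+-suc k m) (cong suc e))) (eq (suc k) m (cong suc e)))

  alternating : ℕ → (ℕ → ℕ → ℚ) → ℚ
  alternating n u = antidiagonal n (λ k m → (sign k * (ifac k * ifac m)) * u k m)

  -- On the antidiagonal the factor n + 1 is k + m; the part k turns 1/k! into 1/(k - 1)!, the part
  -- m does the same to 1/m!. This is Pascal's rule.
  alternating-suc : ∀ n u → fromℕ (suc n) * alternating (suc n) u ≡ alternating n (λ k m → u k (suc m) - u (suc k) m)
  alternating-suc n u = begin
    fromℕ (suc n) * antidiagonal (suc n) (λ k m → w k m * u k m)
      ≡⟨ antidiagonal-*ˡ (fromℕ (suc n)) (suc n) wu ⟨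
    antidiagonal (suc n) (λ k m → fromℕ (suc n) * (w k m * u k m))
      ≡⟨ antidiagonal-cong (suc n) (λ k m e → trans (cong (_* (w k m * u k m)) (trans (cong fromℕ (sym e)) (fromℕ-+ k m))) (distribʳ _ _ _)) ⟩
    antidiagonal (suc n) (λ k m → fromℕ k * (w k m * u k m) + fromℕ m * (w k m * u k m))
      ≡⟨ antidiagonal-+ (suc n) fst′ snd′ ⟩
    (fromℕ 0 * (w 0 (suc n) * u 0 (suc n)) + antidiagonal n (λ k m → fromℕ (suc k) * (w (suc k) m * u (suc k) m)))
      + antidiagonal (suc n) (λ k m → fromℕ m * (w k m * u k m))
      ≡⟨ cong₂ _+_ (trans (cong (_+ antidiagonal n (λ k m → fst′ (suc k) m)) (zeroˡ _)) (+-identityˡ _))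
           (trans (antidiagonal-last n snd′) (trans (cong (antidiagonal n (λ k m → fromℕ (suc m) * (w k (suc m) * u k (suc m))) +_) (zeroˡ _)) (+-identityʳ _))) ⟩
    antidiagonal n (λ k m → fromℕ (suc k) * (w (suc k) m * u (suc k) m)) + antidiagonal n (λ k m → fromℕ (suc m) * (w k (suc m) * u k (suc m)))
      ≡⟨ antidiagonal-+ n (λ k m → fst′ (suc k) m) (λ k m → snd′ k (suc m)) ⟨
    antidiagonal n (λ k m → fromℕ (suc k) * (w (suc k) m * u (suc k) m) + fromℕ (suc m) * (w k (suc m) * u k (suc m)))
      ≡⟨ antidiagonal-cong n (λ k m _ → weights k m) ⟩
    antidiagonal n (λ k m → w k m * (u k (suc m) - u (suc k) m)) ∎
    where
    w wu fst′ snd′ : ℕ → ℕ → ℚ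
    w k m = sign k * (ifac k * ifac m)
    wu k m = w k m * u k m
    fst′ k m = fromℕ k * wu k m
    snd′ k m = fromℕ m * wu k m
    weights : ∀ k m → fromℕ (suc k) * (w (suc k) m * u (suc k) m) + fromℕ (suc m) * (w k (suc m) * u k (suc m)) ≡
                      w k m * (u k (suc m) - u (suc k) m)
    weights k m = begin
      fromℕ (suc k) * (w (suc k) m * u (suc k) m) + fromℕ (suc m) * (w k (suc m) * u k (suc m))
        ≡⟨ cong (λ s → fromℕ (suc k) * ((s * (ifac (suc k) * ifac m)) * u (suc k) m) + fromℕ (suc m) * (w k (suc m) * u k (suc m))) (sign-suc k) ⟩
      fromℕ (suc k) * ((- sign k * (ifac (suc k) * ifac m)) * u (suc k) m) + fromℕ (suc m) * ((sign k * (ifac k * ifac (suc m))) * u k (suc m))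
        ≡⟨ solve 9 (λ a b s f g h i x y → a :* ((:- s :* (f :* g)) :* x) :+ b :* ((s :* (h :* i)) :* y) :=
                    s :* ((h :* (b :* i)) :* y) :- s :* (((a :* f) :* g) :* x)) refl
             (fromℕ (suc k)) (fromℕ (suc m)) (sign k) (ifac (suc k)) (ifac m) (ifac k) (ifac (suc m)) (u (suc k) m) (u k (suc m)) ⟩
      sign k * ((ifac k * (fromℕ (suc m) * ifac (suc m))) * u k (suc m)) - sign k * (((fromℕ (suc k) * ifac (suc k)) * ifac m) * u (suc k) m)
        ≡⟨ cong₂ (λ p q → sign k * ((ifac k * p) * u k (suc m)) - sign k * ((q * ifac m) * u (suc k) m)) (suc*ifac m) (suc*ifac k) ⟩
      sign k * ((ifac k * ifac m) * u k (suc m)) - sign k * ((ifac k * ifac m) * u (suc k) m)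
        ≡⟨ solve 4 (λ s f x y → s :* (f :* y) :- s :* (f :* x) := (s :* f) :* (y :- x)) refl _ _ _ _ ⟩
      w k m * (u k (suc m) - u (suc k) m) ∎

  !*alternating : ∀ n u → fromℕ (n !) * alternating n u ≡ Δ n u
  !*alternating zero    u = solve 1 (λ u → con one :* ((con one :* (con one :* con one)) :* u) := u) refl (u 0 0)
  !*alternating (suc n) u = begin
    fromℕ (suc n ℕ.* n !) * alternating (suc n) u
      ≡⟨ trans (cong (_* alternating (suc n) u) (trans (fromℕ-* (suc n) (n !)) (*-comm _ _))) (*-assoc _ _ _) ⟩
    fromℕ (n !) * (fromℕ (suc n) * alternating (suc n) u)
      ≡⟨ cong (fromℕ (n !) *_) (alternating-suc n u) ⟩
    fromℕ (n !) * alternating n (λ k m → u k (suc m) - u (suc k) m)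
      ≡⟨ !*alternating n _ ⟩
    Δ (suc n) u ∎

  alternating-Δ : ∀ n u → alternating n u ≡ ifac n * Δ n u
  alternating-Δ n u = begin
    alternating n u                                  ≡⟨ *-identityˡ _ ⟨
    1# * alternating n u                             ≡⟨ cong (_* alternating n u) (!*ifac n) ⟨
    (fromℕ (n !) * ifac n) * alternating n u         ≡⟨ solve 3 (λ a b c → (a :* b) :* c := b :* (a :* c)) refl _ _ _ ⟩
    ifac n * (fromℕ (n !) * alternating n u)         ≡⟨ cong (ifac n *_) (!*alternating n u) ⟩
    ifac n * Δ n u                                   ∎

-- Lowering operators and iterated commutators

module Lowering where

  open Rationals
  open Sums
  open Differences

  Fun : Set
  Fun = List ℕ → ℚ

  -- X i lowers the i-th entry, counted from 1; a term with a negative entry is 0.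
  X : ℕ → Fun → Fun
  X (suc zero)    c (suc a ∷ l) = c (a ∷ l)
  X (suc (suc i)) c (a ∷ l)     = X (suc i) (c ∘ (a ∷_)) l
  X _             c _           = 0#

  V : Fun → Fun
  V c []      = 0#
  V c (a ∷ l) = X 1 c (a ∷ l) + V (c ∘ (a ∷_)) l

  X-cong : ∀ i {c d : Fun} → c ≗ d → X i c ≗ X i d
  X-cong zero          e l           = refl
  X-cong (suc zero)    e []          = refl
  X-cong (suc zero)    e (zero ∷ l)  = refl
  X-cong (suc zero)    e (suc a ∷ l) = e (a ∷ l)
  X-cong (suc (suc i)) e []          = refl
  X-cong (suc (suc i)) e (a ∷ l)     = X-cong (suc i) (e ∘ (a ∷_)) l

  X-linear : ∀ i s (c d : Fun) l → X i (λ l → c l + s * d l) l ≡ X i c l + s * X i d l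
  X-linear zero          s c d l           = solve 1 (λ s → con (ℤ.+ 0) := con (ℤ.+ 0) :+ s :* con (ℤ.+ 0)) refl s
  X-linear (suc zero)    s c d []          = solve 1 (λ s → con (ℤ.+ 0) := con (ℤ.+ 0) :+ s :* con (ℤ.+ 0)) refl s
  X-linear (suc zero)    s c d (zero ∷ l)  = solve 1 (λ s → con (ℤ.+ 0) := con (ℤ.+ 0) :+ s :* con (ℤ.+ 0)) refl s
  X-linear (suc zero)    s c d (suc a ∷ l) = refl
  X-linear (suc (suc i)) s c d []          = solve 1 (λ s → con (ℤ.+ 0) := con (ℤ.+ 0) :+ s :* con (ℤ.+ 0)) refl s
  X-linear (suc (suc i)) s c d (a ∷ l)     = X-linear (suc i) s (c ∘ (a ∷_)) (d ∘ (a ∷_)) l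

  V-cong : ∀ {c d : Fun} → c ≗ d → V c ≗ V d
  V-cong e []      = refl
  V-cong e (a ∷ l) = cong₂ _+_ (X-cong 1 e (a ∷ l)) (V-cong (e ∘ (a ∷_)) l)

  V-linear : ∀ s (c d : Fun) l → V (λ l → c l + s * d l) l ≡ V c l + s * V d l
  V-linear s c d []      = solve 1 (λ s → con (ℤ.+ 0) := con (ℤ.+ 0) :+ s :* con (ℤ.+ 0)) refl s
  V-linear s c d (a ∷ l) = trans (cong₂ _+_ (X-linear 1 s c d (a ∷ l)) (V-linear s (c ∘ (a ∷_)) (d ∘ (a ∷_)) l))
    (solve 5 (λ s a b c d → (a :+ s :* b) :+ (c :+ s :* d) := (a :+ c) :+ s :* (b :+ d)) refl _ _ _ _ _)

  Linear : (Fun → Fun) → Set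
  Linear A = ∀ s (c d : Fun) l → A (λ l → c l + s * d l) l ≡ A c l + s * A d l

  Cong : (Fun → Fun) → Set
  Cong A = ∀ {c d : Fun} → c ≗ d → A c ≗ A d

  module _ {A : Fun → Fun} (cg : Cong A) (lin : Linear A) where

    linear-+ : ∀ (c d : Fun) l → A (λ l → c l + d l) l ≡ A c l + A d l
    linear-+ c d l = trans (cg (λ l → cong (c l +_) (sym (*-identityˡ (d l)))) l)
      (trans (lin 1# c d l) (cong (A c l +_) (*-identityˡ _)))

    linear-- : ∀ (c d : Fun) l → A (λ l → c l - d l) l ≡ A c l - A d l
    linear-- c d l = trans (cg (λ l → solve 2 (λ a b → a :- b := a :+ :- con one :* b) refl (c l) (d l)) l)
      (trans (lin (- 1#) c d l) (solve 2 (λ a b → a :+ :- con one :* b := a :- b) refl _ _))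

    linear-0 : ∀ l → A (λ _ → 0#) l ≡ 0#
    linear-0 l = trans (cg (λ _ → solve 0 (con (ℤ.+ 0) := con (ℤ.+ 0) :- con (ℤ.+ 0)) refl) l)
      (trans (linear-- (λ _ → 0#) (λ _ → 0#) l) (solve 1 (λ a → a :- a := con (ℤ.+ 0)) refl _))

    linear-* : ∀ s (c : Fun) l → A (λ l → s * c l) l ≡ s * A c l
    linear-* s c l = trans (cg (λ l → sym (+-identityˡ _)) l)
      (trans (lin s (λ _ → 0#) c l) (trans (cong (_+ s * A c l) (linear-0 l)) (+-identityˡ _)))

  -- Truncation at 0 does not disturb commutativity: if an entry is too small, both orders give 0.
  X-X : ∀ i j c l → X i (X j c) l ≡ X j (X i c) l
  X-X zero          zero          c l           = refl
  X-X zero          (suc zero)    c []          = refl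
  X-X zero          (suc zero)    c (zero ∷ l)  = refl
  X-X zero          (suc zero)    c (suc a ∷ l) = refl
  X-X zero          (suc (suc j)) c []          = refl
  X-X zero          (suc (suc j)) c (a ∷ l)     = sym (linear-0 (X-cong (suc j)) (X-linear (suc j)) l)
  X-X (suc zero)    zero          c []          = refl
  X-X (suc zero)    zero          c (zero ∷ l)  = refl
  X-X (suc zero)    zero          c (suc a ∷ l) = refl
  X-X (suc zero)    (suc zero)    c l           = refl
  X-X (suc zero)    (suc (suc j)) c []          = refl
  X-X (suc zero)    (suc (suc j)) c (zero ∷ l)  = sym (linear-0 (X-cong (suc j)) (X-linear (suc j)) l)
  X-X (suc zero)    (suc (suc j)) c (suc a ∷ l) = refl
  X-X (suc (suc i)) zero          c []          = refl
  X-X (suc (suc i)) zero          c (a ∷ l)     = linear-0 (X-cong (suc i)) (X-linear (suc i)) l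
  X-X (suc (suc i)) (suc zero)    c []          = refl
  X-X (suc (suc i)) (suc zero)    c (zero ∷ l)  = linear-0 (X-cong (suc i)) (X-linear (suc i)) l
  X-X (suc (suc i)) (suc zero)    c (suc a ∷ l) = refl
  X-X (suc (suc i)) (suc (suc j)) c []          = refl
  X-X (suc (suc i)) (suc (suc j)) c (a ∷ l)     = X-X (suc i) (suc j) (c ∘ (a ∷_)) l

  X-V : ∀ i c l → X i (V c) l ≡ V (X i c) l
  X-V zero          c l           = sym (linear-0 V-cong V-linear l)
  X-V (suc zero)    c []          = refl
  X-V (suc zero)    c (zero ∷ l)  = sym (trans (+-identityˡ _) (linear-0 V-cong V-linear l))
  X-V (suc zero)    c (suc a ∷ l) = refl
  X-V (suc (suc i)) c []          = refl
  X-V (suc (suc i)) c (a ∷ l)     = trans (linear-+ (X-cong (suc i)) (X-linear (suc i)) _ _ l)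
    (cong₂ _+_ (sym (X-X 1 (suc (suc i)) c (a ∷ l))) (X-V (suc i) (c ∘ (a ∷_)) l))

  -- The relation [lᵢ, V] = Xᵢ: the term of V that lowers the i-th entry sees the factor lᵢ
  -- decreased by 1, and the other terms leave it alone.
  entry-V : ∀ i (c : Fun) l → fromℕ (part l i) * V c l ≡ V (λ l → fromℕ (part l i) * c l) l + X i c l
  entry-V i             c []          = solve 1 (λ a → a :* con (ℤ.+ 0) := con (ℤ.+ 0) :+ con (ℤ.+ 0)) refl (fromℕ (part [] i)) ∙ cong (0# +_) (nil i)
    where
    infixr 5 _∙_
    _∙_ : ∀ {x y z : ℚ} → x ≡ y → y ≡ z → x ≡ z
    _∙_ = trans
    nil : ∀ i → 0# ≡ X i c []
    nil zero          = refl
    nil (suc zero)    = refl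
    nil (suc (suc i)) = refl
  entry-V zero          c (a ∷ l)     = trans (zeroˡ _) (sym (trans (+-identityʳ _)
    (trans (V-cong (λ { [] → zeroˡ _ ; (_ ∷ _) → zeroˡ _ }) (a ∷ l)) (linear-0 V-cong V-linear (a ∷ l)))))
  entry-V (suc zero)    c (zero ∷ l)  = trans (zeroˡ _) (sym (trans (+-identityʳ _) (trans (+-identityˡ _)
    (trans (V-cong (λ _ → zeroˡ _) l) (linear-0 V-cong V-linear l)))))
  entry-V (suc zero)    c (suc a ∷ l) = begin
    fromℕ (suc a) * (c (a ∷ l) + V c′ l)
      ≡⟨ cong (_* (c (a ∷ l) + V c′ l)) (fromℕ-suc a) ⟩
    (1# + fromℕ a) * (c (a ∷ l) + V c′ l)
      ≡⟨ solve 3 (λ a x y → (con one :+ a) :* (x :+ y) := (a :* x :+ (con one :+ a) :* y) :+ x) refl (fromℕ a) (c (a ∷ l)) (V c′ l) ⟩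
    (fromℕ a * c (a ∷ l) + (1# + fromℕ a) * V c′ l) + c (a ∷ l)
      ≡⟨ cong (λ z → (fromℕ a * c (a ∷ l) + z * V c′ l) + c (a ∷ l)) (sym (fromℕ-suc a)) ⟩
    (fromℕ a * c (a ∷ l) + fromℕ (suc a) * V c′ l) + c (a ∷ l)
      ≡⟨ cong (λ z → (fromℕ a * c (a ∷ l) + z) + c (a ∷ l)) (sym (linear-* V-cong V-linear (fromℕ (suc a)) c′ l)) ⟩
    (fromℕ a * c (a ∷ l) + V (λ l → fromℕ (suc a) * c′ l) l) + c (a ∷ l) ∎
    where
    c′ : Fun
    c′ l = c (suc a ∷ l)
  entry-V (suc (suc i)) c (a ∷ l)     = begin
    p * (X 1 c (a ∷ l) + V c′ l)
      ≡⟨ distribˡ p _ _ ⟩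
    p * X 1 c (a ∷ l) + p * V c′ l
      ≡⟨ cong₂ _+_ (first a) (entry-V (suc i) c′ l) ⟩
    X 1 (λ l → fromℕ (part l (suc (suc i))) * c l) (a ∷ l) + (V (λ l → fromℕ (part l (suc i)) * c′ l) l + X (suc i) c′ l)
      ≡⟨ +-assoc _ _ _ ⟨
    (X 1 (λ l → fromℕ (part l (suc (suc i))) * c l) (a ∷ l) + V (λ l → fromℕ (part l (suc i)) * c′ l) l) + X (suc i) c′ l ∎
    where
    p = fromℕ (part l (suc i))
    c′ = c ∘ (a ∷_)
    first : ∀ a → p * X 1 c (a ∷ l) ≡ X 1 (λ l → fromℕ (part l (suc (suc i))) * c l) (a ∷ l)
    first zero    = zeroʳ p
    first (suc a) = refl

  iterV : ℕ → Fun → Fun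
  iterV zero    c = c
  iterV (suc k) c = V (iterV k c)

  iterV-cong : ∀ k {c d : Fun} → c ≗ d → iterV k c ≗ iterV k d
  iterV-cong zero    e = e
  iterV-cong (suc k) e = V-cong (iterV-cong k e)

  iterV-- : ∀ k (c d : Fun) l → iterV k (λ l → c l - d l) l ≡ iterV k c l - iterV k d l
  iterV-- zero    c d l = refl
  iterV-- (suc k) c d l = trans (V-cong (iterV-- k c d) l) (linear-- V-cong V-linear (iterV k c) (iterV k d) l)

  iterV-V : ∀ k c l → iterV k (V c) l ≡ V (iterV k c) l
  iterV-V zero    c l = refl
  iterV-V (suc k) c l = V-cong (iterV-V k c) l

  commutator : (Fun → Fun) → Fun → Fun
  commutator A c l = A (V c) l - V (A c) l

  commutators : ℕ → (Fun → Fun) → Fun → Fun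
  commutators zero    A = A
  commutators (suc n) A = commutator (commutators n A)

  commutators-shift : ∀ n A → commutators n (commutator A) ≡ commutators (suc n) A
  commutators-shift zero    A = refl
  commutators-shift (suc n) A = cong commutator (commutators-shift n A)

  -- A step of `Δ` compares one more V inside `A` with one more V outside, which is the commutator
  -- of `A` with V; the remaining powers of V are carried along.
  Δ-commutators : ∀ n A c l → Δ n (λ k m → iterV k (A (iterV m c)) l) ≡ commutators n A c l
  Δ-commutators zero    A c l = refl
  Δ-commutators (suc n) A c l = begin
    Δ n (λ k m → iterV k (A (V (iterV m c))) l - V (iterV k (A (iterV m c))) l)
      ≡⟨ Δ-cong n (λ k m _ → trans (cong (λ z → iterV k (A (V (iterV m c))) l - z) (sym (iterV-V k _ l))) (sym (iterV-- k (A (V (iterV m c))) (V (A (iterV m c))) l))) ⟩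
    Δ n (λ k m → iterV k (commutator A (iterV m c)) l)
      ≡⟨ Δ-commutators n (commutator A) c l ⟩
    commutators n (commutator A) c l
      ≡⟨ cong (λ B → B c l) (commutators-shift n A) ⟩
    commutators (suc n) A c l ∎

  -- A has degree n and leading part B, for the filtration by iterated commutators with V.
  record Leading (n : ℕ) (A B : Fun → Fun) : Set where
    field
      top     : ∀ c l → commutators n A c l ≡ fromℕ (n !) * B c l
      higher  : ∀ c l → commutators (suc n) A c l ≡ 0#

  open Leading public

  leading-id : Leading 0 id id
  leading-id = record
    { top = λ c l → sym (*-identityˡ _) ; higher = λ c l → solve 1 (λ a → a :- a := con (ℤ.+ 0)) refl (V c l) }

  linearFactor : ℕ → ℚ → (Fun → Fun) → Fun → Fun
  linearFactor i s A c l = (fromℕ (part l i) - s) * A c l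

  -- Leibniz rule. It has only two terms because Xᵢ, the commutator of the new factor with V,
  -- commutes with V itself.
  commutators-factor : ∀ n i s A c l →
    commutators (suc n) (linearFactor i s A) c l ≡
    (fromℕ (part l i) - s) * commutators (suc n) A c l + fromℕ (suc n) * X i (commutators n A c) l
  commutators-factor zero i s A c l = begin
    (p - s) * A (V c) l - V (λ l → (fromℕ (part l i) - s) * A c l) l
      ≡⟨ cong (λ z → (p - s) * A (V c) l - z) (V-factor i s (A c) l) ⟩
    (p - s) * A (V c) l - ((p - s) * V (A c) l - X i (A c) l)
      ≡⟨ solve 4 (λ f a b x → f :* a :- (f :* b :- x) := f :* (a :- b) :+ con one :* x) refl (p - s) _ _ _ ⟩
    (p - s) * commutator A c l + 1# * X i (A c) l ∎
    where
    p = fromℕ (part l i)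
    V-factor : ∀ i s c l → V (λ l → (fromℕ (part l i) - s) * c l) l ≡ (fromℕ (part l i) - s) * V c l - X i c l
    V-factor i s c l = begin
      V (λ l → (fromℕ (part l i) - s) * c l) l
        ≡⟨ V-cong (λ l → solve 3 (λ p s c → (p :- s) :* c := p :* c :+ :- s :* c) refl (fromℕ (part l i)) s (c l)) l ⟩
      V (λ l → fromℕ (part l i) * c l + - s * c l) l
        ≡⟨ V-linear (- s) (λ l → fromℕ (part l i) * c l) c l ⟩
      V (λ l → fromℕ (part l i) * c l) l + - s * V c l
        ≡⟨ solve 4 (λ v s w x → v :+ :- s :* w := ((v :+ x) :- s :* w) :- x) refl _ s (V c l) (X i c l) ⟩
      ((V (λ l → fromℕ (part l i) * c l) l + X i c l) - s * V c l) - X i c l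
        ≡⟨ cong (λ z → (z - s * V c l) - X i c l) (sym (entry-V i c l)) ⟩
      (fromℕ (part l i) * V c l - s * V c l) - X i c l
        ≡⟨ solve 4 (λ p s w x → (p :* w :- s :* w) :- x := (p :- s) :* w :- x) refl _ _ _ _ ⟩
      (fromℕ (part l i) - s) * V c l - X i c l ∎
  commutators-factor (suc n) i s A c l = begin
    commutators (suc n) (linearFactor i s A) (V c) l - V (commutators (suc n) (linearFactor i s A) c) l
      ≡⟨ cong₂ _-_ (commutators-factor n i s A (V c) l)
           (trans (V-cong (commutators-factor n i s A c) l) (V-linear (fromℕ (suc n)) (linearFactor i s (commutators (suc n) A) c) (X i (commutators n A c)) l)) ⟩
    ((p - s) * C (V c) l + fromℕ (suc n) * X i (B (V c)) l) - (V (linearFactor i s C c) l + fromℕ (suc n) * V (X i (B c)) l)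
      ≡⟨ cong (λ z → ((p - s) * C (V c) l + fromℕ (suc n) * X i (B (V c)) l) - (V (linearFactor i s C c) l + fromℕ (suc n) * z)) (sym (X-V i (B c) l)) ⟩
    ((p - s) * C (V c) l + fromℕ (suc n) * X i (B (V c)) l) - (V (linearFactor i s C c) l + fromℕ (suc n) * X i (V (B c)) l)
      ≡⟨ solve 5 (λ a n x v y → (a :+ n :* x) :- (v :+ n :* y) := (a :- v) :+ n :* (x :- y)) refl _ _ _ _ _ ⟩
    commutators 1 (linearFactor i s C) c l + fromℕ (suc n) * (X i (B (V c)) l - X i (V (B c)) l)
      ≡⟨ cong₂ (λ a b → a + fromℕ (suc n) * b) (commutators-factor zero i s C c l) (sym (linear-- (X-cong i) (X-linear i) (B (V c)) (V (B c)) l)) ⟩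
    ((p - s) * commutator C c l + 1# * X i (C c) l) + fromℕ (suc n) * X i (C c) l
      ≡⟨ solve 3 (λ a x n → (a :+ con one :* x) :+ n :* x := a :+ (con one :+ n) :* x) refl _ _ _ ⟩
    (p - s) * commutator C c l + (1# + fromℕ (suc n)) * X i (C c) l
      ≡⟨ cong (λ z → (p - s) * commutator C c l + z * X i (C c) l) (sym (fromℕ-suc (suc n))) ⟩
    (p - s) * commutator C c l + fromℕ (suc (suc n)) * X i (C c) l ∎
    where
    p = fromℕ (part l i)
    B = commutators n A
    C = commutators (suc n) A

  -- In the Leibniz rule the first term contains the vanishing (n + 1)-fold commutator of `A`, and
  -- the second contributes (n + 1) n!. The constant `s` disappears, so shifts do not affect leading
  -- parts.
  leading-factor : ∀ {n A B} i s → Leading n A B → Leading (suc n) (linearFactor i s A) (λ c → X i (B c))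
  leading-factor {n} {A} {B} i s L = record
    { top = λ c l → begin
        commutators (suc n) (linearFactor i s A) c l
          ≡⟨ commutators-factor n i s A c l ⟩
        (fromℕ (part l i) - s) * commutators (suc n) A c l + fromℕ (suc n) * X i (commutators n A c) l
          ≡⟨ cong₂ (λ a b → (fromℕ (part l i) - s) * a + fromℕ (suc n) * b) (higher L c l)
               (trans (X-cong i (top L c) l) (linear-* (X-cong i) (X-linear i) (fromℕ (n !)) (B c) l)) ⟩
        (fromℕ (part l i) - s) * 0# + fromℕ (suc n) * (fromℕ (n !) * X i (B c) l)
          ≡⟨ solve 4 (λ p a b x → p :* con (ℤ.+ 0) :+ a :* (b :* x) := (a :* b) :* x) refl _ _ _ _ ⟩
        (fromℕ (suc n) * fromℕ (n !)) * X i (B c) l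
          ≡⟨ cong (_* X i (B c) l) (sym (fromℕ-* (suc n) (n !))) ⟩
        fromℕ (suc n !) * X i (B c) l ∎
    ; higher = λ c l → begin
        commutators (suc (suc n)) (linearFactor i s A) c l
          ≡⟨ commutators-factor (suc n) i s A c l ⟩
        (fromℕ (part l i) - s) * (commutators (suc n) A (V c) l - V (commutators (suc n) A c) l) + fromℕ (suc (suc n)) * X i (commutators (suc n) A c) l
          ≡⟨ cong₂ (λ a b → (fromℕ (part l i) - s) * a + fromℕ (suc (suc n)) * b)
               (cong₂ _-_ (higher L (V c) l) (trans (V-cong (higher L c) l) (linear-0 V-cong V-linear l)))
               (trans (X-cong i (higher L c) l) (linear-0 (X-cong i) (X-linear i) l)) ⟩
        (fromℕ (part l i) - s) * (0# - 0#) + fromℕ (suc (suc n)) * 0#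
          ≡⟨ solve 2 (λ p n → p :* (con (ℤ.+ 0) :- con (ℤ.+ 0)) :+ n :* con (ℤ.+ 0) := con (ℤ.+ 0)) refl _ _ ⟩
        0# ∎ }

  commutators-∑ : ∀ n {I : Set} (is : List I) (A : I → Fun → Fun) c l →
    commutators n (λ c l → ∑ is (λ i → A i c l)) c l ≡ ∑ is (λ i → commutators n (A i) c l)
  commutators-∑ zero    is A c l = refl
  commutators-∑ (suc n) is A c l = trans
    (cong₂ _-_ (commutators-∑ n is A (V c) l) (trans (V-cong (commutators-∑ n is A c) l) (V-∑ is (λ i → commutators n (A i) c) l)))
    (sym (∑-- is _ _))
    where
    V-∑ : ∀ {I : Set} (is : List I) (c : I → Fun) l → V (λ l → ∑ is (λ i → c i l)) l ≡ ∑ is (λ i → V (c i) l)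
    V-∑ []       c l = linear-0 V-cong V-linear l
    V-∑ (i ∷ is) c l = trans (linear-+ V-cong V-linear (c i) _ l) (cong (V (c i) l +_) (V-∑ is c l))

  leading-∑ : ∀ {n} {I : Set} (is : List I) {A B : I → Fun → Fun} → (∀ {i} → i ∈ is → Leading n (A i) (B i)) →
    Leading n (λ c l → ∑ is (λ i → A i c l)) (λ c l → ∑ is (λ i → B i c l))
  leading-∑ {n} is {A} {B} L = record
    { top    = λ c l → trans (commutators-∑ n is A c l) (trans (∑-cong∈ is (λ i∈ → top (L i∈) c l)) (∑-*ˡ (fromℕ (n !)) is _))
    ; higher = λ c l → trans (commutators-∑ (suc n) is A c l) (∑-zero∈ is (λ i∈ → higher (L i∈) c l)) }

-- Shifted coordinates and antisymmetric functions

module Antisymmetry where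

  open Rationals
  open Sums
  open SkewTableaux
  open HorizontalStrips
  open Dimensions
  open HookSums
  open Lowering

  -- The strictly decreasing sequence lᵢ = αᵢ + N - i, with N the length of α.
  shift : List ℕ → List ℕ
  shift []       = []
  shift (x ∷ xs) = x ℕ.+ length xs ∷ shift xs

  length-shift : ∀ α → length (shift α) ≡ length α
  length-shift []       = refl
  length-shift (x ∷ xs) = cong suc (length-shift xs)

  -- Exchanges of neighbours suffice, since they generate all permutations and already force the
  -- value 0 at equal neighbours. The length is fixed because `shift` depends on it.
  Antisymmetric : ℕ → Fun → Set
  Antisymmetric N G = ∀ xs a b ys → length (xs ++ a ∷ b ∷ ys) ≡ N →
                      G (xs ++ a ∷ b ∷ ys) ≡ - G (xs ++ b ∷ a ∷ ys)

  antisymmetric-∷ : ∀ {N} G → Antisymmetric (suc N) G → ∀ x → Antisymmetric N (G ∘ (x ∷_))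
  antisymmetric-∷ G anti x xs a b ys eq = anti (x ∷ xs) a b ys (cong suc eq)

  ≡-⇒0 : ∀ {x} → x ≡ - x → x ≡ 0#
  ≡-⇒0 {x} eq = *-cancelˡ-suc 1 (trans (solve 1 (λ x → con (ℤ.+ 2) :* x := x :+ x) refl x)
    (trans (cong (_+_ x) eq) (solve 1 (λ x → x :- x := con (ℤ.+ 2) :* con (ℤ.+ 0)) refl x)))

  antisymmetric-0 : ∀ {N} G → Antisymmetric N G → ∀ a ys → suc (suc (length ys)) ≡ N → G (a ∷ a ∷ ys) ≡ 0#
  antisymmetric-0 G anti a ys eq = ≡-⇒0 (anti [] a a ys eq)

  -- V is a symmetric expression in the Xᵢ, so exchanging two entries only exchanges two of its
  -- terms.
  V-antisymmetric : ∀ {N} G → Antisymmetric N G → Antisymmetric N (V G)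
  V-antisymmetric {zero}  G anti [] a b ys ()
  V-antisymmetric {suc N} G anti [] a b ys eq = begin
    X 1 G (a ∷ b ∷ ys) + (X 1 (G ∘ (a ∷_)) (b ∷ ys) + V (G ∘ (a ∷_) ∘ (b ∷_)) ys)
      ≡⟨ cong₂ _+_ (swapped a b) (cong₂ _+_ (trans (solve 1 (λ x → x := :- (:- x)) refl _) (cong -_ (sym (swapped b a)))) rests) ⟩
    - X 1 (G ∘ (b ∷_)) (a ∷ ys) + (- X 1 G (b ∷ a ∷ ys) + - V (G ∘ (b ∷_) ∘ (a ∷_)) ys)
      ≡⟨ solve 3 (λ x y z → :- x :+ (:- y :+ :- z) := :- (y :+ (x :+ z))) refl _ _ _ ⟩
    - (X 1 G (b ∷ a ∷ ys) + (X 1 (G ∘ (b ∷_)) (a ∷ ys) + V (G ∘ (b ∷_) ∘ (a ∷_)) ys)) ∎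
    where
    swapped : ∀ a b → X 1 G (a ∷ b ∷ ys) ≡ - X 1 (G ∘ (b ∷_)) (a ∷ ys)
    swapped zero    b = solve 0 (con (ℤ.+ 0) := :- con (ℤ.+ 0)) refl
    swapped (suc a) b = anti [] a b ys eq
    rests : V (G ∘ (a ∷_) ∘ (b ∷_)) ys ≡ - V (G ∘ (b ∷_) ∘ (a ∷_)) ys
    rests = go ys eq
      where
      go : ∀ zs → suc (suc (length zs)) ≡ suc N → V (G ∘ (a ∷_) ∘ (b ∷_)) zs ≡ - V (G ∘ (b ∷_) ∘ (a ∷_)) zs
      go zs eq = V-neg zs (G ∘ (a ∷_) ∘ (b ∷_)) (G ∘ (b ∷_) ∘ (a ∷_)) (λ us e → anti [] a b us (trans (cong (suc ∘ suc) e) eq))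
        where
        X-neg : ∀ c d x us → (∀ vs → length vs ≡ suc (length us) → c vs ≡ - d vs) → X 1 c (x ∷ us) ≡ - X 1 d (x ∷ us)
        X-neg c d zero    us h = solve 0 (con (ℤ.+ 0) := :- con (ℤ.+ 0)) refl
        X-neg c d (suc x) us h = h (x ∷ us) refl
        V-neg : ∀ us c d → (∀ vs → length vs ≡ length us → c vs ≡ - d vs) → V c us ≡ - V d us
        V-neg []       c d h = solve 0 (con (ℤ.+ 0) := :- con (ℤ.+ 0)) refl
        V-neg (x ∷ us) c d h = trans (cong₂ _+_ (X-neg c d x us h) (V-neg us (c ∘ (x ∷_)) (d ∘ (x ∷_)) (λ vs e → h (x ∷ vs) (cong suc e))))
          (solve 2 (λ a b → :- a :+ :- b := :- (a :+ b)) refl _ _)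
  V-antisymmetric {suc N} G anti (x ∷ xs) a b ys eq = trans
    (cong₂ _+_ (first x) (V-antisymmetric (G ∘ (x ∷_)) (antisymmetric-∷ G anti x) xs a b ys (ℕ.suc-injective eq)))
    (solve 2 (λ a b → :- a :+ :- b := :- (a :+ b)) refl _ _)
    where
    first : ∀ x → X 1 G (x ∷ xs ++ a ∷ b ∷ ys) ≡ - X 1 G (x ∷ xs ++ b ∷ a ∷ ys)
    first zero    = solve 0 (con (ℤ.+ 0) := :- con (ℤ.+ 0)) refl
    first (suc x) = anti (x ∷ xs) a b ys eq

  iterV-antisymmetric : ∀ k {N} G → Antisymmetric N G → Antisymmetric N (iterV k G)
  iterV-antisymmetric zero    G anti = anti
  iterV-antisymmetric (suc k) G anti = V-antisymmetric (iterV k G) (iterV-antisymmetric k G anti)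

  -- Removing a box from row i lowers lᵢ. If no box can be removed there, either the lowered lᵢ
  -- equals the next entry and antisymmetry kills the term, or the last entry is 0 and `X` gives 0.
  ∑-removals-shift : ∀ G α → Antisymmetric (length α) G → Decreasing α →
    ∑ (removals α) (λ (_ , ν) → G (shift ν)) ≡ V G (shift α)
  ∑-removals-shift G []       anti _       = refl
  ∑-removals-shift G (x ∷ xs) anti (p , d) = begin
    ∑ (removals (x ∷ xs)) (λ (_ , ν) → G (shift ν))
      ≡⟨ ∑-removals-∷ x xs (λ (_ , ν) → G (shift ν)) ⟩
    𝟙 (hd xs ℕ.<? x) * G (shift (pred x ∷ xs)) + ∑ (removals xs) (λ (_ , ν) → G (x ℕ.+ length ν ∷ shift ν))
      ≡⟨ cong₂ _+_ (first x xs p anti) (trans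
           (∑-cong∈ (removals xs) (λ {(_ , ν)} ν∈ → cong (λ m → G (x ℕ.+ m ∷ shift ν)) (Pointwise.Pointwise-length (Removes-⊑ (∈-removals xs ν∈)))))
           (∑-removals-shift (G ∘ (x ℕ.+ length xs ∷_)) xs (antisymmetric-∷ G anti (x ℕ.+ length xs)) d)) ⟩
    X 1 G (shift (x ∷ xs)) + V (G ∘ ((x ℕ.+ length xs) ∷_)) (shift xs) ∎
    where
    first : ∀ x xs → hd xs ≤ x → Antisymmetric (suc (length xs)) G →
      𝟙 (hd xs ℕ.<? x) * G (shift (pred x ∷ xs)) ≡ X 1 G (shift (x ∷ xs))
    first zero    []       p anti = zeroˡ _
    first zero    (zero ∷ ys) p anti = trans (zeroˡ _) (sym (antisymmetric-0 G anti (length ys) (shift ys) (cong (suc ∘ suc) (length-shift ys))))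
    first (suc x) xs       p anti with hd xs ℕ.<? suc x
    first (suc x) xs       p anti | yes q = 𝟙-yes* (hd xs ℕ.<? suc x) q _
    first (suc x) []       p anti | no ¬q = contradiction (s≤s z≤n) ¬q
    first (suc x) (y ∷ ys) p anti | no ¬q = trans (𝟙-no* (y ℕ.<? suc x) ¬q _) (sym (trans
      (cong (λ z → G (z ∷ y ℕ.+ length ys ∷ shift ys)) (trans (ℕ.+-suc x (length ys)) (cong (ℕ._+ length ys) (ℕ.≤-antisym (ℕ.≮⇒≥ ¬q) p))))
      (antisymmetric-0 G anti (y ℕ.+ length ys) (shift ys) (cong (suc ∘ suc) (length-shift ys)))))

  down-shift : ∀ k G α → Antisymmetric (length α) G → Decreasing α → down k (G ∘ shift) α ≡ iterV k G (shift α)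
  down-shift zero    G α anti d = refl
  down-shift (suc k) G α anti d = trans
    (∑-cong∈ (removals α) (λ {(_ , ν)} ν∈ → let r = ∈-removals α ν∈ in
       down-shift k G ν (subst (λ N → Antisymmetric N G) (sym (Pointwise.Pointwise-length (Removes-⊑ r))) anti) (Removes-decreasing r d)))
    (∑-removals-shift (iterV k G) α (iterV-antisymmetric k G anti) d)

  down-cong : ∀ k {G G′ : Fun} α → Decreasing α →
    (∀ ρ → ρ ⊑ α → Decreasing ρ → k ℕ.+ sum ρ ≡ sum α → G ρ ≡ G′ ρ) → down k G α ≡ down k G′ α
  down-cong zero    α d h = h α (Pointwise.refl ℕ.≤-refl) d refl
  down-cong (suc k) α d h = ∑-cong∈ (removals α) (λ {(_ , ν)} ν∈ → let r = ∈-removals α ν∈ in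
    down-cong k ν (Removes-decreasing r d) (λ ρ ρ⊑ν dρ e →
      h ρ (Pointwise.transitive ℕ.≤-trans ρ⊑ν (Removes-⊑ r)) dρ (trans (cong suc e) (Removes-sum r))))

  -- This is the sign of x - y.
  order : ℕ → ℕ → ℚ
  order x y with ℕ.<-cmp x y
  ... | tri< _ _ _ = - 1#
  ... | tri≈ _ _ _ = 0#
  ... | tri> _ _ _ = 1#

  order-> : ∀ {x y} → y < x → order x y ≡ 1#
  order-> {x} {y} y<x with ℕ.<-cmp x y
  ... | tri< x<y _ _ = contradiction x<y (ℕ.<-asym y<x)
  ... | tri≈ _ e _   = contradiction (sym e) (ℕ.<⇒≢ y<x)
  ... | tri> _ _ _   = refl

  order-< : ∀ {x y} → x < y → order x y ≡ - 1#
  order-< {x} {y} x<y with ℕ.<-cmp x y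
  ... | tri< _ _ _   = refl
  ... | tri≈ _ e _   = contradiction e (ℕ.<⇒≢ x<y)
  ... | tri> _ _ y<x = contradiction x<y (ℕ.<-asym y<x)

  order-≡ : ∀ x → order x x ≡ 0#
  order-≡ x with ℕ.<-cmp x x
  ... | tri< x<x _ _ = contradiction x<x (ℕ.<-irrefl refl)
  ... | tri≈ _ _ _   = refl
  ... | tri> _ _ x<x = contradiction x<x (ℕ.<-irrefl refl)

  order-swap : ∀ x y → order x y ≡ - order y x
  order-swap x y with ℕ.<-cmp x y
  ... | tri< x<y _ _  = cong -_ (sym (order-> x<y))
  ... | tri≈ _ refl _ = trans (solve 0 (con (ℤ.+ 0) := :- con (ℤ.+ 0)) refl) (cong -_ (sym (order-≡ x)))
  ... | tri> _ _ y<x  = trans (solve 0 (con one := :- (:- con one)) refl) (cong -_ (sym (order-< y<x)))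

  ∏ : ∀ {A : Set} → List A → (A → ℚ) → ℚ
  ∏ []       f = 1#
  ∏ (x ∷ xs) f = f x * ∏ xs f

  ∏-cong∈ : ∀ {A : Set} (xs : List A) {f g : A → ℚ} → (∀ {x} → x ∈ xs → f x ≡ g x) → ∏ xs f ≡ ∏ xs g
  ∏-cong∈ []       eq = refl
  ∏-cong∈ (x ∷ xs) eq = cong₂ _*_ (eq (here refl)) (∏-cong∈ xs (eq ∘ there))
    where open import Data.List.Relation.Unary.Any using (here; there)

  ∏-swap : ∀ {A : Set} (xs : List A) a b ys f → ∏ (xs ++ a ∷ b ∷ ys) f ≡ ∏ (xs ++ b ∷ a ∷ ys) f
  ∏-swap []       a b ys f = solve 3 (λ a b c → a :* (b :* c) := b :* (a :* c)) refl _ _ _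
  ∏-swap (x ∷ xs) a b ys f = cong (f x *_) (∏-swap xs a b ys f)

  -- The sign of the Vandermonde product of the entries: antisymmetric, 0 on repeated entries and 1
  -- on strictly decreasing sequences.
  orderSign : List ℕ → ℚ
  orderSign []       = 1#
  orderSign (x ∷ xs) = ∏ xs (order x) * orderSign xs

  orderSign-swap : ∀ xs a b ys → orderSign (xs ++ a ∷ b ∷ ys) ≡ - orderSign (xs ++ b ∷ a ∷ ys)
  orderSign-swap []       a b ys = trans
    (cong (λ o → (o * ∏ ys (order a)) * (∏ ys (order b) * orderSign ys)) (order-swap a b))
    (solve 4 (λ o p q s → (:- o :* p) :* (q :* s) := :- ((o :* q) :* (p :* s))) refl _ _ _ _)
  orderSign-swap (x ∷ xs) a b ys = trans
    (cong₂ _*_ (∏-swap xs a b ys (order x)) (orderSign-swap xs a b ys))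
    (solve 2 (λ p s → p :* :- s := :- (p :* s)) refl _ _)

  -- The sum of (n - 1, ..., 0), the shifted empty partition.
  staircase : ℕ → ℕ
  staircase zero    = 0
  staircase (suc n) = n ℕ.+ staircase n

  sum-shift : ∀ α → sum (shift α) ≡ sum α ℕ.+ staircase (length α)
  sum-shift []       = refl
  sum-shift (x ∷ xs) = trans (cong (x ℕ.+ length xs ℕ.+_) (sum-shift xs)) (interchange x (length xs) (sum xs) (staircase (length xs)))
    where open import Algebra.Properties.CommutativeSemigroup ℕ.+-commutativeSemigroup using (interchange)

  -- On sequences with the sum of (N - 1, …, 0) only permutations of that
  -- sequence have distinct entries, so this is the antisymmetrization of it.
  vacuum : Fun
  vacuum l = 𝟙 (sum l ℕ.≟ staircase (length l)) * orderSign l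

  vacuum-antisymmetric : ∀ N → Antisymmetric N vacuum
  vacuum-antisymmetric N xs a b ys _ = trans
    (cong₂ _*_ (cong₂ (λ s n → 𝟙 (s ℕ.≟ staircase n)) sums lengths) (orderSign-swap xs a b ys))
    (solve 2 (λ p s → p :* :- s := :- (p :* s)) refl _ _)
    where
    sums : sum (xs ++ a ∷ b ∷ ys) ≡ sum (xs ++ b ∷ a ∷ ys)
    sums = trans (sum-++ xs (a ∷ b ∷ ys)) (trans (cong (sum xs ℕ.+_)
      (trans (sym (ℕ.+-assoc a b (sum ys))) (trans (cong (ℕ._+ sum ys) (ℕ.+-comm a b)) (ℕ.+-assoc b a (sum ys))))) (sym (sum-++ xs (b ∷ a ∷ ys))))
    lengths : length (xs ++ a ∷ b ∷ ys) ≡ length (xs ++ b ∷ a ∷ ys)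
    lengths = trans (List.length-++ xs) (sym (List.length-++ xs))

  shift-bounded : ∀ α → Decreasing α → All (λ y → y < hd α ℕ.+ length α) (shift α)
  shift-bounded []       d       = []
  shift-bounded (x ∷ xs) (p , d) = ℕ.+-monoʳ-< x (ℕ.n<1+n (length xs)) ∷
    All.map (λ q → ℕ.<-trans q (ℕ.+-mono-≤-< p (ℕ.n<1+n (length xs)))) (shift-bounded xs d)

  orderSign-shift : ∀ α → Decreasing α → orderSign (shift α) ≡ 1#
  orderSign-shift []       d       = refl
  orderSign-shift (x ∷ xs) (p , d) = trans (cong₂ _*_ (ones (shift-bounded xs d)) (orderSign-shift xs d)) (*-identityˡ 1#)
    where
    ones : ∀ {ys} → All (λ y → y < hd xs ℕ.+ length xs) ys → ∏ ys (order (x ℕ.+ length xs)) ≡ 1#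
    ones []       = refl
    ones (q ∷ qs) = trans (cong₂ _*_ (order-> (ℕ.<-≤-trans q (ℕ.+-monoˡ-≤ (length xs) p))) (ones qs)) (*-identityˡ 1#)

  vacuum-shift : ∀ α → Decreasing α → vacuum (shift α) ≡ 𝟙 (sum α ℕ.≟ 0)
  vacuum-shift α d = begin
    𝟙 (sum (shift α) ℕ.≟ staircase (length (shift α))) * orderSign (shift α)
      ≡⟨ cong (𝟙 (sum (shift α) ℕ.≟ staircase (length (shift α))) *_) (orderSign-shift α d) ⟩
    𝟙 (sum (shift α) ℕ.≟ staircase (length (shift α))) * 1#
      ≡⟨ *-identityʳ _ ⟩
    𝟙 (sum (shift α) ℕ.≟ staircase (length (shift α)))
      ≡⟨ 𝟙-⇔ (sum (shift α) ℕ.≟ staircase (length (shift α))) (sum α ℕ.≟ 0)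
           (λ e → ℕ.+-cancelʳ-≡ (staircase (length α)) _ 0 (trans (sym (sum-shift α)) (trans e (cong staircase (length-shift α)))))
           (λ e → trans (sum-shift α) (trans (cong (ℕ._+ staircase (length α)) e) (cong staircase (sym (length-shift α))))) ⟩
    𝟙 (sum α ℕ.≟ 0) ∎

  -- The constant 1 is not antisymmetric. It may be replaced by `vacuum` because it is evaluated
  -- only after |α| removals, at the empty shape, where both are 1.
  down-1 : ∀ α → Decreasing α → down (sum α) (λ _ → 1#) α ≡ iterV (sum α) vacuum (shift α)
  down-1 α d = trans (down-cong (sum α) α d (λ ρ ρ⊑α dρ e → sym (trans (vacuum-shift ρ dρ)
      (𝟙-yes (sum ρ ℕ.≟ 0) (ℕ.+-cancelˡ-≡ (sum α) _ 0 (trans e (sym (ℕ.+-identityʳ (sum α)))))))))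
    (down-shift (sum α) vacuum α (vacuum-antisymmetric (length α)) d)

-- Complete symmetric functions of lowering operators and the Pieri rule

module Pieri where

  open Rationals
  open Sums
  open SkewTableaux
  open HorizontalStrips
  open Dimensions
  open HookSums
  open Lowering
  open Antisymmetry

  -- The sum over all N ≥ i₁ ≥ … ≥ i_k ≥ 1.
  ∑≥ : ℕ → ℕ → Fun → ℚ
  ∑≥ zero    N       F = F []
  ∑≥ (suc k) zero    F = 0#
  ∑≥ (suc k) (suc N) F = ∑≥ (suc k) N F + ∑≥ k (suc N) (F ∘ (suc N ∷_))

  ∑≥-cong : ∀ k N {F G : Fun} → F ≗ G → ∑≥ k N F ≡ ∑≥ k N G
  ∑≥-cong zero    N       e = e []
  ∑≥-cong (suc k) zero    e = refl
  ∑≥-cong (suc k) (suc N) e = cong₂ _+_ (∑≥-cong (suc k) N e) (∑≥-cong k (suc N) (e ∘ (suc N ∷_)))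

  ∑≥-*ˡ : ∀ k N s (F : Fun) → ∑≥ k N (λ is → s * F is) ≡ s * ∑≥ k N F
  ∑≥-*ˡ zero    N       s F = refl
  ∑≥-*ˡ (suc k) zero    s F = sym (zeroʳ s)
  ∑≥-*ˡ (suc k) (suc N) s F = trans (cong₂ _+_ (∑≥-*ˡ (suc k) N s F) (∑≥-*ˡ k (suc N) s _)) (sym (distribˡ s _ _))

  ∑≥-suc : ∀ k j (F : Fun) → ∑≥ (suc k) j F ≡ ∑ (range j) (λ i → ∑≥ k i (F ∘ (i ∷_)))
  ∑≥-suc k zero    F = refl
  ∑≥-suc k (suc j) F = trans (cong (_+ ∑≥ k (suc j) (F ∘ (suc j ∷_))) (∑≥-suc k j F)) (sym (∑-applyUpTo-suc suc j _))

  decreasings : ℕ → ℕ → List (List ℕ)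
  decreasings k N = filter (linked? (λ i j → j ℕ.≤? i)) (choices (replicate k (range N)))

  -- Prepending j ≤ N to a decreasing sequence bounds the sequence by j.
  ∑-bounded : ∀ k N j (F : Fun) → j ≤ N →
    ∑ (choices (replicate k (range N))) (λ is → 𝟙 (decreasing? (j ∷ is)) * F is) ≡ ∑≥ k j F
  ∑-bounded zero    N j F j≤N = trans (+-identityʳ _) (*-identityˡ _)
  ∑-bounded (suc k) N j F j≤N = begin
    ∑ (choices (range N ∷ replicate k (range N))) (λ is → 𝟙 (decreasing? (j ∷ is)) * F is)
      ≡⟨ ∑-choices-∷ (range N) (replicate k (range N)) _ ⟩
    ∑ (range N) (λ i → ∑ (choices (replicate k (range N))) (λ is → 𝟙 (decreasing? (j ∷ i ∷ is)) * F (i ∷ is)))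
      ≡⟨ ∑-cong∈ (range N) (λ {i} i∈ → trans (∑-cong (choices (replicate k (range N))) (λ is → trans (cong (_* F (i ∷ is))
             (trans (𝟙-⇔ (decreasing? (j ∷ i ∷ is)) ((i ℕ.≤? j) ×-dec decreasing? (i ∷ is)) (λ { (p ∷ ps) → p , ps }) (λ (p , ps) → p ∷ ps)) (𝟙-× (i ℕ.≤? j) (decreasing? (i ∷ is)))))
             (*-assoc (𝟙 (i ℕ.≤? j)) _ _)))
           (trans (∑-*ˡ (𝟙 (i ℕ.≤? j)) (choices (replicate k (range N))) _) (cong (𝟙 (i ℕ.≤? j) *_) (∑-bounded k N i (F ∘ (i ∷_)) (range≤ i∈))))) ⟩
    ∑ (range N) (λ i → 𝟙 (i ℕ.≤? j) * ∑≥ k i (F ∘ (i ∷_)))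
      ≡⟨ ∑-range-≤ N j≤N _ ⟩
    ∑ (range j) (λ i → ∑≥ k i (F ∘ (i ∷_)))
      ≡⟨ ∑≥-suc k j F ⟨
    ∑≥ (suc k) j F ∎
    where
    range≤ : ∀ {i} → i ∈ range N → i ≤ N
    range≤ i∈ with ∈-applyUpTo⁻ suc i∈
    ... | _ , p , refl = p
    ∑-range-≤ : ∀ N {j} → j ≤ N → (f : ℕ → ℚ) → ∑ (range N) (λ i → 𝟙 (i ℕ.≤? j) * f i) ≡ ∑ (range j) f
    ∑-range-≤ N {zero}  j≤N f = ∑-zero∈ (range N) (λ {i} i∈ → 𝟙-no* (i ℕ.≤? 0) (λ i≤0 → none i≤0 i∈) (f i))
      where
      none : ∀ {i} → i ≤ 0 → ¬ i ∈ range N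
      none z≤n i∈ with ∈-applyUpTo⁻ suc i∈
      ... | _ , _ , ()
    ∑-range-≤ (suc N) {suc j} (s≤s j≤N) f = begin
      ∑ (range (suc N)) (λ i → 𝟙 (i ℕ.≤? suc j) * f i)
        ≡⟨ ∑-applyUpTo suc (suc N) _ ⟩
      ∑ (upTo (suc N)) (λ i → 𝟙 (suc i ℕ.≤? suc j) * f (suc i))
        ≡⟨ ∑-cong (upTo (suc N)) (λ i → cong (_* f (suc i)) (𝟙-⇔ (suc i ℕ.≤? suc j) (i ℕ.≤? j) ℕ.≤-pred s≤s)) ⟩
      ∑ (upTo (suc N)) (λ i → 𝟙 (i ℕ.≤? j) * f (suc i))
        ≡⟨ ∑-upTo-≤ j≤N (f ∘ suc) ⟩
      ∑ (upTo (suc j)) (f ∘ suc)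
        ≡⟨ ∑-applyUpTo suc (suc j) f ⟨
      ∑ (range (suc j)) f ∎

  ∑-decreasings : ∀ k N (F : Fun) → ∑ (decreasings k N) F ≡ ∑≥ k N F
  ∑-decreasings k N F = begin
    ∑ (decreasings k N) F
      ≡⟨ ∑-filter decreasing? (choices (replicate k (range N))) F ⟩
    ∑ (choices (replicate k (range N))) (λ is → 𝟙 (decreasing? is) * F is)
      ≡⟨ ∑-cong∈ (choices (replicate k (range N))) (λ {is} is∈ → cong (_* F is)
           (𝟙-⇔ (decreasing? is) (decreasing? (N ∷ is)) (bound k is∈) (λ { [-] → [] ; (p ∷ ps) → ps }))) ⟩
    ∑ (choices (replicate k (range N))) (λ is → 𝟙 (decreasing? (N ∷ is)) * F is)
      ≡⟨ ∑-bounded k N N F ℕ.≤-refl ⟩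
    ∑≥ k N F ∎
    where
    bound : ∀ k {is} → is ∈ choices (replicate k (range N)) → Linked _≥_ is → Linked _≥_ (N ∷ is)
    bound zero    (here refl) _ = [-]
    bound (suc k) is∈ l with ∈-concatMap-map⁻ _∷_ (λ _ → choices (replicate k (range N))) (range N) is∈
    ... | _ , _ , i∈ , _ , refl = ℕ.≤-pred (proj₂ (∈-range⁻ i∈)) ∷ l

  Xs : List ℕ → Fun → Fun
  Xs []       c = c
  Xs (i ∷ is) c = X i (Xs is c)

  -- Multiplication by the complete symmetric function h_k in the variables X₁, …, X_N.
  completeX : ℕ → ℕ → Fun → Fun
  completeX k N c l = ∑≥ k N (λ is → Xs is c l)

  X-∑≥ : ∀ i k N (F : List ℕ → Fun) l → ∑≥ k N (λ is → X i (F is) l) ≡ X i (λ l → ∑≥ k N (λ is → F is l)) l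
  X-∑≥ i zero    N       F l = refl
  X-∑≥ i (suc k) zero    F l = sym (linear-0 (X-cong i) (X-linear i) l)
  X-∑≥ i (suc k) (suc N) F l = trans (cong₂ _+_ (X-∑≥ i (suc k) N F l) (X-∑≥ i k (suc N) (F ∘ (suc N ∷_)) l))
    (sym (linear-+ (X-cong i) (X-linear i) _ _ l))

  completeX-suc : ∀ k N c l → completeX (suc k) (suc N) c l ≡ completeX (suc k) N c l + X (suc N) (completeX k (suc N) c) l
  completeX-suc k N c l = cong (completeX (suc k) N c l +_) (X-∑≥ (suc N) k (suc N) (λ is → Xs is c) l)

  -- The same in the variables X₂, …, X_{N+1}.
  completeX′ : ℕ → ℕ → Fun → Fun
  completeX′ zero    N       c l = c l
  completeX′ (suc k) zero    c l = 0#
  completeX′ (suc k) (suc N) c l = completeX′ (suc k) N c l + X (suc (suc N)) (completeX′ k (suc N) c) l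

  completeX′-∷ : ∀ k N c a l → completeX′ k N c (a ∷ l) ≡ completeX k N (c ∘ (a ∷_)) l
  completeX′-∷ zero    N       c a l = refl
  completeX′-∷ (suc k) zero    c a l = refl
  completeX′-∷ (suc k) (suc N) c a l = trans
    (cong₂ _+_ (completeX′-∷ (suc k) N c a l) (X-cong (suc N) (completeX′-∷ k (suc N) c a) l))
    (sym (completeX-suc k N (c ∘ (a ∷_)) l))

  -- By definition the last variable is split off, whereas lists give access to the first one. The
  -- passage between the two recursions uses that the Xᵢ commute.
  completeX-first : ∀ k N c l → completeX (suc k) (suc N) c l ≡ completeX′ (suc k) N c l + X 1 (completeX k (suc N) c) l
  completeX-first k       zero    c l = completeX-suc k zero c l
  completeX-first zero    (suc N) c l = begin
    completeX 1 (suc (suc N)) c l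
      ≡⟨⟩
    completeX 1 (suc N) c l + X (suc (suc N)) c l
      ≡⟨ cong (_+ X (suc (suc N)) c l) (completeX-first zero N c l) ⟩
    (completeX′ 1 N c l + X 1 c l) + X (suc (suc N)) c l
      ≡⟨ solve 3 (λ a b c → (a :+ b) :+ c := (a :+ c) :+ b) refl _ _ _ ⟩
    completeX′ 1 (suc N) c l + X 1 c l ∎
  completeX-first (suc k) (suc N) c l = begin
    completeX (suc (suc k)) (suc (suc N)) c l
      ≡⟨ completeX-suc (suc k) (suc N) c l ⟩
    completeX (suc (suc k)) (suc N) c l + X (suc (suc N)) (completeX (suc k) (suc (suc N)) c) l
      ≡⟨ cong₂ _+_ (completeX-first (suc k) N c l)
           (trans (X-cong (suc (suc N)) (completeX-first k (suc N) c) l) (linear-+ (X-cong (suc (suc N))) (X-linear (suc (suc N))) _ _ l)) ⟩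
    (completeX′ (suc (suc k)) N c l + X 1 (completeX (suc k) (suc N) c) l) +
      (X (suc (suc N)) (completeX′ (suc k) (suc N) c) l + X (suc (suc N)) (X 1 (completeX k (suc (suc N)) c)) l)
      ≡⟨ cong (λ z → (completeX′ (suc (suc k)) N c l + X 1 (completeX (suc k) (suc N) c) l) + (X (suc (suc N)) (completeX′ (suc k) (suc N) c) l + z))
           (X-X (suc (suc N)) 1 _ l) ⟩
    (completeX′ (suc (suc k)) N c l + X 1 (completeX (suc k) (suc N) c) l) +
      (X (suc (suc N)) (completeX′ (suc k) (suc N) c) l + X 1 (X (suc (suc N)) (completeX k (suc (suc N)) c)) l)
      ≡⟨ solve 4 (λ a b c d → (a :+ b) :+ (c :+ d) := (a :+ c) :+ (b :+ d)) refl _ _ _ _ ⟩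
    completeX′ (suc (suc k)) (suc N) c l +
      (X 1 (completeX (suc k) (suc N) c) l + X 1 (X (suc (suc N)) (completeX k (suc (suc N)) c)) l)
      ≡⟨ cong (completeX′ (suc (suc k)) (suc N) c l +_) (sym (trans (X-cong 1 (completeX-suc k (suc N) c) l) (linear-+ (X-cong 1) (X-linear 1) _ _ l))) ⟩
    completeX′ (suc (suc k)) (suc N) c l + X 1 (completeX (suc k) (suc (suc N)) c) l ∎

  -- All ways to decrease the entries independently, with the total decrease recorded.
  lowerings : List ℕ → List (ℕ × List ℕ)
  lowerings []      = (0 , []) ∷ []
  lowerings (a ∷ l) = concatMap (λ v → map (λ (t , ν) → a ∸ v ℕ.+ t , v ∷ ν) (lowerings l)) (upTo (suc a))

  ∑-lowerings-∷ : ∀ a l (f : ℕ × List ℕ → ℚ) → ∑ (lowerings (a ∷ l)) f ≡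
    ∑ (upTo (suc a)) (λ v → ∑ (lowerings l) (λ (t , ν) → f (a ∸ v ℕ.+ t , v ∷ ν)))
  ∑-lowerings-∷ a l f = trans (∑-concatMap (λ v → map (λ (t , ν) → a ∸ v ℕ.+ t , v ∷ ν) (lowerings l)) (upTo (suc a)) f) (∑-cong (upTo (suc a)) (λ v → ∑-map _ (lowerings l) f))

  length-lowerings : ∀ l {t ν} → (t , ν) ∈ lowerings l → length ν ≡ length l
  length-lowerings []      (here refl) = refl
  length-lowerings (a ∷ l) ν∈ with ∈-concatMap-map⁻ (λ v (t , ν) → a ∸ v ℕ.+ t , v ∷ ν) (λ _ → lowerings l) (upTo (suc a)) ν∈
  ... | _ , _ , _ , q , refl = cong suc (length-lowerings l q)

  -- A monomial of degree k in the Xᵢ lowers the entries by amounts of total k, and different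
  -- monomials lower them by different amounts.
  completeX-lowerings : ∀ k l (c : Fun) → completeX k (length l) c l ≡ ∑ (lowerings l) (λ (t , ν) → 𝟙 (t ℕ.≟ k) * c ν)
  completeX-lowerings zero    []      c = sym (trans (+-identityʳ _) (*-identityˡ _))
  completeX-lowerings (suc k) []      c = sym (trans (+-identityʳ _) (zeroˡ _))
  completeX-lowerings k       (a ∷ l) c = go k a
    where
    inner : ℕ → ℕ → ℕ → ℚ
    inner k a v = ∑ (lowerings l) (λ (t , ν) → 𝟙 (a ∸ v ℕ.+ t ℕ.≟ k) * c (v ∷ ν))
    last-term : ∀ k a → inner k a a ≡ completeX k (length l) (c ∘ (a ∷_)) l
    last-term k a = trans (cong (λ z → ∑ (lowerings l) (λ (t , ν) → 𝟙 (z ℕ.+ t ℕ.≟ k) * c (a ∷ ν))) (ℕ.n∸n≡0 a))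
      (sym (completeX-lowerings k l (c ∘ (a ∷_))))
    first-term : ∀ k → completeX k (suc (length l)) c (zero ∷ l) ≡ completeX k (length l) (c ∘ (zero ∷_)) l
    first-term zero    = refl
    first-term (suc k) = trans (completeX-first k (length l) c (zero ∷ l)) (trans (+-identityʳ _) (completeX′-∷ (suc k) (length l) c zero l))
    go : ∀ k a → completeX k (suc (length l)) c (a ∷ l) ≡ ∑ (lowerings (a ∷ l)) (λ (t , ν) → 𝟙 (t ℕ.≟ k) * c ν)
    go k zero = trans (first-term k) (sym (trans (∑-lowerings-∷ zero l _) (trans (+-identityʳ _) (last-term k zero))))
    go zero (suc a) = sym (trans (∑-lowerings-∷ (suc a) l _) (trans (∑-applyUpTo-suc id (suc a) (inner zero (suc a)))
      (trans (cong₂ _+_ (∑-zero∈ (upTo (suc a)) (λ {v} v∈ → ∑-zero (lowerings l) (λ (t , ν) → 𝟙-no* (suc a ∸ v ℕ.+ t ℕ.≟ 0)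
          (λ e → contradiction (trans (sym (cong (ℕ._+ t) (ℕ.+-∸-assoc 1 (ℕ.≤-pred (∈-upTo⁻ v∈))))) e) λ ()) _)))
        (last-term zero (suc a))) (+-identityˡ _))))
    -- Either the first entry is kept, or one factor X₁ is split off and the rest is the same sum
    -- for the entry `a`.
    go (suc k) (suc a) = begin
      completeX (suc k) (suc (length l)) c (suc a ∷ l)
        ≡⟨ completeX-first k (length l) c (suc a ∷ l) ⟩
      completeX′ (suc k) (length l) c (suc a ∷ l) + completeX k (suc (length l)) c (a ∷ l)
        ≡⟨ cong₂ _+_ (trans (completeX′-∷ (suc k) (length l) c (suc a) l) (sym (last-term (suc k) (suc a)))) (trans (go k a) (∑-lowerings-∷ a l _)) ⟩
      inner (suc k) (suc a) (suc a) + ∑ (upTo (suc a)) (inner k a)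
        ≡⟨ +-comm _ _ ⟩
      ∑ (upTo (suc a)) (inner k a) + inner (suc k) (suc a) (suc a)
        ≡⟨ cong (_+ inner (suc k) (suc a) (suc a)) (∑-cong∈ (upTo (suc a)) (λ {v} v∈ → ∑-cong (lowerings l) (λ (t , ν) → cong (_* c (v ∷ ν))
             (𝟙-⇔ (a ∸ v ℕ.+ t ℕ.≟ k) (suc a ∸ v ℕ.+ t ℕ.≟ suc k)
                (λ e → trans (cong (ℕ._+ t) (ℕ.+-∸-assoc 1 (ℕ.≤-pred (∈-upTo⁻ v∈)))) (cong suc e))
                (λ e → ℕ.suc-injective (trans (cong (ℕ._+ t) (sym (ℕ.+-∸-assoc 1 (ℕ.≤-pred (∈-upTo⁻ v∈))))) e)))))) ⟩
      ∑ (upTo (suc a)) (inner (suc k) (suc a)) + inner (suc k) (suc a) (suc a)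
        ≡⟨ ∑-applyUpTo-suc id (suc a) (inner (suc k) (suc a)) ⟨
      ∑ (upTo (suc (suc a))) (inner (suc k) (suc a))
        ≡⟨ ∑-lowerings-∷ (suc a) l _ ⟨
      ∑ (lowerings (suc a ∷ l)) (λ (t , ν) → 𝟙 (t ℕ.≟ suc k) * c ν) ∎

  ∑-upTo-+ : ∀ m n (f : ℕ → ℚ) → ∑ (upTo (m ℕ.+ n)) f ≡ ∑ (upTo m) f + ∑ (upTo n) (λ t → f (m ℕ.+ t))
  ∑-upTo-+ zero    n f = sym (+-identityˡ _)
  ∑-upTo-+ (suc m) n f = begin
    f 0 + ∑ (applyUpTo suc (m ℕ.+ n)) f
      ≡⟨ cong (_+_ (f 0)) (trans (∑-applyUpTo suc (m ℕ.+ n) f) (∑-upTo-+ m n (f ∘ suc))) ⟩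
    f 0 + (∑ (upTo m) (f ∘ suc) + ∑ (upTo n) (λ t → f (suc m ℕ.+ t)))
      ≡⟨ +-assoc (f 0) _ _ ⟨
    (f 0 + ∑ (upTo m) (f ∘ suc)) + ∑ (upTo n) (λ t → f (suc m ℕ.+ t))
      ≡⟨ cong (λ z → (f 0 + z) + ∑ (upTo n) (λ t → f (suc m ℕ.+ t))) (sym (∑-applyUpTo suc m f)) ⟩
    (f 0 + ∑ (applyUpTo suc m) f) + ∑ (upTo n) (λ t → f (suc m ℕ.+ t)) ∎

  ∑-upTo-split : ∀ h n (f : ℕ → ℚ) → h ≤ n → ∑ (upTo n) f ≡ ∑ (upTo h) f + ∑ (upTo n) (λ t → 𝟙 (h ℕ.≤? t) * f t)
  ∑-upTo-split h zero    f z≤n = sym (+-identityˡ 0#)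
  ∑-upTo-split h (suc n) f h≤  with h ℕ.≤? n
  ... | yes h≤n = begin
    ∑ (upTo (suc n)) f
      ≡⟨ ∑-applyUpTo-suc id n f ⟩
    ∑ (upTo n) f + f n
      ≡⟨ cong₂ _+_ (∑-upTo-split h n f h≤n) (sym (𝟙-yes* (h ℕ.≤? n) h≤n (f n))) ⟩
    (∑ (upTo h) f + ∑ (upTo n) (λ t → 𝟙 (h ℕ.≤? t) * f t)) + 𝟙 (h ℕ.≤? n) * f n
      ≡⟨ +-assoc _ _ _ ⟩
    ∑ (upTo h) f + (∑ (upTo n) (λ t → 𝟙 (h ℕ.≤? t) * f t) + 𝟙 (h ℕ.≤? n) * f n)
      ≡⟨ cong (∑ (upTo h) f +_) (sym (∑-applyUpTo-suc id n (λ t → 𝟙 (h ℕ.≤? t) * f t))) ⟩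
    ∑ (upTo h) f + ∑ (upTo (suc n)) (λ t → 𝟙 (h ℕ.≤? t) * f t) ∎
  ... | no h≰n = begin
    ∑ (upTo (suc n)) f
      ≡⟨ cong (λ m → ∑ (upTo m) f) (ℕ.≤-antisym (ℕ.≰⇒> h≰n) h≤) ⟩
    ∑ (upTo h) f
      ≡⟨ +-identityʳ _ ⟨
    ∑ (upTo h) f + 0#
      ≡⟨ cong (∑ (upTo h) f +_) (sym (∑-zero∈ (upTo (suc n)) (λ {t} t∈ → 𝟙-no* (h ℕ.≤? t) (λ h≤t → h≰n (ℕ.≤-trans h≤t (ℕ.≤-pred (∈-upTo⁻ t∈)))) (f t)))) ⟩
    ∑ (upTo h) f + ∑ (upTo (suc n)) (λ t → 𝟙 (h ℕ.≤? t) * f t) ∎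

  Fun² : Set
  Fun² = ℕ × List ℕ → ℚ

  -- The terms in which both leading entries are at most b cancel in pairs.
  ∑-square-0 : ∀ a b l (g : Fun²) → b ≤ a → (∀ t → Antisymmetric (suc (suc (length l))) (λ ν → g (t , ν))) →
    ∑ (upTo (suc b)) (λ v → ∑ (lowerings (b ∷ l)) (λ (t , ν) → g (a ∸ v ℕ.+ t , v ∷ ν))) ≡ 0#
  ∑-square-0 a b l g b≤a anti = ≡-⇒0 (begin
    S
      ≡⟨ ∑-cong (upTo (suc b)) (λ v → ∑-lowerings-∷ b l _) ⟩
    ∑ (upTo (suc b)) (λ v → ∑ (upTo (suc b)) (h v))
      ≡⟨ ∑-swap (upTo (suc b)) (upTo (suc b)) h ⟩
    ∑ (upTo (suc b)) (λ w → ∑ (upTo (suc b)) (λ v → h v w))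
      ≡⟨ ∑-cong∈ (upTo (suc b)) (λ {w} w∈ → trans (∑-cong∈ (upTo (suc b)) (λ {v} v∈ → flip′ v w (ℕ.≤-pred (∈-upTo⁻ v∈)) (ℕ.≤-pred (∈-upTo⁻ w∈)))) (∑-neg (upTo (suc b)) (h w))) ⟩
    ∑ (upTo (suc b)) (λ w → - ∑ (upTo (suc b)) (h w))
      ≡⟨ ∑-neg (upTo (suc b)) _ ⟩
    - ∑ (upTo (suc b)) (λ w → ∑ (upTo (suc b)) (h w))
      ≡⟨ cong -_ (sym (∑-cong (upTo (suc b)) (λ v → ∑-lowerings-∷ b l _))) ⟩
    - S ∎)
    where
    S = ∑ (upTo (suc b)) (λ v → ∑ (lowerings (b ∷ l)) (λ (t , ν) → g (a ∸ v ℕ.+ t , v ∷ ν)))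
    h : ℕ → ℕ → ℚ
    h v w = ∑ (lowerings l) (λ (t , ν) → g (a ∸ v ℕ.+ (b ∸ w ℕ.+ t) , v ∷ w ∷ ν))
    deficits : ∀ v w t → v ≤ b → w ≤ b → a ∸ v ℕ.+ (b ∸ w ℕ.+ t) ≡ a ∸ w ℕ.+ (b ∸ v ℕ.+ t)
    deficits v w t v≤b w≤b = begin
      a ∸ v ℕ.+ (b ∸ w ℕ.+ t)      ≡⟨ ℕ.+-assoc (a ∸ v) (b ∸ w) t ⟨
      (a ∸ v) ℕ.+ (b ∸ w) ℕ.+ t    ≡⟨ cong (ℕ._+ t) (ℕ.+-cancelʳ-≡ (v ℕ.+ w) _ _ (trans (both a b v w (ℕ.≤-trans v≤b b≤a) w≤b)
                                        (sym (trans (cong (a ∸ w ℕ.+ (b ∸ v) ℕ.+_) (ℕ.+-comm v w)) (both a b w v (ℕ.≤-trans w≤b b≤a) v≤b))))) ⟩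
      (a ∸ w) ℕ.+ (b ∸ v) ℕ.+ t    ≡⟨ ℕ.+-assoc (a ∸ w) (b ∸ v) t ⟩
      a ∸ w ℕ.+ (b ∸ v ℕ.+ t)      ∎
      where
      open import Algebra.Properties.CommutativeSemigroup ℕ.+-commutativeSemigroup using (interchange)
      both : ∀ a b v w → v ≤ a → w ≤ b → (a ∸ v) ℕ.+ (b ∸ w) ℕ.+ (v ℕ.+ w) ≡ a ℕ.+ b
      both a b v w p q = trans (interchange (a ∸ v) (b ∸ w) v w) (cong₂ ℕ._+_ (ℕ.m∸n+n≡m p) (ℕ.m∸n+n≡m q))
    flip′ : ∀ v w → v ≤ b → w ≤ b → h v w ≡ - h w v
    flip′ v w v≤b w≤b = trans (∑-cong∈ (lowerings l) (λ {(t , ν)} ν∈ → trans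
        (anti (a ∸ v ℕ.+ (b ∸ w ℕ.+ t)) [] v w ν (cong (suc ∘ suc) (length-lowerings l ν∈)))
        (cong (λ d → - g (d , w ∷ v ∷ ν)) (deficits v w t v≤b w≤b))))
      (∑-neg (lowerings l) _)

  -- Lowerings in which the first entry does not exceed the original second one cancel by
  -- `∑-square-0`. What remains is `hd xs` ≤ t for the new first part t, the interlacing condition
  -- of a horizontal strip.
  ∑-lowerings-shift : ∀ α → Decreasing α → (g : Fun²) → (∀ t → Antisymmetric (length α) (λ ν → g (t , ν))) →
    ∑ (lowerings (shift α)) g ≡ ∑ (strips α (zeros (length α))) (λ (t , ν) → g (t , shift ν))
  ∑-lowerings-shift []       d g anti = refl
  ∑-lowerings-shift (x ∷ xs) (p , d) g anti = begin
    ∑ (lowerings (x ℕ.+ m ∷ shift xs)) g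
      ≡⟨ ∑-lowerings-∷ (x ℕ.+ m) (shift xs) g ⟩
    ∑ (upTo (suc (x ℕ.+ m))) φ
      ≡⟨ cong (λ n → ∑ (upTo n) φ) (trans (cong suc (ℕ.+-comm x m)) (sym (ℕ.+-suc m x))) ⟩
    ∑ (upTo (m ℕ.+ suc x)) φ
      ≡⟨ ∑-upTo-+ m (suc x) φ ⟩
    ∑ (upTo m) φ + ∑ (upTo (suc x)) (λ t → φ (m ℕ.+ t))
      ≡⟨ cong (∑ (upTo m) φ +_) (∑-upTo-split (hd xs) (suc x) (λ t → φ (m ℕ.+ t)) (ℕ.m≤n⇒m≤1+n p)) ⟩
    ∑ (upTo m) φ + (∑ (upTo (hd xs)) (λ t → φ (m ℕ.+ t)) + ∑ (upTo (suc x)) (λ t → 𝟙 (hd xs ℕ.≤? t) * φ (m ℕ.+ t)))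
      ≡⟨ +-assoc _ _ _ ⟨
    (∑ (upTo m) φ + ∑ (upTo (hd xs)) (λ t → φ (m ℕ.+ t))) + ∑ (upTo (suc x)) (λ t → 𝟙 (hd xs ℕ.≤? t) * φ (m ℕ.+ t))
      ≡⟨ cong (_+ ∑ (upTo (suc x)) (λ t → 𝟙 (hd xs ℕ.≤? t) * φ (m ℕ.+ t))) (trans (sym (∑-upTo-+ m (hd xs) φ)) (low-0 xs p anti)) ⟩
    0# + ∑ (upTo (suc x)) (λ t → 𝟙 (hd xs ℕ.≤? t) * φ (m ℕ.+ t))
      ≡⟨ +-identityˡ _ ⟩
    ∑ (upTo (suc x)) (λ t → 𝟙 (hd xs ℕ.≤? t) * φ (m ℕ.+ t))
      ≡⟨ ∑-cong (upTo (suc x)) (λ t → cong (𝟙 (hd xs ℕ.≤? t) *_) (per-row t)) ⟩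
    ∑ (upTo (suc x)) (λ t → 𝟙 (hd xs ℕ.≤? t) * ∑ (strips xs (zeros m)) (λ (s , ν) → g (x ∸ t ℕ.+ s , shift (t ∷ ν))))
      ≡⟨ ∑-strips-∷ x xs 0 (zeros m) (λ (t , ν) → g (t , shift ν)) ⟨
    ∑ (strips (x ∷ xs) (zeros (suc m))) (λ (t , ν) → g (t , shift ν)) ∎
    where
    m = length xs
    φ : ℕ → ℚ
    φ v = ∑ (lowerings (shift xs)) (λ (t , ν) → g (x ℕ.+ m ∸ v ℕ.+ t , v ∷ ν))
    low-0 : ∀ xs → hd xs ≤ x → (∀ t → Antisymmetric (suc (length xs)) (λ ν → g (t , ν))) →
      ∑ (upTo (length xs ℕ.+ hd xs)) (λ v → ∑ (lowerings (shift xs)) (λ (t , ν) → g (x ℕ.+ length xs ∸ v ℕ.+ t , v ∷ ν))) ≡ 0#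
    low-0 []       p anti = refl
    low-0 (y ∷ ys) p anti = trans
      (cong (λ n → ∑ (upTo (suc n)) (λ v → ∑ (lowerings (shift (y ∷ ys))) (λ (t , ν) → g (x ℕ.+ suc (length ys) ∸ v ℕ.+ t , v ∷ ν)))) (ℕ.+-comm (length ys) y))
      (∑-square-0 (x ℕ.+ suc (length ys)) (y ℕ.+ length ys) (shift ys) g (ℕ.+-mono-≤ p (ℕ.n≤1+n _))
        (λ t → subst (λ N → Antisymmetric (suc (suc N)) (λ ν → g (t , ν))) (sym (length-shift ys)) (anti t)))
    per-row : ∀ t → φ (m ℕ.+ t) ≡ ∑ (strips xs (zeros m)) (λ (s , ν) → g (x ∸ t ℕ.+ s , shift (t ∷ ν)))
    per-row t = begin
      φ (m ℕ.+ t)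
        ≡⟨ cong φ (ℕ.+-comm m t) ⟩
      φ (t ℕ.+ m)
        ≡⟨ cong (λ e → ∑ (lowerings (shift xs)) (λ (s , ν) → g (e ℕ.+ s , t ℕ.+ m ∷ ν))) (trans (cong₂ _∸_ (ℕ.+-comm x m) (ℕ.+-comm t m)) (ℕ.[m+n]∸[m+o]≡n∸o m x t)) ⟩
      ∑ (lowerings (shift xs)) (λ (s , ν) → g (x ∸ t ℕ.+ s , t ℕ.+ m ∷ ν))
        ≡⟨ ∑-lowerings-shift xs d (λ (s , ν) → g (x ∸ t ℕ.+ s , t ℕ.+ m ∷ ν)) (λ s → antisymmetric-∷ (λ ν → g (x ∸ t ℕ.+ s , ν)) (anti (x ∸ t ℕ.+ s)) (t ℕ.+ m)) ⟩
      ∑ (strips xs (zeros m)) (λ (s , ν) → g (x ∸ t ℕ.+ s , t ℕ.+ m ∷ shift ν))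
        ≡⟨ ∑-cong∈ (strips xs (zeros m)) (λ {(s , ν)} ∈s → cong (λ n → g (x ∸ t ℕ.+ s , t ℕ.+ n ∷ shift ν))
             (sym (Pointwise.Pointwise-length (proj₁ (proj₂ (proj₂ (strips-all d (zeros-⊑ xs) ∈s))))))) ⟩
      ∑ (strips xs (zeros m)) (λ (s , ν) → g (x ∸ t ℕ.+ s , shift (t ∷ ν))) ∎

  pieri : ∀ k α c → Decreasing α → Antisymmetric (length α) c →
    completeX k (length α) c (shift α) ≡ ∑ (strips α (zeros (length α))) (λ (t , ν) → 𝟙 (t ℕ.≟ k) * c (shift ν))
  pieri k α c d anti = trans (cong (λ N → completeX k N c (shift α)) (sym (length-shift α)))
    (trans (completeX-lowerings k (shift α) c)
      (∑-lowerings-shift α d (λ (t , ν) → 𝟙 (t ℕ.≟ k) * c ν) (λ t xs a b ys e → trans (cong (𝟙 (t ℕ.≟ k) *_) (anti xs a b ys e))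
        (solve 2 (λ p s → p :* :- s := :- (p :* s)) refl _ _))))

  -- With all N variables the operator is a sum over lowerings, and the exchange of two entries
  -- permutes these without changing the total decrease.
  completeX-antisymmetric : ∀ k {N} c → Antisymmetric N c → Antisymmetric N (completeX k N c)
  completeX-antisymmetric k {N} c anti xs a b ys eq = begin
    completeX k N c (xs ++ a ∷ b ∷ ys)
      ≡⟨ cong (λ n → completeX k n c (xs ++ a ∷ b ∷ ys)) (sym eq) ⟩
    completeX k (length (xs ++ a ∷ b ∷ ys)) c (xs ++ a ∷ b ∷ ys)
      ≡⟨ completeX-lowerings k (xs ++ a ∷ b ∷ ys) c ⟩
    ∑ (lowerings (xs ++ a ∷ b ∷ ys)) (λ (t , ν) → 𝟙 (t ℕ.≟ k) * c ν)
      ≡⟨ swapped xs (λ (t , ν) → 𝟙 (t ℕ.≟ k) * c ν) N eq (λ t xs a b ys e → trans (cong (𝟙 (t ℕ.≟ k) *_) (anti xs a b ys e)) (solve 2 (λ p s → p :* :- s := :- (p :* s)) refl _ _)) ⟩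
    - ∑ (lowerings (xs ++ b ∷ a ∷ ys)) (λ (t , ν) → 𝟙 (t ℕ.≟ k) * c ν)
      ≡⟨ cong -_ (sym (completeX-lowerings k (xs ++ b ∷ a ∷ ys) c)) ⟩
    - completeX k (length (xs ++ b ∷ a ∷ ys)) c (xs ++ b ∷ a ∷ ys)
      ≡⟨ cong (λ n → - completeX k n c (xs ++ b ∷ a ∷ ys)) (trans (trans (List.length-++ xs) (sym (List.length-++ xs {a ∷ b ∷ ys}))) eq) ⟩
    - completeX k N c (xs ++ b ∷ a ∷ ys) ∎
    where
    two : ∀ x y zs (g : Fun²) → ∑ (lowerings (x ∷ y ∷ zs)) g ≡
      ∑ (upTo (suc x)) (λ v → ∑ (upTo (suc y)) (λ w → ∑ (lowerings zs) (λ (t , ν) → g (x ∸ v ℕ.+ (y ∸ w ℕ.+ t) , v ∷ w ∷ ν))))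
    two x y zs g = trans (∑-lowerings-∷ x (y ∷ zs) g) (∑-cong (upTo (suc x)) (λ v → ∑-lowerings-∷ y zs _))
    swapped : ∀ xs (g : Fun²) N → length (xs ++ a ∷ b ∷ ys) ≡ N → (∀ t → Antisymmetric N (λ ν → g (t , ν))) →
      ∑ (lowerings (xs ++ a ∷ b ∷ ys)) g ≡ - ∑ (lowerings (xs ++ b ∷ a ∷ ys)) g
    swapped []       g N eq anti = begin
      ∑ (lowerings (a ∷ b ∷ ys)) g
        ≡⟨ two a b ys g ⟩
      ∑ (upTo (suc a)) (λ v → ∑ (upTo (suc b)) (λ w → ∑ (lowerings ys) (λ (t , ν) → g (a ∸ v ℕ.+ (b ∸ w ℕ.+ t) , v ∷ w ∷ ν))))
        ≡⟨ ∑-swap (upTo (suc a)) (upTo (suc b)) _ ⟩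
      ∑ (upTo (suc b)) (λ w → ∑ (upTo (suc a)) (λ v → ∑ (lowerings ys) (λ (t , ν) → g (a ∸ v ℕ.+ (b ∸ w ℕ.+ t) , v ∷ w ∷ ν))))
        ≡⟨ ∑-cong (upTo (suc b)) (λ w → trans (∑-cong (upTo (suc a)) (λ v → trans (∑-cong∈ (lowerings ys) (λ {(t , ν)} ν∈ →
             trans (cong (λ d → g (d , v ∷ w ∷ ν)) (trans (sym (ℕ.+-assoc (a ∸ v) (b ∸ w) t)) (trans (cong (ℕ._+ t) (ℕ.+-comm (a ∸ v) (b ∸ w))) (ℕ.+-assoc (b ∸ w) (a ∸ v) t))))
               (anti _ [] v w ν (trans (cong (suc ∘ suc) (length-lowerings ys ν∈)) eq)))) (∑-neg (lowerings ys) _))) (∑-neg (upTo (suc a)) _)) ⟩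
      ∑ (upTo (suc b)) (λ w → - ∑ (upTo (suc a)) (λ v → ∑ (lowerings ys) (λ (t , ν) → g (b ∸ w ℕ.+ (a ∸ v ℕ.+ t) , w ∷ v ∷ ν))))
        ≡⟨ ∑-neg (upTo (suc b)) _ ⟩
      - ∑ (upTo (suc b)) (λ w → ∑ (upTo (suc a)) (λ v → ∑ (lowerings ys) (λ (t , ν) → g (b ∸ w ℕ.+ (a ∸ v ℕ.+ t) , w ∷ v ∷ ν))))
        ≡⟨ cong -_ (sym (two b a ys g)) ⟩
      - ∑ (lowerings (b ∷ a ∷ ys)) g ∎
    swapped (x ∷ xs) g (suc N) eq anti = begin
      ∑ (lowerings (x ∷ xs ++ a ∷ b ∷ ys)) g
        ≡⟨ ∑-lowerings-∷ x (xs ++ a ∷ b ∷ ys) g ⟩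
      ∑ (upTo (suc x)) (λ v → ∑ (lowerings (xs ++ a ∷ b ∷ ys)) (λ (t , ν) → g (x ∸ v ℕ.+ t , v ∷ ν)))
        ≡⟨ ∑-cong (upTo (suc x)) (λ v → swapped xs (λ (t , ν) → g (x ∸ v ℕ.+ t , v ∷ ν)) N (ℕ.suc-injective eq) (λ t → antisymmetric-∷ (λ ν → g (x ∸ v ℕ.+ t , ν)) (anti (x ∸ v ℕ.+ t)) v)) ⟩
      ∑ (upTo (suc x)) (λ v → - ∑ (lowerings (xs ++ b ∷ a ∷ ys)) (λ (t , ν) → g (x ∸ v ℕ.+ t , v ∷ ν)))
        ≡⟨ ∑-neg (upTo (suc x)) _ ⟩
      - ∑ (upTo (suc x)) (λ v → ∑ (lowerings (xs ++ b ∷ a ∷ ys)) (λ (t , ν) → g (x ∸ v ℕ.+ t , v ∷ ν)))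
        ≡⟨ cong -_ (sym (∑-lowerings-∷ x (xs ++ b ∷ a ∷ ys) g)) ⟩
      - ∑ (lowerings (x ∷ xs ++ b ∷ a ∷ ys)) g ∎

-- Shifted complete symmetric functions and the Kostka numbers

module KostkaFormula where

  open Rationals
  open Sums
  open SkewTableaux
  open HorizontalStrips
  open Dimensions
  open HookSums
  open Differences
  open Lowering
  open Antisymmetry
  open Pieri

  ∏ℤ-* : ∀ {A : Set} (xs : List A) (f g : A → ℤ) → ∏ℤ xs (λ x → f x ℤ.* g x) ≡ ∏ℤ xs f ℤ.* ∏ℤ xs g
  ∏ℤ-* []       f g = refl
  ∏ℤ-* (x ∷ xs) f g = trans (cong (f x ℤ.* g x ℤ.*_) (∏ℤ-* xs f g)) (interchange (f x) (g x) _ _)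
    where open import Algebra.Properties.CommutativeSemigroup ℤ.*-commutativeSemigroup using (interchange)

  ∏ℤ-cong∈ : ∀ {A : Set} (xs : List A) {f g : A → ℤ} → (∀ {x} → x ∈ xs → f x ≡ g x) → ∏ℤ xs f ≡ ∏ℤ xs g
  ∏ℤ-cong∈ []       eq = refl
  ∏ℤ-cong∈ (x ∷ xs) eq = cong₂ ℤ._*_ (eq (here refl)) (∏ℤ-cong∈ xs (eq ∘ there))

  ∏ℤ-one : ∀ {A : Set} (xs : List A) {f : A → ℤ} → (∀ {x} → x ∈ xs → f x ≡ 1ℤ) → ∏ℤ xs f ≡ 1ℤ
  ∏ℤ-one []       eq = refl
  ∏ℤ-one (x ∷ xs) eq = trans (cong₂ ℤ._*_ (eq (here refl)) (∏ℤ-one xs (eq ∘ there))) refl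

  δ : ℕ → ℕ → ℕ
  δ k x with k ℕ.≟ x
  ... | yes _ = 1
  ... | no  _ = 0

  multiplicity-δ : ∀ k x xs → multiplicity k (x ∷ xs) ≡ δ k x ℕ.+ multiplicity k xs
  multiplicity-δ k x xs with k ℕ.≟ x
  ... | yes p = cong length (List.filter-accept (k ℕ.≟_) p)
  ... | no ¬p = cong length (List.filter-reject (k ℕ.≟_) ¬p)

  ∏ℤ-δ : ∀ {ks} {x} → Unique ks → x ∈ ks → (f : ℕ → ℤ) → ∏ℤ ks (λ k → f k ℤ.^ δ k x) ≡ f x
  ∏ℤ-δ {k ∷ ks} {x} (k∉ ∷ u) x∈ f with k ℕ.≟ x
  ∏ℤ-δ {k ∷ ks} {x} (k∉ ∷ u) x∈ f | yes refl = trans (cong (f k ℤ.^ 1 ℤ.*_) (∏ℤ-one ks off)) (trans (ℤ.*-identityʳ _) (ℤ.*-identityʳ (f k)))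
    where
    off : ∀ {j} → j ∈ ks → f j ℤ.^ δ j k ≡ 1ℤ
    off {j} j∈ with j ℕ.≟ k
    ... | yes e = contradiction (sym e) (All.lookup k∉ j∈)
    ... | no  _ = refl
  ∏ℤ-δ {k ∷ ks} {x} (k∉ ∷ u) (here e)   f | no k≢x = contradiction (sym e) k≢x
  ∏ℤ-δ {k ∷ ks} {x} (k∉ ∷ u) (there x∈) f | no k≢x = trans (ℤ.*-identityˡ _) (∏ℤ-δ u x∈ f)

  ∏ℤ-multiplicities : ∀ {ks} → Unique ks → ∀ xs → All (_∈ ks) xs → (f : ℕ → ℤ) →
    ∏ℤ ks (λ k → f k ℤ.^ multiplicity k xs) ≡ ∏ℤ xs f
  ∏ℤ-multiplicities {ks} u []       _        f = ∏ℤ-one ks (λ _ → refl)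
  ∏ℤ-multiplicities {ks} u (x ∷ xs) (p ∷ ps) f = begin
    ∏ℤ ks (λ k → f k ℤ.^ multiplicity k (x ∷ xs))
      ≡⟨ ∏ℤ-cong∈ ks (λ {k} _ → trans (cong (f k ℤ.^_) (multiplicity-δ k x xs)) (ℤ.^-distribˡ-+-* (f k) (δ k x) _)) ⟩
    ∏ℤ ks (λ k → f k ℤ.^ δ k x ℤ.* f k ℤ.^ multiplicity k xs)
      ≡⟨ ∏ℤ-* ks (λ k → f k ℤ.^ δ k x) (λ k → f k ℤ.^ multiplicity k xs) ⟩
    ∏ℤ ks (λ k → f k ℤ.^ δ k x) ℤ.* ∏ℤ ks (λ k → f k ℤ.^ multiplicity k xs)
      ≡⟨ cong₂ ℤ._*_ (∏ℤ-δ u p f) (∏ℤ-multiplicities u xs ps f) ⟩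
    ∏ℤ (x ∷ xs) f ∎

  -- Exponents are traded for repeated factors, so that later products run over the parts of μ and
  -- admit induction on the list.
  ∏-multiplicities-parts : ∀ {n} (μ : Partition n) f → ∏-multiplicities μ f ≡ ∏ℤ (parts μ) f
  ∏-multiplicities-parts μ f = ∏ℤ-multiplicities (range-unique _) (parts μ) (bounded (parts μ) (positive μ)) f
    where
    bounded : ∀ xs → All ℕ.NonZero xs → All (_∈ range (foldr _⊔_ 0 xs)) xs
    bounded xs nz = go xs nz ℕ.≤-refl
      where
      go : ∀ ys → All ℕ.NonZero ys → ∀ {m} → foldr _⊔_ 0 ys ≤ m → All (_∈ range m) ys
      go []       []       h = []
      go (y ∷ ys) (q ∷ qs) h = ∈-range (ℕ.>-nonZero⁻¹ y {{q}}) (s≤s (ℕ.≤-trans (ℕ.m≤m⊔n y _) h)) ∷ go ys qs (ℕ.≤-trans (ℕ.m≤n⊔m y _) h)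

  ι-∏ : ∀ {A : Set} (xs : List A) f → ι (∏ℤ xs f) ≡ ∏ xs (ι ∘ f)
  ι-∏ []       f = refl
  ι-∏ (x ∷ xs) f = trans (ι-* (f x) _) (cong (ι (f x) *_) (ι-∏ xs f))

  ι-∑ : ∀ {A : Set} (xs : List A) f → ι (∑ℤ xs f) ≡ ∑ xs (ι ∘ f)
  ι-∑ []       f = refl
  ι-∑ (x ∷ xs) f = trans (ι-+ (f x) _) (cong (ι (f x) +_) (ι-∑ xs f))

  fallingℚ : (ℕ → ℚ) → ℕ → List ℕ → ℚ
  fallingℚ p s []       = 1#
  fallingℚ p s (i ∷ is) = (p i - fromℕ s) * fallingℚ p (suc s) is

  -- For s = 0 this is the shifted complete symmetric function of degree k in the first M variables.
  -- The offset `s` is a parameter because splitting off the largest index leaves factors that start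
  -- with the offset s + 1.
  completeFalling : (ℕ → ℚ) → ℕ → ℕ → ℕ → ℚ
  completeFalling p k s M = ∑≥ k M (fallingℚ p s)

  completeFalling-suc : ∀ p k s M → completeFalling p (suc k) s (suc M) ≡
    completeFalling p (suc k) s M + (p (suc M) - fromℕ s) * completeFalling p k (suc s) (suc M)
  completeFalling-suc p k s M = cong (completeFalling p (suc k) s M +_) (∑≥-*ˡ k (suc M) _ _)

  -- p and q come from sequences l which differ by exchanging the entries m and m + 1.
  module Exchange (p q : ℕ → ℚ) (m : ℕ)
    (below : ∀ i → i ≤ m → p i ≡ q i)
    (first : q (suc m) ≡ p (suc (suc m)) - 1#) (second : q (suc (suc m)) ≡ p (suc m) + 1#)
    (above : ∀ i → suc (suc m) < i → p i ≡ q i) where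

    below-cong : ∀ k s M → M ≤ m → completeFalling p k s M ≡ completeFalling q k s M
    below-cong zero    s M       M≤m = refl
    below-cong (suc k) s zero    M≤m = refl
    below-cong (suc k) s (suc M) M≤m = begin
      completeFalling p (suc k) s (suc M)
        ≡⟨ completeFalling-suc p k s M ⟩
      completeFalling p (suc k) s M + (p (suc M) - fromℕ s) * completeFalling p k (suc s) (suc M)
        ≡⟨ cong₂ _+_ (below-cong (suc k) s M (ℕ.<⇒≤ M≤m)) (cong₂ (λ a b → (a - fromℕ s) * b) (below (suc M) M≤m) (below-cong k (suc s) (suc M) M≤m)) ⟩
      completeFalling q (suc k) s M + (q (suc M) - fromℕ s) * completeFalling q k (suc s) (suc M)
        ≡⟨ completeFalling-suc q k s M ⟨
      completeFalling q (suc k) s (suc M) ∎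

    private
      x = p (suc m)
      y = p (suc (suc m))

      B B′ C C′ A : ℕ → ℕ → ℚ
      A k s  = completeFalling p k s m
      B k s  = completeFalling p k s (suc m)
      B′ k s = completeFalling q k s (suc m)
      C k s  = completeFalling p k s (suc (suc m))
      C′ k s = completeFalling q k s (suc (suc m))

      B-suc : ∀ k s → B (suc k) s ≡ A (suc k) s + (x - fromℕ s) * B k (suc s)
      B-suc k s = completeFalling-suc p k s m

      B′-suc : ∀ k s → B′ (suc k) s ≡ A (suc k) s + ((y - 1#) - fromℕ s) * B′ k (suc s)
      B′-suc k s = trans (completeFalling-suc q k s m)
        (cong₂ (λ a b → a + (b - fromℕ s) * B′ k (suc s)) (sym (below-cong (suc k) s m ℕ.≤-refl)) first)

      C′-suc : ∀ k s → C′ (suc k) s ≡ B′ (suc k) s + ((x + 1#) - fromℕ s) * C′ k (suc s)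
      C′-suc k s = trans (completeFalling-suc q k s (suc m)) (cong (λ b → B′ (suc k) s + (b - fromℕ s) * C′ k (suc s)) second)

      -- The two claims need each other. Sums over the first m + 1 indices see only one of the
      -- exchanged entries and do differ, but by a multiple of the full sum with the next offset;
      -- the terms with index m + 2 compensate exactly this.
      exchange : ∀ k s → C k s ≡ C′ k s × B (suc k) s - B′ (suc k) s ≡ ((x + 1#) - y) * C k (suc s)
      exchange zero s = refl , trans (cong₂ _-_ (B-suc zero s) (B′-suc zero s))
        (solve 4 (λ a x y s → (a :+ (x :- s) :* con one) :- (a :+ ((y :- con one) :- s) :* con one) := ((x :+ con one) :- y) :* con one) refl (A 1 s) x y (fromℕ s))
      exchange (suc k) s = equal s , difference
        where
        ih₁ : ∀ s → C k s ≡ C′ k s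
        ih₁ s = proj₁ (exchange k s)
        equal : ∀ s → C (suc k) s ≡ C′ (suc k) s
        equal s = begin
          C (suc k) s
            ≡⟨ completeFalling-suc p k s (suc m) ⟩
          B (suc k) s + (y - fromℕ s) * C k (suc s)
            ≡⟨ solve 5 (λ b b′ y s c → b :+ (y :- s) :* c := b′ :+ ((b :- b′) :+ (y :- s) :* c)) refl (B (suc k) s) (B′ (suc k) s) y (fromℕ s) (C k (suc s)) ⟩
          B′ (suc k) s + ((B (suc k) s - B′ (suc k) s) + (y - fromℕ s) * C k (suc s))
            ≡⟨ cong (λ z → B′ (suc k) s + (z + (y - fromℕ s) * C k (suc s))) (proj₂ (exchange k s)) ⟩
          B′ (suc k) s + (((x + 1#) - y) * C k (suc s) + (y - fromℕ s) * C k (suc s))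
            ≡⟨ solve 5 (λ b x y s c → b :+ (((x :+ con one) :- y) :* c :+ (y :- s) :* c) := b :+ ((x :+ con one) :- s) :* c) refl (B′ (suc k) s) x y (fromℕ s) (C k (suc s)) ⟩
          B′ (suc k) s + ((x + 1#) - fromℕ s) * C k (suc s)
            ≡⟨ cong (λ c → B′ (suc k) s + ((x + 1#) - fromℕ s) * c) (ih₁ (suc s)) ⟩
          B′ (suc k) s + ((x + 1#) - fromℕ s) * C′ k (suc s)
            ≡⟨ C′-suc k s ⟨
          C′ (suc k) s ∎
        equal′ : C (suc k) (suc s) ≡ B′ (suc k) (suc s) + ((x + 1#) - fromℕ (suc s)) * C k (suc (suc s))
        equal′ = trans (equal (suc s)) (trans (C′-suc k (suc s)) (cong (λ c → B′ (suc k) (suc s) + ((x + 1#) - fromℕ (suc s)) * c) (sym (ih₁ (suc (suc s))))))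
        difference : B (suc (suc k)) s - B′ (suc (suc k)) s ≡ ((x + 1#) - y) * C (suc k) (suc s)
        difference = begin
          B (suc (suc k)) s - B′ (suc (suc k)) s
            ≡⟨ cong₂ _-_ (B-suc (suc k) s) (B′-suc (suc k) s) ⟩
          (A (suc (suc k)) s + (x - fromℕ s) * B (suc k) (suc s)) - (A (suc (suc k)) s + ((y - 1#) - fromℕ s) * B′ (suc k) (suc s))
            ≡⟨ solve 6 (λ a x y s b b′ → (a :+ (x :- s) :* b) :- (a :+ ((y :- con one) :- s) :* b′) :=
                 (x :- s) :* (b :- b′) :+ ((x :+ con one) :- y) :* b′) refl (A (suc (suc k)) s) x y (fromℕ s) (B (suc k) (suc s)) (B′ (suc k) (suc s)) ⟩
          (x - fromℕ s) * (B (suc k) (suc s) - B′ (suc k) (suc s)) + ((x + 1#) - y) * B′ (suc k) (suc s)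
            ≡⟨ cong (λ z → (x - fromℕ s) * z + ((x + 1#) - y) * B′ (suc k) (suc s)) (proj₂ (exchange k (suc s))) ⟩
          (x - fromℕ s) * (((x + 1#) - y) * C k (suc (suc s))) + ((x + 1#) - y) * B′ (suc k) (suc s)
            ≡⟨ solve 5 (λ x y s c b → (x :- s) :* (((x :+ con one) :- y) :* c) :+ ((x :+ con one) :- y) :* b :=
                 ((x :+ con one) :- y) :* (b :+ ((x :+ con one) :- (con one :+ s)) :* c)) refl x y (fromℕ s) (C k (suc (suc s))) (B′ (suc k) (suc s)) ⟩
          ((x + 1#) - y) * (B′ (suc k) (suc s) + ((x + 1#) - (1# + fromℕ s)) * C k (suc (suc s)))
            ≡⟨ cong (λ z → ((x + 1#) - y) * (B′ (suc k) (suc s) + ((x + 1#) - z) * C k (suc (suc s)))) (sym (fromℕ-suc s)) ⟩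
          ((x + 1#) - y) * (B′ (suc k) (suc s) + ((x + 1#) - fromℕ (suc s)) * C k (suc (suc s)))
            ≡⟨ cong (((x + 1#) - y) *_) (sym equal′) ⟩
          ((x + 1#) - y) * C (suc k) (suc s) ∎

    above-cong : ∀ k s M → suc (suc m) ≤ M → completeFalling p k s M ≡ completeFalling q k s M
    above-cong k s M m<M with ℕ.≤⇒≤′ m<M
    ... | ℕ.≤′-reflexive refl = proj₁ (exchange k s)
    above-cong zero    s (suc M) m<M | ℕ.≤′-step r = refl
    above-cong (suc k) s (suc M) m<M | ℕ.≤′-step r = begin
      completeFalling p (suc k) s (suc M)
        ≡⟨ completeFalling-suc p k s M ⟩
      completeFalling p (suc k) s M + (p (suc M) - fromℕ s) * completeFalling p k (suc s) (suc M)
        ≡⟨ cong₂ _+_ (above-cong (suc k) s M (ℕ.≤′⇒≤ r)) (cong₂ (λ a b → (a - fromℕ s) * b) (above (suc M) (s≤s (ℕ.≤′⇒≤ r))) (above-cong k (suc s) (suc M) m<M)) ⟩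
      completeFalling q (suc k) s M + (q (suc M) - fromℕ s) * completeFalling q k (suc s) (suc M)
        ≡⟨ completeFalling-suc q k s M ⟨
      completeFalling q (suc k) s (suc M) ∎

  -- ρᵢ as a function of l = shift ρ.
  unshift : ℕ → List ℕ → ℕ → ℚ
  unshift N l i = fromℕ (part l i) - ι (ℤ.+ N ℤ.- ℤ.+ i)

  completeShifted : ℕ → ℕ → Fun
  completeShifted N k l = completeFalling (unshift N l) k 0 N

  part-first : ∀ xs a zs → part (xs ++ a ∷ zs) (suc (length xs)) ≡ a
  part-first []       a zs = refl
  part-first (x ∷ xs) a zs = part-first xs a zs

  part-second : ∀ xs a b ys → part (xs ++ a ∷ b ∷ ys) (suc (suc (length xs))) ≡ b
  part-second []       a b ys = refl
  part-second (x ∷ xs) a b ys = part-second xs a b ys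

  part-prefix : ∀ xs us vs i → i ≤ length xs → part (xs ++ us) i ≡ part (xs ++ vs) i
  part-prefix []       us vs zero          p       = trans (part-0 us) (sym (part-0 vs))
    where
    part-0 : ∀ us → part us 0 ≡ 0
    part-0 []       = refl
    part-0 (_ ∷ _)  = refl
  part-prefix (x ∷ xs) us vs zero          p       = refl
  part-prefix (x ∷ xs) us vs (suc zero)    p       = refl
  part-prefix (x ∷ xs) us vs (suc (suc i)) (s≤s p) = part-prefix xs us vs (suc i) p

  part-suffix : ∀ xs a b c d ys i → suc (suc (length xs)) < i → part (xs ++ a ∷ b ∷ ys) i ≡ part (xs ++ c ∷ d ∷ ys) i
  part-suffix []       a b c d ys (suc (suc (suc i))) p       = refl
  part-suffix []       a b c d ys (suc (suc zero))    (s≤s (s≤s ()))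
  part-suffix []       a b c d ys (suc zero)          (s≤s ())
  part-suffix (x ∷ xs) a b c d ys (suc (suc i))       (s≤s p) = part-suffix xs a b c d ys (suc i) p

  -- As ρᵢ = lᵢ - N + i, exchanging neighbours in l replaces the pair (x, y) of parts by (y - 1, x +
  -- 1), which is the situation of `Exchange`.
  completeShifted-symmetric : ∀ N k xs a b ys → length (xs ++ a ∷ b ∷ ys) ≡ N →
    completeShifted N k (xs ++ a ∷ b ∷ ys) ≡ completeShifted N k (xs ++ b ∷ a ∷ ys)
  completeShifted-symmetric N k xs a b ys eq = Exchange.above-cong p q m
    (λ i i≤m → cong (λ x → fromℕ x - ι (ℤ.+ N ℤ.- ℤ.+ i)) (part-prefix xs (a ∷ b ∷ ys) (b ∷ a ∷ ys) i i≤m))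
    (trans (cong (λ x → fromℕ x - c) (part-first xs b (a ∷ ys)))
      (trans (step (fromℕ b)) (cong (λ x → (fromℕ x - ι (ℤ.+ N ℤ.- ℤ.+ suc (suc m))) - 1#) (sym (part-second xs a b ys)))))
    (trans (cong (λ x → fromℕ x - ι (ℤ.+ N ℤ.- ℤ.+ suc (suc m))) (part-second xs b a ys))
      (trans (step′ (fromℕ a)) (cong (λ x → (fromℕ x - c) + 1#) (sym (part-first xs a (b ∷ ys))))))
    (λ i m<i → cong (λ x → fromℕ x - ι (ℤ.+ N ℤ.- ℤ.+ i)) (part-suffix xs a b b a ys i m<i))
    k 0 N m≤N
    where
    m = length xs
    p = unshift N (xs ++ a ∷ b ∷ ys)
    q = unshift N (xs ++ b ∷ a ∷ ys)
    c = ι (ℤ.+ N ℤ.- ℤ.+ suc m)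
    m≤N : suc (suc m) ≤ N
    m≤N = subst (suc (suc m) ≤_) (trans (sym (List.length-++ xs)) eq)
      (ℕ.≤-trans (ℕ.≤-reflexive (ℕ.+-comm 2 m)) (ℕ.+-monoʳ-≤ m (s≤s (s≤s z≤n))))
    next : c ≡ ι (ℤ.+ N ℤ.- ℤ.+ suc (suc m)) + 1#
    next = trans (trans (ι-- (ℤ.+ N) (ℤ.+ suc m)) (trans
      (solve 2 (λ n m → n :- m := (n :- (con one :+ m)) :+ con one) refl (fromℕ N) (fromℕ (suc m)))
      (cong (λ z → (fromℕ N - z) + 1#) (sym (fromℕ-suc (suc m))))))
      (cong (_+ 1#) (sym (ι-- (ℤ.+ N) (ℤ.+ suc (suc m)))))
    step : ∀ z → z - c ≡ (z - ι (ℤ.+ N ℤ.- ℤ.+ suc (suc m))) - 1#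
    step z = trans (cong (λ w → z - w) next) (solve 2 (λ z d → z :- (d :+ con one) := (z :- d) :- con one) refl _ _)
    step′ : ∀ z → z - ι (ℤ.+ N ℤ.- ℤ.+ suc (suc m)) ≡ (z - c) + 1#
    step′ z = sym (trans (cong (λ w → (z - w) + 1#) next) (solve 2 (λ z d → (z :- (d :+ con one)) :+ con one := z :- d) refl _ _))

  commutators-cong : ∀ n {A A′ : Fun → Fun} → (∀ c l → A c l ≡ A′ c l) → ∀ c l → commutators n A c l ≡ commutators n A′ c l
  commutators-cong zero    e c l = e c l
  commutators-cong (suc n) e c l = cong₂ _-_ (commutators-cong n e (V c) l) (V-cong (commutators-cong n e c) l)

  leading-cong : ∀ {n A A′ B B′} → (∀ c l → A c l ≡ A′ c l) → (∀ c l → B c l ≡ B′ c l) → Leading n A B → Leading n A′ B′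
  leading-cong {n} e f L = record
    { top    = λ c l → trans (sym (commutators-cong n e c l)) (trans (top L c l) (cong (fromℕ (n !) *_) (f c l)))
    ; higher = λ c l → trans (sym (commutators-cong (suc n) e c l)) (higher L c l) }

  -- Every factor is a coordinate lᵢ minus a constant, and constants do not affect leading parts;
  -- the offsets in ϰ_μ thus leave no trace.
  leading-falling : ∀ {n A B} N s is → Leading n A B →
    Leading (length is ℕ.+ n) (λ c l → fallingℚ (unshift N l) s is * A c l) (λ c l → Xs is (B c) l)
  leading-falling N s []       L = leading-cong (λ c l → sym (*-identityˡ _)) (λ c l → refl) L
  leading-falling N s (i ∷ is) L = leading-cong
    (λ c l → trans (sym (*-assoc _ _ _)) (cong (λ z → (z * _) * _) (solve 3 (λ a b c → a :- (b :+ c) := (a :- b) :- c) refl _ _ _)))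
    (λ c l → refl)
    (leading-factor i (ι (ℤ.+ N ℤ.- ℤ.+ i) + fromℕ s) (leading-falling N (suc s) is L))

  length-decreasings : ∀ k N {is} → is ∈ decreasings k N → length is ≡ k
  length-decreasings k N is∈ = proj₁ (∈-choices-replicate⁻ k (proj₁ (∈-filter⁻ decreasing? {xs = choices (replicate k (range N))} is∈)))

  leading-complete : ∀ {n A B} N k → Leading n A B →
    Leading (k ℕ.+ n) (λ c l → completeShifted N k l * A c l) (λ c l → completeX k N (B c) l)
  leading-complete {n} {A} {B} N k L = leading-cong
    (λ c l → trans (∑-*ʳ (A c l) (decreasings k N) _) (cong (_* A c l) (∑-decreasings k N _)))
    (λ c l → ∑-decreasings k N _)
    (leading-∑ (decreasings k N) {λ is c l → fallingℚ (unshift N l) 0 is * A c l} {λ is c l → Xs is (B c) l} λ {is} is∈ →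
      subst (λ j → Leading (j ℕ.+ n) (λ c l → fallingℚ (unshift N l) 0 is * A c l) (λ c l → Xs is (B c) l))
        (length-decreasings k N is∈) (leading-falling N 0 is L))

  completeXs : ℕ → List ℕ → Fun → Fun
  completeXs N []      c = c
  completeXs N (k ∷ μ) c = completeX k N (completeXs N μ c)

  leading-completes : ∀ N μ → Leading (sum μ) (λ c l → ∏ μ (λ k → completeShifted N k l) * c l) (completeXs N μ)
  leading-completes N []      = leading-cong (λ c l → sym (*-identityˡ _)) (λ c l → refl) leading-id
  leading-completes N (k ∷ μ) = leading-cong (λ c l → sym (*-assoc _ _ _)) (λ c l → refl) (leading-complete N k (leading-completes N μ))

  completeXs-antisymmetric : ∀ μ {N} c → Antisymmetric N c → Antisymmetric N (completeXs N μ c)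
  completeXs-antisymmetric []      c anti = anti
  completeXs-antisymmetric (k ∷ μ) {N} c anti = completeX-antisymmetric k (completeXs N μ c) (completeXs-antisymmetric μ c anti)

  ∏-swap-args : ∀ μ N xs a b ys → length (xs ++ a ∷ b ∷ ys) ≡ N →
    ∏ μ (λ k → completeShifted N k (xs ++ a ∷ b ∷ ys)) ≡ ∏ μ (λ k → completeShifted N k (xs ++ b ∷ a ∷ ys))
  ∏-swap-args μ N xs a b ys eq = ∏-cong∈ μ (λ {k} _ → completeShifted-symmetric N k xs a b ys eq)

  -- Both sides satisfy the same recursion, `SS-strips` on tableaux and `pieri` on antisymmetric
  -- functions. The weight is reversed because the largest letter belongs to its last entry.
  SS-complete : ∀ μ α → Decreasing α →
    SS (length μ) (skew 1 α (zeros (length α))) (reverse μ) ≡ completeXs (length α) μ vacuum (shift α)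
  SS-complete [] α d = trans base (sym (vacuum-shift α d))
    where
    base : SS 0 (skew 1 α (zeros (length α))) [] ≡ 𝟙 (sum α ℕ.≟ 0)
    base with skew 1 α (zeros (length α)) | length-skew-zeros α
    ... | []    | e = trans (+-identityʳ _) (trans (*-identityˡ _) (sym (𝟙-yes (sum α ℕ.≟ 0) (sym e))))
    ... | _ ∷ _ | e = sym (𝟙-no (sum α ℕ.≟ 0) (λ e′ → contradiction (trans e e′) λ ()))
  SS-complete (k ∷ μ) α d = begin
    SS (suc (length μ)) (skew 1 α (zeros (length α))) (reverse (k ∷ μ))
      ≡⟨ cong (SS (suc (length μ)) (skew 1 α (zeros (length α)))) (List.unfold-reverse k μ) ⟩
    SS (suc (length μ)) (skew 1 α (zeros (length α))) (reverse μ ∷ʳ k)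
      ≡⟨ SS-strips (length μ) 1 α (zeros (length α)) (reverse μ) k d (zeros-decreasing (length α)) (zeros-⊑ α) ⟩
    ∑ (strips α (zeros (length α))) (λ (t , ν) → 𝟙 (t ℕ.≟ k) * SS (length μ) (skew 1 ν (zeros (length α))) (reverse μ))
      ≡⟨ ∑-cong∈ (strips α (zeros (length α))) (λ {(t , ν)} ∈s → cong (𝟙 (t ℕ.≟ k) *_) (per-strip (strips-all d (zeros-⊑ α) ∈s))) ⟩
    ∑ (strips α (zeros (length α))) (λ (t , ν) → 𝟙 (t ℕ.≟ k) * completeXs (length α) μ vacuum (shift ν))
      ≡⟨ pieri k α (completeXs (length α) μ vacuum) d (completeXs-antisymmetric μ vacuum (vacuum-antisymmetric (length α))) ⟨
    completeX k (length α) (completeXs (length α) μ vacuum) (shift α) ∎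
    where
    per-strip : ∀ {t ν} → StripOf α (zeros (length α)) (t , ν) →
      SS (length μ) (skew 1 ν (zeros (length α))) (reverse μ) ≡ completeXs (length α) μ vacuum (shift ν)
    per-strip {t} {ν} (dν , _ , ν⊑α , _) = trans (cong (λ N → SS (length μ) (skew 1 ν (zeros N)) (reverse μ)) (sym lν))
      (trans (SS-complete μ ν dν) (cong (λ N → completeXs N μ vacuum (shift ν)) lν))
      where lν = Pointwise.Pointwise-length ν⊑α

  unshift-shift : ∀ ρ i → 0 < i → i ≤ length ρ → unshift (length ρ) (shift ρ) i ≡ fromℕ (part ρ i)
  unshift-shift (x ∷ xs) (suc zero) p q = begin
    fromℕ (x ℕ.+ length xs) - ι (ℤ.+ suc (length xs) ℤ.- ℤ.+ 1)
      ≡⟨ cong₂ _-_ (fromℕ-+ x (length xs)) (trans (ι-- (ℤ.+ suc (length xs)) (ℤ.+ 1)) (cong (_- 1#) (fromℕ-suc (length xs)))) ⟩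
    (fromℕ x + fromℕ (length xs)) - ((1# + fromℕ (length xs)) - 1#)
      ≡⟨ solve 2 (λ x n → (x :+ n) :- ((con one :+ n) :- con one) := x) refl (fromℕ x) (fromℕ (length xs)) ⟩
    fromℕ x ∎
  unshift-shift (x ∷ xs) (suc (suc i)) p (s≤s q) = trans
    (cong (fromℕ (part (shift xs) (suc i)) -′_) (trans (ι-- (ℤ.+ suc (length xs)) (ℤ.+ suc (suc i))) (trans
      (cong₂ _-_ (fromℕ-suc (length xs)) (fromℕ-suc (suc i)))
      (trans (solve 2 (λ a b → (con one :+ a) :- (con one :+ b) := a :- b) refl (fromℕ (length xs)) (fromℕ (suc i))) (sym (ι-- (ℤ.+ length xs) (ℤ.+ suc i)))))))
    (unshift-shift xs (suc i) (s≤s z≤n) q)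
    where
    _-′_ : ℚ → ℚ → ℚ
    a -′ b = a - b

  fallingℚ-cong : ∀ {p q : ℕ → ℚ} {is} → All (λ i → p i ≡ q i) is → ∀ s → fallingℚ p s is ≡ fallingℚ q s is
  fallingℚ-cong []       s = refl
  fallingℚ-cong (e ∷ es) s = cong₂ (λ a b → (a - fromℕ s) * b) e (fallingℚ-cong es (suc s))

  ι-falling : ∀ ρ s is → ι (falling ρ s is) ≡ fallingℚ (λ i → fromℕ (part ρ i)) s is
  ι-falling ρ s []       = refl
  ι-falling ρ s (i ∷ is) = trans (ι-* (ℤ.+ part ρ i ℤ.- ℤ.+ s) _) (cong₂ _*_ (ι-- (ℤ.+ part ρ i) (ℤ.+ s)) (ι-falling ρ (suc s) is))

  ι-complete : ∀ k ρ → ι (∑ℤ (decreasings k (length ρ)) (falling ρ 0)) ≡ completeShifted (length ρ) k (shift ρ)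
  ι-complete k ρ = begin
    ι (∑ℤ (decreasings k (length ρ)) (falling ρ 0))
      ≡⟨ ι-∑ (decreasings k (length ρ)) (falling ρ 0) ⟩
    ∑ (decreasings k (length ρ)) (λ is → ι (falling ρ 0 is))
      ≡⟨ ∑-cong∈ (decreasings k (length ρ)) (λ {is} is∈ → trans (ι-falling ρ 0 is) (fallingℚ-cong (All.map sym (entries is∈)) 0)) ⟩
    ∑ (decreasings k (length ρ)) (fallingℚ (unshift (length ρ) (shift ρ)) 0)
      ≡⟨ ∑-decreasings k (length ρ) _ ⟩
    completeShifted (length ρ) k (shift ρ) ∎
    where
    entries : ∀ {is} → is ∈ decreasings k (length ρ) → All (λ i → unshift (length ρ) (shift ρ) i ≡ fromℕ (part ρ i)) is
    entries is∈ = All.map in-range (proj₂ (∈-choices-replicate⁻ k (proj₁ (∈-filter⁻ decreasing? {xs = choices (replicate k (range (length ρ)))} is∈))))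
      where
      in-range : ∀ {i} → i ∈ range (length ρ) → unshift (length ρ) (shift ρ) i ≡ fromℕ (part ρ i)
      in-range i∈ with ∈-applyUpTo⁻ suc i∈
      ... | j , j< , refl = unshift-shift ρ (suc j) (s≤s z≤n) j<

  ∏-↭ : ∀ {A : Set} {xs ys : List A} → xs ↭ ys → ∀ f → ∏ xs f ≡ ∏ ys f
  ∏-↭ ↭.refl         f = refl
  ∏-↭ (↭.prep x p)   f = cong (f x *_) (∏-↭ p f)
  ∏-↭ (↭.swap x y p) f = trans (cong (λ s → f x * (f y * s)) (∏-↭ p f))
    (solve 3 (λ a b c → a :* (b :* c) := b :* (a :* c)) refl _ _ _)
  ∏-↭ (↭.trans p q)  f = trans (∏-↭ p f) (∏-↭ q f)

  ι-ϰ : ∀ {n} (μ : Partition n) ρ → ι (ϰ μ ρ) ≡ ∏ (reverse (parts μ)) (λ k → completeShifted (length ρ) k (shift ρ))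
  ι-ϰ μ ρ = begin
    ι (ϰ μ ρ)
      ≡⟨ cong ι (∏-multiplicities-parts μ (λ k → ∑ℤ (decreasings k (length ρ)) (falling ρ 0))) ⟩
    ι (∏ℤ (parts μ) (λ k → ∑ℤ (decreasings k (length ρ)) (falling ρ 0)))
      ≡⟨ ι-∏ (parts μ) _ ⟩
    ∏ (parts μ) (λ k → ι (∑ℤ (decreasings k (length ρ)) (falling ρ 0)))
      ≡⟨ ∏-cong∈ (parts μ) (λ {k} _ → ι-complete k ρ) ⟩
    ∏ (parts μ) (λ k → completeShifted (length ρ) k (shift ρ))
      ≡⟨ ∏-↭ (↭.↭-sym (↭-reverse (parts μ))) _ ⟩
    ∏ (reverse (parts μ)) (λ k → completeShifted (length ρ) k (shift ρ)) ∎

  down-*ˡ : ∀ k s G α → down k (λ ρ → s * G ρ) α ≡ s * down k G α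
  down-*ˡ zero    s G α = refl
  down-*ˡ (suc k) s G α = trans (∑-cong (removals α) (λ (_ , ν) → down-*ˡ k s G ν)) (∑-*ˡ s (removals α) _)

  kostkaFormula : ∀ {n : ℕ} (α μ : Partition n) →
    fromℤ (ℤ.+ kostka α μ) ≡
      ∑ℚ (subpartitions (parts α)) (λ ρ → (-1ℤ ℤ.^ length (parts α ⧸ ρ) ℤ.* ϰ μ ρ) /H[ diagram ρ , parts α ⧸ ρ ])
  kostkaFormula {n} α μ = sym (begin
    ∑ℚ (subpartitions a) (λ ρ → (-1ℤ ℤ.^ length (a ⧸ ρ) ℤ.* ϰ μ ρ) /H[ diagram ρ , a ⧸ ρ ])
      ≡⟨ hookSum n a dα (size α) (λ ρ → -1ℤ ℤ.^ length (a ⧸ ρ) ℤ.* ϰ μ ρ) ⟩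
    ∑ (upTo (suc n)) (λ k → (ifac k * ifac (n ∸ k)) * down k (λ ρ → ι (-1ℤ ℤ.^ length (a ⧸ ρ) ℤ.* ϰ μ ρ) * down (n ∸ k) (λ _ → 1#) ρ) a)
      ≡⟨ ∑-antidiagonal n (λ k m → (ifac k * ifac m) * down k (λ ρ → ι (-1ℤ ℤ.^ length (a ⧸ ρ) ℤ.* ϰ μ ρ) * down m (λ _ → 1#) ρ) a) ⟩
    antidiagonal n (λ k m → (ifac k * ifac m) * down k (λ ρ → ι (-1ℤ ℤ.^ length (a ⧸ ρ) ℤ.* ϰ μ ρ) * down m (λ _ → 1#) ρ) a)
      -- For |λ/ρ| = k the sign is the constant (-1)^k, which turns the sum into `alternating`.
      ≡⟨ antidiagonal-cong n (λ k m e → trans (cong ((ifac k * ifac m) *_) (graded k m e))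
           (solve 3 (λ f s v → f :* (s :* v) := (s :* f) :* v) refl (ifac k * ifac m) (sign k) _)) ⟩
    alternating n (λ k m → iterV k (A (iterV m vacuum)) (shift a))
      ≡⟨ alternating-Δ n _ ⟩
    ifac n * Δ n (λ k m → iterV k (A (iterV m vacuum)) (shift a))
      ≡⟨ cong (ifac n *_) (Δ-commutators n A vacuum (shift a)) ⟩
    ifac n * commutators n A vacuum (shift a)
      -- The degree of ϰ_μ is |μ| = n, so the n-fold commutator yields exactly its leading part.
      ≡⟨ cong (ifac n *_) (top (subst (λ j → Leading j A (completeXs N rμ)) sum-rμ (leading-completes N rμ)) vacuum (shift a)) ⟩
    ifac n * (fromℕ (n !) * completeXs N rμ vacuum (shift a))
      ≡⟨ solve 3 (λ a b c → a :* (b :* c) := (b :* a) :* c) refl _ _ _ ⟩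
    (fromℕ (n !) * ifac n) * completeXs N rμ vacuum (shift a)
      ≡⟨ trans (cong (_* completeXs N rμ vacuum (shift a)) (!*ifac n)) (*-identityˡ _) ⟩
    completeXs N rμ vacuum (shift a)
      ≡⟨ SS-complete rμ a dα ⟨
    SS (length rμ) (skew 1 a (zeros N)) (reverse rμ)
      ≡⟨ cong₂ (λ l w → SS l (skew 1 a (zeros N)) w) (List.length-reverse (parts μ)) (List.reverse-involutive (parts μ)) ⟩
    SS (length (parts μ)) (skew 1 a (zeros N)) (parts μ)
      ≡⟨ cong (λ θ → SS (length (parts μ)) θ (parts μ)) (sym (trans (⧸-skew a []) (skew-[] 1 a))) ⟩
    SS (length (parts μ)) (diagram a) (parts μ)
      ≡⟨ kostka-SS α μ ⟨
    fromℕ (kostka α μ)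
      ≡⟨ ι-def _ ⟩
    fromℤ (ℤ.+ kostka α μ) ∎)
    where
    a = parts α
    N = length a
    rμ = reverse (parts μ)
    dα : Decreasing a
    dα = Linked⇒Decreasing (decreasing α)
    sum-rμ : sum rμ ≡ n
    sum-rμ = trans (sum-↭ (↭-reverse (parts μ))) (size μ)
    Φ : Fun
    Φ l = ∏ rμ (λ k → completeShifted N k l)
    A : Fun → Fun
    A c l = Φ l * c l
    -- Removals that follow the factor ϰ_μ can be replaced by V only if the product is still
    -- antisymmetric; here the symmetry of ϰ_μ in the shifted coordinates enters.
    anti : ∀ m → Antisymmetric N (A (iterV m vacuum))
    anti m xs x y ys e = trans (cong₂ _*_ (∏-swap-args rμ N xs x y ys e) (iterV-antisymmetric m vacuum (vacuum-antisymmetric N) xs x y ys e))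
      (solve 2 (λ p s → p :* :- s := :- (p :* s)) refl _ _)
    graded : ∀ k m → k ℕ.+ m ≡ n →
      down k (λ ρ → ι (-1ℤ ℤ.^ length (a ⧸ ρ) ℤ.* ϰ μ ρ) * down m (λ _ → 1#) ρ) a ≡ sign k * iterV k (A (iterV m vacuum)) (shift a)
    graded k m e = begin
      down k (λ ρ → ι (-1ℤ ℤ.^ length (a ⧸ ρ) ℤ.* ϰ μ ρ) * down m (λ _ → 1#) ρ) a
        ≡⟨ down-cong k a dα (λ ρ ρ⊑a dρ k+ρ → per-ρ ρ ρ⊑a dρ k+ρ) ⟩
      down k (λ ρ → sign k * A (iterV m vacuum) (shift ρ)) a
        ≡⟨ down-*ˡ k (sign k) _ a ⟩
      sign k * down k (A (iterV m vacuum) ∘ shift) a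
        ≡⟨ cong (sign k *_) (down-shift k (A (iterV m vacuum)) a (anti m) dα) ⟩
      sign k * iterV k (A (iterV m vacuum)) (shift a) ∎
      where
      per-ρ : ∀ ρ → ρ ⊑ a → Decreasing ρ → k ℕ.+ sum ρ ≡ sum a →
        ι (-1ℤ ℤ.^ length (a ⧸ ρ) ℤ.* ϰ μ ρ) * down m (λ _ → 1#) ρ ≡ sign k * A (iterV m vacuum) (shift ρ)
      per-ρ ρ ρ⊑a dρ k+ρ = begin
        ι (-1ℤ ℤ.^ length (a ⧸ ρ) ℤ.* ϰ μ ρ) * down m (λ _ → 1#) ρ
          ≡⟨ cong₂ _*_ (trans (ι-* (-1ℤ ℤ.^ length (a ⧸ ρ)) (ϰ μ ρ)) (cong₂ _*_ (cong sign len) (trans (ι-ϰ μ ρ)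
               (cong (λ N → ∏ rμ (λ k → completeShifted N k (shift ρ))) (Pointwise.Pointwise-length ρ⊑a)))))
               (trans (cong (λ m → down m (λ _ → 1#) ρ) m≡) (trans (down-1 ρ dρ) (cong (λ m → iterV m vacuum (shift ρ)) (sym m≡)))) ⟩
        (sign k * Φ (shift ρ)) * iterV m vacuum (shift ρ)
          ≡⟨ *-assoc _ _ _ ⟩
        sign k * A (iterV m vacuum) (shift ρ) ∎
        where
        m≡ : m ≡ sum ρ
        m≡ = ℕ.+-cancelˡ-≡ k _ _ (trans e (sym (trans k+ρ (size α))))
        len : length (a ⧸ ρ) ≡ k
        len = ℕ.+-cancelʳ-≡ (sum ρ) _ k (trans (trans (cong (λ θ → length θ ℕ.+ sum ρ) (⧸-skew a ρ)) (length-skew 1 ρ⊑a)) (sym k+ρ))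

-- Highest weight vectors, row words and Jucys-Murphy elements

module HighestWeight where

  open Rationals
  open Sums
  open SkewTableaux
  open Dimensions
  open HookSums
  open KostkaFormula using (δ)
  open import Data.Fin.Base using (zero; suc)

  Words : ℕ → Set
  Words n = Vec ℕ n → ℚ

  count : ∀ {n} → ℕ → Vec ℕ n → ℕ
  count c []      = 0
  count c (x ∷ w) = δ c x ℕ.+ count c w

  δ-yes : ∀ c → δ c c ≡ 1
  δ-yes c with c ℕ.≟ c
  ... | yes _ = refl
  ... | no ¬p = contradiction refl ¬p

  δ-no : ∀ {c x} → c ≢ x → δ c x ≡ 0
  δ-no {c} {x} c≢x with c ℕ.≟ x
  ... | yes p = contradiction p c≢x
  ... | no  _ = refl

  δ-𝟙 : ∀ c x → fromℕ (δ c x) ≡ 𝟙 (x ℕ.≟ c)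
  δ-𝟙 c x with c ℕ.≟ x
  ... | yes refl = sym (𝟙-yes (c ℕ.≟ c) refl)
  ... | no ¬p    = sym (𝟙-no (x ℕ.≟ c) (¬p ∘ sym))

  -- Moves one letter from j to i, in all ways.
  E : ∀ {n} → ℕ → ℕ → Words n → Words n
  E i j v w = ∑ᶠ (λ p → 𝟙 (lookup w p ℕ.≟ i) * v (w [ p ]≔ j))

  E-cong : ∀ {n} i j {u v : Words n} → u ≗ v → E i j u ≗ E i j v
  E-cong i j e w = ∑ᶠ-cong (λ p → cong (𝟙 (lookup w p ℕ.≟ i) *_) (e (w [ p ]≔ j)))

  E-linear : ∀ {n} i j s (u v : Words n) w → E i j (λ w → u w + s * v w) w ≡ E i j u w + s * E i j v w
  E-linear i j s u v w = trans (∑ᶠ-cong (λ p → solve 4 (λ a u s v → a :* (u :+ s :* v) := a :* u :+ s :* (a :* v)) refl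
      (𝟙 (lookup w p ℕ.≟ i)) (u (w [ p ]≔ j)) s (v (w [ p ]≔ j))))
    (trans (∑ᶠ-+ (λ p → 𝟙 (lookup w p ℕ.≟ i) * u (w [ p ]≔ j)) (λ p → s * (𝟙 (lookup w p ℕ.≟ i) * v (w [ p ]≔ j))))
      (cong (E i j u w +_) (∑ᶠ-*ˡ s (λ p → 𝟙 (lookup w p ℕ.≟ i) * v (w [ p ]≔ j)))))

  E-zero : ∀ {n} i j {v : Words n} → (∀ w → v w ≡ 0#) → ∀ w → E i j v w ≡ 0#
  E-zero i j z w = ∑ᶠ-zero (λ p → trans (cong (𝟙 (lookup w p ℕ.≟ i) *_) (z _)) (zeroʳ _))

  iterE : ∀ {n} → ℕ → ℕ → ℕ → Words n → Words n
  iterE i j zero    v = v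
  iterE i j (suc m) v = E i j (iterE i j m v)

  iterE-zero : ∀ {n} i j m {v : Words n} → (∀ w → v w ≡ 0#) → ∀ w → iterE i j m v w ≡ 0#
  iterE-zero i j zero    z = z
  iterE-zero i j (suc m) z = E-zero i j (iterE-zero i j m z)

  module _ {i j : ℕ} (i≢j : i ≢ j) where

    -- As i ≠ j, the first letter is moved at most once, and this can happen at any of the m steps;
    -- hence the factor m.
    iterE-∷ : ∀ {n} m (u : Words (suc n)) x w → iterE i j m u (x ∷ w) ≡
      iterE i j m (u ∘ (x ∷_)) w + 𝟙 (x ℕ.≟ i) * (fromℕ m * iterE i j (pred m) (u ∘ (j ∷_)) w)
    iterE-∷ zero    u x w = solve 3 (λ a b c → a := a :+ b :* (con (ℤ.+ 0) :* c)) refl _ _ _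
    iterE-∷ {n} (suc m) u x w = begin
      𝟙x * iterE i j m u (j ∷ w) + E i j (λ w → iterE i j m u (x ∷ w)) w
        ≡⟨ cong₂ (λ a b → 𝟙x * a + b) at-j (E-cong i j (λ w → trans (iterE-∷ m u x w) (cong (iterE i j m (u ∘ (x ∷_)) w +_) (sym (*-assoc 𝟙x (fromℕ m) _)))) w) ⟩
      𝟙x * Um w + E i j (λ w → iterE i j m (u ∘ (x ∷_)) w + (𝟙x * fromℕ m) * iterE i j (pred m) (u ∘ (j ∷_)) w) w
        ≡⟨ cong (𝟙x * Um w +_) (E-linear i j (𝟙x * fromℕ m) (iterE i j m (u ∘ (x ∷_))) (iterE i j (pred m) (u ∘ (j ∷_))) w) ⟩
      𝟙x * Um w + (iterE i j (suc m) (u ∘ (x ∷_)) w + (𝟙x * fromℕ m) * E i j (iterE i j (pred m) (u ∘ (j ∷_))) w)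
        ≡⟨ cong (λ z → 𝟙x * Um w + (iterE i j (suc m) (u ∘ (x ∷_)) w + z)) (again m) ⟩
      𝟙x * Um w + (iterE i j (suc m) (u ∘ (x ∷_)) w + (𝟙x * fromℕ m) * Um w)
        ≡⟨ solve 4 (λ o a e f → o :* a :+ (e :+ (o :* f) :* a) := e :+ o :* ((con one :+ f) :* a)) refl 𝟙x (Um w) _ (fromℕ m) ⟩
      iterE i j (suc m) (u ∘ (x ∷_)) w + 𝟙x * ((1# + fromℕ m) * Um w)
        ≡⟨ cong (λ z → iterE i j (suc m) (u ∘ (x ∷_)) w + 𝟙x * (z * Um w)) (sym (fromℕ-suc m)) ⟩
      iterE i j (suc m) (u ∘ (x ∷_)) w + 𝟙x * (fromℕ (suc m) * Um w) ∎
      where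
      𝟙x = 𝟙 (x ℕ.≟ i)
      Um : Words n
      Um = iterE i j m (u ∘ (j ∷_))
      at-j : iterE i j m u (j ∷ w) ≡ Um w
      at-j = trans (iterE-∷ m u j w) (trans (cong (Um w +_) (𝟙-no* (j ℕ.≟ i) (i≢j ∘ sym) _)) (+-identityʳ _))
      again : ∀ m → (𝟙x * fromℕ m) * E i j (iterE i j (pred m) (u ∘ (j ∷_))) w ≡ (𝟙x * fromℕ m) * iterE i j m (u ∘ (j ∷_)) w
      again zero    = solve 3 (λ o a b → (o :* con (ℤ.+ 0)) :* a := (o :* con (ℤ.+ 0)) :* b) refl _ _ _
      again (suc m) = refl

    -- As for representations of sl₂: raising is injective below the middle weight.
    E-injective : ∀ {n} m a b (u : Words n) → m ℕ.+ a ≤ b →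
      (∀ w → count i w ≢ a → u w ≡ 0#) → (∀ w → count j w ≢ b → u w ≡ 0#) →
      (∀ w → iterE i j m u w ≡ 0#) → ∀ w → u w ≡ 0#
    E-injective m       a       (suc b) u le ci cj z []      = cj [] λ ()
    E-injective m       (suc a) zero    u le ci cj z []      = ci [] λ ()
    E-injective zero    zero    zero    u le ci cj z []      = z []
    E-injective {suc n} zero    a b u le ci cj z w           = z w
    E-injective {suc n} (suc m) a b u le ci cj z (x ∷ w)     = by-head (x ℕ.≟ i) (x ℕ.≟ j)
      where
      tail-j : ∀ w → iterE i j (suc m) (u ∘ (j ∷_)) w ≡ 0#
      tail-j w = trans (sym (trans (cong (iterE i j (suc m) (u ∘ (j ∷_)) w +_) (𝟙-no* (j ℕ.≟ i) (i≢j ∘ sym) _)) (+-identityʳ _)))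
        (trans (sym (iterE-∷ (suc m) u j w)) (z (j ∷ w)))
      -- One more step is applied: the correction term then contains m + 1 steps on the words after
      -- j, which vanish by `tail-j`. Having one i less makes room for the larger number of steps.
      at-i : ∀ a b → suc m ℕ.+ a ≤ b → (∀ w → count i w ≢ a → u w ≡ 0#) → (∀ w → count j w ≢ b → u w ≡ 0#) → ∀ w → u (i ∷ w) ≡ 0#
      at-i zero    b le ci cj w = ci (i ∷ w) (λ e → contradiction (trans (sym (cong (ℕ._+ count i w) (δ-yes i))) e) λ ())
      at-i (suc a) b le ci cj w = E-injective (suc (suc m)) a b (u ∘ (i ∷_)) (subst (_≤ b) (ℕ.+-suc (suc m) a) le)
        (λ w ne → ci (i ∷ w) (λ e → ne (ℕ.suc-injective (trans (sym (cong (ℕ._+ count i w) (δ-yes i))) e))))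
        (λ w ne → cj (i ∷ w) (λ e → ne (trans (sym (cong (ℕ._+ count j w) (δ-no (i≢j ∘ sym)))) e)))
        (λ w → begin
          iterE i j (suc (suc m)) (u ∘ (i ∷_)) w
            ≡⟨ solve 3 (λ a o f → a := (a :+ o :* (f :* con (ℤ.+ 0)))) refl _ (𝟙 (i ℕ.≟ i)) (fromℕ (suc (suc m))) ⟩
          iterE i j (suc (suc m)) (u ∘ (i ∷_)) w + 𝟙 (i ℕ.≟ i) * (fromℕ (suc (suc m)) * 0#)
            ≡⟨ cong (λ t → iterE i j (suc (suc m)) (u ∘ (i ∷_)) w + 𝟙 (i ℕ.≟ i) * (fromℕ (suc (suc m)) * t)) (sym (tail-j w)) ⟩
          iterE i j (suc (suc m)) (u ∘ (i ∷_)) w + 𝟙 (i ℕ.≟ i) * (fromℕ (suc (suc m)) * iterE i j (suc m) (u ∘ (j ∷_)) w)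
            ≡⟨ iterE-∷ (suc (suc m)) u i w ⟨
          iterE i j (suc (suc m)) u (i ∷ w)
            ≡⟨ E-zero i j z (i ∷ w) ⟩
          0# ∎) w
      -- With the words after i settled, the relation at i reduces to m + 1 times m steps on the
      -- words after j; division by m + 1 leaves a case with one j less.
      at-j : ∀ b → suc m ℕ.+ a ≤ b → (∀ w → count j w ≢ b → u w ≡ 0#) → (∀ w → u (i ∷ w) ≡ 0#) → ∀ w → u (j ∷ w) ≡ 0#
      at-j (suc b) (s≤s le) cj ui w = E-injective m a b (u ∘ (j ∷_)) le
        (λ w ne → ci (j ∷ w) (λ e → ne (trans (sym (cong (ℕ._+ count i w) (δ-no i≢j))) e)))
        (λ w ne → cj (j ∷ w) (λ e → ne (ℕ.suc-injective (trans (sym (cong (ℕ._+ count j w) (δ-yes j))) e))))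
        (λ w → *-cancelˡ-suc m (begin
          fromℕ (suc m) * iterE i j m (u ∘ (j ∷_)) w
            ≡⟨ trans (sym (*-identityˡ _)) (sym (+-identityˡ _)) ⟩
          0# + 1# * (fromℕ (suc m) * iterE i j m (u ∘ (j ∷_)) w)
            ≡⟨ cong₂ (λ s t → s + t * (fromℕ (suc m) * iterE i j m (u ∘ (j ∷_)) w)) (sym (iterE-zero i j (suc m) ui w)) (sym (𝟙-yes (i ℕ.≟ i) refl)) ⟩
          iterE i j (suc m) (u ∘ (i ∷_)) w + 𝟙 (i ℕ.≟ i) * (fromℕ (suc m) * iterE i j m (u ∘ (j ∷_)) w)
            ≡⟨ iterE-∷ (suc m) u i w ⟨
          iterE i j (suc m) u (i ∷ w)
            ≡⟨ trans (z (i ∷ w)) (sym (zeroʳ _)) ⟩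
          fromℕ (suc m) * 0# ∎)) w
      by-head : Dec (x ≡ i) → Dec (x ≡ j) → u (x ∷ w) ≡ 0#
      by-head (yes refl) _          = at-i a b le ci cj w
      by-head (no _)     (yes refl) = at-j b le cj (at-i a b le ci cj) w
      by-head (no x≢i)   (no x≢j)   = E-injective (suc m) a b (u ∘ (x ∷_)) le
        (λ w ne → ci (x ∷ w) (λ e → ne (trans (sym (cong (ℕ._+ count i w) (δ-no (x≢i ∘ sym)))) e)))
        (λ w ne → cj (x ∷ w) (λ e → ne (trans (sym (cong (ℕ._+ count j w) (δ-no (x≢j ∘ sym)))) e)))
        (λ w → trans (sym (trans (cong (iterE i j (suc m) (u ∘ (x ∷_)) w +_) (𝟙-no* (x ℕ.≟ i) x≢i _)) (+-identityʳ _)))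
          (trans (sym (iterE-∷ (suc m) u x w)) (z (x ∷ w)))) w

  -- Highest weight vectors of weight α; they turn out to form the Specht module.
  record HighestWeight {n : ℕ} (α : List ℕ) (v : Words n) : Set where
    field
      content : ∀ w c → count c w ≢ part α c → v w ≡ 0#
      raising : ∀ i j → 0 < i → i < j → ∀ w → E i j v w ≡ 0#

  open HighestWeight public

  part-0 : ∀ α → part α 0 ≡ 0
  part-0 []      = refl
  part-0 (_ ∷ _) = refl

  Removes-part : ∀ {α r ν} → Removes α r ν → ∀ c → part α c ≡ δ c r ℕ.+ part ν c
  Removes-part (here _)  zero          = refl
  Removes-part (here _)  (suc zero)    = refl
  Removes-part (here {xs = xs} _) (suc (suc c)) = cong (ℕ._+ part xs (suc c)) (sym (δ-no {suc (suc c)} {1} λ ()))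
  Removes-part {r = suc r} (there _) zero = cong (ℕ._+ 0) (sym (δ-no {0} {suc r} λ ()))
  Removes-part (there {i = zero} ()) (suc zero)
  Removes-part {r = suc (suc r)} (there {x} _) (suc zero) = cong (ℕ._+ x) (sym (δ-no {1} {suc (suc r)} λ ()))
  Removes-part (there {i = i} {ν} r) (suc (suc c)) = trans (Removes-part r (suc c)) (cong (ℕ._+ part ν (suc c)) (δ-suc (suc c) i))
    where
    δ-suc : ∀ c i → δ c i ≡ δ (suc c) (suc i)
    δ-suc c i with c ℕ.≟ i
    ... | yes refl = sym (δ-yes (suc c))
    ... | no c≢i   = sym (δ-no (c≢i ∘ ℕ.suc-injective))

  Removes-positive : ∀ {α r ν} → Removes α r ν → 0 < r
  Removes-positive (here _)  = s≤s z≤n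
  Removes-positive (there _) = s≤s z≤n

  removals-∈ : ∀ {α r ν} → Removes α r ν → (r , ν) ∈ removals α
  removals-∈ {suc x ∷ xs} (here h) with hd xs ℕ.<? suc x
  ... | yes p = ∈-++⁺ˡ (∈-if′ (hd xs ℕ.<? suc x) (s≤s h))
    where
    ∈-if′ : ∀ {A P : Set} (d : Dec P) {a : A} → P → a ∈ (if does d then a ∷ [] else [])
    ∈-if′ d p with d
    ... | yes _ = here refl
    ... | no ¬p = contradiction p ¬p
  ... | no ¬p = contradiction (s≤s h) ¬p
  removals-∈ {x ∷ xs} (there r) = ∈-++⁺ʳ _ (∈-map⁺ (λ (i , ν) → suc i , x ∷ ν) (removals-∈ r))

  removable? : ∀ α r → Decreasing α → (∃[ ν ] Removes α (suc r) ν) ⊎ part α (suc r) ≡ part α (suc (suc r))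
  removable? []       r       d = inj₂ refl
  removable? (x ∷ xs) zero    (p , d) = first x xs p
    where
    first : ∀ x xs → hd xs ≤ x → (∃[ ν ] Removes (x ∷ xs) 1 ν) ⊎ x ≡ part xs 1
    first zero    []       p = inj₂ refl
    first zero    (y ∷ ys) p = inj₂ (sym (ℕ.n≤0⇒n≡0 p))
    first (suc x) xs       p with hd xs ℕ.≤? x
    ... | yes q = inj₁ (_ , here q)
    first (suc x) []       p | no ¬q = contradiction z≤n ¬q
    first (suc x) (y ∷ ys) p | no ¬q = inj₂ (ℕ.≤-antisym (ℕ.≰⇒> ¬q) p)
  removable? (x ∷ xs) (suc r) (p , d) with removable? xs r d
  ... | inj₁ (ν , q) = inj₁ (_ , there q)
  ... | inj₂ e       = inj₂ e

  part-beyond : ∀ α r → length α < r → part α r ≡ 0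
  part-beyond []       r             p       = refl
  part-beyond (x ∷ xs) (suc zero)    (s≤s ())
  part-beyond (x ∷ xs) (suc (suc r)) (s≤s p) = part-beyond xs (suc r) p

  -- The raising relation for v has one more term, in which the first letter r is replaced by a
  -- larger one; there v vanishes.
  highestWeight-tail : ∀ {n α r ν} {v : Words (suc n)} → Removes α r ν → HighestWeight α v →
    (∀ s → r < s → ∀ w → v (s ∷ w) ≡ 0#) → HighestWeight ν (v ∘ (r ∷_))
  highestWeight-tail {r = r} {v = v} rem hw top = record
    { content = λ w c ne → content hw (r ∷ w) c (λ e → ne (ℕ.+-cancelˡ-≡ (δ c r) _ _ (trans e (Removes-part rem c))))
    ; raising = λ i j 0<i i<j w → tail-raising i j i<j w (raising hw i j 0<i i<j (r ∷ w)) }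
    where
    tail-raising : ∀ i j → i < j → ∀ w → E i j v (r ∷ w) ≡ 0# → E i j (v ∘ (r ∷_)) w ≡ 0#
    tail-raising i j i<j w z = trans (sym (trans (cong (_+ E i j (v ∘ (r ∷_)) w) (head-0 (r ℕ.≟ i))) (+-identityˡ _))) z
      where
      head-0 : (d : Dec (r ≡ i)) → 𝟙 d * v (j ∷ w) ≡ 0#
      head-0 (yes refl) = trans (cong (1# *_) (top j i<j w)) (zeroʳ 1#)
      head-0 (no _)     = zeroˡ _

  -- Row readings of standard tableaux: the entry at position p is the row of
  -- the box that is p-th to be removed from the shape.
  paths : ∀ n → List ℕ → List (Vec ℕ n)
  paths zero    α = [] ∷ []
  paths (suc n) α = concatMap (λ (r , ν) → map (r ∷_) (paths n ν)) (removals α)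

  data Path : ∀ {n} → List ℕ → Vec ℕ n → Set where
    []  : ∀ {α} → Path α []
    _∷_ : ∀ {n α r ν} {T : Vec ℕ n} → Removes α r ν → Path ν T → Path α (r ∷ T)

  ∈-paths⁻ : ∀ n α {T} → T ∈ paths n α → Path α T
  ∈-paths⁻ zero    α {[]} _ = []
  ∈-paths⁻ (suc n) α T∈ with ∈-concatMap-map⁻ (λ (r , _) → r ∷_) (λ (_ , ν) → paths n ν) (removals α) T∈
  ... | (r , ν) , _ , rν∈ , T∈′ , refl = ∈-removals α rν∈ ∷ ∈-paths⁻ n ν T∈′

  ∈-paths⁺ : ∀ {n α} {T : Vec ℕ n} → Path α T → T ∈ paths n α
  ∈-paths⁺ []        = here refl
  ∈-paths⁺ {suc n} {α} (_∷_ {r = r} {ν} rem P) = ∈-concatMap⁺ (λ (r , ν) → map (r ∷_) (paths n ν)) (Any.map (λ { refl → ∈-map⁺ (r ∷_) (∈-paths⁺ P) }) (removals-∈ rem))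

  content-head : ∀ {n α} {v : Words (suc n)} → HighestWeight α v → ∀ r → part α r ≡ 0 → ∀ w → v (r ∷ w) ≡ 0#
  content-head hw r e w = content hw (r ∷ w) r (λ e′ → contradiction (trans (sym (trans (cong (ℕ._+ count r w) (δ-yes r)) refl)) (trans e′ e)) λ ())

  -- Descending induction on the first letter: as v vanishes on larger first letters, the tail is
  -- again of highest weight whenever the row has a removable box. Otherwise the row is as long as
  -- the next one, and `E-injective` kills the tail.
  highestWeight-vanish : ∀ {n α} {v : Words n} → Decreasing α → HighestWeight α v →
    (∀ {T} → Path α T → v T ≡ 0#) → ∀ w → v w ≡ 0#
  highestWeight-vanish {zero}  dα hw z [] = z []
  highestWeight-vanish {suc n} {α} {v} dα hw z (r ∷ w) = go (suc (length α)) r (ℕ.m≤n+m (suc (length α)) r) w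
    where
    -- `k` is the fuel of the descending induction; it runs out only at letters beyond the length of
    -- α, which have content 0.
    go : ∀ k r → length α < r ℕ.+ k → ∀ w → v (r ∷ w) ≡ 0#
    go zero    r       p w = content-head hw r (part-beyond α r (subst (length α <_) (ℕ.+-identityʳ r) p)) w
    go (suc k) zero    p w = content-head hw 0 (part-0 α) w
    go (suc k) (suc r) p = by-row (removable? α r dα)
      where
      above : ∀ s → suc r < s → ∀ w → v (s ∷ w) ≡ 0#
      above s r<s = go k s (ℕ.<-≤-trans (subst (length α <_) (ℕ.+-suc (suc r) k) p) (ℕ.+-monoˡ-≤ k r<s))
      by-row : (∃[ ν ] Removes α (suc r) ν) ⊎ part α (suc r) ≡ part α (suc (suc r)) → ∀ w → v (suc r ∷ w) ≡ 0#
      by-row (inj₁ (ν , rem)) = highestWeight-vanish (Removes-decreasing rem dα) (highestWeight-tail rem hw above) (λ P → z (rem ∷ P))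
      by-row (inj₂ e) with part α (suc r) in eq
      ... | zero  = content-head hw (suc r) eq
      -- One letter of the row is used up by the first position, so the next letter is in excess by
      -- one; this is just enough for a single raising step, m = 1, to be injective.
      ... | suc a = E-injective {suc r} {suc (suc r)} (λ e → contradiction (sym e) ℕ.1+n≢n) 1 a (suc a) (v ∘ (suc r ∷_)) ℕ.≤-refl
        (λ w ne → content hw (suc r ∷ w) (suc r) (λ e′ → ne (ℕ.suc-injective (trans (sym (cong (ℕ._+ count (suc r) w) (δ-yes (suc r)))) (trans e′ eq)))))
        (λ w ne → content hw (suc r ∷ w) (suc (suc r)) (λ e′ → ne (trans (sym (cong (ℕ._+ count (suc (suc r)) w) (δ-no {suc (suc r)} {suc r} ℕ.1+n≢n))) (trans e′ (sym e)))))
        (λ w → trans (sym (trans (cong (_+ E (suc r) (suc (suc r)) (v ∘ (suc r ∷_)) w) (trans (cong (𝟙 (suc r ℕ.≟ suc r) *_) (above (suc (suc r)) ℕ.≤-refl w)) (zeroʳ _))) (+-identityˡ _)))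
          (raising hw (suc r) (suc (suc r)) (s≤s z≤n) ℕ.≤-refl (suc r ∷ w)))

  -- The Jucys-Murphy element of the first position, summed over later positions instead of earlier
  -- ones.
  JM₀ : ∀ {n} → Words (suc n) → Words (suc n)
  JM₀ v (s ∷ w) = ∑ᶠ (λ q → v (lookup w q ∷ w [ q ]≔ s))

  count-∑ : ∀ {n} s (w : Vec ℕ n) → ∑ᶠ (λ q → 𝟙 (lookup w q ℕ.≟ s)) ≡ fromℕ (count s w)
  count-∑ s []      = refl
  count-∑ s (x ∷ w) = trans (cong₂ _+_ (sym (δ-𝟙 s x)) (count-∑ s w)) (sym (fromℕ-+ (δ s x) (count s w)))

  ∑-range-const : ∀ s x → ∑ (range s) (λ _ → x) ≡ fromℕ s * x
  ∑-range-const zero    x = sym (zeroˡ x)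
  ∑-range-const (suc s) x = trans (∑-applyUpTo-suc suc s (λ _ → x)) (trans (cong (_+ x) (∑-range-const s x))
    (trans (solve 2 (λ s x → s :* x :+ x := (con one :+ s) :* x) refl (fromℕ s) x) (cong (_* x) (sym (fromℕ-suc s)))))

  -- Exchanges with a larger letter vanish, and those with an equal letter give `part α s` - 1
  -- copies. For each of the s - 1 smaller letters the raising relation makes the exchanges add up
  -- to minus one copy. The total is the content of the last box of row s.
  JM₀-eigen : ∀ {n α} {v : Words (suc n)} → HighestWeight α v → ∀ s → 0 < s →
    (∀ r → s < r → ∀ w → v (r ∷ w) ≡ 0#) → ∀ w → JM₀ v (s ∷ w) ≡ (fromℕ (part α s) - fromℕ s) * v (s ∷ w)
  JM₀-eigen {n} {α} {v} hw (suc s) _ above w = begin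
    ∑ᶠ (λ q → v (lookup w q ∷ w [ q ]≔ suc s))
      ≡⟨ ∑ᶠ-cong terms ⟩
    ∑ᶠ (λ q → 𝟙 (lookup w q ℕ.≟ suc s) * v (suc s ∷ w) + ∑ (range s) (λ i → 𝟙 (lookup w q ℕ.≟ i) * v (i ∷ w [ q ]≔ suc s)))
      ≡⟨ ∑ᶠ-+ (λ q → 𝟙 (lookup w q ℕ.≟ suc s) * v (suc s ∷ w)) _ ⟩
    ∑ᶠ (λ q → 𝟙 (lookup w q ℕ.≟ suc s) * v (suc s ∷ w)) + ∑ᶠ (λ q → ∑ (range s) (λ i → 𝟙 (lookup w q ℕ.≟ i) * v (i ∷ w [ q ]≔ suc s)))
      ≡⟨ cong₂ _+_ (trans (∑ᶠ-*ʳ (v (suc s ∷ w)) (λ q → 𝟙 (lookup w q ℕ.≟ suc s))) (cong (_* v (suc s ∷ w)) (count-∑ (suc s) w)))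
           (sym (∑-∑ᶠ-swap (range s) (λ i q → 𝟙 (lookup w q ℕ.≟ i) * v (i ∷ w [ q ]≔ suc s)))) ⟩
    fromℕ (count (suc s) w) * v (suc s ∷ w) + ∑ (range s) (λ i → E i (suc s) (v ∘ (i ∷_)) w)
      ≡⟨ cong₂ _+_ same (∑-cong∈ (range s) (λ {i} i∈ → lower i i∈)) ⟩
    (fromℕ (part α (suc s)) - 1#) * v (suc s ∷ w) + ∑ (range s) (λ _ → - v (suc s ∷ w))
      ≡⟨ cong ((fromℕ (part α (suc s)) - 1#) * v (suc s ∷ w) +_) (∑-range-const s (- v (suc s ∷ w))) ⟩
    (fromℕ (part α (suc s)) - 1#) * v (suc s ∷ w) + fromℕ s * - v (suc s ∷ w)
      ≡⟨ solve 3 (λ p x s → (p :- con one) :* x :+ s :* :- x := (p :- (con one :+ s)) :* x) refl _ _ _ ⟩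
    (fromℕ (part α (suc s)) - (1# + fromℕ s)) * v (suc s ∷ w)
      ≡⟨ cong (λ z → (fromℕ (part α (suc s)) - z) * v (suc s ∷ w)) (sym (fromℕ-suc s)) ⟩
    (fromℕ (part α (suc s)) - fromℕ (suc s)) * v (suc s ∷ w) ∎
    where
    range-bounds : ∀ {i} → i ∈ range s → 0 < i × i < suc s
    range-bounds i∈ with ∈-applyUpTo⁻ suc i∈
    ... | _ , p , refl = s≤s z≤n , s≤s p
    same : fromℕ (count (suc s) w) * v (suc s ∷ w) ≡ (fromℕ (part α (suc s)) - 1#) * v (suc s ∷ w)
    same with suc (count (suc s) w) ℕ.≟ part α (suc s)
    ... | yes e = cong (_* v (suc s ∷ w)) (trans (solve 1 (λ x → x := (con one :+ x) :- con one) refl _) (cong (_- 1#) (trans (sym (fromℕ-suc (count (suc s) w))) (cong fromℕ e))))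
    ... | no ne = trans (trans (cong (fromℕ (count (suc s) w) *_) z) (zeroʳ _)) (sym (trans (cong ((fromℕ (part α (suc s)) - 1#) *_) z) (zeroʳ _)))
      where
      z : v (suc s ∷ w) ≡ 0#
      z = content hw (suc s ∷ w) (suc s) (λ e → ne (trans (sym (cong (ℕ._+ count (suc s) w) (δ-yes (suc s)))) e))
    lower : ∀ i → i ∈ range s → E i (suc s) (v ∘ (i ∷_)) w ≡ - v (suc s ∷ w)
    lower i i∈ = begin
      E i (suc s) (v ∘ (i ∷_)) w
        ≡⟨ solve 2 (λ e x → e := (con one :* x :+ e) :- x) refl _ (v (suc s ∷ w)) ⟩
      (1# * v (suc s ∷ w) + E i (suc s) (v ∘ (i ∷_)) w) - v (suc s ∷ w)
        ≡⟨ cong (λ o → (o * v (suc s ∷ w) + E i (suc s) (v ∘ (i ∷_)) w) - v (suc s ∷ w)) (sym (𝟙-yes (i ℕ.≟ i) refl)) ⟩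
      E i (suc s) v (i ∷ w) - v (suc s ∷ w)
        ≡⟨ cong (_- v (suc s ∷ w)) (raising hw i (suc s) (proj₁ (range-bounds i∈)) (proj₂ (range-bounds i∈)) (i ∷ w)) ⟩
      0# - v (suc s ∷ w)
        ≡⟨ +-identityˡ _ ⟩
      - v (suc s ∷ w) ∎
    terms : ∀ q → v (lookup w q ∷ w [ q ]≔ suc s) ≡
      𝟙 (lookup w q ℕ.≟ suc s) * v (suc s ∷ w) + ∑ (range s) (λ i → 𝟙 (lookup w q ℕ.≟ i) * v (i ∷ w [ q ]≔ suc s))
    terms q with ℕ.<-cmp (lookup w q) (suc s)
    ... | tri≈ _ e _ = begin
      v (lookup w q ∷ w [ q ]≔ suc s)
        ≡⟨ cong₂ (λ a b → v (a ∷ b)) e (trans (cong (w [ q ]≔_) (sym e)) (Vec.[]≔-lookup w q)) ⟩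
      v (suc s ∷ w)
        ≡⟨ trans (sym (*-identityˡ _)) (sym (+-identityʳ _)) ⟩
      1# * v (suc s ∷ w) + 0#
        ≡⟨ cong₂ (λ a b → a * v (suc s ∷ w) + b) (sym (𝟙-yes (lookup w q ℕ.≟ suc s) e))
             (sym (∑-zero∈ (range s) (λ {i} i∈ → 𝟙-no* (lookup w q ℕ.≟ i) (λ e′ → ℕ.<-irrefl (trans (sym e′) e) (proj₂ (range-bounds i∈))) _))) ⟩
      𝟙 (lookup w q ℕ.≟ suc s) * v (suc s ∷ w) + ∑ (range s) (λ i → 𝟙 (lookup w q ℕ.≟ i) * v (i ∷ w [ q ]≔ suc s)) ∎
    ... | tri> _ ne gt = trans (above (lookup w q) gt _) (sym (trans (cong₂ _+_ (𝟙-no* (lookup w q ℕ.≟ suc s) ne _)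
        (∑-zero∈ (range s) (λ {i} i∈ → 𝟙-no* (lookup w q ℕ.≟ i) (λ e′ → ℕ.<-asym gt (subst (_< suc s) (sym e′) (proj₂ (range-bounds i∈)))) _))) (+-identityˡ 0#)))
    ... | tri< lt ne _ = sym (trans (cong₂ _+_ (𝟙-no* (lookup w q ℕ.≟ suc s) ne _) (only (lookup w q) refl lt)) (+-identityˡ _))
      where
      only : ∀ x → lookup w q ≡ x → x < suc s → ∑ (range s) (λ i → 𝟙 (lookup w q ℕ.≟ i) * v (i ∷ w [ q ]≔ suc s)) ≡ v (lookup w q ∷ w [ q ]≔ suc s)
      only zero    e lt = trans (∑-zero∈ (range s) (λ {i} i∈ → 𝟙-no* (lookup w q ℕ.≟ i) (λ e′ → ℕ.<-irrefl (trans (sym e) e′) (proj₁ (range-bounds i∈))) _))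
        (sym (trans (cong (λ z → v (z ∷ w [ q ]≔ suc s)) e) (content-head hw 0 (part-0 α) _)))
      only (suc x) e lt = trans (∑-cong (range s) (λ i → cong (_* v (i ∷ w [ q ]≔ suc s)) (𝟙-⇔ (lookup w q ℕ.≟ i) (i ℕ.≟ lookup w q) sym sym)))
        (∑-single ℕ._≟_ (range-unique s) (∈-range (subst (0 <_) (sym e) (s≤s z≤n)) (subst (_< suc s) (sym e) lt)) (λ i → v (i ∷ w [ q ]≔ suc s)))

-- Triangularity, dual families and traces

module Traces where

  open Rationals
  open Sums
  open SkewTableaux
  open Dimensions
  open HookSums
  open HighestWeight
  open import Data.Fin.Base using (zero; suc)

  -- v vanishes on the words lexicographically beyond T.
  Bounded : ∀ {n} → Vec ℕ n → Words n → Set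
  Bounded []      v = ⊤
  Bounded (r ∷ T) v = (∀ s → r < s → ∀ w → v (s ∷ w) ≡ 0#) × Bounded T (v ∘ (r ∷_))

  bounded-cong : ∀ {n} (T : Vec ℕ n) {u v : Words n} → u ≗ v → Bounded T u → Bounded T v
  bounded-cong []      e b       = tt
  bounded-cong (r ∷ T) e (z , b) = (λ s r<s w → trans (sym (e (s ∷ w))) (z s r<s w)) , bounded-cong T (e ∘ (r ∷_)) b

  bounded-linear : ∀ {n} (T : Vec ℕ n) {u v : Words n} s → Bounded T u → Bounded T v → Bounded T (λ w → u w + s * v w)
  bounded-linear []      s b       c       = tt
  bounded-linear (r ∷ T) s (y , b) (z , c) =
    (λ t r<t w → trans (cong₂ (λ a b → a + s * b) (y t r<t w) (z t r<t w)) (solve 1 (λ s → con (ℤ.+ 0) :+ s :* con (ℤ.+ 0) := con (ℤ.+ 0)) refl s)) ,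
    bounded-linear T s b c

  bounded-zero : ∀ {n} (T : Vec ℕ n) {v : Words n} → (∀ w → v w ≡ 0#) → Bounded T v
  bounded-zero []      z = tt
  bounded-zero (r ∷ T) z = (λ s _ w → z (s ∷ w)) , bounded-zero T (z ∘ (r ∷_))

  bounded-* : ∀ {n} (T : Vec ℕ n) {v : Words n} s → Bounded T v → Bounded T (λ w → s * v w)
  bounded-* T s b = bounded-cong T (λ w → +-identityˡ _) (bounded-linear T s (bounded-zero T {λ _ → 0#} (λ _ → refl)) b)

  -- The Jucys–Murphy element ∑ (p q), summed over the positions q > p.
  JM : ∀ {n} → Fin n → Words n → Words n
  JM zero    v w       = JM₀ v w
  JM (suc p) v (s ∷ w) = JM p (v ∘ (s ∷_)) w

  JM-zero : ∀ {n} p {v : Words n} → (∀ w → v w ≡ 0#) → ∀ w → JM p v w ≡ 0#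
  JM-zero zero    z (s ∷ w) = ∑ᶠ-zero (λ q → z (lookup w q ∷ w [ q ]≔ s))
  JM-zero (suc p) z (s ∷ w) = JM-zero p (z ∘ (s ∷_)) w

  contentAt : ∀ {n α} {T : Vec ℕ n} → Path α T → Fin n → ℚ
  contentAt (_∷_ {α = α} {r} rem P) zero    = fromℕ (part α r) - fromℕ r
  contentAt (rem ∷ P)               (suc p) = contentAt P p

  -- Only the leading value is multiplied by the content; v itself need not be an eigenvector. That
  -- the bound is preserved is part of the claim, so that products of such elements can be treated.
  JM-eigen : ∀ {n α} {T : Vec ℕ n} {v : Words n} (P : Path α T) → HighestWeight α v → Bounded T v →
    ∀ p → Bounded T (JM p v) × JM p v T ≡ contentAt P p * v T
  JM-eigen {α = α} {r ∷ T} {v} (rem ∷ P) hw (top , b) zero =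
    ((λ s r<s w → trans (JM₀-eigen hw s (ℕ.<-trans (Removes-positive rem) r<s) (λ t s<t → top t (ℕ.<-trans r<s s<t)) w)
                        (trans (cong ((fromℕ (part α s) - fromℕ s) *_) (top s r<s w)) (zeroʳ _))) ,
     bounded-cong T (λ w → sym (JM₀-eigen hw r (Removes-positive rem) top w)) (bounded-* T (fromℕ (part α r) - fromℕ r) b)) ,
    JM₀-eigen hw r (Removes-positive rem) top T
  JM-eigen {T = r ∷ T} (rem ∷ P) hw (top , b) (suc p) =
    ((λ s r<s w → JM-zero p (top s r<s) w) , proj₁ ih) , proj₂ ih
    where ih = JM-eigen P (highestWeight-tail rem hw top) b p

  data _≺_ : ∀ {n} → Vec ℕ n → Vec ℕ n → Set where
    head : ∀ {n r s} {T S : Vec ℕ n} → r < s → (r ∷ T) ≺ (s ∷ S)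
    tail : ∀ {n r} {T S : Vec ℕ n} → T ≺ S → (r ∷ T) ≺ (r ∷ S)

  ≺-irreflexive : ∀ {n} {T : Vec ℕ n} → ¬ T ≺ T
  ≺-irreflexive (head r<r) = ℕ.<-irrefl refl r<r
  ≺-irreflexive (tail p)   = ≺-irreflexive p

  bounded-≺ : ∀ {n} {T S : Vec ℕ n} {v : Words n} → T ≺ S → Bounded T v → Bounded S v × v S ≡ 0#
  bounded-≺ {S = s ∷ S} (head r<s) (z , _) = ((λ t s<t → z t (ℕ.<-trans r<s s<t)) , bounded-zero S (z s r<s)) , z s r<s S
  bounded-≺ (tail p)   (z , b) = (z , proj₁ (bounded-≺ p b)) , proj₂ (bounded-≺ p b)

  removals-sorted : ∀ α → AllPairs (λ a b → proj₁ a < proj₁ b) (removals α)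
  removals-sorted []       = []
  removals-sorted (x ∷ xs) = with-head (hd xs ℕ.<? x)
    where
    rest : List (ℕ × List ℕ)
    rest = map (λ (i , ν) → suc i , x ∷ ν) (removals xs)
    rest-sorted : AllPairs (λ a b → proj₁ a < proj₁ b) rest
    rest-sorted = AllPairs.map⁺ (AllPairs.map s≤s (removals-sorted xs))
    rest-large : All (λ b → 1 < proj₁ b) rest
    rest-large = All.map⁺ (All.tabulate (λ {(i , ν)} m → s≤s (Removes-positive (∈-removals xs m))))
    with-head : (d : Dec (hd xs < x)) → AllPairs (λ a b → proj₁ a < proj₁ b) ((if does d then (1 , ℕ.pred x ∷ xs) ∷ [] else []) ++ rest)
    with-head (yes _) = rest-large ∷ rest-sorted
    with-head (no _)  = rest-sorted

  paths-sorted : ∀ n α → AllPairs _≺_ (paths n α)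
  paths-sorted zero    α = [] ∷ []
  paths-sorted (suc n) α = AllPairs.concat⁺
    (All.map⁺ (All.tabulate (λ {(r , ν)} _ → AllPairs.map⁺ (AllPairs.map tail (paths-sorted n ν)))))
    (AllPairs.map⁺ (AllPairs.map (λ {(r , ν)} {(s , ν′)} r<s →
       All.map⁺ (All.tabulate (λ _ → All.map⁺ (All.tabulate (λ _ → head r<s))))) (removals-sorted α)))

  paths-unique : ∀ n α → Unique (paths n α)
  paths-unique n α = AllPairs.map (λ { p refl → ≺-irreflexive p }) (paths-sorted n α)

  _≟ʷ_ : ∀ {n} (T S : Vec ℕ n) → Dec (T ≡ S)
  _≟ʷ_ = Vec.≡-dec ℕ._≟_

  -- A family dual to evaluation at the words `ts`. The bound is recorded because leading values of
  -- Jucys-Murphy elements are known on bounded vectors.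
  record Dual {n} (Good : Words n → Set) (ts : List (Vec ℕ n)) : Set where
    field
      dual    : Vec ℕ n → Words n
      good    : ∀ {T} → T ∈ ts → Good (dual T)
      bounded : ∀ {T} → T ∈ ts → Bounded T (dual T)
      pairing : ∀ {T S} → T ∈ ts → S ∈ ts → dual T S ≡ 𝟙 (T ≟ʷ S)

  open Dual public

  -- Gaussian elimination on a triangular family.
  triangular⇒dual : ∀ {n} {Good : Words n → Set} →
    (∀ {u v} s → Good u → Good v → Good (λ w → u w + s * v w)) →
    ∀ {ts} → AllPairs _≺_ ts →
    (∀ {T} → T ∈ ts → Σ[ e ∈ Words n ] Good e × Bounded T e × Σ[ i ∈ ℚ ] i * e T ≡ 1#) → Dual Good ts
  triangular⇒dual {n} lin {[]}     _         e = record { dual = λ _ _ → 0# ; good = λ () ; bounded = λ () ; pairing = λ () }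
  triangular⇒dual {n} {Good} lin {t ∷ ts} (t≺ ∷ ts≺) family = record { dual = b ; good = b-good ; bounded = b-bounded ; pairing = b-pairing }
    where
    ih : Dual Good ts
    ih = triangular⇒dual lin ts≺ (family ∘ there)
    first = family (here refl)
    e = proj₁ first
    i = proj₁ (proj₂ (proj₂ (proj₂ first)))
    bₜ : Words n
    -- This is i · e, written in the form under which `Good` is known to be closed.
    bₜ w = e w + (i - 1#) * e w
    bₜ-* : ∀ w → bₜ w ≡ i * e w
    bₜ-* w = solve 2 (λ e i → e :+ (i :- con one) :* e := i :* e) refl (e w) i
    bₜ-bounded : Bounded t bₜ
    bₜ-bounded = bounded-linear t (i - 1#) (proj₁ (proj₂ (proj₂ first))) (proj₁ (proj₂ (proj₂ first)))
    bₜ-good : Good bₜ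
    bₜ-good = lin (i - 1#) (proj₁ (proj₂ first)) (proj₁ (proj₂ first))
    bₜ-t : bₜ t ≡ 1#
    bₜ-t = trans (bₜ-* t) (proj₂ (proj₂ (proj₂ (proj₂ first))))
    bₜ-0 : ∀ {S} → S ∈ ts → bₜ S ≡ 0#
    bₜ-0 S∈ = proj₂ (bounded-≺ (All.lookup t≺ S∈) bₜ-bounded)
    reduce : Vec ℕ n → Words n
    -- The value at `t` is cancelled; the values at the later words stay, since `bₜ` vanishes there.
    reduce T w = dual ih T w + - dual ih T t * bₜ w
    pick : ∀ T → Dec (T ≡ t) → Words n
    pick T (yes _) = bₜ
    pick T (no _)  = reduce T
    b : Vec ℕ n → Words n
    b T = pick T (T ≟ʷ t)
    t∉ : ¬ t ∈ ts
    t∉ t∈ = ≺-irreflexive (All.lookup t≺ t∈)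
    b-t : b t ≡ bₜ
    b-t with t ≟ʷ t
    ... | yes _ = refl
    ... | no ¬p = contradiction refl ¬p
    b-there : ∀ {T} → T ∈ ts → b T ≡ reduce T
    b-there {T} T∈ with T ≟ʷ t
    ... | yes refl = contradiction T∈ t∉
    ... | no _     = refl
    b-good : ∀ {T} → T ∈ t ∷ ts → Good (b T)
    b-good (here refl) = subst Good (sym b-t) bₜ-good
    b-good (there T∈)  = subst Good (sym (b-there T∈)) (lin (- dual ih _ t) (good ih T∈) bₜ-good)
    b-bounded : ∀ {T} → T ∈ t ∷ ts → Bounded T (b T)
    b-bounded (here refl) = subst (Bounded t) (sym b-t) bₜ-bounded
    b-bounded {T} (there T∈)  = subst (Bounded T) (sym (b-there T∈)) (bounded-linear T (- dual ih T t) (bounded ih T∈) (proj₁ (bounded-≺ (All.lookup t≺ T∈) bₜ-bounded)))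
    b-pairing : ∀ {T S} → T ∈ t ∷ ts → S ∈ t ∷ ts → b T S ≡ 𝟙 (T ≟ʷ S)
    b-pairing (here refl) (here refl) = trans (cong (λ f → f t) b-t) (trans bₜ-t (sym (𝟙-yes (t ≟ʷ t) refl)))
    b-pairing {S = S} (here refl) (there S∈)  = trans (cong (λ f → f S) b-t) (trans (bₜ-0 S∈) (sym (𝟙-no (t ≟ʷ S) (λ { refl → t∉ S∈ }))))
    b-pairing {T} (there T∈) (here refl) = trans (cong (λ f → f t) (b-there T∈)) (trans (cong (λ z → dual ih T t + - dual ih T t * z) bₜ-t)
      (trans (solve 1 (λ a → a :+ :- a :* con one := con (ℤ.+ 0)) refl (dual ih T t)) (sym (𝟙-no (T ≟ʷ t) (λ { refl → t∉ T∈ })))))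
    b-pairing {T} {S} (there T∈) (there S∈) = trans (cong (λ f → f S) (b-there T∈)) (trans (cong (λ z → dual ih T S + - dual ih T t * z) (bₜ-0 S∈))
      (trans (solve 2 (λ a b → a :+ :- b :* con (ℤ.+ 0) := a) refl _ _) (pairing ih T∈ S∈)))

  highestWeight-linear : ∀ {n α} {u v : Words n} s → HighestWeight α u → HighestWeight α v → HighestWeight α (λ w → u w + s * v w)
  highestWeight-linear {u = u} {v} s hu hv = record
    { content = λ w c ne → trans (cong₂ (λ a b → a + s * b) (content hu w c ne) (content hv w c ne)) (zero′ s)
    ; raising = λ i j p q w → trans (E-linear i j s u v w) (trans (cong₂ (λ a b → a + s * b) (raising hu i j p q w) (raising hv i j p q w)) (zero′ s)) }
    where
    zero′ : ∀ s → 0# + s * 0# ≡ 0#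
    zero′ = solve 1 (λ s → con (ℤ.+ 0) :+ s :* con (ℤ.+ 0) := con (ℤ.+ 0)) refl

  highestWeight-cong : ∀ {n α} {u v : Words n} → u ≗ v → HighestWeight α u → HighestWeight α v
  highestWeight-cong e hu = record
    { content = λ w c ne → trans (sym (e w)) (content hu w c ne)
    ; raising = λ i j p q w → trans (sym (E-cong i j e w)) (raising hu i j p q w) }

  highestWeight-zero : ∀ {n α} → HighestWeight {n} α (λ _ → 0#)
  highestWeight-zero = record { content = λ _ _ _ → refl ; raising = λ i j _ _ → E-zero i j (λ _ → refl) }

  highestWeight-∑ : ∀ {n α} {I : Set} (is : List I) (c : I → ℚ) (u : I → Words n) → (∀ {i} → i ∈ is → HighestWeight α (u i)) →
    HighestWeight α (λ w → ∑ is (λ i → c i * u i w))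
  highestWeight-∑ []       c u h = highestWeight-zero
  highestWeight-∑ (i ∷ is) c u h = highestWeight-cong (λ w → +-comm _ _)
    (highestWeight-linear (c i) (highestWeight-∑ is c u (h ∘ there)) (h (here refl)))

  record Operator {n} (α : List ℕ) : Set where
    field
      apply    : Words n → Words n
      respects : ∀ {u v} → u ≗ v → apply u ≗ apply v
      linear   : ∀ s u v w → apply (λ w → u w + s * v w) w ≡ apply u w + s * apply v w
      preserve : ∀ {v} → HighestWeight α v → HighestWeight α (apply v)

    apply-0 : ∀ w → apply (λ _ → 0#) w ≡ 0#
    apply-0 w = trans (respects (λ _ → solve 0 (con (ℤ.+ 0) := con (ℤ.+ 0) :+ (:- con one) :* con (ℤ.+ 0)) refl) w)
      (trans (linear (- 1#) (λ _ → 0#) (λ _ → 0#) w) (solve 1 (λ a → a :+ (:- con one) :* a := con (ℤ.+ 0)) refl _))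

    apply-∑ : ∀ {I : Set} (is : List I) (c : I → ℚ) (u : I → Words n) w →
      apply (λ w → ∑ is (λ i → c i * u i w)) w ≡ ∑ is (λ i → c i * apply (u i) w)
    apply-∑ []       c u w = apply-0 w
    apply-∑ (i ∷ is) c u w = trans (respects (λ w → +-comm _ _) w) (trans (linear (c i) (λ w → ∑ is (λ i → c i * u i w)) (u i) w)
      (trans (+-comm _ _) (cong (c i * apply (u i) w +_) (apply-∑ is c u w))))

  open Operator public

  module Trace {n α} (dα : Decreasing α) {Good : Words n → Set} (good⇒highest : ∀ {v} → Good v → HighestWeight α v)
               (D : Dual Good (paths n α)) where

    ts : List (Vec ℕ n)
    ts = paths n α

    -- The difference of the two sides is a highest weight vector that vanishes at all paths.
    expansion : ∀ {v : Words n} → HighestWeight α v → ∀ w → v w ≡ ∑ ts (λ S → v S * dual D S w)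
    expansion {v} hv w = trans (solve 2 (λ a b → a := (a :+ (:- con one) :* b) :+ b) refl (v w) _)
      (trans (cong (_+ ∑ ts (λ S → v S * dual D S w)) (highestWeight-vanish dα difference zero-on w)) (+-identityˡ _))
      where
      difference : HighestWeight α (λ w → v w + (- 1#) * ∑ ts (λ S → v S * dual D S w))
      difference = highestWeight-linear (- 1#) hv (highestWeight-∑ ts v (dual D) (λ S∈ → good⇒highest (good D S∈)))
      zero-on : ∀ {T} → Path α T → v T + (- 1#) * ∑ ts (λ S → v S * dual D S T) ≡ 0#
      zero-on {T} P = trans (cong (λ z → v T + (- 1#) * z) (trans
          (∑-cong∈ ts (λ {S} S∈ → trans (cong (v S *_) (pairing D S∈ (∈-paths⁺ P))) (*-comm _ _)))
          (∑-single _≟ʷ_ (paths-unique n α) (∈-paths⁺ P) v)))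
        (solve 1 (λ a → a :+ (:- con one) :* a := con (ℤ.+ 0)) refl (v T))

    -- Evaluations at the words of `ts` are the coordinates with respect to the dual family, so this
    -- sums the diagonal entries of `A`.
    trace : (Words n → Words n) → ℚ
    trace A = ∑ ts (λ T → A (dual D T) T)

    trace-comm : ∀ (A B : Operator {n} α) → trace (apply A ∘ apply B) ≡ trace (apply B ∘ apply A)
    trace-comm A B = begin
      ∑ ts (λ T → apply A (apply B (dual D T)) T)
        ≡⟨ ∑-cong∈ ts (λ {T} T∈ → product A B T∈) ⟩
      ∑ ts (λ T → ∑ ts (λ S → apply B (dual D T) S * apply A (dual D S) T))
        ≡⟨ ∑-swap ts ts (λ T S → apply B (dual D T) S * apply A (dual D S) T) ⟩
      ∑ ts (λ S → ∑ ts (λ T → apply B (dual D T) S * apply A (dual D S) T))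
        ≡⟨ ∑-cong ts (λ S → ∑-cong ts (λ T → *-comm (apply B (dual D T) S) (apply A (dual D S) T))) ⟩
      ∑ ts (λ S → ∑ ts (λ T → apply A (dual D S) T * apply B (dual D T) S))
        ≡⟨ ∑-cong∈ ts (λ {S} S∈ → sym (product B A S∈)) ⟩
      ∑ ts (λ S → apply B (apply A (dual D S)) S) ∎
      where
      product : ∀ (A B : Operator {n} α) {T} → T ∈ ts → apply A (apply B (dual D T)) T ≡ ∑ ts (λ S → apply B (dual D T) S * apply A (dual D S) T)
      product A B {T} T∈ = trans (respects A (expansion (preserve B (good⇒highest (good D T∈)))) T) (apply-∑ A ts (apply B (dual D T)) (dual D) T)

  infixl 6 _∘ʷ_
  _∘ʷ_ : ∀ {n} → Vec ℕ n → Permutation′ n → Vec ℕ n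
  w ∘ʷ σ = Vec.tabulate (λ i → lookup w (σ ⟨$⟩ʳ i))

  lookup-∘ʷ : ∀ {n} (w : Vec ℕ n) σ i → lookup (w ∘ʷ σ) i ≡ lookup w (σ ⟨$⟩ʳ i)
  lookup-∘ʷ w σ i = Vec.lookup∘tabulate (λ i → lookup w (σ ⟨$⟩ʳ i)) i

  lookup-ext : ∀ {n} {v w : Vec ℕ n} → (∀ i → lookup v i ≡ lookup w i) → v ≡ w
  lookup-ext {v = v} {w} h = trans (sym (Vec.tabulate∘lookup v)) (trans (Vec.tabulate-cong h) (Vec.tabulate∘lookup w))

  count-∘ʷ : ∀ {n} c (w : Vec ℕ n) σ → count c (w ∘ʷ σ) ≡ count c w
  count-∘ʷ c w σ = fromℕ-injective (begin
    fromℕ (count c (w ∘ʷ σ))                              ≡⟨ count-∑ c (w ∘ʷ σ) ⟨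
    ∑ᶠ (λ q → 𝟙 (lookup (w ∘ʷ σ) q ℕ.≟ c))               ≡⟨ ∑ᶠ-cong {_} {λ q → 𝟙 (lookup (w ∘ʷ σ) q ℕ.≟ c)} {λ q → 𝟙 (lookup w (σ ⟨$⟩ʳ q) ℕ.≟ c)} (λ q → cong (λ x → 𝟙 (x ℕ.≟ c)) (lookup-∘ʷ w σ q)) ⟩
    ∑ᶠ (λ q → 𝟙 (lookup w (σ ⟨$⟩ʳ q) ℕ.≟ c))             ≡⟨ ∑ᶠ-permute (λ q → 𝟙 (lookup w q ℕ.≟ c)) σ ⟨
    ∑ᶠ (λ q → 𝟙 (lookup w q ℕ.≟ c))                       ≡⟨ count-∑ c w ⟩
    fromℕ (count c w)                                      ∎)

  update-∘ʷ : ∀ {n} (w : Vec ℕ n) σ q j → (w [ σ ⟨$⟩ʳ q ]≔ j) ∘ʷ σ ≡ (w ∘ʷ σ) [ q ]≔ j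
  update-∘ʷ w σ q j = lookup-ext λ i → trans (lookup-∘ʷ (w [ σ ⟨$⟩ʳ q ]≔ j) σ i) (go i (i Fin.≟ q))
    where
    go : ∀ i → Dec (i ≡ q) → lookup (w [ σ ⟨$⟩ʳ q ]≔ j) (σ ⟨$⟩ʳ i) ≡ lookup ((w ∘ʷ σ) [ q ]≔ j) i
    go i (yes refl) = trans (Vec.lookup∘updateAt (σ ⟨$⟩ʳ i) w) (sym (Vec.lookup∘updateAt i (w ∘ʷ σ)))
    go i (no i≢q)   = trans (Vec.lookup∘updateAt′ (σ ⟨$⟩ʳ i) (σ ⟨$⟩ʳ q) (λ e → i≢q (trans (sym (inverseˡ σ)) (trans (cong (σ ⟨$⟩ˡ_) e) (inverseˡ σ)))) w)
      (sym (trans (Vec.lookup∘updateAt′ i q i≢q (w ∘ʷ σ)) (lookup-∘ʷ w σ i)))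

  -- Changing letters and permuting positions commute, as in Schur-Weyl duality.
  highestWeight-• : ∀ {n α} {v : Words n} σ → HighestWeight α v → HighestWeight α (σ • v)
  highestWeight-• {v = v} σ hv = record
    { content = λ w c ne → content hv (w ∘ʷ σ) c (λ e → ne (trans (sym (count-∘ʷ c w σ)) e))
    ; raising = λ i j p q w → trans (begin
        ∑ᶠ (λ p → 𝟙 (lookup w p ℕ.≟ i) * v ((w [ p ]≔ j) ∘ʷ σ))
          ≡⟨ ∑ᶠ-permute (λ p → 𝟙 (lookup w p ℕ.≟ i) * v ((w [ p ]≔ j) ∘ʷ σ)) σ ⟩
        ∑ᶠ (λ q → 𝟙 (lookup w (σ ⟨$⟩ʳ q) ℕ.≟ i) * v ((w [ σ ⟨$⟩ʳ q ]≔ j) ∘ʷ σ))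
          ≡⟨ ∑ᶠ-cong (λ q → cong₂ (λ x u → 𝟙 (x ℕ.≟ i) * v u) (sym (lookup-∘ʷ w σ q)) (update-∘ʷ w σ q j)) ⟩
        E i j v (w ∘ʷ σ) ∎) (raising hv i j p q (w ∘ʷ σ)) }

  •-operator : ∀ {n α} → Permutation′ n → Operator {n} α
  •-operator σ = record
    { apply = σ •_ ; respects = λ e w → e (w ∘ʷ σ) ; linear = λ s u v w → refl ; preserve = highestWeight-• σ }

-- Formal sums of permutations with recorded letters

module PartialPermutations where

  open Rationals
  open Sums
  open Differences
  open import Data.Fin.Base using (zero; suc)

  -- A term is a coefficient, the letters it was built from, and a permutation
  -- which moves only these letters.
  Term : ℕ → Set
  Term n = ℚ × List (Fin n) × Permutation′ n

  FormalSum : ℕ → Set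
  FormalSum n = List (Term n)

  module _ {n : ℕ} where

    ⟨_,_⟩ : FormalSum n → (List (Fin n) → Permutation′ n → ℚ) → ℚ
    ⟨ F , φ ⟩ = ∑ F (λ (c , ls , p) → c * φ ls p)

    ⟨⟩-++ : ∀ F G φ → ⟨ F ++ G , φ ⟩ ≡ ⟨ F , φ ⟩ + ⟨ G , φ ⟩
    ⟨⟩-++ F G φ = ∑-++ F G _

    ⟨⟩-cong : ∀ F {φ ψ} → (∀ ls p → φ ls p ≡ ψ ls p) → ⟨ F , φ ⟩ ≡ ⟨ F , ψ ⟩
    ⟨⟩-cong F e = ∑-cong F (λ (c , ls , p) → cong (c *_) (e ls p))

    ⟨⟩-*ʳ : ∀ F φ s → ⟨ F , (λ ls p → φ ls p * s) ⟩ ≡ ⟨ F , φ ⟩ * s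
    ⟨⟩-*ʳ F φ s = trans (∑-cong F (λ (c , ls , p) → sym (*-assoc c (φ ls p) s))) (∑-*ʳ s F _)

    infixr 7 _⊛_
    -- Lists of letters are concatenated with repetitions, so their lengths add up and measure the
    -- degree of a term.
    _⊛_ : FormalSum n → FormalSum n → FormalSum n
    F ⊛ G = concatMap (λ (c , ls , p) → map (λ (d , ms , q) → c * d , ls ++ ms , p ∘ₚ q) G) F

    ⟨⟩-⊛ : ∀ F G φ → ⟨ F ⊛ G , φ ⟩ ≡ ⟨ F , (λ ls p → ⟨ G , (λ ms q → φ (ls ++ ms) (p ∘ₚ q)) ⟩) ⟩
    ⟨⟩-⊛ F G φ = trans (∑-concatMap (λ (c , ls , p) → map (λ (d , ms , q) → c * d , ls ++ ms , p ∘ₚ q) G) F _)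
      (∑-cong F (λ (c , ls , p) → trans (∑-map (λ (d , ms , q) → c * d , ls ++ ms , p ∘ₚ q) G _)
        (trans (∑-cong G (λ (d , ms , q) → *-assoc c d (φ (ls ++ ms) (p ∘ₚ q)))) (∑-*ˡ c G _))))

    scalar : ℚ → FormalSum n
    scalar c = (c , [] , Perm.id) ∷ []

    transpositions : Fin n → List (Fin n) → FormalSum n
    transpositions x ys = map (λ y → 1# , y ∷ [] , transpose x y) ys

    power : FormalSum n → ℕ → FormalSum n
    power F zero    = scalar 1#
    power F (suc k) = F ⊛ power F k

    -- The subtracted constant carries no letters, so it is of lower degree in the letter count.
    pred′ : FormalSum n → FormalSum n
    pred′ F = F ++ scalar (- 1#)

    -- X^k - (X - 1)^k without cancellation, as the sum of all X^a (X - 1)^b with a + b = k - 1.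
    difference : FormalSum n → ℕ → FormalSum n
    difference F zero    = []
    difference F (suc k) = power F k ++ difference F k ⊛ pred′ F

    -- Adds the base letter x, which `transpositions` does not record.
    mark : Fin n → FormalSum n → FormalSum n
    mark x F = map (λ (c , ls , p) → c , x ∷ ls , p) F

    ⟨⟩-mark : ∀ x F φ → ⟨ mark x F , φ ⟩ ≡ ⟨ F , (λ ls p → φ (x ∷ ls) p) ⟩
    ⟨⟩-mark x F φ = ∑-map (λ (c , ls , p) → c , x ∷ ls , p) F _

    -- The sum of X^k - (X - 1)^k over the Jucys-Murphy elements X of the listed letters, each taken
    -- with respect to the letters after it.
    powerSum : ℕ → List (Fin n) → FormalSum n
    powerSum k []       = []
    powerSum k (x ∷ ys) = mark x (difference (transpositions x ys) k) ++ powerSum k ys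

    powerSums : List ℕ → List (Fin n) → FormalSum n
    powerSums []      xs = scalar 1#
    powerSums (k ∷ μ) xs = powerSum k xs ⊛ powerSums μ xs

    opaque
      _∈?_ : ∀ (x : Fin n) xs → Dec (x ∈ xs)
      _∈?_ = member? Fin._≟_

    inside : List (Fin n) → List (Fin n) → ℚ
    inside X []       = 1#
    inside X (l ∷ ls) = 𝟙 (l ∈? X) * inside X ls

    inside-++ : ∀ X ls ms → inside X (ls ++ ms) ≡ inside X ls * inside X ms
    inside-++ X []       ms = sym (*-identityˡ _)
    inside-++ X (l ∷ ls) ms = trans (cong (𝟙 (l ∈? X) *_) (inside-++ X ls ms)) (sym (*-assoc (𝟙 (l ∈? X)) _ _))

    -- Keeping the terms with all letters in X turns F into G.
    Restricts : List (Fin n) → FormalSum n → FormalSum n → Set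
    Restricts X F G = ∀ φ → ⟨ F , (λ ls p → inside X ls * φ ls p) ⟩ ≡ ⟨ G , φ ⟩

    restricts-scalar : ∀ X c → Restricts X (scalar c) (scalar c)
    restricts-scalar X c φ = cong (λ z → c * z + 0#) (*-identityˡ (φ [] Perm.id))

    restricts-[] : ∀ X → Restricts X [] []
    restricts-[] X φ = refl

    restricts-++ : ∀ {X F F′ G G′} → Restricts X F F′ → Restricts X G G′ → Restricts X (F ++ G) (F′ ++ G′)
    restricts-++ {X} {F} {F′} {G} {G′} r s φ = trans (⟨⟩-++ F G _) (trans (cong₂ _+_ (r φ) (s φ)) (sym (⟨⟩-++ F′ G′ φ)))

    restricts-⊛ : ∀ {X F F′ G G′} → Restricts X F F′ → Restricts X G G′ → Restricts X (F ⊛ G) (F′ ⊛ G′)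
    restricts-⊛ {X} {F} {F′} {G} {G′} r s φ = begin
      ⟨ F ⊛ G , (λ ls p → inside X ls * φ ls p) ⟩
        ≡⟨ ⟨⟩-⊛ F G _ ⟩
      ⟨ F , (λ ls p → ⟨ G , (λ ms q → inside X (ls ++ ms) * φ (ls ++ ms) (p ∘ₚ q)) ⟩) ⟩
        ≡⟨ ⟨⟩-cong F (λ ls p → trans (∑-cong G (λ (d , ms , q) → trans (cong (λ z → d * (z * φ (ls ++ ms) (p ∘ₚ q))) (inside-++ X ls ms))
             (solve 4 (λ d a b f → d :* ((a :* b) :* f) := a :* (d :* (b :* f))) refl d (inside X ls) (inside X ms) (φ (ls ++ ms) (p ∘ₚ q)))))
             (trans (∑-*ˡ (inside X ls) G _) (cong (inside X ls *_) (s (λ ms q → φ (ls ++ ms) (p ∘ₚ q)))))) ⟩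
      ⟨ F , (λ ls p → inside X ls * ⟨ G′ , (λ ms q → φ (ls ++ ms) (p ∘ₚ q)) ⟩) ⟩
        ≡⟨ r _ ⟩
      ⟨ F′ , (λ ls p → ⟨ G′ , (λ ms q → φ (ls ++ ms) (p ∘ₚ q)) ⟩) ⟩
        ≡⟨ ⟨⟩-⊛ F′ G′ φ ⟨
      ⟨ F′ ⊛ G′ , φ ⟩ ∎

    restricts-power : ∀ {X F G} → Restricts X F G → ∀ k → Restricts X (power F k) (power G k)
    restricts-power {X} r zero            = restricts-scalar X 1#
    restricts-power {X} {F} {G} r (suc k) = restricts-⊛ {F = F} {G} {power F k} {power G k} r (restricts-power {X} {F} {G} r k)

    restricts-difference : ∀ {X F G} → Restricts X F G → ∀ k → Restricts X (difference F k) (difference G k)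
    restricts-difference {X} r zero            = restricts-[] X
    restricts-difference {X} {F} {G} r (suc k) = restricts-++ {X} {power F k} {power G k} {difference F k ⊛ pred′ F} {difference G k ⊛ pred′ G}
      (restricts-power {X} {F} {G} r k)
      (restricts-⊛ {X} {difference F k} {difference G k} {pred′ F} {pred′ G} (restricts-difference {X} {F} {G} r k)
        (restricts-++ {X} {F} {G} {scalar (- 1#)} {scalar (- 1#)} r (restricts-scalar X (- 1#))))

    -- The set `X` stays fixed while the lists are consumed, so the hypotheses express only that
    -- `xs` consists of the letters of `zs` in `X`.
    restricts-transpositions : ∀ {X} x {zs xs} → Unique zs → xs ⊆ zs → (∀ {y} → y ∈ zs → y ∈ X → y ∈ xs) → (∀ {y} → y ∈ xs → y ∈ X) →
      Restricts X (transpositions x zs) (transpositions x xs)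
    restricts-transpositions x u        []        to from φ = refl
    restricts-transpositions {X} x {z ∷ zs} {xs} (z∉ ∷ u) (z Sub.∷ʳ s) to from φ = trans
      (cong₂ _+_ (trans (cong (1# *_) (trans (cong (_* φ (z ∷ []) (transpose x z)) (trans (cong (_* 1#) (𝟙-no (z ∈? X) (λ z∈ → All.lookup z∉ (Sub.lookup s (to (here refl) z∈)) refl))) (zeroˡ _))) (zeroˡ _))) (zeroʳ _))
        (restricts-transpositions x u s (to ∘ there) from φ))
      (+-identityˡ _)
    restricts-transpositions {X} x {z ∷ zs} {z ∷ xs} (z∉ ∷ u) (refl ∷ s) to from φ = cong₂ _+_
      (cong (1# *_) (trans (cong (λ i → (i * 1#) * φ (z ∷ []) (transpose x z)) (𝟙-yes (z ∈? X) (from (here refl)))) (solve 1 (λ a → (con one :* con one) :* a := a) refl _)))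
      (restricts-transpositions x u s (λ y∈ yX → tail′ y∈ (to (there y∈) yX)) (from ∘ there) φ)
      where
      tail′ : ∀ {y} → y ∈ zs → y ∈ z ∷ xs → y ∈ xs
      tail′ y∈ (here refl) = contradiction refl (All.lookup z∉ y∈)
      tail′ y∈ (there q)   = q

    restricts-powerSum : ∀ {X} k {zs xs} → Unique zs → xs ⊆ zs → (∀ {y} → y ∈ zs → y ∈ X → y ∈ xs) → (∀ {y} → y ∈ xs → y ∈ X) →
      Restricts X (powerSum k zs) (powerSum k xs)
    restricts-powerSum k u        []        to from φ = refl
    restricts-powerSum {X} k {z ∷ zs} {xs} (z∉ ∷ u) (z Sub.∷ʳ s) to from φ = trans (⟨⟩-++ (mark z (difference (transpositions z zs) k)) (powerSum k zs) _) (trans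
      (cong₂ _+_ (trans (⟨⟩-mark z (difference (transpositions z zs) k) _) (∑-zero (difference (transpositions z zs) k) (λ (c , ls , p) →
          trans (cong (λ i → c * ((i * inside X ls) * φ (z ∷ ls) p)) (𝟙-no (z ∈? X) (λ z∈ → All.lookup z∉ (Sub.lookup s (to (here refl) z∈)) refl)))
            (solve 3 (λ c i f → c :* ((con (ℤ.+ 0) :* i) :* f) := con (ℤ.+ 0)) refl c (inside X ls) (φ (z ∷ ls) p)))))
        (restricts-powerSum k u s (to ∘ there) from φ))
      (+-identityˡ _))
    restricts-powerSum {X} k {z ∷ zs} {z ∷ xs} (z∉ ∷ u) (refl ∷ s) to from φ = begin
      ⟨ mark z (difference (transpositions z zs) k) ++ powerSum k zs , (λ ls p → inside X ls * φ ls p) ⟩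
        ≡⟨ ⟨⟩-++ (mark z (difference (transpositions z zs) k)) (powerSum k zs) _ ⟩
      ⟨ mark z (difference (transpositions z zs) k) , (λ ls p → inside X ls * φ ls p) ⟩ + ⟨ powerSum k zs , (λ ls p → inside X ls * φ ls p) ⟩
        ≡⟨ cong₂ _+_ (trans (⟨⟩-mark z (difference (transpositions z zs) k) _) (trans
             (⟨⟩-cong (difference (transpositions z zs) k) (λ ls p → cong (_* φ (z ∷ ls) p) (𝟙-yes* (z ∈? X) (from (here refl)) (inside X ls))))
             (trans (restricts-difference {X} {transpositions z zs} {transpositions z xs} (restricts-transpositions z u s tail″ (from ∘ there)) k (λ ls p → φ (z ∷ ls) p))
               (sym (⟨⟩-mark z (difference (transpositions z xs) k) φ)))))
             (restricts-powerSum k u s tail″ (from ∘ there) φ) ⟩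
      ⟨ mark z (difference (transpositions z xs) k) , φ ⟩ + ⟨ powerSum k xs , φ ⟩
        ≡⟨ ⟨⟩-++ (mark z (difference (transpositions z xs) k)) (powerSum k xs) φ ⟨
      ⟨ powerSum k (z ∷ xs) , φ ⟩ ∎
      where
      tail′ : ∀ {y} → y ∈ zs → y ∈ z ∷ xs → y ∈ xs
      tail′ y∈ (here refl) = contradiction refl (All.lookup z∉ y∈)
      tail′ y∈ (there q)   = q
      tail″ : ∀ {y} → y ∈ zs → y ∈ X → y ∈ xs
      tail″ y∈ yX = tail′ y∈ (to (there y∈) yX)

    -- Sublists keep the order of the letters, so the Jucys-Murphy elements of `xs` are those of
    -- `zs` with the other letters struck out.
    restricts-powerSums : ∀ μ {zs xs} → Unique zs → xs ⊆ zs → Restricts xs (powerSums μ zs) (powerSums μ xs)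
    restricts-powerSums []      {xs = xs} u s = restricts-scalar xs 1#
    restricts-powerSums (k ∷ μ) {zs} {xs} u s = restricts-⊛ {xs} {powerSum k zs} {powerSum k xs} {powerSums μ zs} {powerSums μ xs}
      (restricts-powerSum k u s (λ _ → id) id) (restricts-powerSums μ u s)

    -- Inclusion–exclusion over the sublists of zs.
    alternatingSublists : List (Fin n) → (List (Fin n) → ℚ) → ℚ
    alternatingSublists []       f = f []
    alternatingSublists (z ∷ zs) f = alternatingSublists zs (λ xs → f (z ∷ xs) - f xs)

    alternatingSublists-cong : ∀ zs {f g} → (∀ xs → xs ⊆ zs → f xs ≡ g xs) → alternatingSublists zs f ≡ alternatingSublists zs g
    alternatingSublists-cong []       e = e [] []
    alternatingSublists-cong (z ∷ zs) e = alternatingSublists-cong zs (λ xs s → cong₂ _-_ (e (z ∷ xs) (refl ∷ s)) (e xs (z Sub.∷ʳ s)))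

    alternatingSublists-*ˡ : ∀ zs c f → alternatingSublists zs (λ xs → c * f xs) ≡ c * alternatingSublists zs f
    alternatingSublists-*ˡ []       c f = refl
    alternatingSublists-*ˡ (z ∷ zs) c f = trans (alternatingSublists-cong zs (λ xs _ → solve 3 (λ c a b → c :* a :- c :* b := c :* (a :- b)) refl c _ _))
      (alternatingSublists-*ˡ zs c _)

    alternatingSublists-+ : ∀ zs f g → alternatingSublists zs (λ xs → f xs + g xs) ≡ alternatingSublists zs f + alternatingSublists zs g
    alternatingSublists-+ []       f g = refl
    alternatingSublists-+ (z ∷ zs) f g = trans (alternatingSublists-cong zs (λ xs _ → solve 4 (λ a b c d → (a :+ b) :- (c :+ d) := (a :- c) :+ (b :- d)) refl _ _ _ _))
      (alternatingSublists-+ zs _ _)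

    alternatingSublists-0 : ∀ zs → alternatingSublists zs (λ _ → 0#) ≡ 0#
    alternatingSublists-0 []       = refl
    alternatingSublists-0 (z ∷ zs) = trans (alternatingSublists-cong zs (λ _ _ → solve 0 (con (ℤ.+ 0) :- con (ℤ.+ 0) := con (ℤ.+ 0)) refl)) (alternatingSublists-0 zs)

    alternatingSublists-∑ : ∀ {I : Set} zs (is : List I) (f : I → List (Fin n) → ℚ) → alternatingSublists zs (λ xs → ∑ is (λ i → f i xs)) ≡ ∑ is (λ i → alternatingSublists zs (f i))
    alternatingSublists-∑ zs []       f = alternatingSublists-0 zs
    alternatingSublists-∑ zs (i ∷ is) f = trans (alternatingSublists-+ zs (f i) _) (cong (alternatingSublists zs (f i) +_) (alternatingSublists-∑ zs is f))

    -- This links inclusion-exclusion with `Δ`: for a function of the length alone, adding a letter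
    -- means increasing the second index.
    alternatingSublists-length : ∀ zs (t : ℕ → ℚ) → alternatingSublists zs (t ∘ length) ≡ Δ (length zs) (λ _ m → t m)
    alternatingSublists-length []       t = refl
    alternatingSublists-length (z ∷ zs) t = alternatingSublists-length zs (λ m → t (suc m) - t m)

    covers : List (Fin n) → List (Fin n) → ℚ
    covers []       ls = 1#
    covers (z ∷ zs) ls = 𝟙 (z ∈? ls) * covers zs ls

    without : Fin n → List (Fin n) → List (Fin n)
    without z = filter (λ l → ¬? (l Fin.≟ z))

    -- A letter that does not occur in `ls` makes the two terms of its difference equal. For a
    -- letter that occurs only the term containing it survives, and the letter may then be deleted
    -- from `ls`.
    inclusion-exclusion : ∀ {zs} → Unique zs → ∀ ls → All (_∈ zs) ls → alternatingSublists zs (λ xs → inside xs ls) ≡ covers zs ls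
    inclusion-exclusion {[]}     u        []       _        = refl
    inclusion-exclusion {[]}     u        (l ∷ ls) (() ∷ _)
    inclusion-exclusion {z ∷ zs} (z∉ ∷ u) ls       ls∈ with z ∈? ls
    ... | no z∉ls = trans (alternatingSublists-cong zs (λ xs s → trans (cong (_- inside xs ls) (inside-∷-∉ z xs ls z∉ls)) (solve 1 (λ a → a :- a := con (ℤ.+ 0)) refl _)))
                      (trans (alternatingSublists-0 zs) (sym (zeroˡ _)))
      where
      inside-∷-∉ : ∀ z xs ls → ¬ z ∈ ls → inside (z ∷ xs) ls ≡ inside xs ls
      inside-∷-∉ z xs []       _  = refl
      inside-∷-∉ z xs (l ∷ ls) ∉ = cong₂ _*_ (𝟙-⇔ (l ∈? (z ∷ xs)) (l ∈? xs) (λ { (here refl) → contradiction (here refl) ∉ ; (there q) → q }) there)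
        (inside-∷-∉ z xs ls (∉ ∘ there))
    ... | yes z∈ls = begin
      alternatingSublists zs (λ xs → inside (z ∷ xs) ls - inside xs ls)
        ≡⟨ alternatingSublists-cong zs (λ xs s → trans (cong₂ _-_ (inside-without xs ls) (inside-0 xs ls z∈ls (λ z∈xs → All.lookup z∉ (Sub.lookup s z∈xs) refl)))
             (solve 1 (λ a → a :- con (ℤ.+ 0) := a) refl _)) ⟩
      alternatingSublists zs (λ xs → inside xs (without z ls))
        ≡⟨ inclusion-exclusion u (without z ls) (All.tabulate (λ {l} l∈ → tail′ (∈-filter⁻ (λ l → ¬? (l Fin.≟ z)) l∈))) ⟩
      covers zs (without z ls)
        ≡⟨ covers-without zs z∉ ⟩
      covers zs ls
        ≡⟨ *-identityˡ _ ⟨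
      1# * covers zs ls ∎
      where
      tail′ : ∀ {l} → l ∈ ls × l ≢ z → l ∈ zs
      tail′ (l∈ , l≢z) with All.lookup ls∈ l∈
      ... | here e  = contradiction e l≢z
      ... | there q = q
      inside-without : ∀ xs ls → inside (z ∷ xs) ls ≡ inside xs (without z ls)
      inside-without xs []       = refl
      inside-without xs (l ∷ ls) with l Fin.≟ z
      ... | yes refl = trans (𝟙-yes* (l ∈? (l ∷ xs)) (here refl) _) (inside-without xs ls)
      ... | no l≢z   = cong₂ _*_ (𝟙-⇔ (l ∈? (z ∷ xs)) (l ∈? xs) (λ { (here e) → contradiction e l≢z ; (there q) → q }) there) (inside-without xs ls)
      inside-0 : ∀ xs ls → z ∈ ls → ¬ z ∈ xs → inside xs ls ≡ 0#
      inside-0 xs (l ∷ ls) (here refl) z∉ = 𝟙-no* (l ∈? xs) z∉ _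
      inside-0 xs (l ∷ ls) (there q)   z∉ = trans (cong (𝟙 (l ∈? xs) *_) (inside-0 xs ls q z∉)) (zeroʳ _)
      covers-without : ∀ ys → All (z ≢_) ys → covers ys (without z ls) ≡ covers ys ls
      covers-without []       _        = refl
      covers-without (y ∷ ys) (p ∷ ps) = cong₂ _*_ (𝟙-⇔ (y ∈? without z ls) (y ∈? ls) (λ q → proj₁ (∈-filter⁻ (λ l → ¬? (l Fin.≟ z)) q))
        (λ q → ∈-filter⁺ (λ l → ¬? (l Fin.≟ z)) q (p ∘ sym))) (covers-without ys ps)

    -- Of the terms only those survive whose letters exhaust zs.
    alternating-powerSums : ∀ μ {zs} → Unique zs → (χ : Permutation′ n → ℚ) → All (λ (_ , ls , _) → All (_∈ zs) ls) (powerSums μ zs) →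
      alternatingSublists zs (λ xs → ⟨ powerSums μ xs , (λ _ p → χ p) ⟩) ≡ ⟨ powerSums μ zs , (λ ls p → covers zs ls * χ p) ⟩
    alternating-powerSums μ {zs} u χ letters = begin
      alternatingSublists zs (λ xs → ⟨ powerSums μ xs , (λ _ p → χ p) ⟩)
        ≡⟨ alternatingSublists-cong zs (λ xs s → sym (restricts-powerSums μ u s (λ _ p → χ p))) ⟩
      alternatingSublists zs (λ xs → ⟨ powerSums μ zs , (λ ls p → inside xs ls * χ p) ⟩)
        ≡⟨ alternatingSublists-∑ zs (powerSums μ zs) _ ⟩
      ∑ (powerSums μ zs) (λ (c , ls , p) → alternatingSublists zs (λ xs → c * (inside xs ls * χ p)))
        ≡⟨ ∑-cong∈ (powerSums μ zs) (λ {(c , ls , p)} t∈ → trans (alternatingSublists-cong zs (λ xs _ → solve 3 (λ c i x → c :* (i :* x) := (c :* x) :* i) refl c (inside xs ls) (χ p)))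
             (trans (alternatingSublists-*ˡ zs (c * χ p) (λ xs → inside xs ls)) (trans (cong ((c * χ p) *_) (inclusion-exclusion u ls (All.lookup letters t∈)))
               (solve 3 (λ c x i → (c :* x) :* i := c :* (i :* x)) refl c (χ p) (covers zs ls))))) ⟩
      ⟨ powerSums μ zs , (λ ls p → covers zs ls * χ p) ⟩ ∎

    Letters : List (Fin n) → FormalSum n → Set
    Letters zs = All (λ (_ , ls , _) → All (_∈ zs) ls)

    All-⊛ : ∀ (P Q R : Term n → Set) F G → (∀ c ls p d ms q → P (c , ls , p) → Q (d , ms , q) → R (c * d , ls ++ ms , p ∘ₚ q)) →
      All P F → All Q G → All R (F ⊛ G)
    All-⊛ P Q R []                 G f []       qs = []
    All-⊛ P Q R ((c , ls , p) ∷ F) G f (x ∷ ps) qs = All.++⁺ (All.map⁺ (All.map (λ {(d , ms , q)} y → f c ls p d ms q x y) qs)) (All-⊛ P Q R F G f ps qs)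

    letters-⊛ : ∀ {zs F G} → Letters zs F → Letters zs G → Letters zs (F ⊛ G)
    letters-⊛ {zs} {F} {G} = All-⊛ _ _ _ F G (λ _ _ _ _ _ _ → All.++⁺)

    letters-difference : ∀ {zs F} → Letters zs F → ∀ k → Letters zs (difference F k)
    letters-difference {zs} L zero    = []
    letters-difference {zs} {F} L (suc k) = All.++⁺ (powers k) (letters-⊛ {zs} {difference F k} {pred′ F} (letters-difference L k) (All.++⁺ L ([] ∷ [])))
      where
      powers : ∀ k → Letters zs (power F k)
      powers zero    = [] ∷ []
      powers (suc k) = letters-⊛ {zs} {F} {power F k} L (powers k)

    letters-powerSum : ∀ k zs → Letters zs (powerSum k zs)
    letters-powerSum k []       = []
    letters-powerSum k (z ∷ zs) = All.++⁺
      (All.map⁺ (All.map (here refl ∷_) (letters-difference (All.map⁺ (All.tabulate (λ y∈ → there y∈ ∷ []))) k)))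
      (All.map (All.map there) (letters-powerSum k zs))

    letters-powerSums : ∀ μ zs → Letters zs (powerSums μ zs)
    letters-powerSums []      zs = [] ∷ []
    letters-powerSums (k ∷ μ) zs = letters-⊛ {zs} {powerSum k zs} {powerSums μ zs} (letters-powerSum k zs) (letters-powerSums μ zs)

    -- As `_∘ₚ_` applies its left factor first, for distinct letters x goes to the first entry of
    -- `ys`, each entry to the next one, and the last back to x.
    cycle : Fin n → List (Fin n) → Permutation′ n
    cycle x []       = Perm.id
    cycle x (y ∷ ys) = transpose x y ∘ₚ cycle x ys

    cycle-++ : ∀ x ys y → cycle x (ys ++ y ∷ []) ≈ cycle x ys ∘ₚ transpose x y
    cycle-++ x []       y i = refl
    cycle-++ x (z ∷ ys) y i = cycle-++ x ys y (transpose x z ⟨$⟩ʳ i)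

    cycles : List (Fin n × List (Fin n)) → Permutation′ n
    cycles []              = Perm.id
    cycles ((x , ys) ∷ bs) = cycle x ys ∘ₚ cycles bs

    block : Fin n × List (Fin n) → List (Fin n)
    block (x , ys) = x ∷ ys

    -- Below the top degree only the number of letters is controlled; at the top the letters
    -- determine the permutation.
    CycleTerm : Fin n → ℕ → Term n → Set
    CycleTerm x m (_ , ls , p) = length ls < m ⊎ length ls ≡ m × p ≈ cycle x ls

    SingleTerm : Fin n → Term n → Set
    SingleTerm x (_ , ls , p) = ∃[ y ] ls ≡ y ∷ [] × p ≡ transpose x y

    -- X^k - (X - 1)^k has degree k - 1. The predecessor exists because there are no terms for k =
    -- 0.
    CycleTerm′ : Fin n → ℕ → Term n → Set
    CycleTerm′ x k t = ∃[ m ] k ≡ suc m × CycleTerm x m t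

    cycleTerm-power : ∀ x ys k → All (CycleTerm x k) (power (transpositions x ys) k)
    cycleTerm-power x ys zero    = inj₂ (refl , λ _ → refl) ∷ []
    cycleTerm-power x ys (suc k) = All-⊛ (SingleTerm x) (CycleTerm x k) (CycleTerm x (suc k)) (transpositions x ys) (power (transpositions x ys) k)
      (λ { c ls p d ms q (y , refl , refl) (inj₁ l<k)       → inj₁ (s≤s l<k)
         ; c ls p d ms q (y , refl , refl) (inj₂ (refl , e)) → inj₂ (refl , λ i → e (transpose x y ⟨$⟩ʳ i)) })
      (All.map⁺ (All.tabulate (λ {y} _ → y , refl , refl))) (cycleTerm-power x ys k)

    cycleTerm-difference : ∀ x ys k → All (CycleTerm′ x k) (difference (transpositions x ys) k)
    cycleTerm-difference x ys zero    = []
    cycleTerm-difference x ys (suc k) = All.++⁺ (All.map (λ c → k , refl , c) (cycleTerm-power x ys k))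
      (All-⊛ (CycleTerm′ x k) Factor (CycleTerm′ x (suc k)) (difference (transpositions x ys) k) (pred′ (transpositions x ys)) step (cycleTerm-difference x ys k)
        (All.++⁺ (All.map⁺ (All.tabulate (λ {y} _ → inj₁ (y , refl , refl)))) (inj₂ refl ∷ [])))
      where
      Factor : Term n → Set
      Factor t = SingleTerm x t ⊎ proj₁ (proj₂ t) ≡ []
      step : ∀ c ls p d ms q → CycleTerm′ x k (c , ls , p) → Factor (d , ms , q) → CycleTerm′ x (suc k) (c * d , ls ++ ms , p ∘ₚ q)
      step c ls p d ms q (m , refl , inj₁ l<m) (inj₁ (y , refl , refl)) = suc m , refl ,
        inj₁ (subst (_< suc m) (sym (trans (List.length-++ ls) (ℕ.+-comm (length ls) 1))) (s≤s l<m))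
      step c ls p d ms q (m , refl , inj₂ (refl , e)) (inj₁ (y , refl , refl)) = suc m , refl ,
        inj₂ (trans (List.length-++ ls) (ℕ.+-comm (length ls) 1) , λ i → trans (cong (transpose x y ⟨$⟩ʳ_) (e i)) (sym (cycle-++ x ls y i)))
      -- The constant -1 brings no letter, so this term drops below the top degree.
      step c ls p d ms q (m , refl , t) (inj₂ refl) = suc m , refl , inj₁ (subst (_< suc m) (sym (cong length (List.++-identityʳ ls))) (short t))
        where
        short : CycleTerm x m (c , ls , p) → length ls < suc m
        short (inj₁ l<m)     = ℕ.m<n⇒m<1+n l<m
        short (inj₂ (e , _)) = s≤s (ℕ.≤-reflexive e)

    -- The terms with the maximal number of letters are products of cycles.
    TopTerm : List ℕ → Term n → Set
    TopTerm μ (_ , ls , p) = length ls < sum μ ⊎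
      Σ[ bs ∈ List (Fin n × List (Fin n)) ] ls ≡ concat (map block bs) × map (length ∘ block) bs ≡ μ × p ≈ cycles bs

    TopBlock : ℕ → Term n → Set
    TopBlock k (_ , ls , p) = length ls < k ⊎
      Σ[ b ∈ Fin n × List (Fin n) ] ls ≡ block b × length ls ≡ k × p ≈ cycle (proj₁ b) (proj₂ b)

    topTerm-powerSum : ∀ k zs → All (TopBlock k) (powerSum k zs)
    topTerm-powerSum k []       = []
    topTerm-powerSum k (z ∷ zs) = All.++⁺ (All.map⁺ (All.map
      (λ { {c , ls , p} (m , refl , inj₁ l<m) → inj₁ (s≤s l<m) ; {c , ls , p} (m , refl , inj₂ (refl , e)) → inj₂ ((z , ls) , refl , refl , e) })
      (cycleTerm-difference z zs k))) (topTerm-powerSum k zs)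

    topTerm-powerSums : ∀ μ zs → All (TopTerm μ) (powerSums μ zs)
    topTerm-powerSums []      zs = inj₂ ([] , refl , refl , λ _ → refl) ∷ []
    topTerm-powerSums (k ∷ μ) zs = All-⊛ (TopBlock k) (TopTerm μ) (TopTerm (k ∷ μ)) (powerSum k zs) (powerSums μ zs) step (topTerm-powerSum k zs) (topTerm-powerSums μ zs)
      where
      lengths : ∀ bs → length (concat (map block bs)) ≡ sum (map (length ∘ block) bs)
      lengths []       = refl
      lengths (b ∷ bs) = trans (List.length-++ (block b)) (cong (length (block b) ℕ.+_) (lengths bs))
      bound : ∀ c ls p → TopTerm μ (c , ls , p) → length ls ≤ sum μ
      bound c ls p (inj₁ l<)                      = ℕ.<⇒≤ l<
      bound c ls p (inj₂ (bs , refl , refl , _)) = ℕ.≤-reflexive (lengths bs)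
      bound′ : ∀ c ls p → TopBlock k (c , ls , p) → length ls ≤ k
      bound′ c ls p (inj₁ l<)              = ℕ.<⇒≤ l<
      bound′ c ls p (inj₂ (_ , _ , e , _)) = ℕ.≤-reflexive e
      step : ∀ c ls p d ms q → TopBlock k (c , ls , p) → TopTerm μ (d , ms , q) → TopTerm (k ∷ μ) (c * d , ls ++ ms , p ∘ₚ q)
      step c ls p d ms q (inj₁ l<) t = inj₁ (subst (_< k ℕ.+ sum μ) (sym (List.length-++ ls)) (ℕ.+-mono-<-≤ l< (bound d ms q t)))
      step c ls p d ms q b (inj₁ l<) = inj₁ (subst (_< k ℕ.+ sum μ) (sym (List.length-++ ls)) (ℕ.+-mono-≤-< (bound′ c ls p b) l<))
      step c ls p d ms q (inj₂ ((x , ys) , refl , e , f)) (inj₂ (bs , refl , g , h)) =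
        inj₂ ((x , ys) ∷ bs , refl , cong₂ _∷_ e g , λ i → trans (cong (q ⟨$⟩ʳ_) (f i)) (h (cycle x ys ⟨$⟩ʳ i)))

    conjugate : Permutation′ n → Permutation′ n → Permutation′ n
    conjugate g p = flip g ∘ₚ p ∘ₚ g

    Respects : (List (Fin n) → Permutation′ n → ℚ) → Set
    Respects φ = ∀ ls {p q} → p ≈ q → φ ls p ≡ φ ls q

    -- Renaming the letters by g turns F into G.
    Renames : Permutation′ n → FormalSum n → FormalSum n → Set
    Renames g F G = ∀ φ → Respects φ → ⟨ G , φ ⟩ ≡ ⟨ F , (λ ls p → φ (map (g ⟨$⟩ʳ_) ls) (conjugate g p)) ⟩

    renames-scalar : ∀ g c → Renames g (scalar c) (scalar c)
    renames-scalar g c φ r = cong (λ z → c * z + 0#) (r [] (λ i → sym (inverseʳ g)))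

    renames-++ : ∀ {g F F′ G G′} → Renames g F F′ → Renames g G G′ → Renames g (F ++ G) (F′ ++ G′)
    renames-++ {g} {F} {F′} {G} {G′} r s φ ρ = trans (⟨⟩-++ F′ G′ φ) (trans (cong₂ _+_ (r φ ρ) (s φ ρ)) (sym (⟨⟩-++ F G _)))

    renames-⊛ : ∀ {g F F′ G G′} → Renames g F F′ → Renames g G G′ → Renames g (F ⊛ G) (F′ ⊛ G′)
    renames-⊛ {g} {F} {F′} {G} {G′} r s φ ρ = begin
      ⟨ F′ ⊛ G′ , φ ⟩
        ≡⟨ ⟨⟩-⊛ F′ G′ φ ⟩
      ⟨ F′ , (λ ls p → ⟨ G′ , (λ ms q → φ (ls ++ ms) (p ∘ₚ q)) ⟩) ⟩
        ≡⟨ r _ (λ ls {p} {q} e → ⟨⟩-cong G′ (λ ms t → ρ (ls ++ ms) (λ i → cong (t ⟨$⟩ʳ_) (e i)))) ⟩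
      ⟨ F , (λ ls p → ⟨ G′ , (λ ms q → φ (map (g ⟨$⟩ʳ_) ls ++ ms) (conjugate g p ∘ₚ q)) ⟩) ⟩
        ≡⟨ ⟨⟩-cong F (λ ls p → trans (s _ (λ ms e → ρ (map (g ⟨$⟩ʳ_) ls ++ ms) (λ i → e (conjugate g p ⟨$⟩ʳ i))))
             (⟨⟩-cong G (λ ms q → trans (cong (λ l → φ l (conjugate g p ∘ₚ conjugate g q)) (sym (List.map-++ (g ⟨$⟩ʳ_) ls ms)))
               (ρ (map (g ⟨$⟩ʳ_) (ls ++ ms)) (λ i → cong (λ j → g ⟨$⟩ʳ (q ⟨$⟩ʳ j)) (inverseˡ g)))))) ⟩
      ⟨ F , (λ ls p → ⟨ G , (λ ms q → φ (map (g ⟨$⟩ʳ_) (ls ++ ms)) (conjugate g (p ∘ₚ q))) ⟩) ⟩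
        ≡⟨ ⟨⟩-⊛ F G _ ⟨
      ⟨ F ⊛ G , (λ ls p → φ (map (g ⟨$⟩ʳ_) ls) (conjugate g p)) ⟩ ∎

    ⟨$⟩ʳ-injective : ∀ (g : Permutation′ n) {i j} → g ⟨$⟩ʳ i ≡ g ⟨$⟩ʳ j → i ≡ j
    ⟨$⟩ʳ-injective g e = trans (sym (inverseˡ g)) (trans (cong (g ⟨$⟩ˡ_) e) (inverseˡ g))

    transpose-left : ∀ (x y : Fin n) → transpose x y ⟨$⟩ʳ x ≡ y
    transpose-left x y with x Fin.≟ x
    ... | yes _ = refl
    ... | no ¬p = contradiction refl ¬p

    transpose-right : ∀ (x y : Fin n) → transpose x y ⟨$⟩ʳ y ≡ x
    transpose-right x y with y Fin.≟ x
    ... | yes e = e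
    ... | no _ with y Fin.≟ y
    ...   | yes _ = refl
    ...   | no ¬p = contradiction refl ¬p

    transpose-other : ∀ {x y i : Fin n} → i ≢ x → i ≢ y → transpose x y ⟨$⟩ʳ i ≡ i
    transpose-other {x} {y} {i} i≢x i≢y with i Fin.≟ x
    ... | yes e = contradiction e i≢x
    ... | no _ with i Fin.≟ y
    ...   | yes e = contradiction e i≢y
    ...   | no _  = refl

    conjugate-transpose : ∀ g (x y : Fin n) → conjugate g (transpose x y) ≈ transpose (g ⟨$⟩ʳ x) (g ⟨$⟩ʳ y)
    conjugate-transpose g x y i = subst (λ k → g ⟨$⟩ʳ (transpose x y ⟨$⟩ʳ (g ⟨$⟩ˡ i)) ≡ transpose (g ⟨$⟩ʳ x) (g ⟨$⟩ʳ y) ⟨$⟩ʳ k) (inverseʳ g) (at (g ⟨$⟩ˡ i))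
      where
      at : ∀ j → g ⟨$⟩ʳ (transpose x y ⟨$⟩ʳ j) ≡ transpose (g ⟨$⟩ʳ x) (g ⟨$⟩ʳ y) ⟨$⟩ʳ (g ⟨$⟩ʳ j)
      at j = go (j Fin.≟ x) (j Fin.≟ y)
        where
        go : Dec (j ≡ x) → Dec (j ≡ y) → g ⟨$⟩ʳ (transpose x y ⟨$⟩ʳ j) ≡ transpose (g ⟨$⟩ʳ x) (g ⟨$⟩ʳ y) ⟨$⟩ʳ (g ⟨$⟩ʳ j)
        go (yes refl) _          = trans (cong (g ⟨$⟩ʳ_) (transpose-left x y)) (sym (transpose-left (g ⟨$⟩ʳ x) (g ⟨$⟩ʳ y)))
        go (no _)     (yes refl) = trans (cong (g ⟨$⟩ʳ_) (transpose-right x y)) (sym (transpose-right (g ⟨$⟩ʳ x) (g ⟨$⟩ʳ y)))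
        go (no j≢x)   (no j≢y)   = trans (cong (g ⟨$⟩ʳ_) (transpose-other j≢x j≢y))
          (sym (transpose-other (j≢x ∘ ⟨$⟩ʳ-injective g) (j≢y ∘ ⟨$⟩ʳ-injective g)))

    renames-transpositions : ∀ g x ys → Renames g (transpositions x ys) (transpositions (g ⟨$⟩ʳ x) (map (g ⟨$⟩ʳ_) ys))
    renames-transpositions g x []       φ r = refl
    renames-transpositions g x (y ∷ ys) φ r = cong₂ (λ a b → 1# * a + b) (r ((g ⟨$⟩ʳ y) ∷ []) (λ i → sym (conjugate-transpose g x y i)))
      (renames-transpositions g x ys φ r)

    renames-power : ∀ {g F G} → Renames g F G → ∀ k → Renames g (power F k) (power G k)
    renames-power {g} r zero            = renames-scalar g 1#
    renames-power {g} {F} {G} r (suc k) = renames-⊛ {g} {F} {G} {power F k} {power G k} r (renames-power {g} {F} {G} r k)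

    renames-difference : ∀ {g F G} → Renames g F G → ∀ k → Renames g (difference F k) (difference G k)
    renames-difference {g} r zero            φ ρ = refl
    renames-difference {g} {F} {G} r (suc k) = renames-++ {g} {power F k} {power G k} {difference F k ⊛ pred′ F} {difference G k ⊛ pred′ G}
      (renames-power {g} {F} {G} r k)
      (renames-⊛ {g} {difference F k} {difference G k} {pred′ F} {pred′ G} (renames-difference {g} {F} {G} r k)
        (renames-++ {g} {F} {G} {scalar (- 1#)} {scalar (- 1#)} r (renames-scalar g (- 1#))))

    renames-powerSum : ∀ g k xs → Renames g (powerSum k xs) (powerSum k (map (g ⟨$⟩ʳ_) xs))
    renames-powerSum g k []       φ r = refl
    renames-powerSum g k (x ∷ xs) = renames-++ {g} {mark x D} {mark (g ⟨$⟩ʳ x) D′} {powerSum k xs} {powerSum k (map (g ⟨$⟩ʳ_) xs)}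
      (λ φ r → trans (⟨⟩-mark (g ⟨$⟩ʳ x) D′ φ) (trans
        (renames-difference {g} {transpositions x xs} {transpositions (g ⟨$⟩ʳ x) (map (g ⟨$⟩ʳ_) xs)} (renames-transpositions g x xs) k (λ ls p → φ ((g ⟨$⟩ʳ x) ∷ ls) p) (λ ls e → r ((g ⟨$⟩ʳ x) ∷ ls) e))
        (sym (⟨⟩-mark x D _))))
      (renames-powerSum g k xs)
      where
      D  = difference (transpositions x xs) k
      D′ = difference (transpositions (g ⟨$⟩ʳ x) (map (g ⟨$⟩ʳ_) xs)) k

    renames-powerSums : ∀ g μ xs → Renames g (powerSums μ xs) (powerSums μ (map (g ⟨$⟩ʳ_) xs))
    renames-powerSums g []      xs = renames-scalar g 1#
    renames-powerSums g (k ∷ μ) xs = renames-⊛ {g} {powerSum k xs} {powerSum k (map (g ⟨$⟩ʳ_) xs)} {powerSums μ xs} {powerSums μ (map (g ⟨$⟩ʳ_) xs)}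
      (renames-powerSum g k xs) (renames-powerSums g μ xs)

-- Cycle types and inclusion-exclusion for class functions

module CycleTypes where

  open Rationals
  open Sums
  open Differences
  open PartialPermutations
  open import Data.Fin.Base using (zero; suc)

  unique-resp-↭ : ∀ {A : Set} {xs ys : List A} → xs ↭ ys → Unique xs → Unique ys
  unique-resp-↭ ↭.refl          u = u
  unique-resp-↭ (↭.prep x p)    (x∉ ∷ u) = All.tabulate (λ y∈ → All.lookup x∉ (∈-resp-↭ (↭-sym p) y∈)) ∷ unique-resp-↭ p u
  unique-resp-↭ (↭.swap x y p)  ((x≢y ∷ x∉) ∷ y∉ ∷ u) =
    ((x≢y ∘ sym) ∷ All.tabulate (λ z∈ → All.lookup y∉ (∈-resp-↭ (↭-sym p) z∈))) ∷
    All.tabulate (λ z∈ → All.lookup x∉ (∈-resp-↭ (↭-sym p) z∈)) ∷ unique-resp-↭ p u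
  unique-resp-↭ (↭.trans p q)   u = unique-resp-↭ q (unique-resp-↭ p u)

  -- Pigeonhole: a list that contains every element of the duplicate-free `zs` and is no longer has
  -- no room for repetitions or other elements.
  unique-covered : ∀ {A : Set} {zs ls : List A} → Unique zs → (∀ {z} → z ∈ zs → z ∈ ls) → length ls ≤ length zs → ls ↭ zs
  unique-covered {zs = []}     {[]}    u        _   _  = ↭.refl
  unique-covered {zs = z ∷ zs} {ls}    (z∉ ∷ u) sub le with ∈-∃++ (sub (here refl))
  ... | as , bs , refl = ↭-trans (↭-shift z as bs) (↭.prep z (unique-covered u sub′ le′))
    where
    sub′ : ∀ {y} → y ∈ zs → y ∈ as ++ bs
    sub′ y∈ with ∈-++⁻ as (sub (there y∈))
    ... | inj₁ q           = ∈-++⁺ˡ q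
    ... | inj₂ (here refl) = contradiction refl (All.lookup z∉ y∈)
    ... | inj₂ (there q)   = ∈-++⁺ʳ as q
    le′ : length (as ++ bs) ≤ length zs
    le′ = ℕ.≤-pred (subst (_≤ suc (length zs)) (↭-length (↭-shift z as bs)) le)

  unique-covered-length : ∀ {A : Set} {zs ls : List A} → Unique zs → (∀ {z} → z ∈ zs → z ∈ ls) → length zs ≤ length ls
  unique-covered-length {zs = zs} {ls} u sub with ℕ.≤-total (length zs) (length ls)
  ... | inj₁ le = le
  ... | inj₂ ge = ℕ.≤-reflexive (sym (↭-length (unique-covered u sub ge)))

  module _ {n : ℕ} where

    -- The permutation is a product of transpositions that put one letter after the other in place.
    -- That letters outside both lists stay fixed is part of the claim, because a letter once in
    -- place must not move again.
    extend : ∀ (xs ys : List (Fin n)) → Unique xs → Unique ys → length xs ≡ length ys →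
      Σ[ g ∈ Permutation′ n ] map (g ⟨$⟩ʳ_) xs ≡ ys × (∀ i → ¬ i ∈ xs → ¬ i ∈ ys → g ⟨$⟩ʳ i ≡ i)
    extend []       []       _        _        _  = Perm.id , refl , λ _ _ _ → refl
    extend (x ∷ xs) (y ∷ ys) (x∉ ∷ u) (y∉ ∷ v) eq = τ ∘ₚ g , cong₂ _∷_ at-x tails , fixes
      where
      τ = transpose x y
      y∉τxs : ¬ y ∈ map (τ ⟨$⟩ʳ_) xs
      y∉τxs m with ∈-map⁻ (τ ⟨$⟩ʳ_) m

      ... | z , z∈ , e = All.lookup x∉ z∈ (⟨$⟩ʳ-injective τ (trans (transpose-left x y) e))
      rec = extend (map (τ ⟨$⟩ʳ_) xs) ys (Unique.map⁺ (⟨$⟩ʳ-injective τ) u) v (trans (List.length-map _ xs) (ℕ.suc-injective eq))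
      g = proj₁ rec
      at-x : g ⟨$⟩ʳ (τ ⟨$⟩ʳ x) ≡ y
      at-x = trans (cong (g ⟨$⟩ʳ_) (transpose-left x y)) (proj₂ (proj₂ rec) y y∉τxs (λ y∈ → All.lookup y∉ y∈ refl))
      tails : map ((τ ∘ₚ g) ⟨$⟩ʳ_) xs ≡ ys
      tails = trans (List.map-∘ xs) (proj₁ (proj₂ rec))
      fixes : ∀ i → ¬ i ∈ x ∷ xs → ¬ i ∈ y ∷ ys → g ⟨$⟩ʳ (τ ⟨$⟩ʳ i) ≡ i
      fixes i i∉ i∉′ = trans (cong (g ⟨$⟩ʳ_) τi) (proj₂ (proj₂ rec) i outside (i∉′ ∘ there))
        where
        τi : τ ⟨$⟩ʳ i ≡ i
        τi = transpose-other (i∉ ∘ here) (i∉′ ∘ here)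
        outside : ¬ i ∈ map (τ ⟨$⟩ʳ_) xs
        outside m with ∈-map⁻ (τ ⟨$⟩ʳ_) m

        ... | z , z∈ , e = i∉ (there (subst (_∈ xs) (sym (⟨$⟩ʳ-injective τ (trans τi e))) z∈))

    cycle-fixes : ∀ x ys {i : Fin n} → ¬ i ∈ x ∷ ys → cycle x ys ⟨$⟩ʳ i ≡ i
    cycle-fixes x []       _  = refl
    cycle-fixes x (y ∷ ys) ∉ = trans (cong (cycle x ys ⟨$⟩ʳ_) (transpose-other (∉ ∘ here) (∉ ∘ there ∘ here)))
      (cycle-fixes x ys (λ { (here e) → ∉ (here e) ; (there m) → ∉ (there (there m)) }))

    map-cycle : ∀ (x : Fin n) ys → Unique (x ∷ ys) → map (cycle x ys ⟨$⟩ʳ_) (x ∷ ys) ≡ ys ++ x ∷ []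
    map-cycle x []       _ = refl
    map-cycle x (y ∷ ys) ((x≢y ∷ x∉) ∷ y∉ ∷ u) = cong₂ _∷_
      (trans (cong (cycle x ys ⟨$⟩ʳ_) (transpose-left x y)) (cycle-fixes x ys (λ { (here e) → x≢y (sym e) ; (there m) → All.lookup y∉ m refl })))
      (trans (cong₂ _∷_ (cong (cycle x ys ⟨$⟩ʳ_) (transpose-right x y))
        (List.map-cong-local (All.tabulate (λ {z} z∈ → cong (cycle x ys ⟨$⟩ʳ_) (transpose-other (λ e → All.lookup x∉ z∈ (sym e)) (λ e → All.lookup y∉ z∈ (sym e)))))))
        (map-cycle x ys (x∉ ∷ u)))

    cycles-fixes : ∀ bs {i : Fin n} → ¬ i ∈ concat (map block bs) → cycles bs ⟨$⟩ʳ i ≡ i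
    cycles-fixes []              _  = refl
    cycles-fixes ((x , ys) ∷ bs) ∉ = trans (cong (cycles bs ⟨$⟩ʳ_) (cycle-fixes x ys (∉ ∘ ∈-++⁺ˡ))) (cycles-fixes bs (∉ ∘ ∈-++⁺ʳ (x ∷ ys)))

    unique-++ : ∀ (xs : List (Fin n)) {ys} → Unique (xs ++ ys) → Unique xs × Unique ys × (∀ {i} → i ∈ xs → ¬ i ∈ ys)
    unique-++ []       u = [] , u , λ ()
    unique-++ (x ∷ xs) (x∉ ∷ u) with unique-++ xs u
    ... | a , b , d = All.++⁻ˡ xs x∉ ∷ a , b , λ { (here refl) m → All.lookup (All.++⁻ʳ xs x∉) m refl ; (there q) m → d q m }

    cycles-rotate : ∀ bs → Unique (concat (map block bs)) → All (IsCycleOf (cycles bs)) (map block bs)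
    cycles-rotate []              u = []
    cycles-rotate ((x , ys) ∷ bs) u with unique-++ (x ∷ ys) u
    ... | ub , urest , disjoint = first ∷ rest (map block bs) id (cycles-rotate bs urest)
      where
      moved : ∀ {i} → i ∈ ys ++ x ∷ [] → i ∈ x ∷ ys
      moved m with ∈-++⁻ ys m
      ... | inj₁ q          = there q
      ... | inj₂ (here e)   = here e
      first : map (cycles ((x , ys) ∷ bs) ⟨$⟩ʳ_) (x ∷ ys) ≡ ys ++ x ∷ []
      first = trans (List.map-∘ (x ∷ ys)) (trans (cong (map (cycles bs ⟨$⟩ʳ_)) (map-cycle x ys ub))
        (trans (List.map-cong-local (All.tabulate (λ m → cycles-fixes bs (disjoint (moved m))))) (List.map-id _)))
      rest : ∀ cs → (∀ {c} → c ∈ cs → c ∈ map block bs) → All (IsCycleOf (cycles bs)) cs → All (IsCycleOf (cycles ((x , ys) ∷ bs))) cs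
      rest []       _   []       = []
      rest (c ∷ cs) sub (e ∷ es) = trans (List.map-cong-local (All.tabulate (λ {i} i∈ → cong (cycles bs ⟨$⟩ʳ_)
        (cycle-fixes x ys (λ m → disjoint m (∈-concat⁺′ i∈ (sub (here refl)))))))) e ∷ rest cs (sub ∘ there) es
        where open import Data.List.Membership.Propositional.Properties using (∈-concat⁺′)

    map-rotate : ∀ (f : Fin n → Fin n) xs → map f (rotate xs) ≡ rotate (map f xs)
    map-rotate f []       = refl
    map-rotate f (x ∷ xs) = List.map-++ f xs (x ∷ [])

    concat-cancel : ∀ {A : Set} (f : Fin n → A) (bs : List (List (Fin n))) (cs : List (List A)) → map f (concat bs) ≡ concat cs →
      map length bs ≡ map length cs → map (map f) bs ≡ cs
    concat-cancel f []       []       _  _  = refl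
    concat-cancel f (b ∷ bs) (c ∷ cs) e l = cong₂ _∷_ (proj₁ split) (concat-cancel f bs cs (proj₂ split) (List.∷-injectiveʳ l))
      where
      ++-split : ∀ {A : Set} (xs ys : List A) {us vs} → length xs ≡ length ys → xs ++ us ≡ ys ++ vs → xs ≡ ys × us ≡ vs
      ++-split []       []       _ e = refl , e
      ++-split (x ∷ xs) (y ∷ ys) l e with ++-split xs ys (ℕ.suc-injective l) (List.∷-injectiveʳ e)
      ... | p , q = cong₂ _∷_ (List.∷-injectiveˡ e) p , q
      split : map f b ≡ c × map f (concat bs) ≡ concat cs
      split = ++-split (map f b) c (trans (List.length-map f b) (List.∷-injectiveˡ l)) (trans (sym (List.map-++ f b (concat bs))) e)

    IsClassFunction : (Permutation′ n → ℚ) → Set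
    IsClassFunction χ = (∀ {p q} → p ≈ q → χ p ≡ χ q) × (∀ g p → χ (conjugate g p) ≡ χ p)

    -- The letters of the blocks are renamed, in order, to those of the given cycles of σ. Both
    -- lists of lengths are the parts of μ, so blocks match cycles one by one, and the renaming
    -- conjugates one rotation into the other.
    cycleType-conjugate : ∀ {χ} → IsClassFunction χ → ∀ bs {μ : Partition n} {σ} → concat (map block bs) ↭ allFin n →
      map (length ∘ block) bs ≡ parts μ → HasCycleType σ μ → χ (cycles bs) ≡ χ σ
    cycleType-conjugate {χ} (resp , conj) bs {μ} {σ} perm lens (cs , cyc , permc , lenc) =
      trans (sym (conj g (cycles bs))) (resp agree)
      where
      u : Unique (concat (map block bs))
      u = unique-resp-↭ (↭-sym perm) (Unique.allFin⁺ n)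
      uc : Unique (concat cs)
      uc = unique-resp-↭ (↭-sym permc) (Unique.allFin⁺ n)
      ext = extend (concat (map block bs)) (concat cs) u uc (trans (↭-length perm) (sym (↭-length permc)))
      g = proj₁ ext
      pieces : map (map (g ⟨$⟩ʳ_)) (map block bs) ≡ cs
      pieces = concat-cancel (g ⟨$⟩ʳ_) (map block bs) cs (proj₁ (proj₂ ext))
        (trans (sym (List.map-∘ bs)) (trans lens (sym lenc)))
      on-block : ∀ bks → All (IsCycleOf (cycles bs)) bks → All (IsCycleOf σ) (map (map (g ⟨$⟩ʳ_)) bks) →
        All (λ i → conjugate g (cycles bs) ⟨$⟩ʳ i ≡ σ ⟨$⟩ʳ i) (concat (map (map (g ⟨$⟩ʳ_)) bks))
      on-block []         []       []       = []
      on-block (bk ∷ bks) (e ∷ es) (f ∷ fs) = All.++⁺ (pointwise (map (g ⟨$⟩ʳ_) bk) (begin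
          map (conjugate g (cycles bs) ⟨$⟩ʳ_) (map (g ⟨$⟩ʳ_) bk)
            ≡⟨ List.map-∘ bk ⟨
          map (λ i → g ⟨$⟩ʳ (cycles bs ⟨$⟩ʳ (g ⟨$⟩ˡ (g ⟨$⟩ʳ i)))) bk
            ≡⟨ List.map-cong (λ i → cong (λ j → g ⟨$⟩ʳ (cycles bs ⟨$⟩ʳ j)) (inverseˡ g)) bk ⟩
          map (λ i → g ⟨$⟩ʳ (cycles bs ⟨$⟩ʳ i)) bk
            ≡⟨ List.map-∘ bk ⟩
          map (g ⟨$⟩ʳ_) (map (cycles bs ⟨$⟩ʳ_) bk)
            ≡⟨ cong (map (g ⟨$⟩ʳ_)) e ⟩
          map (g ⟨$⟩ʳ_) (rotate bk)
            ≡⟨ map-rotate (g ⟨$⟩ʳ_) bk ⟩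
          rotate (map (g ⟨$⟩ʳ_) bk)
            ≡⟨ f ⟨
          map (σ ⟨$⟩ʳ_) (map (g ⟨$⟩ʳ_) bk) ∎)) (on-block bks es fs)
        where
        pointwise : ∀ xs → map (conjugate g (cycles bs) ⟨$⟩ʳ_) xs ≡ map (σ ⟨$⟩ʳ_) xs → All (λ i → conjugate g (cycles bs) ⟨$⟩ʳ i ≡ σ ⟨$⟩ʳ i) xs
        pointwise []       _ = []
        pointwise (x ∷ xs) e = List.∷-injectiveˡ e ∷ pointwise xs (List.∷-injectiveʳ e)
      agree : conjugate g (cycles bs) ≈ σ
      agree i = All.lookup (subst (λ ds → All (λ i → conjugate g (cycles bs) ⟨$⟩ʳ i ≡ σ ⟨$⟩ʳ i) (concat ds)) pieces
        (on-block (map block bs) (cycles-rotate bs u) (subst (All (IsCycleOf σ)) (sym pieces) cyc)))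
        (∈-resp-↭ (↭-sym permc) (∈-allFin i))

    -- Power sums of Jucys-Murphy elements for lists of equal length differ by a renaming of
    -- letters, that is, by a conjugation, which a class function does not see.
    classFunction-renames : ∀ {χ} → IsClassFunction χ → ∀ μ xs ys → Unique xs → Unique ys → length xs ≡ length ys →
      ⟨ powerSums μ xs , (λ _ p → χ p) ⟩ ≡ ⟨ powerSums μ ys , (λ _ p → χ p) ⟩
    classFunction-renames {χ} (resp , conj) μ xs ys u v eq with extend xs ys u v eq
    ... | g , refl , _ = sym (trans (renames-powerSums g μ xs (λ _ p → χ p) (λ _ → resp)) (⟨⟩-cong (powerSums μ xs) (λ _ p → conj g p)))

    covers-sub : ∀ (zs ls : List (Fin n)) → (∀ z → z ∈ zs → z ∈ ls) ⊎ covers zs ls ≡ 0#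
    covers-sub []       ls = inj₁ (λ _ ())
    covers-sub (z ∷ zs) ls with z ∈? ls | covers-sub zs ls
    ... | no z∉  | _        = inj₂ (zeroˡ _)
    ... | yes z∈ | inj₂ e   = inj₂ (trans (cong (1# *_) e) (zeroʳ _))
    ... | yes z∈ | inj₁ sub = inj₁ λ { _ (here refl) → z∈ ; y (there m) → sub y m }

    -- A term that covers all n letters has at least n of them, and no term has more. So it is a
    -- product of cycles of lengths μ on disjoint letters, where the class function takes its value
    -- at σ.
    top-value : ∀ {χ} → IsClassFunction χ → (μ : Partition n) → ∀ {σ} → HasCycleType σ μ →
      ⟨ powerSums (parts μ) (allFin n) , (λ ls p → covers (allFin n) ls * χ p) ⟩ ≡
      ⟨ powerSums (parts μ) (allFin n) , (λ ls p → covers (allFin n) ls * 1#) ⟩ * χ σ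
    top-value {χ} class μ {σ} type = trans
      (∑-cong∈ (powerSums (parts μ) (allFin n)) (λ {(c , ls , p)} t∈ → cong (c *_) (term c ls p (All.lookup (topTerm-powerSums (parts μ) (allFin n)) t∈))))
      (⟨⟩-*ʳ (powerSums (parts μ) (allFin n)) (λ ls p → covers (allFin n) ls * 1#) (χ σ))
      where
      term : ∀ c ls p → TopTerm (parts μ) (c , ls , p) → covers (allFin n) ls * χ p ≡ (covers (allFin n) ls * 1#) * χ σ
      term c ls p top = by top (covers-sub (allFin n) ls)
        where
        blocks : ∀ bs → length (concat (map block bs)) ≡ sum (map (length ∘ block) bs)
        blocks []       = refl
        blocks (b ∷ bs) = trans (List.length-++ (block b)) (cong (length (block b) ℕ.+_) (blocks bs))
        lengths : ∀ bs → map (length ∘ block) bs ≡ parts μ → length (concat (map block bs)) ≤ length (allFin n)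
        lengths bs lens = ℕ.≤-reflexive (trans (blocks bs) (trans (cong sum lens) (trans (size μ) (sym (List.length-tabulate {n = n} id)))))
        by : TopTerm (parts μ) (c , ls , p) → (∀ z → z ∈ allFin n → z ∈ ls) ⊎ covers (allFin n) ls ≡ 0# →
          covers (allFin n) ls * χ p ≡ (covers (allFin n) ls * 1#) * χ σ
        by _ (inj₂ e) = trans (cong (_* χ p) e) (trans (zeroˡ _) (sym (trans (cong (λ z → (z * 1#) * χ σ) e) (trans (cong (_* χ σ) (zeroˡ _)) (zeroˡ _)))))
        by (inj₁ l<) (inj₁ sub) = contradiction (unique-covered-length (Unique.allFin⁺ n) (λ {z} → sub z))
          (ℕ.<⇒≱ (subst (length ls <_) (trans (size μ) (sym (List.length-tabulate {n = n} id))) l<))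
        by (inj₂ (bs , refl , lens , e)) (inj₁ sub) = trans (cong (covers (allFin n) ls *_) (trans (proj₁ class e)
            (cycleType-conjugate class bs {μ} {σ} (unique-covered (Unique.allFin⁺ n) (λ {z} → sub z) (lengths bs lens)) lens type)))
            (cong (_* χ σ) (sym (*-identityʳ (covers (allFin n) ls))))

  infixr 8 _^ℚ_
  _^ℚ_ : ℚ → ℕ → ℚ
  x ^ℚ zero  = 1#
  x ^ℚ suc k = x * x ^ℚ k

  -- t has degree d and leading coefficient a.
  Polynomial : ℕ → ℚ → (ℕ → ℚ) → Set
  Polynomial zero    a t = ∀ m → t m ≡ a
  Polynomial (suc d) a t = Polynomial d (fromℕ (suc d) * a) (λ m → t (suc m) - t m)

  polynomial-Δ : ∀ d {a t} → Polynomial d a t → Δ d (λ _ m → t m) ≡ fromℕ (d !) * a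
  polynomial-Δ zero    {a} P = trans (P 0) (sym (*-identityˡ a))
  polynomial-Δ (suc d) {a} P = trans (polynomial-Δ d P) (trans (sym (*-assoc _ _ _))
    (cong (_* a) (trans (*-comm _ _) (sym (fromℕ-* (suc d) (d !))))))

  polynomial-cong : ∀ d {a b s t} → a ≡ b → s ≗ t → Polynomial d a s → Polynomial d b t
  polynomial-cong zero    e f P m = trans (sym (f m)) (trans (P m) e)
  polynomial-cong (suc d) e f P   = polynomial-cong d (cong (fromℕ (suc d) *_) e) (λ m → cong₂ _-_ (f (suc m)) (f m)) P

  polynomial-+ : ∀ d {a b s t} → Polynomial d a s → Polynomial d b t → Polynomial d (a + b) (λ m → s m + t m)
  polynomial-+ zero    P Q m = cong₂ _+_ (P m) (Q m)
  polynomial-+ (suc d) {a} {b} {s} {t} P Q = polynomial-cong d (sym (distribˡ _ a b))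
    (λ m → solve 4 (λ a b c d → (a :- b) :+ (c :- d) := (a :+ c) :- (b :+ d)) refl (s (suc m)) (s m) (t (suc m)) (t m)) (polynomial-+ d P Q)

  polynomial-* : ∀ d c {a t} → Polynomial d a t → Polynomial d (c * a) (λ m → c * t m)
  polynomial-* zero    c P m = cong (c *_) (P m)
  polynomial-* (suc d) c {a} {t} P = polynomial-cong d (solve 3 (λ c f a → c :* (f :* a) := f :* (c :* a)) refl c (fromℕ (suc d)) a)
    (λ m → solve 3 (λ c a b → c :* (a :- b) := c :* a :- c :* b) refl c (t (suc m)) (t m)) (polynomial-* d c P)

  polynomial-lower : ∀ d {a t} → Polynomial d a t → Polynomial (suc d) 0# t
  polynomial-lower zero    {a} {t} P m = trans (cong₂ _-_ (P (suc m)) (P m)) (solve 2 (λ a f → a :- a := f :* con (ℤ.+ 0)) refl a (fromℕ 1))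
  polynomial-lower (suc d) {a} {t} P   = polynomial-cong (suc d) (sym (zeroʳ _)) (λ _ → refl) (polynomial-lower d P)

  -- Discrete product rule: (m + 1 + c) t(m + 1) - (m + c) t(m) = (m + c + 1) (t(m + 1) - t(m)) +
  -- t(m). The induction therefore runs over all `c`.
  polynomial-linear : ∀ d c {a t} → Polynomial d a t → Polynomial (suc d) a (λ m → (fromℕ m + c) * t m)
  polynomial-linear zero    c {a} {t} P m = begin
    (fromℕ (suc m) + c) * t (suc m) - (fromℕ m + c) * t m
      ≡⟨ cong₂ (λ x y → (fromℕ (suc m) + c) * x - (fromℕ m + c) * y) (P (suc m)) (P m) ⟩
    (fromℕ (suc m) + c) * a - (fromℕ m + c) * a
      ≡⟨ cong (λ z → (z + c) * a - (fromℕ m + c) * a) (fromℕ-suc m) ⟩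
    ((1# + fromℕ m) + c) * a - (fromℕ m + c) * a
      ≡⟨ solve 3 (λ m c a → ((con one :+ m) :+ c) :* a :- (m :+ c) :* a := con one :* a) refl (fromℕ m) c a ⟩
    1# * a ∎
  polynomial-linear (suc d) c {a} {t} P = polynomial-cong (suc d)
    (trans (solve 2 (λ f a → f :* a :+ a := (con one :+ f) :* a) refl (fromℕ (suc d)) a) (cong (_* a) (sym (fromℕ-suc (suc d)))))
    (λ m → sym (trans (cong (λ z → (z + c) * t (suc m) - (fromℕ m + c) * t m) (fromℕ-suc m))
      (solve 4 (λ m c x y → ((con one :+ m) :+ c) :* x :- (m :+ c) :* y := (m :+ (c :+ con one)) :* (x :- y) :+ y) refl (fromℕ m) c (t (suc m)) (t m))))
    (polynomial-+ (suc d) (polynomial-linear d (c + 1#) P) (P′ d P))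
    where
    P′ : ∀ d → Polynomial d (fromℕ (suc d) * a) (λ m → t (suc m) - t m) → Polynomial (suc d) a t
    P′ d P = P

  polynomial-power : ∀ k c d {a t} → Polynomial d a t → Polynomial (k ℕ.+ d) a (λ m → (fromℕ m + c) ^ℚ k * t m)
  polynomial-power zero    c d {a} {t} P = polynomial-cong d refl (λ m → sym (*-identityˡ (t m))) P
  polynomial-power (suc k) c d {a} {t} P = polynomial-cong (suc (k ℕ.+ d)) refl (λ m → sym (*-assoc (fromℕ m + c) _ (t m)))
    (polynomial-linear (k ℕ.+ d) c (polynomial-power k c d P))

  polynomial-raise : ∀ k d {a t} → Polynomial d a t → Polynomial (suc k ℕ.+ d) 0# t
  polynomial-raise zero    d P = polynomial-lower d P
  polynomial-raise (suc k) d P = polynomial-lower (suc k ℕ.+ d) (polynomial-raise k d P)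

  powerGap : ℚ → ℕ → ℚ
  powerGap x k = x ^ℚ k - (x - 1#) ^ℚ k

  powerGap-suc : ∀ x k → x ^ℚ k + powerGap x k * (x - 1#) ≡ powerGap x (suc k)
  powerGap-suc x k = solve 3 (λ x p q → p :+ (p :- q) :* (x :- con one) := x :* p :- (x :- con one) :* q) refl x (x ^ℚ k) ((x - 1#) ^ℚ k)

  module _ {n : ℕ} where

    private
      ones : List (Fin n) → Permutation′ n → ℚ
      ones _ _ = 1#

    ones-scalar : ∀ c → ⟨ scalar c , ones ⟩ ≡ c
    ones-scalar c = trans (+-identityʳ _) (*-identityʳ c)

    ones-⊛ : ∀ F G → ⟨ F ⊛ G , ones ⟩ ≡ ⟨ F , ones ⟩ * ⟨ G , ones ⟩
    ones-⊛ F G = trans (⟨⟩-⊛ F G ones) (trans (⟨⟩-cong F (λ _ _ → sym (*-identityˡ _))) (⟨⟩-*ʳ F ones ⟨ G , ones ⟩))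

    ones-transpositions : ∀ x ys → ⟨ transpositions x ys , ones ⟩ ≡ fromℕ (length ys)
    ones-transpositions x []       = refl
    ones-transpositions x (y ∷ ys) = trans (cong₂ _+_ (*-identityˡ 1#) (ones-transpositions x ys)) (sym (fromℕ-suc (length ys)))

    ones-power : ∀ F {a} → ⟨ F , ones ⟩ ≡ a → ∀ k → ⟨ power F k , ones ⟩ ≡ a ^ℚ k
    ones-power F e zero    = ones-scalar 1#
    ones-power F e (suc k) = trans (ones-⊛ F (power F k)) (cong₂ _*_ e (ones-power F e k))

    ones-difference : ∀ F {a} → ⟨ F , ones ⟩ ≡ a → ∀ k → ⟨ difference F k , ones ⟩ ≡ powerGap a k
    ones-difference F {a} e zero    = solve 0 (con (ℤ.+ 0) := con one :- con one) refl
    ones-difference F {a} e (suc k) = trans (⟨⟩-++ (power F k) (difference F k ⊛ pred′ F) ones) (trans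
      (cong₂ _+_ (ones-power F e k) (trans (ones-⊛ (difference F k) (pred′ F)) (cong₂ _*_ (ones-difference F e k)
        (trans (⟨⟩-++ F (scalar (- 1#)) ones) (cong₂ _+_ e (ones-scalar (- 1#)))))))
      (powerGap-suc a k))

    -- For the trivial character the Jucys-Murphy element of a letter is the number of letters after
    -- it, so the sum telescopes.
    ones-powerSum : ∀ k xs → ⟨ powerSum k xs , ones ⟩ ≡ (fromℕ (length xs) - 1#) ^ℚ k - (- 1#) ^ℚ k
    ones-powerSum k []       = sym (trans (cong (λ z → z ^ℚ k - (- 1#) ^ℚ k) (+-identityˡ (- 1#))) (-‿inverseʳ _))
    ones-powerSum k (x ∷ xs) = begin
      ⟨ powerSum k (x ∷ xs) , ones ⟩
        ≡⟨ ⟨⟩-++ (mark x (difference (transpositions x xs) k)) (powerSum k xs) ones ⟩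
      ⟨ mark x (difference (transpositions x xs) k) , ones ⟩ + ⟨ powerSum k xs , ones ⟩
        ≡⟨ cong₂ _+_ (trans (⟨⟩-mark x (difference (transpositions x xs) k) ones) (ones-difference (transpositions x xs) (ones-transpositions x xs) k)) (ones-powerSum k xs) ⟩
      powerGap (fromℕ (length xs)) k + ((fromℕ (length xs) - 1#) ^ℚ k - (- 1#) ^ℚ k)
        ≡⟨ solve 3 (λ a b c → (a :- b) :+ (b :- c) := a :- c) refl _ _ _ ⟩
      fromℕ (length xs) ^ℚ k - (- 1#) ^ℚ k
        ≡⟨ cong (λ z → z ^ℚ k - (- 1#) ^ℚ k) (trans (solve 1 (λ a → a := (con one :+ a) :- con one) refl _) (cong (_- 1#) (sym (fromℕ-suc (length xs))))) ⟩
      (fromℕ (suc (length xs)) - 1#) ^ℚ k - (- 1#) ^ℚ k ∎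

    onesValue : List ℕ → ℕ → ℚ
    onesValue []      m = 1#
    onesValue (k ∷ μ) m = ((fromℕ m - 1#) ^ℚ k - (- 1#) ^ℚ k) * onesValue μ m

    ones-powerSums : ∀ μ xs → ⟨ powerSums μ xs , ones ⟩ ≡ onesValue μ (length xs)
    ones-powerSums []      xs = ones-scalar 1#
    ones-powerSums (k ∷ μ) xs = trans (ones-⊛ (powerSum k xs) (powerSums μ xs)) (cong₂ _*_ (ones-powerSum k xs) (ones-powerSums μ xs))

    -- Each factor is (m - 1)^k minus a constant, hence monic of degree k; for this the part k must
    -- be positive.
    onesValue-polynomial : ∀ μ → All ℕ.NonZero μ → Polynomial (sum μ) 1# (onesValue μ)
    onesValue-polynomial []          _        m = refl
    onesValue-polynomial (suc k ∷ μ) (_ ∷ nz) = polynomial-cong (suc k ℕ.+ sum μ) (+-identityʳ 1#)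
      (λ m → solve 3 (λ a b t → a :* t :+ :- b :* t := (a :- b) :* t) refl ((fromℕ m - 1#) ^ℚ suc k) ((- 1#) ^ℚ suc k) (onesValue μ m))
      (polynomial-+ (suc k ℕ.+ sum μ) (polynomial-power (suc k) (- 1#) (sum μ) P)
        (polynomial-raise k (sum μ) (polynomial-* (sum μ) (- (- 1#) ^ℚ suc k) P)))
      where P = onesValue-polynomial μ nz

    classFunction-Δ : ∀ {χ : Permutation′ n → ℚ} → IsClassFunction χ → (μ : Partition n) → ∀ {σ} → HasCycleType σ μ →
      Δ n (λ k m → ⟨ powerSums (parts μ) (drop k (allFin n)) , (λ _ p → χ p) ⟩) ≡ fromℕ (n !) * χ σ
    classFunction-Δ {χ} class μ {σ} type = begin
      Δ n (λ k m → ⟨ powerSums (parts μ) (drop k zs) , (λ _ p → χ p) ⟩)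
        -- With k = n - m everything becomes a function of the number m of letters.
        ≡⟨ Δ-cong n (λ k m e → cong (λ j → ⟨ powerSums (parts μ) (drop j zs) , (λ _ p → χ p) ⟩) (trans (sym (ℕ.m+n∸n≡m k m)) (cong (_∸ m) e))) ⟩
      Δ n (λ _ m → t m)
        ≡⟨ cong (λ l → Δ l (λ _ m → t m)) (sym lz) ⟩
      Δ (length zs) (λ _ m → t m)
        ≡⟨ alternatingSublists-length zs t ⟨
      alternatingSublists zs (t ∘ length)
        -- The last m letters may be replaced by any m letters, and the iterated difference becomes
        -- inclusion-exclusion over sublists.
        ≡⟨ alternatingSublists-cong zs (λ xs s → classFunction-renames class (parts μ) (drop (n ∸ length xs) zs) xs
             (Unique.drop⁺ (n ∸ length xs) uz) (sub-unique s uz)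
             (trans (List.length-drop (n ∸ length xs) zs) (trans (cong (_∸ (n ∸ length xs)) lz) (ℕ.m∸[m∸n]≡n (subst (length xs ≤_) lz (sub-length s)))))) ⟩
      alternatingSublists zs (λ xs → ⟨ powerSums (parts μ) xs , (λ _ p → χ p) ⟩)
        ≡⟨ alternating-powerSums (parts μ) uz χ (letters-powerSums (parts μ) zs) ⟩
      ⟨ powerSums (parts μ) zs , (λ ls p → covers zs ls * χ p) ⟩
        ≡⟨ top-value class μ type ⟩
      ⟨ powerSums (parts μ) zs , (λ ls p → covers zs ls * 1#) ⟩ * χ σ
        ≡⟨ cong (_* χ σ) weight-total ⟩
      fromℕ (n !) * χ σ ∎
      where
      zs = allFin n
      uz : Unique zs
      uz = Unique.allFin⁺ n
      lz : length zs ≡ n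
      lz = List.length-tabulate id
      t : ℕ → ℚ
      t m = ⟨ powerSums (parts μ) (drop (n ∸ m) zs) , (λ _ p → χ p) ⟩
      sub-unique : ∀ {xs ys : List (Fin n)} → xs ⊆ ys → Unique ys → Unique xs
      sub-unique []         u        = []
      sub-unique (y Sub.∷ʳ s)   (_ ∷ u)  = sub-unique s u
      sub-unique (refl ∷ s) (y∉ ∷ u) = All.tabulate (λ m → All.lookup y∉ (Sub.lookup s m)) ∷ sub-unique s u
      sub-length : ∀ {xs ys : List (Fin n)} → xs ⊆ ys → length xs ≤ length ys
      sub-length []         = z≤n
      sub-length (y Sub.∷ʳ s)   = ℕ.m≤n⇒m≤1+n (sub-length s)
      sub-length (refl ∷ s) = s≤s (sub-length s)
      -- The same computation for the trivial character counts the top terms.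
      weight-total : ⟨ powerSums (parts μ) zs , (λ ls p → covers zs ls * 1#) ⟩ ≡ fromℕ (n !)
      weight-total = begin
        ⟨ powerSums (parts μ) zs , (λ ls p → covers zs ls * 1#) ⟩
          ≡⟨ alternating-powerSums (parts μ) uz (λ _ → 1#) (letters-powerSums (parts μ) zs) ⟨
        alternatingSublists zs (λ xs → ⟨ powerSums (parts μ) xs , ones ⟩)
          ≡⟨ alternatingSublists-cong zs (λ xs _ → ones-powerSums (parts μ) xs) ⟩
        alternatingSublists zs (onesValue (parts μ) ∘ length)
          ≡⟨ alternatingSublists-length zs (onesValue (parts μ)) ⟩
        Δ (length zs) (λ _ m → onesValue (parts μ) m)
          ≡⟨ cong (λ l → Δ l (λ _ m → onesValue (parts μ) m)) lz ⟩
        Δ n (λ _ m → onesValue (parts μ) m)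
          ≡⟨ polynomial-Δ n (subst (λ d → Polynomial d 1# (onesValue (parts μ))) (size μ) (onesValue-polynomial (parts μ) (positive μ))) ⟩
        fromℕ (n !) * 1#
          ≡⟨ *-identityʳ _ ⟩
        fromℕ (n !) ∎

-- Contents as eigenvalues

module Eigenvalues where

  open Rationals
  open Sums
  open Differences
  open SkewTableaux
  open Dimensions
  open HookSums
  open Antisymmetry using (∏; ∏-cong∈)
  open HighestWeight
  open Traces
  open PartialPermutations
  open CycleTypes
  open import Data.Fin.Base using (zero; suc)

  ∑-tabulate : ∀ {A : Set} {n} (g : Fin n → A) f → ∑ (List.tabulate g) f ≡ ∑ᶠ (λ i → f (g i))
  ∑-tabulate {n = zero}  g f = refl
  ∑-tabulate {n = suc n} g f = cong (f (g zero) +_) (∑-tabulate (g ∘ suc) f)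

  drop-suc-allFin : ∀ k n → drop k (List.tabulate {n = n} (λ i → Fin.suc i)) ≡ map Fin.suc (drop k (allFin n))
  drop-suc-allFin k n = trans (cong (drop k) (sym (List.map-tabulate id Fin.suc))) (List.drop-map {f = Fin.suc} k (allFin n))

  ∘ʷ-zero : ∀ {n} s (w : Vec ℕ n) q → (s ∷ w) ∘ʷ transpose zero (suc q) ≡ lookup w q ∷ w [ q ]≔ s
  ∘ʷ-zero s w q = lookup-ext λ i → trans (lookup-∘ʷ (s ∷ w) (transpose zero (suc q)) i) (at i)
    where
    at : ∀ i → lookup (s ∷ w) (transpose zero (suc q) ⟨$⟩ʳ i) ≡ lookup (lookup w q ∷ w [ q ]≔ s) i
    at zero    = cong (lookup (s ∷ w)) (transpose-left zero (suc q))
    at (suc i) = by (i Fin.≟ q)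
      where
      by : Dec (i ≡ q) → lookup (s ∷ w) (transpose zero (suc q) ⟨$⟩ʳ suc i) ≡ lookup (w [ q ]≔ s) i
      by (yes refl) = trans (cong (lookup (s ∷ w)) (transpose-right zero (suc i))) (sym (Vec.lookup∘updateAt i w))
      by (no i≢q)   = trans (cong (lookup (s ∷ w)) (transpose-other {x = zero} {suc q} (λ ()) (i≢q ∘ Fin.suc-injective)))
        (sym (Vec.lookup∘updateAt′ i q i≢q w))

  ∘ʷ-suc : ∀ {n} s (w : Vec ℕ n) p q → (s ∷ w) ∘ʷ transpose (suc p) (suc q) ≡ s ∷ (w ∘ʷ transpose p q)
  ∘ʷ-suc s w p q = lookup-ext λ i → trans (lookup-∘ʷ (s ∷ w) (transpose (suc p) (suc q)) i)
    (trans (cong (lookup (s ∷ w)) (Perm.lift₀-transpose p q i)) (at i))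
    where
    at : ∀ i → lookup (s ∷ w) (Perm.lift₀ (transpose p q) ⟨$⟩ʳ i) ≡ lookup (s ∷ (w ∘ʷ transpose p q)) i
    at zero    = refl
    at (suc i) = sym (lookup-∘ʷ w (transpose p q) i)

  ∘ʷ-∘ₚ : ∀ {n} (w : Vec ℕ n) p q → w ∘ʷ (p ∘ₚ q) ≡ (w ∘ʷ q) ∘ʷ p
  ∘ʷ-∘ₚ w p q = lookup-ext λ i → trans (lookup-∘ʷ w (p ∘ₚ q) i)
    (sym (trans (lookup-∘ʷ (w ∘ʷ q) p i) (lookup-∘ʷ w q (p ⟨$⟩ʳ i))))

  map-suc-∷ : ∀ {n} (zs : List (Fin n)) {x ys} → map suc zs ≡ x ∷ ys →
    Σ[ z ∈ Fin n ] Σ[ us ∈ List (Fin n) ] zs ≡ z ∷ us × x ≡ suc z × ys ≡ map suc us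
  map-suc-∷ (z ∷ us) refl = z , us , refl , refl , refl

  -- In a final segment of `allFin n` the letters after x are exactly the positions after x.
  JM-transpositions : ∀ {n} k {x ys} → drop k (allFin n) ≡ x ∷ ys → ∀ (v : Words n) w → ∑ ys (λ y → v (w ∘ʷ transpose x y)) ≡ JM x v w
  JM-transpositions {zero}  zero    () v w
  JM-transpositions {zero}  (suc k) () v w
  JM-transpositions {suc n} zero    refl v (s ∷ w) = trans (∑-tabulate {n = n} (λ i → Fin.suc i) (λ y → v ((s ∷ w) ∘ʷ transpose zero y)))
    (∑ᶠ-cong {n} {λ q → v ((s ∷ w) ∘ʷ transpose zero (suc q))} {λ q → v (lookup w q ∷ w [ q ]≔ s)} (λ q → cong v (∘ʷ-zero s w q)))
  JM-transpositions {suc n} (suc k) eq v (s ∷ w) with map-suc-∷ (drop k (allFin n)) (trans (sym (drop-suc-allFin k n)) eq)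
  ... | x , ys , eq′ , refl , refl = trans (∑-map suc ys _)
    (trans (∑-cong ys (λ y → cong v (∘ʷ-suc s w x y))) (JM-transpositions k eq′ (v ∘ (s ∷_)) w))

  op : ∀ {n} → FormalSum n → Words n → Words n
  op F v w = ⟨ F , (λ _ p → (p • v) w) ⟩

  -- The factors act in the order in which `_∘ₚ_` composes, the left one first.
  op-⊛ : ∀ {n} (F G : FormalSum n) v w → op (F ⊛ G) v w ≡ op G (op F v) w
  op-⊛ F G v w = begin
    op (F ⊛ G) v w
      ≡⟨ ⟨⟩-⊛ F G _ ⟩
    ∑ F (λ (c , _ , p) → c * ∑ G (λ (d , _ , q) → d * v (w ∘ʷ (p ∘ₚ q))))
      ≡⟨ ∑-cong F (λ (c , _ , p) → trans (sym (∑-*ˡ c G _)) (∑-cong G (λ (d , _ , q) →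
           trans (solve 3 (λ c d v → c :* (d :* v) := d :* (c :* v)) refl c d _) (cong (λ u → d * (c * v u)) (∘ʷ-∘ₚ w p q))))) ⟩
    ∑ F (λ (c , _ , p) → ∑ G (λ (d , _ , q) → d * (c * v ((w ∘ʷ q) ∘ʷ p))))
      ≡⟨ ∑-swap F G (λ (c , _ , p) (d , _ , q) → d * (c * v ((w ∘ʷ q) ∘ʷ p))) ⟩
    ∑ G (λ (d , _ , q) → ∑ F (λ (c , _ , p) → d * (c * v ((w ∘ʷ q) ∘ʷ p))))
      ≡⟨ ∑-cong G (λ (d , _ , q) → ∑-*ˡ d F _) ⟩
    op G (op F v) w ∎

  op-scalar : ∀ {n} c (v : Words n) w → op (scalar c) v w ≡ c * v w
  op-scalar c v w = trans (+-identityʳ _) (cong (λ u → c * v u) (Vec.tabulate∘lookup w))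

  op-highestWeight : ∀ {n α} F {v : Words n} → HighestWeight α v → HighestWeight α (op F v)
  op-highestWeight F {v} hv = highestWeight-∑ F proj₁ (λ (_ , _ , p) → p • v) (λ {(_ , _ , p)} _ → highestWeight-• p hv)

  module _ {n α} {T : Vec ℕ n} (P : Path α T) where

    -- The diagonal entry of `F` at T in the triangular structure. It speaks of all bounded highest
    -- weight vectors, so that entries multiply under `_⊛_`.
    Eigen : FormalSum n → ℚ → Set
    Eigen F a = ∀ {v} → HighestWeight α v → Bounded T v → Bounded T (op F v) × op F v T ≡ a * v T

    eigen-cong : ∀ {F a b} → a ≡ b → Eigen F a → Eigen F b
    eigen-cong refl e = e

    eigen-scalar : ∀ c → Eigen (scalar c) c
    eigen-scalar c {v} hv bv = bounded-cong T (λ w → sym (op-scalar c v w)) (bounded-* T c bv) , op-scalar c v T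

    eigen-[] : Eigen [] 0#
    eigen-[] hv bv = bounded-zero T (λ _ → refl) , sym (zeroˡ _)

    eigen-++ : ∀ F G {a b} → Eigen F a → Eigen G b → Eigen (F ++ G) (a + b)
    eigen-++ F G e f {v} hv bv =
      bounded-cong T (λ w → sym (trans (⟨⟩-++ F G _) (cong (op F v w +_) (sym (*-identityˡ _))))) (bounded-linear T 1# (proj₁ (e hv bv)) (proj₁ (f hv bv))) ,
      trans (⟨⟩-++ F G _) (trans (cong₂ _+_ (proj₂ (e hv bv)) (proj₂ (f hv bv))) (sym (distribʳ _ _ _)))

    eigen-⊛ : ∀ F G {a b} → Eigen F a → Eigen G b → Eigen (F ⊛ G) (a * b)
    eigen-⊛ F G {a} {b} e f {v} hv bv = bounded-cong T (λ w → sym (op-⊛ F G v w)) (proj₁ applied) ,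
      trans (op-⊛ F G v T) (trans (proj₂ applied) (trans (cong (b *_) (proj₂ (e hv bv))) (solve 3 (λ a b x → b :* (a :* x) := (a :* b) :* x) refl _ _ _)))
      where applied = f (op-highestWeight F hv) (proj₁ (e hv bv))

    eigen-transpositions : ∀ k {x ys} → drop k (allFin n) ≡ x ∷ ys → Eigen (transpositions x ys) (contentAt P x)
    eigen-transpositions k {x} {ys} eq {v} hv bv = bounded-cong T (sym ∘ same) (proj₁ jm) , trans (same T) (proj₂ jm)
      where
      jm = JM-eigen P hv bv x
      same : ∀ w → op (transpositions x ys) v w ≡ JM x v w
      same w = trans (∑-map (λ y → 1# , y ∷ [] , transpose x y) ys _) (trans (∑-cong ys (λ y → *-identityˡ _)) (JM-transpositions k eq v w))

    eigen-power : ∀ F {a} → Eigen F a → ∀ k → Eigen (power F k) (a ^ℚ k)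
    eigen-power F e zero    = eigen-scalar 1#
    eigen-power F e (suc k) = eigen-⊛ F (power F k) e (eigen-power F e k)

    eigen-difference : ∀ F {a} → Eigen F a → ∀ k → Eigen (difference F k) (powerGap a k)
    eigen-difference F {a} e zero    = eigen-cong {[]} (solve 0 (con (ℤ.+ 0) := con one :- con one) refl) eigen-[]
    eigen-difference F {a} e (suc k) = eigen-cong {difference F (suc k)} (powerGap-suc a k)
      (eigen-++ (power F k) (difference F k ⊛ pred′ F) (eigen-power F e k)
        (eigen-⊛ (difference F k) (pred′ F) (eigen-difference F e k) (eigen-++ F (scalar (- 1#)) e (eigen-scalar (- 1#)))))

    eigen-powerSum : ∀ k j xs → drop j (allFin n) ≡ xs → Eigen (powerSum k xs) (∑ xs (λ p → powerGap (contentAt P p) k))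
    eigen-powerSum k j []       eq = eigen-[]
    eigen-powerSum k j (x ∷ xs) eq = eigen-++ (mark x D) (powerSum k xs) marked (eigen-powerSum k (suc j) xs (drop-tail j (allFin n) eq))
      where
      D = difference (transpositions x xs) k
      marked : Eigen (mark x D) (powerGap (contentAt P x) k)
      marked {v} hv bv with eigen-difference (transpositions x xs) (eigen-transpositions j eq) k hv bv
      ... | b , e = bounded-cong T (λ w → sym (⟨⟩-mark x D _)) b , trans (⟨⟩-mark x D _) e
      drop-tail : ∀ {A : Set} j (zs : List A) {x xs} → drop j zs ≡ x ∷ xs → drop (suc j) zs ≡ xs
      drop-tail zero    (z ∷ zs) refl = refl
      drop-tail (suc j) (z ∷ zs) e    = drop-tail j zs e

    eigen-powerSums : ∀ μ j → Eigen (powerSums μ (drop j (allFin n))) (∏ μ (λ k → ∑ (drop j (allFin n)) (λ p → powerGap (contentAt P p) k)))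
    eigen-powerSums []      j = eigen-scalar 1#
    eigen-powerSums (k ∷ μ) j = eigen-⊛ (powerSum k (drop j (allFin n))) (powerSums μ (drop j (allFin n)))
      (eigen-powerSum k j (drop j (allFin n)) refl) (eigen-powerSums μ j)

  -- The sum of c^k - (c - 1)^k over the contents c of the boxes of ρ.
  contentGap : ℕ → List ℕ → ℚ
  contentGap k ρ = ∑ (range (length ρ)) (λ i → (fromℕ (part ρ i) - fromℕ i) ^ℚ k - (- fromℕ i) ^ℚ k)

  part-sum-0 : ∀ ρ → sum ρ ≡ 0 → ∀ i → part ρ i ≡ 0
  part-sum-0 []       _ i             = refl
  part-sum-0 (x ∷ xs) e zero          = refl
  part-sum-0 (x ∷ xs) e (suc zero)    = ℕ.m+n≡0⇒m≡0 x e
  part-sum-0 (x ∷ xs) e (suc (suc i)) = part-sum-0 xs (ℕ.m+n≡0⇒n≡0 x e) (suc i)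

  contentGap-0 : ∀ k ρ → sum ρ ≡ 0 → contentGap k ρ ≡ 0#
  contentGap-0 k ρ e = ∑-zero (range (length ρ)) (λ i → trans
    (cong (λ x → x ^ℚ k - (- fromℕ i) ^ℚ k) (trans (cong (λ x → fromℕ x - fromℕ i) (part-sum-0 ρ e i)) (+-identityˡ _))) (-‿inverseʳ _))

  Removes-≤length : ∀ {α r ν} → Removes α r ν → r ≤ length α
  Removes-≤length (here _)  = s≤s z≤n
  Removes-≤length (there r) = s≤s (Removes-≤length r)

  -- Along a row the gaps telescope, so taking away the last box of row r removes just the gap at
  -- its content.
  contentGap-Removes : ∀ k {α r ν} → Removes α r ν → contentGap k α ≡ powerGap (fromℕ (part α r) - fromℕ r) k + contentGap k ν
  contentGap-Removes k {α} {r} {ν} rem = begin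
    contentGap k α
      ≡⟨ ∑-cong (range (length α)) term ⟩
    ∑ (range (length α)) (λ i → 𝟙 (i ℕ.≟ r) * powerGap (fromℕ (part α i) - fromℕ i) k + g i)
      ≡⟨ ∑-+ (range (length α)) _ _ ⟩
    ∑ (range (length α)) (λ i → 𝟙 (i ℕ.≟ r) * powerGap (fromℕ (part α i) - fromℕ i) k) + ∑ (range (length α)) g
      ≡⟨ cong₂ _+_ (∑-single ℕ._≟_ (range-unique (length α)) (∈-range (Removes-positive rem) (s≤s (Removes-≤length rem))) _)
           (cong (λ l → ∑ (range l) g) (sym (Pointwise-length (Removes-⊑ rem)))) ⟩
    powerGap (fromℕ (part α r) - fromℕ r) k + contentGap k ν ∎
    where
    g : ℕ → ℚ
    g i = (fromℕ (part ν i) - fromℕ i) ^ℚ k - (- fromℕ i) ^ℚ k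
    term : ∀ i → (fromℕ (part α i) - fromℕ i) ^ℚ k - (- fromℕ i) ^ℚ k ≡ 𝟙 (i ℕ.≟ r) * powerGap (fromℕ (part α i) - fromℕ i) k + g i
    term i = by (i ℕ.≟ r)
      where
      by : (d : Dec (i ≡ r)) → (fromℕ (part α i) - fromℕ i) ^ℚ k - (- fromℕ i) ^ℚ k ≡ 𝟙 d * powerGap (fromℕ (part α i) - fromℕ i) k + g i
      by (no i≢r)   = trans (cong (λ x → (fromℕ x - fromℕ i) ^ℚ k - (- fromℕ i) ^ℚ k) (trans (Removes-part rem i) (cong (ℕ._+ part ν i) (δ-no i≢r))))
        (solve 2 (λ p g → g := con (ℤ.+ 0) :* p :+ g) refl _ (g i))
      by (yes refl) = begin
        c ^ℚ k - (- fromℕ i) ^ℚ k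
          ≡⟨ solve 3 (λ a b c → a :- c := con one :* (a :- b) :+ (b :- c)) refl (c ^ℚ k) ((c - 1#) ^ℚ k) ((- fromℕ i) ^ℚ k) ⟩
        1# * powerGap c k + ((c - 1#) ^ℚ k - (- fromℕ i) ^ℚ k)
          ≡⟨ cong (λ z → 1# * powerGap c k + (z ^ℚ k - (- fromℕ i) ^ℚ k)) (trans
               (cong (λ x → (x - fromℕ i) - 1#) (trans (cong fromℕ (trans (Removes-part rem i) (cong (ℕ._+ part ν i) (δ-yes i)))) (fromℕ-suc (part ν i))))
               (solve 2 (λ p i → ((con one :+ p) :- i) :- con one := p :- i) refl (fromℕ (part ν i)) (fromℕ i))) ⟩
        1# * powerGap c k + g i ∎
        where c = fromℕ (part α i) - fromℕ i

  shapeAt : ∀ {n α} {T : Vec ℕ n} → ℕ → Path α T → List ℕ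
  shapeAt {α = α} zero    P         = α
  shapeAt {α = α} (suc j) []        = α
  shapeAt         (suc j) (rem ∷ P) = shapeAt j P

  -- The boxes removed from step `j` on are the boxes of the shape left at that moment, because |α|
  -- = n makes the path empty the whole shape.
  contentSum : ∀ {n α} {T : Vec ℕ n} (P : Path α T) → sum α ≡ n → ∀ k j →
    ∑ (drop j (allFin n)) (λ p → powerGap (contentAt P p) k) ≡ contentGap k (shapeAt j P)
  contentSum {α = α} []        e k zero    = sym (contentGap-0 k α e)
  contentSum {α = α} []        e k (suc j) = sym (contentGap-0 k α e)
  contentSum {suc n} {α} (_∷_ {r = r} rem P) e k zero = trans
    (cong (powerGap (fromℕ (part α r) - fromℕ r) k +_) (trans (cong (λ zs → ∑ zs f) (drop-suc-allFin 0 n)) (trans (∑-map suc (allFin n) f)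
      (contentSum P (ℕ.suc-injective (trans (Removes-sum rem) e)) k 0))))
    (sym (contentGap-Removes k rem))
    where
    f : Fin (suc n) → ℚ
    f p = powerGap (contentAt (rem ∷ P) p) k
  contentSum {suc n} (rem ∷ P) e k (suc j) = trans (cong (λ zs → ∑ zs f) (drop-suc-allFin j n)) (trans (∑-map suc (drop j (allFin n)) f)
    (contentSum P (ℕ.suc-injective (trans (Removes-sum rem) e)) k j))
    where
    f : Fin (suc n) → ℚ
    f p = powerGap (contentAt (rem ∷ P) p) k

  ∑-paths-∷ : ∀ n α (h : Vec ℕ (suc n) → ℚ) → ∑ (paths (suc n) α) h ≡ ∑ (removals α) (λ (r , ν) → ∑ (paths n ν) (h ∘ (r ∷_)))
  ∑-paths-∷ n α h = trans (∑-concatMap (λ (r , ν) → map (r ∷_) (paths n ν)) (removals α) h) (∑-cong (removals α) (λ (r , ν) → ∑-map (r ∷_) (paths n ν) h))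

  paths-count : ∀ n α → ∑ (paths n α) (λ _ → 1#) ≡ down n (λ _ → 1#) α
  paths-count zero    α = +-identityʳ 1#
  paths-count (suc n) α = trans (∑-paths-∷ n α _) (∑-cong (removals α) (λ (_ , ν) → paths-count n ν))

  -- Paths are grouped by their first `j` steps; the remaining steps are counted by D^(n - j)
  -- applied to 1.
  ∑-paths-shape : ∀ j {n} α (h : Vec ℕ n → ℚ) (Φ : List ℕ → ℚ) → j ≤ n → (∀ {T} (P : Path α T) → h T ≡ Φ (shapeAt j P)) →
    ∑ (paths n α) h ≡ down j (λ ρ → Φ ρ * down (n ∸ j) (λ _ → 1#) ρ) α
  ∑-paths-shape zero    {n} α h Φ le e = trans (∑-cong∈ (paths n α) (λ T∈ → trans (e (∈-paths⁻ n α T∈)) (sym (*-identityʳ (Φ α)))))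
    (trans (∑-*ˡ (Φ α) (paths n α) _) (cong (Φ α *_) (paths-count n α)))
  ∑-paths-shape (suc j) {suc n} α h Φ (s≤s le) e = trans (∑-paths-∷ n α h) (∑-cong∈ (removals α) (λ {(r , ν)} ν∈ →
    ∑-paths-shape j ν (h ∘ (r ∷_)) Φ le (λ P → e (∈-removals α ν∈ ∷ P))))

  module TraceFormula {n α} (dα : Decreasing α) (sα : sum α ≡ n) {Good : Words n → Set} (good⇒highest : ∀ {v} → Good v → HighestWeight α v)
                      (D : Dual Good (paths n α)) where

    open Trace dα good⇒highest D

    χ : Permutation′ n → ℚ
    χ p = trace (p •_)

    χ-class : IsClassFunction χ
    χ-class = (λ {p} {q} p≈q → ∑-cong ts (λ T → cong (dual D T) (lookup-ext λ i → trans (lookup-∘ʷ T p i) (trans (cong (lookup T) (p≈q i)) (sym (lookup-∘ʷ T q i)))))) ,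
      conj
      where
      open Perm using (flip; inverseˡ; inverseʳ)
      conj : ∀ g p → χ (conjugate g p) ≡ χ p
      conj g p = begin
        trace (conjugate g p •_)
          ≡⟨ ∑-cong ts (λ T → cong (dual D T) (trans (∘ʷ-∘ₚ T (flip g) (p ∘ₚ g)) refl)) ⟩
        trace ((λ v → (p ∘ₚ g) • v) ∘ (flip g •_))
          ≡⟨ trace-comm (•-operator (p ∘ₚ g)) (•-operator (flip g)) ⟩
        trace ((flip g •_) ∘ (λ v → (p ∘ₚ g) • v))
          ≡⟨ ∑-cong ts (λ T → cong (dual D T) (lookup-ext λ i → trans (lookup-∘ʷ (T ∘ʷ flip g) (p ∘ₚ g) i) (trans (lookup-∘ʷ T (flip g) _)
               (trans (cong (lookup T) (inverseˡ g)) (sym (lookup-∘ʷ T p i)))))) ⟩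
        trace (p •_) ∎

    trace-op : ∀ F → trace (op F) ≡ ⟨ F , (λ _ p → χ p) ⟩
    trace-op F = trans (∑-swap ts F (λ T (c , _ , p) → c * (p • dual D T) T)) (∑-cong F (λ (c , _ , p) → ∑-*ˡ c ts _))

    -- Diagonal entries of triangular operators multiply, so the trace is a sum over paths of
    -- products of content sums. The last n - k letters see only the shape left after k removals.
    χ-powerSums : ∀ μ k m → k ℕ.+ m ≡ n → ⟨ powerSums μ (drop k (allFin n)) , (λ _ p → χ p) ⟩ ≡
      down k (λ ρ → ∏ μ (λ j → contentGap j ρ) * down m (λ _ → 1#) ρ) α
    χ-powerSums μ k m e = begin
      ⟨ powerSums μ (drop k (allFin n)) , (λ _ p → χ p) ⟩
        ≡⟨ trace-op (powerSums μ (drop k (allFin n))) ⟨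
      ∑ ts (λ T → op (powerSums μ (drop k (allFin n))) (dual D T) T)
        ≡⟨ ∑-paths-shape k α _ (λ ρ → ∏ μ (λ j → contentGap j ρ)) (ℕ.m+n≤o⇒m≤o k (ℕ.≤-reflexive e)) eigenvalue ⟩
      down k (λ ρ → ∏ μ (λ j → contentGap j ρ) * down (n ∸ k) (λ _ → 1#) ρ) α
        ≡⟨ cong (λ m → down k (λ ρ → ∏ μ (λ j → contentGap j ρ) * down m (λ _ → 1#) ρ) α) (trans (cong (_∸ k) (sym e)) (ℕ.m+n∸m≡n k m)) ⟩
      down k (λ ρ → ∏ μ (λ j → contentGap j ρ) * down m (λ _ → 1#) ρ) α ∎
      where
      eigenvalue : ∀ {T} (P : Path α T) → op (powerSums μ (drop k (allFin n))) (dual D T) T ≡ ∏ μ (λ j → contentGap j (shapeAt k P))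
      eigenvalue {T} P = trans (proj₂ (eigen-powerSums P μ k (good⇒highest (good D T∈)) (bounded D T∈)))
        (trans (cong₂ _*_ (∏-cong∈ μ (λ {j} _ → contentSum P sα j k)) (trans (pairing D T∈ T∈) (𝟙-yes (T ≟ʷ T) refl))) (*-identityʳ _))
        where T∈ = ∈-paths⁺ P

-- Signs of permutations

module Signs where

  open Rationals
  open Sums
  open Differences
  open Antisymmetry using (∏; ∏-cong∈)
  open KostkaFormula using (∏-↭)
  open PartialPermutations using (⟨$⟩ʳ-injective; transpose-left; transpose-right; transpose-other)
  open CycleTypes using (unique-covered; unique-covered-length)
  open import Data.Fin.Base using (zero; suc)

  _≈?_ : ∀ {n} (p q : Permutation′ n) → Dec (p ≈ q)
  p ≈? q = Fin.all? (λ i → p ⟨$⟩ʳ i Fin.≟ q ⟨$⟩ʳ i)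

  insert-zero : ∀ {n} (j : Fin (suc n)) (q : Permutation′ n) i → insert zero j q ⟨$⟩ʳ suc i ≡ Fin.punchIn j (q ⟨$⟩ʳ i)
  insert-zero j q i = Perm.insert-punchIn zero j q i

  -- Permutations with equal values need not be equal as records, so occurrence exactly once is
  -- stated by counting up to `_≈_`. The recursion fixes the image of 0 first.
  permutations-count : ∀ {n} (p : Permutation′ n) → ∑ (permutations n) (λ q → 𝟙 (q ≈? p)) ≡ 1#
  permutations-count {zero}  p = trans (+-identityʳ _) (𝟙-yes (Perm.id ≈? p) (λ ()))
  permutations-count {suc n} p = begin
    ∑ (permutations (suc n)) (λ q → 𝟙 (q ≈? p))
      ≡⟨ ∑-concatMap (λ j → map (insert zero j) (permutations n)) (allFin (suc n)) _ ⟩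
    ∑ (allFin (suc n)) (λ j → ∑ (map (insert zero j) (permutations n)) (λ q → 𝟙 (q ≈? p)))
      ≡⟨ ∑-cong (allFin (suc n)) (λ j → trans (∑-map (insert zero j) (permutations n) _) (trans
           (∑-cong (permutations n) (λ q → trans (𝟙-⇔ (insert zero j q ≈? p) ((j Fin.≟ (p ⟨$⟩ʳ zero)) ×-dec (q ≈? remove zero p)) (to j q) (from j q)) (𝟙-× (j Fin.≟ (p ⟨$⟩ʳ zero)) (q ≈? remove zero p))))
           (∑-*ˡ (𝟙 (j Fin.≟ (p ⟨$⟩ʳ zero))) (permutations n) _))) ⟩
    ∑ (allFin (suc n)) (λ j → 𝟙 (j Fin.≟ (p ⟨$⟩ʳ zero)) * ∑ (permutations n) (λ q → 𝟙 (q ≈? remove zero p)))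
      ≡⟨ ∑-single Fin._≟_ (Unique.allFin⁺ (suc n)) (∈-allFin (p ⟨$⟩ʳ zero)) _ ⟩
    ∑ (permutations n) (λ q → 𝟙 (q ≈? remove zero p))
      ≡⟨ permutations-count (remove zero p) ⟩
    1# ∎
    where
    to : ∀ j q → insert zero j q ≈ p → j ≡ p ⟨$⟩ʳ zero × q ≈ remove zero p
    to j q e = e zero , λ i → Fin.punchIn-injective (p ⟨$⟩ʳ zero) _ _ (begin
      Fin.punchIn (p ⟨$⟩ʳ zero) (q ⟨$⟩ʳ i)               ≡⟨ cong (λ k → Fin.punchIn k (q ⟨$⟩ʳ i)) (sym (e zero)) ⟩
      Fin.punchIn j (q ⟨$⟩ʳ i)                            ≡⟨ insert-zero j q i ⟨
      insert zero j q ⟨$⟩ʳ suc i                          ≡⟨ e (suc i) ⟩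
      p ⟨$⟩ʳ suc i                                        ≡⟨ Perm.punchIn-permute p zero i ⟩
      Fin.punchIn (p ⟨$⟩ʳ zero) (remove zero p ⟨$⟩ʳ i)   ∎)
    from : ∀ j q → j ≡ p ⟨$⟩ʳ zero × q ≈ remove zero p → insert zero j q ≈ p
    from j q (e , f) zero    = e
    from j q (e , f) (suc i) = begin
      insert zero j q ⟨$⟩ʳ suc i                          ≡⟨ insert-zero j q i ⟩
      Fin.punchIn j (q ⟨$⟩ʳ i)                            ≡⟨ cong₂ Fin.punchIn e (f i) ⟩
      Fin.punchIn (p ⟨$⟩ʳ zero) (remove zero p ⟨$⟩ʳ i)   ≡⟨ Perm.punchIn-permute p zero i ⟨
      p ⟨$⟩ʳ suc i                                        ∎

  ∑-permutations-≈ : ∀ {n} (p : Permutation′ n) (Φ : Permutation′ n → ℚ) → (∀ {p q} → p ≈ q → Φ p ≡ Φ q) →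
    ∑ (permutations n) (λ q → 𝟙 (q ≈? p) * Φ q) ≡ Φ p
  ∑-permutations-≈ {n} p Φ resp = trans (∑-cong (permutations n) (λ q → 𝟙-cong* (q ≈? p) (λ e → resp e)))
    (trans (∑-*ʳ (Φ p) (permutations n) _) (trans (cong (_* Φ p) (permutations-count p)) (*-identityˡ (Φ p))))

  -- Translation is invertible up to `_≈_`, and a double sum over pairs with p ≈ q ∘ₚ τ can be
  -- evaluated in either order.
  ∑-permutations-translate : ∀ {n} (τ : Permutation′ n) (Φ : Permutation′ n → ℚ) → (∀ {p q} → p ≈ q → Φ p ≡ Φ q) →
    ∑ (permutations n) (λ q → Φ (q ∘ₚ τ)) ≡ ∑ (permutations n) Φ
  ∑-permutations-translate {n} τ Φ resp = begin
    ∑ P (λ q → Φ (q ∘ₚ τ))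
      ≡⟨ ∑-cong P (λ q → sym (∑-permutations-≈ (q ∘ₚ τ) Φ resp)) ⟩
    ∑ P (λ q → ∑ P (λ p → 𝟙 (p ≈? (q ∘ₚ τ)) * Φ p))
      ≡⟨ ∑-swap P P (λ q p → 𝟙 (p ≈? (q ∘ₚ τ)) * Φ p) ⟩
    ∑ P (λ p → ∑ P (λ q → 𝟙 (p ≈? (q ∘ₚ τ)) * Φ p))
      ≡⟨ ∑-cong P (λ p → trans (∑-*ʳ (Φ p) P _) (trans (cong (_* Φ p) (trans
           (∑-cong P (λ q → 𝟙-⇔ (p ≈? (q ∘ₚ τ)) (q ≈? (p ∘ₚ flip τ))
              (λ e i → trans (sym (inverseˡ τ)) (cong (τ ⟨$⟩ˡ_) (sym (e i))))
              (λ e i → trans (sym (inverseʳ τ)) (cong (τ ⟨$⟩ʳ_) (sym (e i))))))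
           (permutations-count (p ∘ₚ flip τ)))) (*-identityˡ (Φ p)))) ⟩
    ∑ P Φ ∎
    where P = permutations n

  ∏pairs : ∀ {A : Set} → List A → (A → A → ℚ) → ℚ
  ∏pairs []       g = 1#
  ∏pairs (x ∷ xs) g = ∏ xs (g x) * ∏pairs xs g

  ∏-* : ∀ {A : Set} (xs : List A) (f g : A → ℚ) → ∏ xs (λ x → f x * g x) ≡ ∏ xs f * ∏ xs g
  ∏-* []       f g = sym (*-identityˡ 1#)
  ∏-* (x ∷ xs) f g = trans (cong (f x * g x *_) (∏-* xs f g)) (solve 4 (λ a b c d → (a :* b) :* (c :* d) := (a :* c) :* (b :* d)) refl _ _ _ _)

  ∏-one : ∀ {A : Set} {xs : List A} {f : A → ℚ} → All (λ x → f x ≡ 1#) xs → ∏ xs f ≡ 1#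
  ∏-one []       = refl
  ∏-one (e ∷ es) = trans (cong₂ _*_ e (∏-one es)) (*-identityˡ 1#)

  ∏pairs-one : ∀ {A : Set} {xs : List A} {f : A → A → ℚ} → AllPairs (λ x y → f x y ≡ 1#) xs → ∏pairs xs f ≡ 1#
  ∏pairs-one []       = refl
  ∏pairs-one (e ∷ es) = trans (cong₂ _*_ (∏-one e) (∏pairs-one es)) (*-identityˡ 1#)

  ∏-map : ∀ {A B : Set} (h : A → B) xs (f : B → ℚ) → ∏ (map h xs) f ≡ ∏ xs (f ∘ h)
  ∏-map h []       f = refl
  ∏-map h (x ∷ xs) f = cong (f (h x) *_) (∏-map h xs f)

  ∏-++ : ∀ {A : Set} (xs ys : List A) (f : A → ℚ) → ∏ (xs ++ ys) f ≡ ∏ xs f * ∏ ys f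
  ∏-++ []       ys f = sym (*-identityˡ _)
  ∏-++ (x ∷ xs) ys f = trans (cong (f x *_) (∏-++ xs ys f)) (sym (*-assoc (f x) _ _))

  ∏pairs-cong : ∀ {A : Set} {xs : List A} {f g : A → A → ℚ} → AllPairs (λ x y → f x y ≡ g x y) xs → ∏pairs xs f ≡ ∏pairs xs g
  ∏pairs-cong []       = refl
  ∏pairs-cong {xs = x ∷ xs} (e ∷ es) = cong₂ _*_ (∏-cong∈ xs (All.lookup e)) (∏pairs-cong es)

  ∏pairs-* : ∀ {A : Set} (xs : List A) (f g : A → A → ℚ) → ∏pairs xs (λ x y → f x y * g x y) ≡ ∏pairs xs f * ∏pairs xs g
  ∏pairs-* []       f g = sym (*-identityˡ 1#)
  ∏pairs-* (x ∷ xs) f g = trans (cong₂ _*_ (∏-* xs (f x) (g x)) (∏pairs-* xs f g))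
    (solve 4 (λ a b c d → (a :* b) :* (c :* d) := (a :* c) :* (b :* d)) refl _ _ _ _)

  ∏pairs-map : ∀ {A B : Set} (h : A → B) xs (f : B → B → ℚ) → ∏pairs (map h xs) f ≡ ∏pairs xs (λ x y → f (h x) (h y))
  ∏pairs-map h []       f = refl
  ∏pairs-map h (x ∷ xs) f = cong₂ _*_ (∏-map h xs (f (h x))) (∏pairs-map h xs f)

  ∏pairs-↭ : ∀ {A : Set} {f : A → A → ℚ} → (∀ x y → f x y ≡ f y x) → ∀ {xs ys} → xs ↭ ys → ∏pairs xs f ≡ ∏pairs ys f
  ∏pairs-↭ s ↭.refl         = refl
  ∏pairs-↭ {f = f} s (↭.prep x p)   = cong₂ _*_ (∏-↭ p (f x)) (∏pairs-↭ s p)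
  ∏pairs-↭ {f = f} s (↭.swap {ys = ys} x y p) = trans
    (cong₂ _*_ (cong₂ _*_ (s x y) (∏-↭ p (f x))) (cong₂ _*_ (∏-↭ p (f y)) (∏pairs-↭ s p)))
    (solve 4 (λ a b c d → (a :* b) :* (c :* d) := (a :* c) :* (b :* d)) refl (f y x) (∏ ys (f x)) (∏ ys (f y)) (∏pairs ys f))
  ∏pairs-↭ s (↭.trans p q)  = trans (∏pairs-↭ s p) (∏pairs-↭ s q)

  parity : ∀ {P : Set} → Dec P → ℚ
  parity d = if does d then - 1# else 1#

  sign-count : ∀ {A : Set} {P : A → Set} (P? : ∀ x → Dec (P x)) xs → sign (length (filter P? xs)) ≡ ∏ xs (parity ∘ P?)
  sign-count P? []       = refl
  sign-count P? (x ∷ xs) with P? x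
  ... | yes _ = trans (sign-suc (length (filter P? xs))) (trans (cong -_ (sign-count P? xs)) (solve 1 (λ a → :- a := :- con one :* a) refl _))
  ... | no  _ = trans (sign-count P? xs) (sym (*-identityˡ _))

  parity-no : ∀ {P : Set} (d : Dec P) → ¬ P → parity d ≡ 1#
  parity-no d ¬p = cong (if_then - 1# else 1#) (dec-false d ¬p)

  parity-yes : ∀ {P : Set} (d : Dec P) → P → parity d ≡ - 1#
  parity-yes d p = cong (if_then - 1# else 1#) (dec-true d p)

  parity-⇔ : ∀ {P Q : Set} (d : Dec P) (e : Dec Q) → (P → Q) → (Q → P) → parity d ≡ parity e
  parity-⇔ d (yes q) to from = parity-yes d (from q)
  parity-⇔ d (no ¬q) to from = parity-no d (¬q ∘ to)

  module _ {n : ℕ} where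

    fins : List (Fin n)
    fins = allFin n

    fins-sorted : AllPairs Fin._<_ fins
    fins-sorted = AllPairs.tabulate⁺-< id

    ∏∏-sorted : ∀ {xs : List (Fin n)} → AllPairs Fin._<_ xs → (g : Fin n → Fin n → ℚ) → (∀ {i j} → ¬ i Fin.< j → g i j ≡ 1#) →
      ∏ xs (λ i → ∏ xs (g i)) ≡ ∏pairs xs g
    ∏∏-sorted []       g h = refl
    ∏∏-sorted {x ∷ xs} (x< ∷ s) g h = begin
      (g x x * ∏ xs (g x)) * ∏ xs (λ i → g i x * ∏ xs (g i))
        ≡⟨ cong₂ _*_ (trans (cong (_* ∏ xs (g x)) (h (ℕ.<-irrefl refl))) (*-identityˡ _))
             (trans (∏-* xs (λ i → g i x) (λ i → ∏ xs (g i))) (trans (cong₂ _*_ (∏-one (All.map (λ x<i → h (ℕ.<-asym x<i)) x<)) (∏∏-sorted s g h)) (*-identityˡ _))) ⟩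
      ∏ xs (g x) * ∏pairs xs g ∎

    ε : Fin n → Fin n → ℚ
    ε a b = parity (b Fin.<? a)

    -- The sign as a product over pairs i < j, which unlike a number of inversions can be compared
    -- factor by factor.
    sg : Permutation′ n → ℚ
    sg q = ∏pairs fins (λ i j → ε (q ⟨$⟩ʳ i) (q ⟨$⟩ʳ j))

    ∏-cartesianProduct : ∀ {A B : Set} (xs : List A) (ys : List B) (f : A × B → ℚ) → ∏ (cartesianProduct xs ys) f ≡ ∏ xs (λ x → ∏ ys (λ y → f (x , y)))
    ∏-cartesianProduct []       ys f = refl
    ∏-cartesianProduct (x ∷ xs) ys f = trans (∏-++ (map (x ,_) ys) _ f) (cong₂ _*_ (∏-map (x ,_) ys f) (∏-cartesianProduct xs ys f))

    sgn-sg : ∀ q → sgn q ≡ sg q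
    sgn-sg q = begin
      sgn q
        ≡⟨ ι-def _ ⟨
      sign (inversions q)
        ≡⟨ sign-count (inversion? q) (cartesianProduct fins fins) ⟩
      ∏ (cartesianProduct fins fins) (λ p → parity (inversion? q p))
        ≡⟨ ∏-cartesianProduct fins fins _ ⟩
      ∏ fins (λ i → ∏ fins (λ j → parity (inversion? q (i , j))))
        ≡⟨ ∏∏-sorted fins-sorted (λ i j → parity (inversion? q (i , j))) (λ {i} {j} i≮j → parity-no (inversion? q (i , j)) (i≮j ∘ proj₁)) ⟩
      ∏pairs fins (λ i j → parity (inversion? q (i , j)))
        ≡⟨ ∏pairs-cong (AllPairs.map (λ {i} {j} i<j → parity-⇔ (inversion? q (i , j)) ((q ⟨$⟩ʳ j) Fin.<? (q ⟨$⟩ʳ i)) proj₂ (i<j ,_)) fins-sorted) ⟩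
      sg q ∎

    sg-resp : ∀ {p q} → p ≈ q → sg p ≡ sg q
    sg-resp e = ∏pairs-cong (AllPairs.map (λ {i} {j} _ → cong₂ ε (e i) (e j)) fins-sorted)

    sg-id : sg Perm.id ≡ 1#
    sg-id = ∏pairs-one (AllPairs.map (λ {i} {j} i<j → parity-no (j Fin.<? i) (ℕ.<-asym i<j)) fins-sorted)

    ε-square : ∀ a b → ε a b * ε a b ≡ 1#
    ε-square a b with b Fin.<? a
    ... | yes p = trans (cong₂ _*_ (parity-yes (b Fin.<? a) p) (parity-yes (b Fin.<? a) p)) (solve 0 (:- con one :* :- con one := con one) refl)
    ... | no ¬p = trans (cong₂ _*_ (parity-no (b Fin.<? a) ¬p) (parity-no (b Fin.<? a) ¬p)) (*-identityˡ 1#)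

    ε-swap : ∀ {a b} → a ≢ b → ε a b ≡ - ε b a
    ε-swap {a} {b} a≢b with Fin.<-cmp a b
    ... | tri< lt _ gt = trans (parity-no (b Fin.<? a) gt) (trans (solve 0 (con one := :- (:- con one)) refl) (cong -_ (sym (parity-yes (a Fin.<? b) lt))))
    ... | tri≈ _ e _   = contradiction e a≢b
    ... | tri> lt _ gt = trans (parity-yes (b Fin.<? a) gt) (cong -_ (sym (parity-no (a Fin.<? b) lt)))

    -- Composing with a transposition of values multiplies the sign by a product over
    -- unordered pairs of values, which does not depend on the permutation.
    sg-transpose : ∀ {x y} → x ≢ y → ∀ q → sg (q ∘ₚ transpose x y) ≡ - sg q
    sg-transpose {x} {y} x≢y q = begin
      ∏pairs fins (λ i j → ε (τ (q ⟨$⟩ʳ i)) (τ (q ⟨$⟩ʳ j)))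
        ≡⟨ ∏pairs-cong (AllPairs.map (λ {i} {j} _ → factor (q ⟨$⟩ʳ i) (q ⟨$⟩ʳ j)) fins-sorted) ⟩
      ∏pairs fins (λ i j → ε (q ⟨$⟩ʳ i) (q ⟨$⟩ʳ j) * ratio (q ⟨$⟩ʳ i) (q ⟨$⟩ʳ j))
        ≡⟨ ∏pairs-* fins _ _ ⟩
      sg q * ∏pairs fins (λ i j → ratio (q ⟨$⟩ʳ i) (q ⟨$⟩ʳ j))
        ≡⟨ cong (sg q *_) (trans (sym (∏pairs-map (q ⟨$⟩ʳ_) fins ratio)) (trans (∏pairs-↭ ratio-sym arrange) first-two)) ⟩
      sg q * - 1#
        ≡⟨ solve 1 (λ a → a :* :- con one := :- a) refl (sg q) ⟩
      - sg q ∎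
      where
      τ : Fin n → Fin n
      τ = transpose x y ⟨$⟩ʳ_
      ratio : Fin n → Fin n → ℚ
      ratio a b = ε a b * ε (τ a) (τ b)
      factor : ∀ a b → ε (τ a) (τ b) ≡ ε a b * ratio a b
      factor a b = trans (sym (*-identityˡ _)) (trans (cong (_* ε (τ a) (τ b)) (sym (ε-square a b))) (*-assoc (ε a b) (ε a b) _))
      ratio-sym : ∀ a b → ratio a b ≡ ratio b a
      ratio-sym a b with a Fin.≟ b
      ... | yes refl = refl
      ... | no a≢b   = trans (cong₂ _*_ (ε-swap a≢b) (ε-swap (a≢b ∘ ⟨$⟩ʳ-injective (transpose x y)))) (solve 2 (λ a b → :- a :* :- b := a :* b) refl _ _)
      others : List (Fin n)
      others = filter (λ i → ¬? (i Fin.≟ x) ×-dec ¬? (i Fin.≟ y)) fins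
      others-≢ : All (λ z → z ≢ x × z ≢ y) others
      others-≢ = All.all-filter (λ i → ¬? (i Fin.≟ x) ×-dec ¬? (i Fin.≟ y)) fins
      -- As `ratio` is symmetric, the values of q may be rearranged with x and y in front, which
      -- removes the dependence on q.
      arrange : map (q ⟨$⟩ʳ_) fins ↭ x ∷ y ∷ others
      arrange = unique-covered unique (λ {z} _ → ∈-map′ z) shorter
        where
        unique : Unique (x ∷ y ∷ others)
        unique = (x≢y ∷ All.map (λ (p , _) e → p (sym e)) others-≢) ∷ All.map (λ (_ , p) e → p (sym e)) others-≢ ∷ Unique.filter⁺ _ (Unique.allFin⁺ n)
        ∈-map′ : ∀ z → z ∈ map (q ⟨$⟩ʳ_) fins
        ∈-map′ z = subst (_∈ map (q ⟨$⟩ʳ_) fins) (inverseʳ q) (∈-map⁺ (q ⟨$⟩ʳ_) (∈-allFin (q ⟨$⟩ˡ z)))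
        listed : ∀ z → z ∈ x ∷ y ∷ others
        listed z with z Fin.≟ x | z Fin.≟ y
        ... | yes e | _     = here e
        ... | no _  | yes e = there (here e)
        ... | no p  | no r  = there (there (∈-filter⁺ _ (∈-allFin z) (p , r)))
        shorter : length (map (q ⟨$⟩ʳ_) fins) ℕ.≤ length (x ∷ y ∷ others)
        shorter = unique-covered-length (Unique.map⁺ (⟨$⟩ʳ-injective q) (Unique.allFin⁺ n)) (λ {z} _ → listed z)

      first-two : ∏pairs (x ∷ y ∷ others) ratio ≡ - 1#
      first-two = begin
        (ratio x y * ∏ others (ratio x)) * (∏ others (ratio y) * ∏pairs others ratio)
          ≡⟨ solve 4 (λ a b c d → (a :* b) :* (c :* d) := a :* ((b :* c) :* d)) refl _ _ _ _ ⟩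
        ratio x y * ((∏ others (ratio x) * ∏ others (ratio y)) * ∏pairs others ratio)
          ≡⟨ cong₂ (λ a b → a * b) top (cong₂ _*_ (trans (sym (∏-* others (ratio x) (ratio y))) (∏-one (All.map cancel others-≢)))
               (∏pairs-one (pairwise others-≢))) ⟩
        - 1# * (1# * 1#)
          ≡⟨ solve 0 (:- con one :* (con one :* con one) := :- con one) refl ⟩
        - 1# ∎
        where
        top : ratio x y ≡ - 1#
        top = trans (cong₂ (λ a b → ε x y * ε a b) (transpose-left x y) (transpose-right x y))
          (trans (cong (ε x y *_) (ε-swap (x≢y ∘ sym))) (trans (solve 1 (λ a → a :* :- a := :- (a :* a)) refl (ε x y)) (cong -_ (ε-square x y))))
        -- The transposition exchanges the pairs (x, z) and (y, z), so the product of their ratios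
        -- is a square.
        cancel : ∀ {z} → z ≢ x × z ≢ y → ratio x z * ratio y z ≡ 1#
        cancel {z} (p , r) = begin
          (ε x z * ε (τ x) (τ z)) * (ε y z * ε (τ y) (τ z))
            ≡⟨ cong₂ (λ a b → (ε x z * a) * (ε y z * b)) (cong₂ ε (transpose-left x y) (transpose-other p r)) (cong₂ ε (transpose-right x y) (transpose-other p r)) ⟩
          (ε x z * ε y z) * (ε y z * ε x z)
            ≡⟨ solve 2 (λ a b → (a :* b) :* (b :* a) := (a :* a) :* (b :* b)) refl _ _ ⟩
          (ε x z * ε x z) * (ε y z * ε y z)
            ≡⟨ trans (cong₂ _*_ (ε-square x z) (ε-square y z)) (*-identityˡ 1#) ⟩
          1# ∎
        pairwise : ∀ {xs} → All (λ z → z ≢ x × z ≢ y) xs → AllPairs (λ a b → ratio a b ≡ 1#) xs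
        pairwise []       = []
        pairwise {a ∷ _} ((p , r) ∷ ps) = All.map (λ {b} (p′ , r′) → trans (cong₂ (λ u v → ε a b * ε u v) (transpose-other p r) (transpose-other p′ r′)) (ε-square a b)) ps ∷ pairwise ps

-- Polytabloids as highest weight vectors

module Polytabloids where

  open Rationals
  open Sums
  open SkewTableaux
  open HorizontalStrips
  open Dimensions
  open HookSums
  open Antisymmetry using (≡-⇒0)
  open KostkaFormula using (δ)
  open HighestWeight
  open Traces
  open PartialPermutations using (transpose-left; transpose-right; transpose-other)
  open Eigenvalues using (∘ʷ-∘ₚ; part-sum-0)
  open Signs
  open import Data.Fin.Base using (zero; suc)

  part-antitone : ∀ α → Decreasing α → ∀ {k l} → k ≤ l → part α (suc l) ≤ part α (suc k)
  part-antitone []       d       le      = z≤n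
  part-antitone (x ∷ xs) (p , d) {zero}  {zero}  le = ℕ.≤-refl
  part-antitone (x ∷ xs) (p , d) {zero}  {suc l} le = ℕ.≤-trans (part-antitone xs d z≤n) (first xs p)
    where
    first : ∀ xs → hd xs ≤ x → part xs 1 ≤ x
    first []      _ = z≤n
    first (_ ∷ _) p = p
  part-antitone (x ∷ xs) (p , d) {suc k} {suc l} (s≤s le) = part-antitone xs d le

  ∈-diagram⁺ : ∀ s α {k c} → c < part α (suc k) → (s ℕ.+ k , suc c) ∈ skew s α []
  ∈-diagram⁺ s (x ∷ xs) {zero}  {c} c< = ∈-++⁺ˡ (subst (λ r → (r , suc c) ∈ row s 0 x) (sym (ℕ.+-identityʳ s)) (∈-row s 0 x c z≤n c<))
  ∈-diagram⁺ s (x ∷ xs) {suc k} {c} c< = ∈-++⁺ʳ (row s 0 x) (subst (λ r → (r , suc c) ∈ skew (suc s) xs []) (sym (ℕ.+-suc s k)) (∈-diagram⁺ (suc s) xs c<))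

  diagram-cells : ∀ s α → All (λ (i , j) → ∃[ k ] ∃[ c ] i ≡ s ℕ.+ k × j ≡ suc c × c < part α (suc k)) (skew s α [])
  diagram-cells s []       = []
  diagram-cells s (x ∷ xs) = All.++⁺
    (All.map (λ { {i , suc j} (e , _ , j≤) → 0 , j , trans e (sym (ℕ.+-identityʳ s)) , refl , j≤ ; {i , zero} (_ , () , _) }) (row-cells s 0 x))
    (All.map (λ { (k , c , e , f , c<) → suc k , c , trans e (sym (ℕ.+-suc s k)) , f , c< }) (diagram-cells (suc s) xs))

  diagram-unique : ∀ s α → Unique (skew s α [])
  diagram-unique s []       = []
  diagram-unique s (x ∷ xs) = Unique.++⁺ (rows s 0 x) (diagram-unique (suc s) xs)
    (λ (a , b) → disjoint (All.lookup (row-cells s 0 x) a) (All.lookup (diagram-cells (suc s) xs) b))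
    where
    rows : ∀ s a k → Unique (row s a k)
    rows s a zero    = []
    rows s a (suc k) = All.map (λ { (_ , a< , _) refl → ℕ.<-irrefl refl a< }) (row-cells s (suc a) k) ∷ rows s (suc a) k
    disjoint : ∀ {c : Cell} → proj₁ c ≡ s × 0 < proj₂ c × proj₂ c ≤ 0 ℕ.+ x →
      (∃[ k ] ∃[ c′ ] proj₁ c ≡ suc s ℕ.+ k × proj₂ c ≡ suc c′ × c′ < part xs (suc k)) → ⊥
    disjoint (e , _) (k , _ , f , _) = ℕ.<⇒≢ (s≤s (ℕ.m≤m+n s k)) (trans (sym e) f)

  lookup-injective : ∀ {A : Set} {xs : List A} → Unique xs → ∀ {i j} → List.lookup xs i ≡ List.lookup xs j → i ≡ j
  lookup-injective (x∉ ∷ u) {zero}  {zero}  e = refl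
  lookup-injective (x∉ ∷ u) {zero}  {suc j} e = contradiction e (All.lookup x∉ (∈-lookup j))
  lookup-injective (x∉ ∷ u) {suc i} {zero}  e = contradiction (sym e) (All.lookup x∉ (∈-lookup i))
  lookup-injective (x∉ ∷ u) {suc i} {suc j} e = cong suc (lookup-injective u e)

  ∑ᶠ-lookup : ∀ {A : Set} (xs : List A) (f : A → ℚ) → ∑ᶠ (λ i → f (List.lookup xs i)) ≡ ∑ xs f
  ∑ᶠ-lookup []       f = refl
  ∑ᶠ-lookup (x ∷ xs) f = cong (f x +_) (∑ᶠ-lookup xs f)

  ∑-diagram-row : ∀ s α k → ∑ (skew s α []) (λ c → 𝟙 (proj₁ c ℕ.≟ s ℕ.+ k)) ≡ fromℕ (part α (suc k))
  ∑-diagram-row s []       k = refl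
  ∑-diagram-row s (x ∷ xs) k = trans (∑-++ (row s 0 x) (skew (suc s) xs []) _) (by k)
    where
    by : ∀ k → ∑ (row s 0 x) (λ c → 𝟙 (proj₁ c ℕ.≟ s ℕ.+ k)) + ∑ (skew (suc s) xs []) (λ c → 𝟙 (proj₁ c ℕ.≟ s ℕ.+ k)) ≡ fromℕ (part (x ∷ xs) (suc k))
    by zero = trans (cong₂ _+_
      (trans (∑-cong∈ (row s 0 x) (λ {c} c∈ → 𝟙-yes (proj₁ c ℕ.≟ s ℕ.+ 0) (trans (proj₁ (All.lookup (row-cells s 0 x) c∈)) (sym (ℕ.+-identityʳ s)))))
        (trans (sym (fromℕ-length (row s 0 x))) (cong fromℕ (length-row s 0 x))))
      (∑-zero∈ (skew (suc s) xs []) (λ {c} c∈ → 𝟙-no (proj₁ c ℕ.≟ s ℕ.+ 0) (λ e → later (All.lookup (diagram-cells (suc s) xs) c∈) e))))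
      (+-identityʳ _)
      where
      later : ∀ {c : Cell} → (∃[ k ] ∃[ c′ ] proj₁ c ≡ suc s ℕ.+ k × proj₂ c ≡ suc c′ × c′ < part xs (suc k)) → proj₁ c ≡ s ℕ.+ 0 → ⊥
      later (k , _ , f , _) e = ℕ.<⇒≢ (s≤s (ℕ.m≤m+n s k)) (trans (sym (ℕ.+-identityʳ s)) (trans (sym e) f))
    by (suc k) = trans (cong₂ _+_
      (∑-zero∈ (row s 0 x) (λ {c} c∈ → 𝟙-no (proj₁ c ℕ.≟ s ℕ.+ suc k) (λ e → ℕ.<⇒≢ (ℕ.m<m+n s (s≤s z≤n)) (trans (sym (proj₁ (All.lookup (row-cells s 0 x) c∈))) e))))
      (trans (∑-cong (skew (suc s) xs []) (λ c → cong (λ t → 𝟙 (proj₁ c ℕ.≟ t)) (ℕ.+-suc s k))) (∑-diagram-row (suc s) xs k)))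
      (+-identityˡ _)

  transpose-cases : ∀ {n} (P : Fin n → Fin n → Set) {x y} → P x y → P y x → (∀ k → k ≢ x → k ≢ y → P k k) → ∀ k → P k (transpose x y ⟨$⟩ʳ k)
  transpose-cases P {x} {y} l r o k = by (k Fin.≟ x) (k Fin.≟ y)
    where
    by : Dec (k ≡ x) → Dec (k ≡ y) → P k (transpose x y ⟨$⟩ʳ k)
    by (yes refl) _          = subst (P k) (sym (transpose-left k y)) l
    by (no k≢x)   (yes refl) = subst (P k) (sym (transpose-right x k)) r
    by (no k≢x)   (no k≢y)   = subst (P k) (sym (transpose-other k≢x k≢y)) (o k k≢x k≢y)

  module _ {n} {α : Partition n} (t : Tableau α) where

    private
      a = parts α
      dα : Decreasing a
      dα = Linked⇒Decreasing (decreasing α)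
      e = polytabloid t
      T = tabloid t
      dg≡ : diagram a ≡ skew 1 a []
      dg≡ = ⧸-skew a []

    rowOf colOf : Fin n → ℕ
    rowOf i = proj₁ (cell t i)
    colOf i = proj₂ (cell t i)

    lookup-tabloid : ∀ i → lookup T i ≡ rowOf i
    lookup-tabloid = Vec.lookup∘tabulate rowOf

    cell-injective : ∀ {i j} → rowOf i ≡ rowOf j → colOf i ≡ colOf j → i ≡ j
    cell-injective {i} {j} p q = trans (sym (inverseˡ (position t))) (trans (cong (position t ⟨$⟩ˡ_)
      (lookup-injective (subst Unique (sym dg≡) (diagram-unique 1 a)) (cong₂ _,_ p q))) (inverseˡ (position t)))

    cell-above : ∀ i r → 0 < r → r < rowOf i → ∃[ j ] rowOf j ≡ r × colOf j ≡ colOf i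
    cell-above i (suc r) _ r< with All.lookup (subst (All _) (sym dg≡) (diagram-cells 1 a)) (∈-lookup (position t ⟨$⟩ʳ i))
    ... | k , c , e , f , c< = position t ⟨$⟩ˡ x , cong proj₁ at , trans (cong proj₂ at) (sym f)
      where
      found : (suc r , suc c) ∈ diagram a
      found = subst ((suc r , suc c) ∈_) (sym dg≡) (∈-diagram⁺ 1 a (ℕ.<-≤-trans c< (part-antitone a dα (ℕ.<⇒≤ (ℕ.≤-pred (subst (suc r <_) e r<))))))
      x = Any.index found
      at : cell t (position t ⟨$⟩ˡ x) ≡ (suc r , suc c)
      at = trans (cong (List.lookup (diagram a)) (inverseʳ (position t))) (sym (lookup-index found))

    Stabilizes : Permutation′ n → Set
    Stabilizes = ColumnStabilizes t

    opaque
      unfolding _*_ ι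
      single-𝟙 : ∀ {m} (s r : Vec ℕ m) → single s r ≡ 𝟙 (s ≟ʷ r)
      single-𝟙 s r = refl

    -- A sum over all permutations with an indicator allows translation of q. Relabelling by q gives
    -- r exactly if T is r with its positions permuted by q.
    polytabloid-∑ : ∀ r → e r ≡ ∑ (permutations n) (λ q → 𝟙 (columnStabilizes? t q) * (sg q * 𝟙 (T ≟ʷ (r ∘ʷ q))))
    polytabloid-∑ r = trans (sym (∑-def (columnStabilizer t) _)) (trans (∑-filter (columnStabilizes? t) (permutations n) _)
      (∑-cong (permutations n) (λ q → cong (𝟙 (columnStabilizes? t q) *_) (trans (sym (*-def _ _)) (cong₂ _*_ (sgn-sg q)
        (trans (single-𝟙 (tabloid (relabel q t)) r) (𝟙-⇔ (tabloid (relabel q t) ≟ʷ r) (T ≟ʷ (r ∘ʷ q)) (to q) (from q))))))))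
      where
      at : ∀ q i → lookup (tabloid (relabel q t)) i ≡ lookup T (q ⟨$⟩ˡ i)
      at q i = trans (Vec.lookup∘tabulate (λ i → proj₁ (cell (relabel q t) i)) i) (sym (lookup-tabloid (q ⟨$⟩ˡ i)))
      to : ∀ q → tabloid (relabel q t) ≡ r → T ≡ r ∘ʷ q
      to q eq = lookup-ext λ i → trans (cong (lookup T) (sym (inverseˡ q))) (trans (sym (at q (q ⟨$⟩ʳ i)))
        (trans (cong (λ u → lookup u (q ⟨$⟩ʳ i)) eq) (sym (lookup-∘ʷ r q i))))
      from : ∀ q → T ≡ r ∘ʷ q → tabloid (relabel q t) ≡ r
      from q eq = lookup-ext λ i → trans (at q i) (trans (cong (λ u → lookup u (q ⟨$⟩ˡ i)) eq) (trans (lookup-∘ʷ r q (q ⟨$⟩ˡ i)) (cong (lookup r) (inverseʳ q))))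

    polytabloid-0 : ∀ r → (∀ q → Stabilizes q → T ≢ r ∘ʷ q) → e r ≡ 0#
    polytabloid-0 r none = trans (polytabloid-∑ r) (∑-zero (permutations n) (λ q → trans
      (𝟙-cong* (columnStabilizes? t q) (λ st → trans (cong (sg q *_) (𝟙-no (T ≟ʷ (r ∘ʷ q)) (none q st))) (zeroʳ (sg q)))) (zeroʳ _)))

    -- Translation by the transposition preserves the column stabilizer and changes all signs.
    polytabloid-transpose : ∀ {x y} → x ≢ y → colOf x ≡ colOf y → ∀ r → e (r ∘ʷ transpose x y) ≡ - e r
    polytabloid-transpose {x} {y} x≢y cxy r = begin
      e (r ∘ʷ τ)
        ≡⟨ polytabloid-∑ (r ∘ʷ τ) ⟩
      ∑ (permutations n) (λ q → 𝟙 (columnStabilizes? t q) * (sg q * 𝟙 (T ≟ʷ ((r ∘ʷ τ) ∘ʷ q))))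
        ≡⟨ ∑-cong (permutations n) term ⟩
      ∑ (permutations n) (λ q → - Φ (q ∘ₚ τ))
        ≡⟨ ∑-neg (permutations n) (λ q → Φ (q ∘ₚ τ)) ⟩
      - ∑ (permutations n) (λ q → Φ (q ∘ₚ τ))
        ≡⟨ cong -_ (trans (∑-permutations-translate τ Φ (λ {p} {q} → Φ-resp p q)) (sym (polytabloid-∑ r))) ⟩
      - e r ∎
      where
      τ = transpose x y
      Φ : Permutation′ n → ℚ
      Φ q = 𝟙 (columnStabilizes? t q) * (sg q * 𝟙 (T ≟ʷ (r ∘ʷ q)))
      Φ-resp : ∀ p q → p ≈ q → Φ p ≡ Φ q
      Φ-resp p q e = cong₂ _*_ (𝟙-⇔ (columnStabilizes? t p) (columnStabilizes? t q)
          (λ s i → trans (cong colOf (sym (e i))) (s i)) (λ s i → trans (cong colOf (e i)) (s i)))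
        (cong₂ _*_ (sg-resp {n} {p} {q} e) (cong (λ u → 𝟙 (T ≟ʷ u)) (lookup-ext λ i → trans (lookup-∘ʷ r p i) (trans (cong (lookup r) (e i)) (sym (lookup-∘ʷ r q i))))))
      τ-col : ∀ i → colOf (τ ⟨$⟩ʳ i) ≡ colOf i
      τ-col = transpose-cases (λ k l → colOf l ≡ colOf k) (sym cxy) cxy (λ _ _ _ → refl)
      term : ∀ q → 𝟙 (columnStabilizes? t q) * (sg q * 𝟙 (T ≟ʷ ((r ∘ʷ τ) ∘ʷ q))) ≡ - Φ (q ∘ₚ τ)
      term q = trans (cong₂ _*_ (𝟙-⇔ (columnStabilizes? t q) (columnStabilizes? t (q ∘ₚ τ))
          (λ s i → trans (τ-col (q ⟨$⟩ʳ i)) (s i)) (λ s i → trans (sym (τ-col (q ⟨$⟩ʳ i))) (s i)))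
        (cong₂ _*_ (trans (solve 1 (λ a → a := :- (:- a)) refl (sg q)) (cong -_ (sym (sg-transpose x≢y q)))) (cong (λ u → 𝟙 (T ≟ʷ u)) (sym (∘ʷ-∘ₚ r q τ)))))
        (solve 3 (λ a b c → a :* (:- b :* c) := :- (a :* (b :* c))) refl _ _ _)

    -- A column permutation would have to put two entries of one column into the same row.
    polytabloid-repeated : ∀ {x y} → x ≢ y → colOf x ≡ colOf y → ∀ r → lookup r x ≡ lookup r y → e r ≡ 0#
    polytabloid-repeated {x} {y} x≢y cxy r rxy = polytabloid-0 r λ q st eq →
      x≢y (trans (sym (inverseʳ q)) (trans (cong (q ⟨$⟩ʳ_) (cell-injective
        (trans (row-at q eq x) (trans rxy (sym (row-at q eq y)))) (trans (col-at q st x) (trans cxy (sym (col-at q st y)))))) (inverseʳ q)))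
      where
      row-at : ∀ q → T ≡ r ∘ʷ q → ∀ x → rowOf (q ⟨$⟩ˡ x) ≡ lookup r x
      row-at q eq x = trans (sym (lookup-tabloid (q ⟨$⟩ˡ x))) (trans (cong (λ u → lookup u (q ⟨$⟩ˡ x)) eq) (trans (lookup-∘ʷ r q (q ⟨$⟩ˡ x)) (cong (lookup r) (inverseʳ q))))
      col-at : ∀ q → Stabilizes q → ∀ x → colOf (q ⟨$⟩ˡ x) ≡ colOf x
      col-at q st x = trans (sym (st (q ⟨$⟩ˡ x))) (cong colOf (inverseʳ q))

    count-tabloid : ∀ c → count c T ≡ part a c
    count-tabloid c = fromℕ-injective (begin
      fromℕ (count c T)                                        ≡⟨ count-∑ c T ⟨
      ∑ᶠ (λ i → 𝟙 (lookup T i ℕ.≟ c))                          ≡⟨ ∑ᶠ-cong {n} {λ i → 𝟙 (lookup T i ℕ.≟ c)} {λ i → 𝟙 (rowOf i ℕ.≟ c)} (λ i → cong (λ x → 𝟙 (x ℕ.≟ c)) (lookup-tabloid i)) ⟩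
      ∑ᶠ (λ i → 𝟙 (rowOf i ℕ.≟ c))                             ≡⟨ ∑ᶠ-permute (λ x → 𝟙 (proj₁ (List.lookup (diagram a) x) ℕ.≟ c)) (position t) ⟨
      ∑ᶠ (λ x → 𝟙 (proj₁ (List.lookup (diagram a) x) ℕ.≟ c))   ≡⟨ ∑ᶠ-lookup (diagram a) (λ x → 𝟙 (proj₁ x ℕ.≟ c)) ⟩
      ∑ (diagram a) (λ x → 𝟙 (proj₁ x ℕ.≟ c))                  ≡⟨ cong (λ θ → ∑ θ (λ x → 𝟙 (proj₁ x ℕ.≟ c))) dg≡ ⟩
      ∑ (skew 1 a []) (λ x → 𝟙 (proj₁ x ℕ.≟ c))                ≡⟨ row-count c ⟩
      fromℕ (part a c)                                          ∎)
      where
      row-count : ∀ c → ∑ (skew 1 a []) (λ x → 𝟙 (proj₁ x ℕ.≟ c)) ≡ fromℕ (part a c)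
      row-count (suc c) = ∑-diagram-row 1 a c
      row-count zero    = trans (∑-zero∈ (skew 1 a []) (λ {x} x∈ → 𝟙-no (proj₁ x ℕ.≟ 0) (λ e → positive-row (All.lookup (diagram-cells 1 a) x∈) e)))
        (cong fromℕ (sym (part-0 a)))
        where
        positive-row : ∀ {c : Cell} → (∃[ k ] ∃[ c′ ] proj₁ c ≡ suc k × proj₂ c ≡ suc c′ × c′ < part a (suc k)) → proj₁ c ≡ 0 → ⊥
        positive-row (k , _ , f , _) e = contradiction (trans (sym f) e) λ ()

    -- If no column carries the letter i twice, then putting j > i in place of i leaves a column
    -- that contains j without i above it, and every term is 0. If two entries of a column carry i,
    -- the terms in which one or the other is replaced cancel, and all other terms have a repeated
    -- letter.
    polytabloid-highestWeight : HighestWeight a e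
    polytabloid-highestWeight = record
      { content = λ w c ne → polytabloid-0 w (λ q st eq → ne (trans (sym (count-∘ʷ c w q)) (trans (cong (count c) (sym eq)) (count-tabloid c))))
      ; raising = raised }
      where
      raised : ∀ i j → 0 < i → i < j → ∀ r → E i j e r ≡ 0#
      raised i j 0<i i<j r = by (Fin.any? (λ x → Fin.any? (λ y → ¬? (x Fin.≟ y) ×-dec ((colOf x ℕ.≟ colOf y) ×-dec ((lookup r x ℕ.≟ i) ×-dec (lookup r y ℕ.≟ i))))))
        where
        f : Fin n → ℚ
        f p = 𝟙 (lookup r p ℕ.≟ i) * e (r [ p ]≔ j)
        Clash : Set
        Clash = ∃[ x ] ∃[ y ] x ≢ y × colOf x ≡ colOf y × lookup r x ≡ i × lookup r y ≡ i
        by : Dec Clash → ∑ᶠ f ≡ 0#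
        by (no none) = ∑ᶠ-zero (λ p → trans (𝟙-cong* (lookup r p ℕ.≟ i) (vanish p)) (zeroʳ _))
          where
          vanish : ∀ p → lookup r p ≡ i → e (r [ p ]≔ j) ≡ 0#
          vanish p rp = polytabloid-0 (r [ p ]≔ j) clash
            where
            clash : ∀ q → Stabilizes q → T ≢ (r [ p ]≔ j) ∘ʷ q
            clash q st eq with cell-above (q ⟨$⟩ˡ p) i 0<i (subst (i <_) (sym row-p) i<j)
              where
              row-p : rowOf (q ⟨$⟩ˡ p) ≡ j
              row-p = trans (sym (lookup-tabloid (q ⟨$⟩ˡ p))) (trans (cong (λ u → lookup u (q ⟨$⟩ˡ p)) eq) (trans (lookup-∘ʷ (r [ p ]≔ j) q (q ⟨$⟩ˡ p))
                (trans (cong (lookup (r [ p ]≔ j)) (inverseʳ q)) (Vec.lookup∘updateAt p r))))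
            ... | x , rx , cx = none (p , q ⟨$⟩ʳ x , p≢ , trans (cong colOf (sym (inverseʳ q))) (trans (st (q ⟨$⟩ˡ p)) (trans (sym cx) (sym (st x)))) , rp , trans (sym (Vec.lookup∘updateAt′ (q ⟨$⟩ʳ x) p (p≢ ∘ sym) r)) s-x)
              where
              s-x : lookup (r [ p ]≔ j) (q ⟨$⟩ʳ x) ≡ i
              s-x = trans (sym (lookup-∘ʷ (r [ p ]≔ j) q x)) (trans (cong (λ u → lookup u x) (sym eq)) (trans (lookup-tabloid x) rx))
              p≢ : p ≢ q ⟨$⟩ʳ x
              p≢ refl = ℕ.<⇒≢ i<j (trans (sym s-x) (Vec.lookup∘updateAt p r))
        -- Reindexing by the transposition of x and y negates every term, so the sum equals its own
        -- negative.
        by (yes (x , y , x≢y , cxy , rx , ry)) = ≡-⇒0 (trans (∑ᶠ-permute f (transpose x y)) (trans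
          (∑ᶠ-cong {n} {λ k → f (transpose x y ⟨$⟩ʳ k)} {λ k → - f k} odd) (trans
          (∑ᶠ-cong {n} {λ k → - f k} {λ k → (- 1#) * f k} (λ k → solve 1 (λ a → :- a := :- con one :* a) refl (f k)))
          (trans (∑ᶠ-*ˡ (- 1#) f) (solve 1 (λ a → :- con one :* a := :- a) refl (∑ᶠ f))))))
          where
          swapped : ∀ {u v} → u ≢ v → lookup r u ≡ i → lookup r v ≡ i → (r [ v ]≔ j) ∘ʷ transpose u v ≡ r [ u ]≔ j
          swapped {u} {v} u≢v ru rv = lookup-ext λ k → trans (lookup-∘ʷ (r [ v ]≔ j) (transpose u v) k) (at k)
            where
            at : ∀ k → lookup (r [ v ]≔ j) (transpose u v ⟨$⟩ʳ k) ≡ lookup (r [ u ]≔ j) k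
            at = transpose-cases (λ k l → lookup (r [ v ]≔ j) l ≡ lookup (r [ u ]≔ j) k) (trans (Vec.lookup∘updateAt v r) (sym (Vec.lookup∘updateAt u r)))
              (trans (Vec.lookup∘updateAt′ u v u≢v r) (trans (trans ru (sym rv)) (sym (Vec.lookup∘updateAt′ v u (u≢v ∘ sym) r))))
              (λ k k≢u k≢v → trans (Vec.lookup∘updateAt′ k v k≢v r) (sym (Vec.lookup∘updateAt′ k u k≢u r)))
          exchange : ∀ {u v} → u ≢ v → colOf u ≡ colOf v → lookup r u ≡ i → lookup r v ≡ i → f v ≡ - f u
          exchange {u} {v} u≢v cuv ru rv = begin
            𝟙 (lookup r v ℕ.≟ i) * e (r [ v ]≔ j)
              ≡⟨ cong₂ _*_ (trans (𝟙-yes (lookup r v ℕ.≟ i) rv) (sym (𝟙-yes (lookup r u ℕ.≟ i) ru)))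
                   (trans (solve 1 (λ a → a := :- (:- a)) refl _) (cong -_ (trans (sym (polytabloid-transpose u≢v cuv (r [ v ]≔ j))) (cong e (swapped u≢v ru rv))))) ⟩
            𝟙 (lookup r u ℕ.≟ i) * - e (r [ u ]≔ j)
              ≡⟨ solve 2 (λ a b → a :* :- b := :- (a :* b)) refl _ _ ⟩
            - f u ∎
          zero-f : ∀ k → k ≢ x → k ≢ y → f k ≡ 0#
          zero-f k k≢x k≢y = trans (cong (𝟙 (lookup r k ℕ.≟ i) *_) (polytabloid-repeated x≢y cxy (r [ k ]≔ j)
              (trans (Vec.lookup∘updateAt′ x k (k≢x ∘ sym) r) (trans (trans rx (sym ry)) (sym (Vec.lookup∘updateAt′ y k (k≢y ∘ sym) r)))))) (zeroʳ _)
          odd : ∀ k → f (transpose x y ⟨$⟩ʳ k) ≡ - f k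
          odd = transpose-cases (λ k l → f l ≡ - f k) (exchange x≢y cxy rx ry) (exchange (x≢y ∘ sym) (sym cxy) ry rx)
            λ k k≢x k≢y → trans (zero-f k k≢x k≢y) (trans (solve 0 (con (ℤ.+ 0) := :- con (ℤ.+ 0)) refl) (cong -_ (sym (zero-f k k≢x k≢y))))

    -- Only the identity preserves both the row and the column of every entry.
    polytabloid-leading : e T ≡ 1#
    polytabloid-leading = trans (polytabloid-∑ T) (trans (∑-cong (permutations n) (λ q → term q))
      (trans (∑-permutations-≈ {n} Perm.id sg (λ {p} {q} → sg-resp {n} {p} {q})) (sg-id {n})))
      where
      term : ∀ q → 𝟙 (columnStabilizes? t q) * (sg q * 𝟙 (T ≟ʷ (T ∘ʷ q))) ≡ 𝟙 (q ≈? Perm.id) * sg q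
      term q = trans (solve 3 (λ a b c → a :* (b :* c) := (a :* c) :* b) refl (𝟙 (columnStabilizes? t q)) (sg q) (𝟙 (T ≟ʷ (T ∘ʷ q))))
        (cong (_* sg q) (trans (sym (𝟙-× (columnStabilizes? t q) (T ≟ʷ (T ∘ʷ q)))) (𝟙-⇔ (columnStabilizes? t q ×-dec (T ≟ʷ (T ∘ʷ q))) (q ≈? Perm.id)
          (λ (st , eq) i → cell-injective (trans (sym (lookup-tabloid (q ⟨$⟩ʳ i))) (trans (sym (lookup-∘ʷ T q i)) (trans (cong (λ u → lookup u i) (sym eq)) (lookup-tabloid i)))) (st i))
          (λ idq → (λ i → cong colOf (idq i)) , lookup-ext λ i → sym (trans (lookup-∘ʷ T q i) (cong (lookup T) (idq i)))))))

    -- Entries decrease down the columns, as the smallest entry is removed first.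
    ReverseStandard : Set
    ReverseStandard = ∀ {x y} → x Fin.< y → colOf x ≡ colOf y → lookup T y < lookup T x

    -- At the first position p where s differs from T, s has a larger letter. A column permutation
    -- that produces s moves to p an entry y from a lower row, and y < p by the standard condition.
    -- But s and T agree at y, so y stays fixed, a contradiction.
    polytabloid-bounded : ReverseStandard → Bounded T e
    polytabloid-bounded std = bounded-by T e λ s T≺s → polytabloid-0 s (λ q st eq → impossible s q st eq (first-difference T≺s))
      where
      bounded-by : ∀ {m} (T : Vec ℕ m) (v : Words m) → (∀ s → T ≺ s → v s ≡ 0#) → Bounded T v
      bounded-by []      v h = _
      bounded-by (r ∷ T) v h = (λ s r<s w → h (s ∷ w) (head r<s)) , bounded-by T (v ∘ (r ∷_)) (λ s p → h (r ∷ s) (tail p))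
      first-difference : ∀ {m} {T s : Vec ℕ m} → T ≺ s → ∃[ p ] lookup T p < lookup s p × (∀ j → j Fin.< p → lookup T j ≡ lookup s j)
      first-difference (head r<s) = zero , r<s , λ _ ()
      first-difference (tail p) with first-difference p
      ... | q , lt , eq = suc q , lt , λ { zero _ → refl ; (suc j) (s≤s j<) → eq j j< }
      impossible : ∀ s q → Stabilizes q → T ≡ s ∘ʷ q → (∃[ p ] lookup T p < lookup s p × (∀ j → j Fin.< p → lookup T j ≡ lookup s j)) → ⊥
      impossible s q st eq (p , lt , same) = compare (Fin.<-cmp y p)
        where
        y = q ⟨$⟩ˡ p
        letter : ∀ x → lookup T (q ⟨$⟩ˡ x) ≡ lookup s x
        letter x = trans (cong (λ u → lookup u (q ⟨$⟩ˡ x)) eq) (trans (lookup-∘ʷ s q (q ⟨$⟩ˡ x)) (cong (lookup s) (inverseʳ q)))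
        column : ∀ x → colOf (q ⟨$⟩ˡ x) ≡ colOf x
        column x = trans (sym (st (q ⟨$⟩ˡ x))) (cong colOf (inverseʳ q))
        fixed : y Fin.< p → q ⟨$⟩ˡ y ≡ y
        fixed y<p = cell-injective (trans (sym (lookup-tabloid (q ⟨$⟩ˡ y))) (trans (letter y) (trans (sym (same y y<p)) (lookup-tabloid y)))) (column y)
        compare : Tri (y Fin.< p) (y ≡ p) (p Fin.< y) → ⊥
        compare (tri≈ _ y≡p _) = ℕ.<⇒≢ lt (trans (sym (cong (lookup T) y≡p)) (letter p))
        compare (tri> _ _ p<y) = ℕ.<-asym lt (subst (_< lookup T p) (letter p) (std p<y (sym (column p))))
        compare (tri< y<p y≢p _) = y≢p (trans (sym (inverseʳ q)) (trans (cong (q ⟨$⟩ʳ_) (fixed y<p)) (inverseʳ q)))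

  -- A removed box is the last of its row, so its column is the length of the row.
  cellAt : ∀ {n α} {T : Vec ℕ n} → Path α T → Fin n → Cell
  cellAt (_∷_ {α = α} {r} rem P) zero    = r , part α r
  cellAt (rem ∷ P)               (suc i) = cellAt P i

  InShape : List ℕ → Cell → Set
  InShape α (r , c) = 0 < r × 0 < c × c ≤ part α r

  removed-positive : ∀ {α r ν} → Removes α r ν → part α r ≡ suc (part ν r)
  removed-positive {r = r} {ν} rem = trans (Removes-part rem r) (cong (ℕ._+ part ν r) (δ-yes r))

  inShape-Removes : ∀ {α r ν c} → Removes α r ν → InShape ν c → InShape α c
  inShape-Removes {α} {r} {ν} {c} rem (p , q , le) = p , q , ℕ.≤-trans le (ℕ.≤-trans (ℕ.m≤n+m (part ν (proj₁ c)) (δ (proj₁ c) r)) (ℕ.≤-reflexive (sym (Removes-part rem (proj₁ c)))))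

  cellAt-inShape : ∀ {n α} {T : Vec ℕ n} (P : Path α T) i → InShape α (cellAt P i)
  cellAt-inShape (rem ∷ P) zero    = Removes-positive rem , subst (0 <_) (sym (removed-positive rem)) (s≤s z≤n) , ℕ.≤-refl
  cellAt-inShape (rem ∷ P) (suc i) = inShape-Removes rem (cellAt-inShape P i)

  cellAt-injective : ∀ {n α} {T : Vec ℕ n} (P : Path α T) {i j} → cellAt P i ≡ cellAt P j → i ≡ j
  cellAt-injective (rem ∷ P) {zero}  {zero}  e = refl
  cellAt-injective (_∷_ {r = r} {ν} rem P) {zero}  {suc j} e = contradiction
    (subst (λ c → proj₂ c ≤ part ν (proj₁ c)) (sym e) (proj₂ (proj₂ (cellAt-inShape P j)))) (ℕ.<⇒≱ (ℕ.≤-reflexive (sym (removed-positive rem))))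
  cellAt-injective (_∷_ {r = r} {ν} rem P) {suc i} {zero}  e = contradiction
    (subst (λ c → proj₂ c ≤ part ν (proj₁ c)) e (proj₂ (proj₂ (cellAt-inShape P i)))) (ℕ.<⇒≱ (ℕ.≤-reflexive (sym (removed-positive rem))))
  cellAt-injective (rem ∷ P) {suc i} {suc j} e = cong suc (cellAt-injective P e)

  cellAt-surjective : ∀ {n α} {T : Vec ℕ n} (P : Path α T) → sum α ≡ n → ∀ {c} → InShape α c → ∃[ i ] cellAt P i ≡ c
  cellAt-surjective {α = α} [] e {r , c} (_ , 0<c , le) = contradiction (ℕ.≤-trans 0<c le) (ℕ.<⇒≱ (s≤s (ℕ.≤-reflexive (part-sum-0 α e r))))
  cellAt-surjective {α = α} (_∷_ {r = r} {ν} rem P) e {s , c} (p , q , le) = by (s ℕ.≟ r) (c ℕ.≟ part α s)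
    where
    recurse : c ≤ part ν s → ∃[ i ] cellAt (rem ∷ P) i ≡ (s , c)
    recurse le′ with cellAt-surjective P (ℕ.suc-injective (trans (Removes-sum rem) e)) (p , q , le′)
    ... | i , f = suc i , f
    by : Dec (s ≡ r) → Dec (c ≡ part α s) → ∃[ i ] cellAt (rem ∷ P) i ≡ (s , c)
    by (yes refl) (yes refl) = zero , refl
    by (yes refl) (no c≢)    = recurse (ℕ.≤-pred (subst (c <_) (removed-positive rem) (ℕ.≤∧≢⇒< le c≢)))
    by (no s≢r)   _          = recurse (subst (c ≤_) (trans (Removes-part rem s) (cong (ℕ._+ part ν s) (δ-no s≢r))) le)

  cellAt-column : ∀ {n α} {T : Vec ℕ n} (P : Path α T) → Decreasing α → ∀ {x y} → x Fin.< y → proj₂ (cellAt P x) ≡ proj₂ (cellAt P y) →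
    proj₁ (cellAt P y) < proj₁ (cellAt P x)
  cellAt-column (rem ∷ P) d {suc x} {suc y} (s≤s x<y) e = cellAt-column P (Removes-decreasing rem d) x<y e
  cellAt-column (_∷_ {r = suc r} {ν} rem P) d {zero} {suc y} _ e = ℕ.≰⇒> λ r≤ → ℕ.<⇒≱
    (ℕ.≤-reflexive (trans (sym (removed-positive rem)) e)) (ℕ.≤-trans (proj₂ (proj₂ (cellAt-inShape P y))) (antitone (proj₁ (cellAt P y)) r≤))
    where
    antitone : ∀ k → suc r ≤ k → part ν k ≤ part ν (suc r)
    antitone (suc k) (s≤s le) = part-antitone ν (Removes-decreasing rem d) le
  cellAt-column (_∷_ {r = zero} rem P) d {zero} {suc y} _ e = contradiction (Removes-positive rem) λ ()

  cellAt-row : ∀ {n α} {T : Vec ℕ n} (P : Path α T) i → proj₁ (cellAt P i) ≡ lookup T i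
  cellAt-row (rem ∷ P) zero    = refl
  cellAt-row (rem ∷ P) (suc i) = cellAt-row P i

  bijection : ∀ {A : Set} {m n} (f : Fin m → A) (g : Fin n → A) → (∀ {i j} → f i ≡ f j → i ≡ j) → (∀ {i j} → g i ≡ g j → i ≡ j) →
    (∀ i → ∃[ j ] g j ≡ f i) → (∀ j → ∃[ i ] f i ≡ g j) → Σ[ π ∈ Permutation m n ] (∀ i → g (π ⟨$⟩ʳ i) ≡ f i)
  bijection f g f-inj g-inj to from =
    permutation (proj₁ ∘ to) (proj₁ ∘ from) (λ j → g-inj (trans (proj₂ (to _)) (proj₂ (from j)))) (λ i → f-inj (trans (proj₂ (from _)) (proj₂ (to i)))) ,
    proj₂ ∘ to

  module _ {n} {α : Partition n} {T : Vec ℕ n} (P : Path (parts α) T) where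

    private
      a = parts α
      dg≡ : diagram a ≡ skew 1 a []
      dg≡ = ⧸-skew a []
      inShape⇒∈ : ∀ {c} → InShape a c → c ∈ diagram a
      inShape⇒∈ {suc r , suc c} (_ , _ , le) = subst ((suc r , suc c) ∈_) (sym dg≡) (∈-diagram⁺ 1 a le)
      ∈⇒inShape : ∀ {c} → c ∈ diagram a → InShape a c
      ∈⇒inShape c∈ with All.lookup (diagram-cells 1 a) (subst (_ ∈_) dg≡ c∈)
      ... | k , c , refl , refl , c< = s≤s z≤n , s≤s z≤n , c<
      placement : Σ[ π ∈ Permutation n (length (diagram a)) ] (∀ i → List.lookup (diagram a) (π ⟨$⟩ʳ i) ≡ cellAt P i)
      placement = bijection (cellAt P) (List.lookup (diagram a)) (cellAt-injective P) (lookup-injective (subst Unique (sym dg≡) (diagram-unique 1 a)))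
        (λ i → Any.index (inShape⇒∈ (cellAt-inShape P i)) , sym (lookup-index (inShape⇒∈ (cellAt-inShape P i))))
        (λ j → cellAt-surjective P (size α) (∈⇒inShape (∈-lookup j)))

    -- Entry i is put into the box that is removed at step i.
    standardTableau : Tableau α
    standardTableau = tableau (proj₁ placement)

    standardTableau-cell : ∀ i → cell standardTableau i ≡ cellAt P i
    standardTableau-cell = proj₂ placement

    standardTableau-tabloid : tabloid standardTableau ≡ T
    standardTableau-tabloid = lookup-ext λ i → trans (lookup-tabloid standardTableau i) (trans (cong proj₁ (standardTableau-cell i)) (cellAt-row P i))

    standardTableau-standard : ReverseStandard standardTableau
    standardTableau-standard {x} {y} x<y e = subst₂ _<_
      (trans (cong proj₁ (sym (standardTableau-cell y))) (sym (lookup-tabloid standardTableau y)))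
      (trans (cong proj₁ (sym (standardTableau-cell x))) (sym (lookup-tabloid standardTableau x)))
      (cellAt-column P (Linked⇒Decreasing (decreasing α)) x<y (trans (cong proj₂ (sym (standardTableau-cell x))) (trans e (cong proj₂ (standardTableau-cell y)))))

-- Specht modules and the character formula

module CharacterFormula where

  open Rationals
  open Sums
  open SkewTableaux
  open HorizontalStrips
  open Dimensions
  open HookSums
  open Differences
  open Antisymmetry using (∏; ∏-cong∈; down-cong)
  open KostkaFormula using (∏-multiplicities-parts; ι-∏; ι-∑; down-*ˡ)
  open HighestWeight
  open Traces
  open CycleTypes using (_^ℚ_; classFunction-Δ)
  open PartialPermutations using (⟨_,_⟩; powerSums)
  open Eigenvalues using (contentGap; ∑-tabulate; module TraceFormula)
  open Polytabloids

  -- The factors of π_μ contain i - ρᵢ where contents have ρᵢ - i; the sign is split off here.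
  ι-^ : ∀ z k → ι (z ℤ.^ k) ≡ sign k * (- ι z) ^ℚ k
  ι-^ z zero    = sym (*-identityˡ 1#)
  ι-^ z (suc k) = begin
    ι (z ℤ.* z ℤ.^ k)                       ≡⟨ trans (ι-* z (z ℤ.^ k)) (cong (ι z *_) (ι-^ z k)) ⟩
    ι z * (sign k * (- ι z) ^ℚ k)           ≡⟨ solve 3 (λ z s y → z :* (s :* y) := :- s :* (:- z :* y)) refl _ _ _ ⟩
    - sign k * (- ι z) ^ℚ suc k             ≡⟨ cong (_* (- ι z) ^ℚ suc k) (sign-suc k) ⟨
    sign (suc k) * (- ι z) ^ℚ suc k         ∎

  ∏-sign : ∀ ks f → ∏ ks (λ k → sign k * f k) ≡ sign (sum ks) * ∏ ks f
  ∏-sign []       f = sym (*-identityˡ 1#)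
  ∏-sign (k ∷ ks) f = trans (cong ((sign k * f k) *_) (∏-sign ks f))
    (trans (solve 4 (λ a b c d → (a :* b) :* (c :* d) := (a :* c) :* (b :* d)) refl _ _ _ _) (cong (_* (f k * ∏ ks f)) (sym (sign-+ k (sum ks)))))

  -- The signs (-1)^k of the factors multiply to (-1)^n because the parts of μ add up to n.
  ι-π : ∀ {n} (μ : Partition n) ρ → ι (π μ ρ) ≡ sign n * ∏ (parts μ) (λ k → contentGap k ρ)
  ι-π {n} μ ρ = begin
    ι (π μ ρ)
      ≡⟨ trans (cong ι (∏-multiplicities-parts μ _)) (ι-∏ (parts μ) _) ⟩
    ∏ (parts μ) (λ k → ι (∑ℤ is (λ i → (ℤ.+ i ℤ.- ℤ.+ part ρ i) ℤ.^ k) ℤ.- ∑ℤ is (λ i → (ℤ.+ i) ℤ.^ k)))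
      ≡⟨ ∏-cong∈ (parts μ) (λ {k} _ → factor k) ⟩
    ∏ (parts μ) (λ k → sign k * contentGap k ρ)
      ≡⟨ ∏-sign (parts μ) _ ⟩
    sign (sum (parts μ)) * ∏ (parts μ) (λ k → contentGap k ρ)
      ≡⟨ cong (λ n → sign n * ∏ (parts μ) (λ k → contentGap k ρ)) (size μ) ⟩
    sign n * ∏ (parts μ) (λ k → contentGap k ρ) ∎
    where
    is = range (length ρ)
    f g : ℕ → ℕ → ℚ
    f k i = (fromℕ (part ρ i) - fromℕ i) ^ℚ k
    g k i = (- fromℕ i) ^ℚ k
    factor : ∀ k → ι (∑ℤ is (λ i → (ℤ.+ i ℤ.- ℤ.+ part ρ i) ℤ.^ k) ℤ.- ∑ℤ is (λ i → (ℤ.+ i) ℤ.^ k)) ≡ sign k * contentGap k ρ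
    factor k = begin
      ι (∑ℤ is (λ i → (ℤ.+ i ℤ.- ℤ.+ part ρ i) ℤ.^ k) ℤ.- ∑ℤ is (λ i → (ℤ.+ i) ℤ.^ k))
        ≡⟨ trans (ι-- (∑ℤ is (λ i → (ℤ.+ i ℤ.- ℤ.+ part ρ i) ℤ.^ k)) (∑ℤ is (λ i → (ℤ.+ i) ℤ.^ k))) (cong₂ _-_ (ι-∑ is (λ i → (ℤ.+ i ℤ.- ℤ.+ part ρ i) ℤ.^ k)) (ι-∑ is (λ i → (ℤ.+ i) ℤ.^ k))) ⟩
      ∑ is (λ i → ι ((ℤ.+ i ℤ.- ℤ.+ part ρ i) ℤ.^ k)) - ∑ is (λ i → ι ((ℤ.+ i) ℤ.^ k))
        ≡⟨ cong₂ _-_ (∑-cong is (λ i → trans (ι-^ (ℤ.+ i ℤ.- ℤ.+ part ρ i) k) (cong (λ x → sign k * x ^ℚ k) (trans (cong -_ (ι-- (ℤ.+ i) (ℤ.+ part ρ i)))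
             (solve 2 (λ i p → :- (i :- p) := p :- i) refl (fromℕ i) (fromℕ (part ρ i))))))) (∑-cong is (λ i → ι-^ (ℤ.+ i) k)) ⟩
      ∑ is (λ i → sign k * f k i) - ∑ is (λ i → sign k * g k i)
        ≡⟨ ∑-- is _ _ ⟨
      ∑ is (λ i → sign k * f k i - sign k * g k i)
        ≡⟨ ∑-cong is (λ i → solve 3 (λ s a b → s :* a :- s :* b := s :* (a :- b)) refl (sign k) (f k i) (g k i)) ⟩
      ∑ is (λ i → sign k * (f k i - g k i))
        ≡⟨ ∑-*ˡ (sign k) is _ ⟩
      sign k * contentGap k ρ ∎

  ∑ᶠ-single : ∀ {n} (i : Fin n) f → ∑ᶠ (λ j → 𝟙 (j Fin.≟ i) * f j) ≡ f i
  ∑ᶠ-single {n} i f = trans (sym (∑-tabulate {n = n} id (λ j → 𝟙 (j Fin.≟ i) * f j))) (∑-single Fin._≟_ (Unique.allFin⁺ n) (∈-allFin i) f)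

  opaque
    unfolding _+_ _*_ ι

    zero-def : 0# ≡ 0ℚ
    zero-def = refl

  combination-def : ∀ {n d} (a : Fin d → ℚ) (b : Fin d → Words n) r → combination a b r ≡ ∑ᶠ (λ i → a i * b i r)
  combination-def a b r = trans (sym (∑ᶠ-def (λ i → a i ℚ.* b i r))) (∑ᶠ-cong (λ i → sym (*-def (a i) (b i r))))

  highestWeight-∑ᶠ : ∀ {n α d} (a : Fin d → ℚ) (b : Fin d → Words n) → (∀ i → HighestWeight α (b i)) → HighestWeight α (λ r → ∑ᶠ (λ i → a i * b i r))
  highestWeight-∑ᶠ {d = d} a b h = highestWeight-cong (λ r → ∑-tabulate {n = d} id (λ i → a i * b i r)) (highestWeight-∑ (allFin d) a b (λ {i} _ → h i))

  specht-highestWeight : ∀ {n} {α : Partition n} {v} → v ∈Specht α → HighestWeight (parts α) v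
  specht-highestWeight (_ , a , t , e) = highestWeight-cong (λ r → sym (trans (e r) (combination-def a (polytabloid ∘ t) r)))
    (highestWeight-∑ᶠ a (polytabloid ∘ t) (polytabloid-highestWeight ∘ t))

  polytabloid-specht : ∀ {n} {α : Partition n} (t : Tableau α) → polytabloid t ∈Specht α
  polytabloid-specht t = 1 , (λ _ → 1#) , (λ _ → t) , λ r → sym (trans (combination-def {d = 1} (λ _ → 1#) (λ _ → polytabloid t) r)
    (trans (+-identityʳ _) (*-identityˡ _)))

  module _ {n} {α : Partition n} (V : SpechtRealization α) where

    private
      a = parts α
      d = dimension V
      b = basis V
      dα : Decreasing a
      dα = Linked⇒Decreasing (decreasing α)

    -- Coordinates in the given basis are carried along with the highest weight property, since the
    -- trace has to be compared with the given matrices.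
    Good : Words n → Set
    Good v = HighestWeight a v × Σ[ q ∈ (Fin d → ℚ) ] (∀ r → v r ≡ ∑ᶠ (λ i → q i * b i r))

    good-linear : ∀ {u v} s → Good u → Good v → Good (λ w → u w + s * v w)
    good-linear {u} {v} s (hu , p , ep) (hv , q , eq) = highestWeight-linear s hu hv , (λ i → p i + s * q i) , λ r → begin
      u r + s * v r
        ≡⟨ cong₂ (λ x y → x + s * y) (ep r) (eq r) ⟩
      ∑ᶠ (λ i → p i * b i r) + s * ∑ᶠ (λ i → q i * b i r)
        ≡⟨ cong (∑ᶠ (λ i → p i * b i r) +_) (∑ᶠ-*ˡ s (λ i → q i * b i r)) ⟨
      ∑ᶠ (λ i → p i * b i r) + ∑ᶠ (λ i → s * (q i * b i r))
        ≡⟨ ∑ᶠ-+ (λ i → p i * b i r) (λ i → s * (q i * b i r)) ⟨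
      ∑ᶠ (λ i → p i * b i r + s * (q i * b i r))
        ≡⟨ ∑ᶠ-cong (λ i → solve 4 (λ p s q b → p :* b :+ s :* (q :* b) := (p :+ s :* q) :* b) refl (p i) s (q i) (b i r)) ⟩
      ∑ᶠ (λ i → (p i + s * q i) * b i r) ∎

    good-polytabloid : ∀ t → Good (polytabloid t)
    good-polytabloid t with spanning V (polytabloid t) (polytabloid-specht t)
    ... | q , e = polytabloid-highestWeight t , q , λ r → trans (e r) (combination-def q b r)

    -- Polytabloids of the tableaux that belong to paths supply the triangular family, with leading
    -- value 1.
    D : Dual Good (paths n a)
    D = triangular⇒dual {Good = Good} (λ {u} {v} → good-linear {u} {v}) (paths-sorted n a) λ {T} T∈ → let P = ∈-paths⁻ n a T∈; t = standardTableau {α = α} P in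
      polytabloid t , good-polytabloid t ,
      subst (λ T → Bounded T (polytabloid t)) (standardTableau-tabloid P) (polytabloid-bounded t (standardTableau-standard P)) ,
      1# , trans (*-identityˡ _) (trans (cong (polytabloid t) (sym (standardTableau-tabloid P))) (polytabloid-leading t))

    open TraceFormula {α = a} dα (size α) {Good} proj₁ D
    open Trace dα {Good} proj₁ D using (ts; expansion)

    -- Membership is decided in order to make coordinates total in the word; the sums below run over
    -- paths, where they are those of the dual family.
    coordinate : ∀ T → Dec (T ∈ ts) → Fin d → ℚ
    coordinate T (yes T∈) = proj₁ (proj₂ (good D T∈))
    coordinate T (no _)   = λ _ → 0#

    Q : Vec ℕ n → Fin d → ℚ
    Q T = coordinate T (any? (T ≟ʷ_) ts)

    dual-Q : ∀ {T} → T ∈ ts → ∀ r → dual D T r ≡ ∑ᶠ (λ k → Q T k * b k r)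
    dual-Q {T} T∈ r = by (any? (T ≟ʷ_) ts)
      where
      by : ∀ m → dual D T r ≡ ∑ᶠ (λ k → coordinate T m k * b k r)
      by (yes m) = proj₂ (proj₂ (good D m)) r
      by (no m)  = contradiction T∈ m

    independent# : ∀ c → (∀ r → ∑ᶠ (λ k → c k * b k r) ≡ 0#) → ∀ k → c k ≡ 0#
    independent# c e k = trans (independent V c (λ r → trans (combination-def c b r) (trans (e r) zero-def)) k) (sym zero-def)

    -- Each basis vector is expanded in the dual family and this again in the basis; linear
    -- independence compares the coefficients. This one-sided inverse replaces the proof that the
    -- number of paths is the dimension.
    ∑-Q : ∀ j k → ∑ ts (λ S → b j S * Q S k) ≡ 𝟙 (k Fin.≟ j)
    ∑-Q j k = equal (independent# (λ k → ∑ ts (λ S → b j S * Q S k) - 𝟙 (k Fin.≟ j)) vanishing k)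
      where
      equal : ∀ {x y} → x - y ≡ 0# → x ≡ y
      equal {x} {y} e = trans (solve 2 (λ x y → x := (x :- y) :+ y) refl x y) (trans (cong (_+ y) e) (+-identityˡ y))
      vanishing : ∀ r → ∑ᶠ (λ k → (∑ ts (λ S → b j S * Q S k) - 𝟙 (k Fin.≟ j)) * b k r) ≡ 0#
      vanishing r = begin
        ∑ᶠ (λ k → (∑ ts (λ S → b j S * Q S k) - 𝟙 (k Fin.≟ j)) * b k r)
          ≡⟨ ∑ᶠ-cong (λ k → solve 3 (λ s o b → (s :- o) :* b := s :* b :+ (:- con one) :* (o :* b)) refl (∑ ts (λ S → b j S * Q S k)) (𝟙 (k Fin.≟ j)) (b k r)) ⟩
        ∑ᶠ (λ k → ∑ ts (λ S → b j S * Q S k) * b k r + (- 1#) * (𝟙 (k Fin.≟ j) * b k r))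
          ≡⟨ ∑ᶠ-+ (λ k → ∑ ts (λ S → b j S * Q S k) * b k r) (λ k → (- 1#) * (𝟙 (k Fin.≟ j) * b k r)) ⟩
        ∑ᶠ (λ k → ∑ ts (λ S → b j S * Q S k) * b k r) + ∑ᶠ (λ k → (- 1#) * (𝟙 (k Fin.≟ j) * b k r))
          ≡⟨ cong₂ _+_ expanded (trans (∑ᶠ-*ˡ (- 1#) (λ k → 𝟙 (k Fin.≟ j) * b k r)) (cong ((- 1#) *_) (∑ᶠ-single j (λ k → b k r)))) ⟩
        b j r + (- 1#) * b j r
          ≡⟨ solve 1 (λ x → x :+ (:- con one) :* x := con (ℤ.+ 0)) refl (b j r) ⟩
        0# ∎
        where
        expanded : ∑ᶠ (λ k → ∑ ts (λ S → b j S * Q S k) * b k r) ≡ b j r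
        expanded = begin
          ∑ᶠ (λ k → ∑ ts (λ S → b j S * Q S k) * b k r)
            ≡⟨ ∑ᶠ-cong (λ k → trans (sym (∑-*ʳ (b k r) ts (λ S → b j S * Q S k))) (∑-cong ts (λ S → *-assoc (b j S) (Q S k) (b k r)))) ⟩
          ∑ᶠ (λ k → ∑ ts (λ S → b j S * (Q S k * b k r)))
            ≡⟨ ∑-∑ᶠ-swap ts (λ S k → b j S * (Q S k * b k r)) ⟨
          ∑ ts (λ S → ∑ᶠ (λ k → b j S * (Q S k * b k r)))
            ≡⟨ ∑-cong∈ ts (λ {S} S∈ → trans (∑ᶠ-*ˡ (b j S) (λ k → Q S k * b k r)) (cong (b j S *_) (sym (dual-Q S∈ r)))) ⟩
          ∑ ts (λ S → b j S * dual D S r)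
            ≡⟨ expansion (specht-highestWeight (member V j)) r ⟨
          b j r ∎

    -- Both are traces of the same operator; the values of the basis vectors at the paths and the
    -- coordinates `Q` are the matrices of the change of basis.
    character-χ : ∀ σ → character V σ ≡ χ σ
    character-χ σ = sym (begin
      ∑ ts (λ T → dual D T (T ∘ʷ σ))
        ≡⟨ ∑-cong∈ ts (λ {T} T∈ → trans (dual-Q T∈ (T ∘ʷ σ)) (∑ᶠ-cong (λ k → column T k))) ⟩
      ∑ ts (λ T → ∑ᶠ (λ k → ∑ᶠ (λ i → M i k * (b i T * Q T k))))
        ≡⟨ ∑-∑ᶠ-swap ts (λ T k → ∑ᶠ (λ i → M i k * (b i T * Q T k))) ⟩
      ∑ᶠ (λ k → ∑ ts (λ T → ∑ᶠ (λ i → M i k * (b i T * Q T k))))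
        ≡⟨ ∑ᶠ-cong (λ k → diagonal k) ⟩
      ∑ᶠ (λ k → M k k)
        ≡⟨ ∑ᶠ-def (λ k → M k k) ⟩
      character V σ ∎)
      where
      M = matrix V σ
      column : ∀ T k → Q T k * b k (T ∘ʷ σ) ≡ ∑ᶠ (λ i → M i k * (b i T * Q T k))
      column T k = begin
        Q T k * b k (T ∘ʷ σ)
          ≡⟨ cong (Q T k *_) (trans (action V σ k T) (combination-def (λ i → M i k) b T)) ⟩
        Q T k * ∑ᶠ (λ i → M i k * b i T)
          ≡⟨ ∑ᶠ-*ˡ (Q T k) (λ i → M i k * b i T) ⟨
        ∑ᶠ (λ i → Q T k * (M i k * b i T))
          ≡⟨ ∑ᶠ-cong (λ i → solve 3 (λ q m b → q :* (m :* b) := m :* (b :* q)) refl (Q T k) (M i k) (b i T)) ⟩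
        ∑ᶠ (λ i → M i k * (b i T * Q T k)) ∎
      diagonal : ∀ k → ∑ ts (λ T → ∑ᶠ (λ i → M i k * (b i T * Q T k))) ≡ M k k
      diagonal k = begin
        ∑ ts (λ T → ∑ᶠ (λ i → M i k * (b i T * Q T k)))
          ≡⟨ ∑-∑ᶠ-swap ts (λ T i → M i k * (b i T * Q T k)) ⟩
        ∑ᶠ (λ i → ∑ ts (λ T → M i k * (b i T * Q T k)))
          ≡⟨ ∑ᶠ-cong (λ i → trans (∑-*ˡ (M i k) ts (λ T → b i T * Q T k)) (trans (cong (M i k *_)
               (trans (∑-Q i k) (𝟙-⇔ (k Fin.≟ i) (i Fin.≟ k) sym sym))) (*-comm (M i k) _))) ⟩
        ∑ᶠ (λ i → 𝟙 (i Fin.≟ k) * M i k)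
          ≡⟨ ∑ᶠ-single k (λ i → M i k) ⟩
        M k k ∎

    characterSum : ∀ μ σ → HasCycleType σ μ →
      antidiagonal n (λ k m → (ifac k * ifac m) * down k (λ ρ → ι (-1ℤ ℤ.^ length (diagram ρ) ℤ.* π μ ρ) * down m (λ _ → 1#) ρ) a) ≡ χ σ
    characterSum μ σ type = begin
      antidiagonal n (λ k m → (ifac k * ifac m) * down k (λ ρ → ι (-1ℤ ℤ.^ length (diagram ρ) ℤ.* π μ ρ) * down m (λ _ → 1#) ρ) a)
        ≡⟨ antidiagonal-cong n (λ k m e → trans (cong ((ifac k * ifac m) *_) (graded k m e))
             (solve 3 (λ f s v → f :* (s :* v) := (s :* f) :* v) refl (ifac k * ifac m) (sign k) _)) ⟩
      alternating n u
        ≡⟨ alternating-Δ n u ⟩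
      ifac n * Δ n u
        ≡⟨ cong (ifac n *_) (Δ-cong n (λ k m e → sym (χ-powerSums (parts μ) k m e))) ⟩
      ifac n * Δ n (λ k m → ⟨ powerSums (parts μ) (drop k (allFin n)) , (λ _ p → χ p) ⟩)
        ≡⟨ cong (ifac n *_) (classFunction-Δ χ-class μ {σ} type) ⟩
      ifac n * (fromℕ (n !) * χ σ)
        ≡⟨ solve 3 (λ a b c → a :* (b :* c) := (b :* a) :* c) refl (ifac n) (fromℕ (n !)) (χ σ) ⟩
      (fromℕ (n !) * ifac n) * χ σ
        ≡⟨ trans (cong (_* χ σ) (!*ifac n)) (*-identityˡ _) ⟩
      χ σ ∎
      where
      F : List ℕ → ℚ
      F ρ = ∏ (parts μ) (λ j → contentGap j ρ)
      u : ℕ → ℕ → ℚ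
      u k m = down k (λ ρ → F ρ * down m (λ _ → 1#) ρ) a
      graded : ∀ k m → k ℕ.+ m ≡ n → down k (λ ρ → ι (-1ℤ ℤ.^ length (diagram ρ) ℤ.* π μ ρ) * down m (λ _ → 1#) ρ) a ≡ sign k * u k m
      graded k m e = trans (down-cong k a dα (λ ρ _ _ k+ρ → trans (cong (_* down m (λ _ → 1#) ρ) (coefficient ρ k+ρ)) (*-assoc _ _ _)))
        (down-*ˡ k (sign k) (λ ρ → F ρ * down m (λ _ → 1#) ρ) a)
        where
        coefficient : ∀ ρ → k ℕ.+ sum ρ ≡ sum a → ι (-1ℤ ℤ.^ length (diagram ρ) ℤ.* π μ ρ) ≡ sign k * F ρ
        coefficient ρ k+ρ = begin
          ι (-1ℤ ℤ.^ length (diagram ρ) ℤ.* π μ ρ)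
            ≡⟨ trans (ι-* (-1ℤ ℤ.^ length (diagram ρ)) (π μ ρ)) (cong₂ _*_ (cong sign len) (ι-π μ ρ)) ⟩
          sign s * (sign n * F ρ)
            -- As n = k + |ρ|, the signs (-1)^|ρ| and (-1)^n combine to (-1)^k.
            ≡⟨ cong (λ x → sign s * (x * F ρ)) (trans (cong sign (trans (sym (size α)) (sym k+ρ))) (sign-+ k s)) ⟩
          sign s * ((sign k * sign s) * F ρ)
            ≡⟨ solve 3 (λ s k f → s :* ((k :* s) :* f) := (s :* s) :* (k :* f)) refl (sign s) (sign k) (F ρ) ⟩
          (sign s * sign s) * (sign k * F ρ)
            ≡⟨ trans (cong (_* (sign k * F ρ)) (sign-square s)) (*-identityˡ _) ⟩
          sign k * F ρ ∎
          where
          s = sum ρ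
          len : length (diagram ρ) ≡ s
          len = trans (cong length (trans (⧸-skew ρ []) (skew-[] 1 ρ))) (length-skew-zeros ρ)

    characterFormula : ∀ μ σ → HasCycleType σ μ → character V σ ≡
      ∑ℚ (subpartitions a) (λ ρ → (-1ℤ ℤ.^ length (diagram ρ) ℤ.* π μ ρ) /H[ diagram ρ , a ⧸ ρ ])
    characterFormula μ σ type = trans (character-χ σ) (sym (trans (hookSum n a dα (size α) (λ ρ → -1ℤ ℤ.^ length (diagram ρ) ℤ.* π μ ρ)) (trans
      (∑-antidiagonal n (λ k m → (ifac k * ifac m) * down k (λ ρ → ι (-1ℤ ℤ.^ length (diagram ρ) ℤ.* π μ ρ) * down m (λ _ → 1#) ρ) a))
      (characterSum μ σ type))))

open import Data.Integer using (+_; _*_; _^_)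

corollary6p3 : ∀ {n : ℕ} (α μ : Partition n) →
  (∀ (V : SpechtRealization α) (σ : Permutation′ n) → HasCycleType σ μ →
    character V σ ≡
      ∑ℚ (subpartitions (parts α)) (λ ρ →
        (-1ℤ ^ length (diagram ρ) * π μ ρ) /H[ diagram ρ , parts α ⧸ ρ ]))
  ×
  (fromℤ (+ kostka α μ) ≡
    ∑ℚ (subpartitions (parts α)) (λ ρ →
      (-1ℤ ^ length (parts α ⧸ ρ) * ϰ μ ρ) /H[ diagram ρ , parts α ⧸ ρ ]))
corollary6p3 α μ = (λ V σ → CharacterFormula.characterFormula V μ σ) , KostkaFormula.kostkaFormula α μ
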